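{- Define $\Delta$ on $\mathcal A^f$ by $$\Delta(a)=\big(\pi\circ\zeta^f\otimes\pi\circ\zeta^f\big)\big(\Delta_{\mathrm{Gon}}(w)\big)$$ for any $w\in\mathbb Q\langle X\rangle$ with $\pi(\zeta^f(w))=a$. Then $\Delta$ is well defined, and $(\mathcal A^f,\cdot,\Delta)$ is a weight-graded Hopf algebra.
   Context: Let $X=\{x_0,x_1\}$ and let $\mathbb Q\langle X\rangle$ be the free non-commutative $\mathbb Q$-algebra on $X$, with word basis, empty word $\mathbf 1$ and weight equal to length. Write $(f\mid w)$ for coefficients. Shuffle product: $\mathbf 1\sqcup\!\sqcup w=w\sqcup\!\sqcup\mathbf 1=w$ and $au\sqcup\!\sqcup bv=a(u\sqcup\!\sqcup bv)+b(au\sqcup\!\sqcup v)$. Stuffle product on $\mathbb Q\langle Y\rangle$, $Y=\{y_1,y_2,\dots\}$: $\mathbf 1*w=w*\mathbf 1=w$ and $y_iu*y_jv=y_i(u*y_jv)+y_j(y_iu*v)+y_{i+j}(u*v)$. Let $\iota(y_{k_1}\cdots y_{k_d})=x_0^{k_1-1}x_1\cdots x_0^{k_d-1}x_1$, $\mathfrak h^0=\mathbb Q\mathbf 1+x_0\mathbb Q\langle X\rangle x_1$ and $\mathfrak h^1=\mathbb Q\mathbf 1+\mathbb Q\langle X\rangle x_1$. $\mathcal Z^f=(\mathbb Q\langle X\rangle,\sqcup\!\sqcup)/R$, with $R$ the ideal generated by $x_0$, $x_1$ and all $u\sqcup\!\sqcup v-\iota(\iota^{ -1}(u)*\iota^{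 -1}(v))$ ($u\in\mathfrak h^0$, $v\in\mathfrak h^1$). It is weight-graded. $\zeta^f:\mathbb Q\langle X\rangle\to\mathcal Z^f$ is the projection, $\mathcal A^f=\mathcal Z^f/(\zeta^f(2))$ with $\zeta^f(2)=\zeta^f(x_0x_1)$, and $\pi:\mathcal Z^f\to\mathcal A^f$ is the projection. Goncharov coproduct. Let $S(\varepsilon_1\cdots\varepsilon_n)=(-1)^n\varepsilon_n\cdots\varepsilon_1$. Set $I(a;f;b)=f$ if $(a,b)=(x_1,x_0)$, $S(f)$ if $(a,b)=(x_0,x_1)$, and $(f\mid\mathbf 1)\mathbf 1$ if $a=b$. With $\varepsilon_0=x_1$ and $\varepsilon_{n+1}=x_0$, $$\Delta_{\mathrm{Gon}}(\varepsilon_1\cdots\varepsilon_n)=\sum_{0=i_0<i_1<\dots<i_k<i_{k+1}=n+1}\Big(\mathop{\sqcup\!\sqcup}_{p=0}^k I(\varepsilon_{i_p};\varepsilon_{i_p+1}\cdots\varepsilon_{i_{p+1}-1};\varepsilon_{i_{p+1}})\Big)\otimes\varepsilon_{i_1}\cdots\varepsilon_{i_k},$$ extended linearly. -}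

module Defs where

open import Data.Nat using (ℕ; zero; suc; _+_)
open import Data.Rational using (ℚ; 0ℚ; 1ℚ; -_) renaming (_+_ to _+ℚ_; _*_ to _*ℚ_)
open import Data.List using (List; []; _∷_; _++_; map; concatMap; length; reverse; filter; [_])
open import Data.List.Properties using () renaming (≡-dec to ≡-decL)
open import Data.Vec using (Vec; []; _∷_; insertAt)
open import Data.Vec.Properties using () renaming (≡-dec to ≡-decV)
open import Data.Fin using (Fin)
open import Data.Product using (_×_; _,_; Σ; proj₁; proj₂)
open import Relation.Binary.PropositionalEquality using (_≡_; _≢_; refl)
open import Relation.Binary.Definitions using (DecidableEquality)
open import Relation.Nullary using (yes; no; Dec)
open import Relation.Nullary.Decidable using (⌊_⌋)
open import Data.Bool using (Bool; true; false; if_then_else_)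

data Letter : Set where
  x0 x1 : Letter

_≟L_ : DecidableEquality Letter
x0 ≟L x0 = yes refl
x0 ≟L x1 = no (λ ())
x1 ≟L x0 = no (λ ())
x1 ≟L x1 = yes refl

Word : Set
Word = List Letter

_≟W_ : DecidableEquality Word
_≟W_ = ≡-decL _≟L_

-- pure tensors of n words (basis of Q<X>^{⊗ n})
_≟V_ : ∀ {n} → DecidableEquality (Vec Word n)
_≟V_ = ≡-decV _≟W_

-- Finite Q-linear combinations over a basis B (with decidable equality).
-- A linear combination is a list of (coefficient , basis element);
-- two combinations are equal iff all their coefficients agree.

Lin : Set → Set
Lin B = List (ℚ × B)

module _ {B : Set} (_≟_ : DecidableEquality B) where

  coeff : Lin B → B → ℚ
  coeff [] b = 0ℚ
  coeff ((c , b') ∷ p) b with b' ≟ b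
  ... | yes _ = c +ℚ coeff p b
  ... | no  _ = coeff p b

  _≈_ : Lin B → Lin B → Set
  p ≈ q = ∀ b → coeff p b ≡ coeff q b

  data Span (G : Lin B → Set) : Lin B → Set where
    sp-zero  : Span G []
    sp-gen   : ∀ {g} → G g → Span G g
    sp-add   : ∀ {p q} → Span G p → Span G q → Span G (p ++ q)
    sp-scale : ∀ {p} (c : ℚ) → Span G p → Span G (map (λ t → c *ℚ proj₁ t , proj₂ t) p)
    sp-resp  : ∀ {p q} → _≈_ p q → Span G p → Span G q

scale : {B : Set} → ℚ → Lin B → Lin B
scale c p = map (λ t → c *ℚ proj₁ t , proj₂ t) p

_⊝_ : {B : Set} → Lin B → Lin B → Lin B
p ⊝ q = p ++ scale (- 1ℚ) q

linExt : {B C : Set} → (B → Lin C) → Lin B → Lin C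
linExt f p = concatMap (λ t → scale (proj₁ t) (f (proj₂ t))) p

linForm : {B : Set} → (B → ℚ) → Lin B → ℚ
linForm f [] = 0ℚ
linForm f ((c , b) ∷ p) = (c *ℚ f b) +ℚ linForm f p

Poly : Set
Poly = Lin Word

PolyT : ℕ → Set
PolyT n = Lin (Vec Word n)

word : Word → Poly
word w = [ (1ℚ , w) ]

prepend : Letter → Poly → Poly
prepend a p = map (λ t → proj₁ t , a ∷ proj₂ t) p

sh : Word → Word → Poly
sh [] v = word v
sh (a ∷ u) [] = word (a ∷ u)
sh (a ∷ u) (b ∷ v) = prepend a (sh u (b ∷ v)) ++ prepend b (sh (a ∷ u) v)

shP : Poly → Poly → Poly
shP p q = concatMap (λ s → concatMap (λ t → scale (proj₁ s *ℚ proj₁ t) (sh (proj₂ s) (proj₂ t))) q) p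

-- Stuffle on Q<Y>.  READING: the letter y_{k+1} is encoded by k : ℕ,
-- so a Y-word y_{k1}...y_{kd} is the list (k1-1) ... (kd-1).

YWord : Set
YWord = List ℕ

YLin : Set
YLin = Lin YWord

prependY : ℕ → YLin → YLin
prependY a p = map (λ t → proj₁ t , a ∷ proj₂ t) p

-- y_i u * y_j v = y_i (u * y_j v) + y_j (y_i u * v) + y_{i+j} (u * v);
-- with the encoding, y_{(a+1)+(b+1)} is encoded by suc (a + b).
st : YWord → YWord → YLin
st [] v = [ (1ℚ , v) ]
st (a ∷ u) [] = [ (1ℚ , a ∷ u) ]
st (a ∷ u) (b ∷ v) =
  prependY a (st u (b ∷ v)) ++ prependY b (st (a ∷ u) v) ++ prependY (suc (a + b)) (st u v)

x0pow : ℕ → Word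
x0pow zero = []
x0pow (suc k) = x0 ∷ x0pow k

ι : YWord → Word
ι [] = []
ι (k ∷ u) = x0pow k ++ (x1 ∷ ι u)

ιL : YLin → Poly
ιL p = map (λ t → proj₁ t , ι (proj₂ t)) p

-- ι(p) ∈ h^0 (as a word) iff p is empty or k1 ≥ 2 (encoded k1-1 ≥ 1)
data Admissible : YWord → Set where
  adm-nil  : Admissible []
  adm-cons : ∀ k u → Admissible (suc k ∷ u)

-- The ideal defining A^f = Z^f / (ζ^f(2)) inside (Q<X>, ш).
-- Generators: x0, x1, the double shuffle relations
--   ι(p) ш ι(q) − ι(p * q)   (ι(p) ∈ h^0, ι(q) ∈ h^1, by bilinearity words suffice),
-- and ζ^f(2) = x0 x1.

data GenA : Poly → Set where
  gen-x0  : GenA (word (x0 ∷ []))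
  gen-x1  : GenA (word (x1 ∷ []))
  gen-ds  : ∀ p q → Admissible p → GenA (sh (ι p) (ι q) ⊝ ιL (st p q))
  gen-z2  : GenA (word (x0 ∷ x1 ∷ []))

data IdealGen : Poly → Set where
  idg : ∀ {g} → GenA g → (w : Word) → IdealGen (shP g (word w))

-- membership in the ideal  R + (ζ^f(2))  (kernel of π ∘ ζ^f)
InI : Poly → Set
InI = Span _≟W_ IdealGen

_∼A_ : Poly → Poly → Set
p ∼A q = InI (p ⊝ q)

-- kernel of (π∘ζ^f)^{⊗ (n+1)} : Q<X>^{⊗(n+1)} → (A^f)^{⊗(n+1)},
-- spanned by the pure tensors with one factor in the ideal
data TensorGen (n : ℕ) : PolyT (suc n) → Set where
  tg : ∀ {r} → InI r → (ws : Vec Word n) (i : Fin (suc n)) →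
       TensorGen n (map (λ t → proj₁ t , insertAt ws i (proj₂ t)) r)

InIT : (n : ℕ) → PolyT (suc n) → Set
InIT n = Span _≟V_ (TensorGen n)

_∼T[_]_ : ∀ {n} → PolyT (suc n) → (n' : ℕ) → PolyT (suc n) → Set
_∼T[_]_ {n} p _ q = InIT n (p ⊝ q)

signQ : ℕ → ℚ
signQ zero = 1ℚ
signQ (suc n) = - signQ n

antipodeWord : Word → Poly
antipodeWord f = [ (signQ (length f) , reverse f) ]

isEmpty : Word → Bool
isEmpty [] = true
isEmpty (_ ∷ _) = false

Iab : Letter → Word → Letter → Poly
Iab x1 f x0 = word f
Iab x0 f x1 = antipodeWord f
Iab x0 f x0 = if isEmpty f then word [] else []
Iab x1 f x1 = if isEmpty f then word [] else []

combine : Poly → Letter → PolyT 2 → PolyT 2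
combine P e T =
  concatMap (λ s → concatMap (λ t → map (λ r → proj₁ s *ℚ proj₁ t *ℚ proj₁ r ,
                                               (proj₂ r ∷ (e ∷ Data.Vec.head (Data.Vec.tail (proj₂ t))) ∷ []))
                                        (sh (proj₂ s) (Data.Vec.head (proj₂ t)))) T) P

-- gonAux a seg rest : a = last chosen boundary letter ε_{i_p},
-- seg = the letters after it not chosen so far, rest = remaining letters.
gonAux : Letter → Word → Word → PolyT 2
gonAux a seg [] = map (λ t → proj₁ t , (proj₂ t ∷ [] ∷ [])) (Iab a seg x0)
gonAux a seg (e ∷ rest) =
  gonAux a (seg ++ [ e ]) rest ++ combine (Iab a seg e) e (gonAux e [] rest)

-- Δ_Gon on a word (ε_0 = x1, ε_{n+1} = x0)
ΔGon : Word → PolyT 2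
ΔGon w = gonAux x1 [] w

ΔGonL : Poly → PolyT 2
ΔGonL = linExt ΔGon

mul2 : PolyT 2 → PolyT 2 → PolyT 2
mul2 P Q = concatMap (λ s → concatMap (λ t →
   concatMap (λ a → map (λ b → proj₁ s *ℚ proj₁ t *ℚ proj₁ a *ℚ proj₁ b , (proj₂ a ∷ proj₂ b ∷ []))
      (sh (Data.Vec.head (Data.Vec.tail (proj₂ s))) (Data.Vec.head (Data.Vec.tail (proj₂ t)))))
      (sh (Data.Vec.head (proj₂ s)) (Data.Vec.head (proj₂ t)))) Q) P

Δ⊗id : PolyT 2 → PolyT 3
Δ⊗id = linExt (λ uv → map (λ t → proj₁ t , (Data.Vec.head (proj₂ t) ∷ Data.Vec.head (Data.Vec.tail (proj₂ t))
                                               ∷ Data.Vec.head (Data.Vec.tail uv) ∷ []))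
                          (ΔGon (Data.Vec.head uv)))

id⊗Δ : PolyT 2 → PolyT 3
id⊗Δ = linExt (λ uv → map (λ t → proj₁ t , (Data.Vec.head uv ∷ Data.Vec.head (proj₂ t)
                                               ∷ Data.Vec.head (Data.Vec.tail (proj₂ t)) ∷ []))
                          (ΔGon (Data.Vec.head (Data.Vec.tail uv))))

ε⊗id : (Word → ℚ) → PolyT 2 → Poly
ε⊗id ε = linExt (λ uv → [ (ε (Data.Vec.head uv) , Data.Vec.head (Data.Vec.tail uv)) ])

id⊗ε : (Word → ℚ) → PolyT 2 → Poly
id⊗ε ε = linExt (λ uv → [ (ε (Data.Vec.head (Data.Vec.tail uv)) , Data.Vec.head uv) ])

m∘S⊗id : (Word → Poly) → PolyT 2 → Poly
m∘S⊗id S = linExt (λ uv → shP (S (Data.Vec.head uv)) (word (Data.Vec.head (Data.Vec.tail uv))))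

m∘id⊗S : (Word → Poly) → PolyT 2 → Poly
m∘id⊗S S = linExt (λ uv → shP (word (Data.Vec.head uv)) (S (Data.Vec.head (Data.Vec.tail uv))))

Homog : ℕ → Poly → Set
Homog n p = ∀ w → length w ≢ n → coeff _≟W_ p w ≡ 0ℚ

component : ℕ → Poly → Poly
component n p = filter (λ t → length (proj₂ t) Data.Nat.≟ n) p

record WeightGradedHopf : Set where
  field
    Δ-welldef   : ∀ p q → p ∼A q → ΔGonL p ∼T[ 1 ] ΔGonL q
    ideal-homog : ∀ n p → InI p → InI (component n p)
    sh-graded   : ∀ u v w → length w ≢ length u + length v → coeff _≟W_ (sh u v) w ≡ 0ℚ
    Δ-graded    : ∀ w u v → length u + length v ≢ length w →
                  coeff _≟V_ (ΔGon w) (u ∷ v ∷ []) ≡ 0ℚ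
    Δ-unit      : ΔGon [] ∼T[ 1 ] [ (1ℚ , ([] ∷ [] ∷ [])) ]
    Δ-mult      : ∀ u v → ΔGonL (sh u v) ∼T[ 1 ] mul2 (ΔGon u) (ΔGon v)
    Δ-coassoc   : ∀ w → Δ⊗id (ΔGon w) ∼T[ 2 ] id⊗Δ (ΔGon w)
    ε           : Word → ℚ
    ε-welldef   : ∀ p → InI p → linForm ε p ≡ 0ℚ
    ε-graded    : ∀ w → length w ≢ 0 → ε w ≡ 0ℚ
    ε-unit      : ε [] ≡ 1ℚ
    ε-mult      : ∀ u v → linForm ε (sh u v) ≡ ε u *ℚ ε v
    counitˡ     : ∀ w → ε⊗id ε (ΔGon w) ∼A word w
    counitʳ     : ∀ w → id⊗ε ε (ΔGon w) ∼A word w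
    S           : Word → Poly
    S-welldef   : ∀ p → InI p → InI (linExt S p)
    S-graded    : ∀ w → Σ Poly (λ q → Homog (length w) q × (S w ∼A q))
    antipodeˡ   : ∀ w → m∘S⊗id S (ΔGon w) ∼A [ (ε w , []) ]
    antipodeʳ   : ∀ w → m∘id⊗S S (ΔGon w) ∼A [ (ε w , []) ]

{-# OPTIONS --safe #-}

-- A series Φ : ℚ⟨X⟩ → K is grouplike if it is a character of ш, and it kills the ideal defining A^f
-- iff moreover Φ(x0) = Φ(x1) = Φ(x0x1) = 0 and Φ ∘ ι satisfies the stuffle relations with one
-- admissible factor. Let i₁, i₂ be the universal such characters w ↦ w ⊗ 1, 1 ⊗ w with values in
-- A^f ⊗ A^f. Reading Goncharov's formula on coefficients, the class of Δ_Gon is the Ihara product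
-- i₁ ⊛ i₂, where Φ ⊛ Ψ = Φ Ψ(x0 , Φ⁻¹ x1 Φ). So Δ is well defined because such characters are closed
-- under ⊛ (Racinet); it is multiplicative because i₁ ⊛ i₂ is grouplike, and it is coassociative and
-- counital because ⊛ is associative and unital. The antipode is Takeuchi's Σ_k (-1)^k (id - ε)^{⋆ k},
-- which is finite on each word by the grading.
--
-- For Racinet's theorem, write Φ ∘ ι = G(y₁) χ with χ a character of the stuffle product, and let
-- p(u) = Σ_k Φ(ι(u) x0^k) z^k. With Y = 1 + y₁ + y₂ + ⋯ and σ : z ↦ -z, the series T = p Y σ(p reversed),
-- where a word of weight w carries z^w, has the words of Φ x0^k Φ⁻¹ x1 as its coefficients of
-- z^{w-k-1}. It factors as G g G⁻ with G, G⁻ series in y₁ and g grouplike. Stuffling with y₁ is a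
-- derivation of the deconcatenation product; compared with the homogeneity of T it shows that the
-- depth one coefficients of even weight vanish, that G⁻ = G⁻¹, and that T has no terms of degree above
-- the weight. Hence the coefficients of g satisfy the coproduct rule of the letters y_k, and
-- substituting them in χ_Ψ gives, up to a series in y₁ on the left, a stuffle character (Φ ⊛ Ψ) ∘ ι.
module Submission where

open import Defs hiding (_≈_)
open import Algebra.Bundles using (CommutativeRing; RawRing)
import Algebra.Properties.Ring as RingProperties
import Algebra.Solver.Ring as RingSolver
open import Algebra.Solver.Ring.AlmostCommutativeRing using (AlmostCommutativeRing; _-Raw-AlmostCommutative⟶_; fromCommutativeRing)
open import Data.Empty using (⊥; ⊥-elim)
open import Data.Fin using (zero; suc)
open import Data.List using (List; []; _∷_; _++_; [_]; _∷ʳ_; map; concatMap; length; reverse; initLast; _∷ʳ′_)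
import Data.List.Properties as List
open import Data.List.Relation.Unary.All as All using (All; []; _∷_)
import Data.List.Relation.Unary.All.Properties as All
open import Data.Maybe using (Maybe; just; nothing)
open import Data.Nat as ℕ using (ℕ; zero; suc; z≤n; s≤s)
import Data.Nat.Properties as ℕ
open import Algebra.Properties.CommutativeSemigroup ℕ.+-commutativeSemigroup using (x∙yz≈y∙xz) renaming (interchange to +-interchange)
open import Data.Product using (_×_; _,_; proj₁; proj₂)
open import Data.Rational as ℚ using (ℚ; 0ℚ; 1ℚ)
import Data.Rational.Properties as ℚ
open import Data.Sum using (inj₁; inj₂)
open import Data.Unit using (⊤; tt)
open import Data.Vec as Vec using (Vec; []; _∷_)
open import Level using (0ℓ)
open import Relation.Binary.Definitions using (DecidableEquality)
open import Relation.Binary.PropositionalEquality as ≡ using (_≡_; _≢_)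
open import Relation.Nullary using (Dec; yes; no)

-- The obstacle is the factor `G`. Shuffle regularisation kills all powers of `x1`, so `Φ ∘ ι` is in
-- general not a stuffle character; `G` corrects this as the Gamma function does for multiple zeta
-- values. Substituting `Φ x0^k Φ⁻¹ x1` for the letters puts copies of `G` and `G⁻` on both sides of
-- each letter, and a stuffle character is reached only once they cancel between neighbouring
-- letters, that is, once `G⁻ G = 1`. For the Gamma function the corresponding product is given by
-- the reflection formula and involves the even zeta values, so the vanishing of `ζ(2)` has to
-- enter. No explicit zeta values occur: besides the stuffle equation with `y₁` and homogeneity, the
-- input is `Φ Φ⁻¹ x1 = x1`, which fixes one diagonal of `T`, and the vanishing statements follow by
-- dividing by positive integers; hence the coefficients in a ℚ-algebra. Since the alphabet of the
-- `y_k` is infinite, series are functions on words, and sums over letters are linear functionals on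
-- functions of the letter.

record QAlg : Set₁ where
  field
    commutativeRing : CommutativeRing 0ℓ 0ℓ
  open CommutativeRing commutativeRing public
  field
    κ   : ℚ → Carrier
    κ-+ : ∀ p q → κ (p ℚ.+ q) ≈ κ p + κ q
    κ-* : ∀ p q → κ (p ℚ.* q) ≈ κ p * κ q
    κ-1 : κ 1ℚ ≈ 1#

-- Division by positive integers, sums and linear functionals over a ℚ-algebra

natℚ : ℕ → ℚ
natℚ zero    = 0ℚ
natℚ (suc n) = 1ℚ ℚ.+ natℚ n

natℚ-nonNeg : ∀ n → 0ℚ ℚ.≤ natℚ n
natℚ-nonNeg zero    = ℚ.≤-refl
natℚ-nonNeg (suc n) = ≡.subst (ℚ._≤ natℚ (suc n)) (ℚ.+-identityˡ 0ℚ) (ℚ.+-mono-≤ (ℚ.nonNegative⁻¹ 1ℚ) (natℚ-nonNeg n))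

natℚ-pos : ∀ n → ℚ.Positive (natℚ (suc n))
natℚ-pos n = ℚ.positive (ℚ.<-≤-trans (ℚ.positive⁻¹ 1ℚ) (≡.subst (ℚ._≤ natℚ (suc n)) (ℚ.+-identityʳ 1ℚ) (ℚ.+-monoʳ-≤ 1ℚ (natℚ-nonNeg n))))

natℚ-nonZero : ∀ n → ℚ.NonZero (natℚ (suc n))
natℚ-nonZero n = ℚ.pos⇒nonZero (natℚ (suc n)) {{natℚ-pos n}}

1/natℚ : ℕ → ℚ
1/natℚ n = ℚ.1/_ (natℚ (suc n)) {{natℚ-nonZero n}}

1/natℚ-inv : ∀ n → 1/natℚ n ℚ.* natℚ (suc n) ≡ 1ℚ
1/natℚ-inv n = ℚ.*-inverseˡ (natℚ (suc n)) {{natℚ-nonZero n}}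

interchange-suc : ∀ a b m n → suc (suc (a ℕ.+ b)) ℕ.+ (m ℕ.+ n) ≡ suc a ℕ.+ m ℕ.+ (suc b ℕ.+ n)
interchange-suc a b m n = ≡.trans (≡.cong (λ k → suc k ℕ.+ (m ℕ.+ n)) (≡.sym (ℕ.+-suc a b))) (+-interchange (suc a) (suc b) m n)

module Alg (K : QAlg) where
  open QAlg K public
  open import Relation.Binary.Reasoning.Setoid setoid public
  open RingProperties ring public using (-‿distribˡ-*; -‿distribʳ-*; -0#≈0#; -‿involutive)

  private
    acr : AlmostCommutativeRing 0ℓ 0ℓ
    acr = fromCommutativeRing commutativeRing

  κ-0 : κ 0ℚ ≈ 0#
  κ-0 = RingProperties.x+x≈x⇒x≈0 ring (κ 0ℚ) (trans (sym (κ-+ 0ℚ 0ℚ)) (reflexive (≡.cong κ (ℚ.+-identityˡ 0ℚ))))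

  inverse-unique : ∀ {x y} → x + y ≈ 0# → x ≈ - y
  inverse-unique {x} {y} = RingProperties.+-inverseˡ-unique ring x y

  κ-neg : ∀ p → κ (ℚ.- p) ≈ - κ p
  κ-neg p = inverse-unique (trans (sym (κ-+ (ℚ.- p) p)) (trans (reflexive (≡.cong κ (ℚ.+-inverseˡ p))) κ-0))

  private
    -- κ with the constants 0 and 1 sent to 0# and 1# on the nose, so that the solver can use these literals
    ⟦_⟧ : ℚ → Carrier
    ⟦ p ⟧ with p ℚ.≟ 0ℚ | p ℚ.≟ 1ℚ
    ... | yes _ | _     = 0#
    ... | no  _ | yes _ = 1#
    ... | no  _ | no  _ = κ p

    ⟦⟧≈κ : ∀ p → ⟦ p ⟧ ≈ κ p
    ⟦⟧≈κ p with p ℚ.≟ 0ℚ | p ℚ.≟ 1ℚ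
    ... | yes e | _     = sym (trans (reflexive (≡.cong κ e)) κ-0)
    ... | no  _ | yes e = sym (trans (reflexive (≡.cong κ e)) κ-1)
    ... | no  _ | no  _ = refl

    ℚraw : RawRing 0ℓ 0ℓ
    ℚraw = record { Carrier = ℚ; _≈_ = _≡_; _+_ = ℚ._+_; _*_ = ℚ._*_; -_ = ℚ.-_; 0# = 0ℚ; 1# = 1ℚ }

    morph : ℚraw -Raw-AlmostCommutative⟶ acr
    morph = record
      { ⟦_⟧ = ⟦_⟧
      ; +-homo = λ p q → trans (⟦⟧≈κ _) (trans (κ-+ p q) (sym (+-cong (⟦⟧≈κ p) (⟦⟧≈κ q))))
      ; *-homo = λ p q → trans (⟦⟧≈κ _) (trans (κ-* p q) (sym (*-cong (⟦⟧≈κ p) (⟦⟧≈κ q))))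
      ; -‿homo = λ p → trans (⟦⟧≈κ _) (trans (κ-neg p) (sym (-‿cong (⟦⟧≈κ p))))
      ; 0-homo = refl ; 1-homo = refl }

    dec : ∀ p q → Maybe (⟦ p ⟧ ≈ ⟦ q ⟧)
    dec p q with p ℚ.≟ q
    ... | yes e = just (reflexive (≡.cong ⟦_⟧ e))
    ... | no  _ = nothing

  open RingSolver ℚraw acr morph dec public using (solve; _:=_; _:+_; _:*_; _:-_; :-_; con; Polynomial)

  :0 :1 : ∀ {n} → Polynomial n
  :0 = con 0ℚ
  :1 = con 1ℚ

  nat : ℕ → Carrier
  nat zero    = 0#
  nat (suc n) = 1# + nat n

  nat≈κ : ∀ n → nat n ≈ κ (natℚ n)
  nat≈κ zero    = sym κ-0
  nat≈κ (suc n) = trans (+-cong (sym κ-1) (nat≈κ n)) (sym (κ-+ 1ℚ (natℚ n)))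

  nat-+ : ∀ m n → nat (m ℕ.+ n) ≈ nat m + nat n
  nat-+ zero    n = sym (+-identityˡ _)
  nat-+ (suc m) n = trans (+-congˡ (nat-+ m n)) (sym (+-assoc _ _ _))

  sgn : ℕ → Carrier
  sgn zero    = 1#
  sgn (suc n) = - sgn n

  sgn² : ∀ n → sgn n * sgn n ≈ 1#
  sgn² zero    = *-identityˡ _
  sgn² (suc n) = trans (solve 1 (λ x → (:- x) :* (:- x) := x :* x) refl _) (sgn² n)

  1/nat : ℕ → Carrier
  1/nat n = κ (1/natℚ n)

  1/nat-inv : ∀ n → 1/nat n * nat (suc n) ≈ 1#
  1/nat-inv n = begin
    κ (1/natℚ n) * nat (suc n)         ≈⟨ *-congˡ (nat≈κ (suc n)) ⟩
    κ (1/natℚ n) * κ (natℚ (suc n))    ≈⟨ κ-* _ _ ⟨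
    κ (1/natℚ n ℚ.* natℚ (suc n))      ≡⟨ ≡.cong κ (1/natℚ-inv n) ⟩
    κ 1ℚ                               ≈⟨ κ-1 ⟩
    1#                                 ∎

  nat-cancel : ∀ n {x y} → nat (suc n) * x ≈ nat (suc n) * y → x ≈ y
  nat-cancel n {x} {y} e = begin
    x                               ≈⟨ *-identityˡ x ⟨
    1# * x                          ≈⟨ *-congʳ (1/nat-inv n) ⟨
    (1/nat n * nat (suc n)) * x     ≈⟨ *-assoc _ _ _ ⟩
    1/nat n * (nat (suc n) * x)     ≈⟨ *-congˡ e ⟩
    1/nat n * (nat (suc n) * y)     ≈⟨ *-assoc _ _ _ ⟨
    (1/nat n * nat (suc n)) * y     ≈⟨ *-congʳ (1/nat-inv n) ⟩
    1# * y                          ≈⟨ *-identityˡ y ⟩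
    y                               ∎

  nat-torsion-free : ∀ n {x} → nat (suc n) * x ≈ 0# → x ≈ 0#
  nat-torsion-free n e = nat-cancel n (trans e (sym (zeroʳ _)))

  Σ : {I : Set} → List I → (I → Carrier) → Carrier
  Σ []      f = 0#
  Σ (i ∷ p) f = f i + Σ p f

  module _ {I : Set} where
    Σ-cong : ∀ (p : List I) {f g : I → Carrier} → (∀ i → f i ≈ g i) → Σ p f ≈ Σ p g
    Σ-cong []      e = refl
    Σ-cong (i ∷ p) e = +-cong (e i) (Σ-cong p e)

    Σ-+ : ∀ (p : List I) {f g : I → Carrier} → Σ p (λ i → f i + g i) ≈ Σ p f + Σ p g
    Σ-+ []      = sym (+-identityˡ _)
    Σ-+ (i ∷ p) {f} {g} = trans (+-congˡ (Σ-+ p))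
      (solve 4 (λ a b c d → (a :+ b) :+ (c :+ d) := (a :+ c) :+ (b :+ d)) refl (f i) (g i) (Σ p f) (Σ p g))

    Σ-* : ∀ (p : List I) c {f : I → Carrier} → Σ p (λ i → c * f i) ≈ c * Σ p f
    Σ-* []      c = sym (zeroʳ c)
    Σ-* (i ∷ p) c = trans (+-congˡ (Σ-* p c)) (sym (distribˡ c _ _))

    Σ-++ : ∀ (p q : List I) {f : I → Carrier} → Σ (p ++ q) f ≈ Σ p f + Σ q f
    Σ-++ []      q = sym (+-identityˡ _)
    Σ-++ (i ∷ p) q = trans (+-congˡ (Σ-++ p q)) (sym (+-assoc _ _ _))

    Σ-map : {J : Set} (g : J → I) (p : List J) {f : I → Carrier} → Σ (map g p) f ≈ Σ p (λ j → f (g j))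
    Σ-map g []      = refl
    Σ-map g (j ∷ p) = +-congˡ (Σ-map g p)

    Σ-concatMap : {J : Set} (g : J → List I) (p : List J) {f : I → Carrier} →
                  Σ (concatMap g p) f ≈ Σ p (λ j → Σ (g j) f)
    Σ-concatMap g []      = refl
    Σ-concatMap g (j ∷ p) = trans (Σ-++ (g j) (concatMap g p)) (+-congˡ (Σ-concatMap g p))

  record IsLinear {I : Set} (O : (I → Carrier) → Carrier) : Set where
    field
      O-cong : ∀ {f g} → (∀ i → f i ≈ g i) → O f ≈ O g
      O-+    : ∀ f g → O (λ i → f i + g i) ≈ O f + O g
      O-*    : ∀ c f → O (λ i → c * f i) ≈ c * O f

    O-0 : O (λ _ → 0#) ≈ 0#
    O-0 = trans (O-cong (λ _ → sym (zeroˡ 0#))) (trans (O-* 0# (λ _ → 0#)) (zeroˡ _))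

    O-zero : ∀ {f} → (∀ i → f i ≈ 0#) → O f ≈ 0#
    O-zero e = trans (O-cong e) O-0

    O-*ʳ : ∀ f c → O (λ i → f i * c) ≈ O f * c
    O-*ʳ f c = trans (O-cong (λ i → *-comm (f i) c)) (trans (O-* c f) (*-comm c _))

    O-neg : ∀ f → O (λ i → - f i) ≈ - O f
    O-neg f = trans (O-cong (λ i → n1 (f i))) (trans (O-* (- 1#) f) (sym (n1 _)))
      where n1 : ∀ x → - x ≈ - 1# * x
            n1 = solve 1 (λ x → :- x := :- :1 :* x) refl

  Σ-linear : {I : Set} (p : List I) → IsLinear (Σ p)
  Σ-linear p = record { O-cong = Σ-cong p ; O-+ = λ _ _ → Σ-+ p ; O-* = λ c _ → Σ-* p c }

  module _ {I : Set} where
    open IsLinear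

    at-linear : (i : I) → IsLinear (λ f → f i)
    at-linear i = record { O-cong = λ e → e i ; O-+ = λ _ _ → refl ; O-* = λ _ _ → refl }

    0-linear : IsLinear {I} (λ _ → 0#)
    0-linear = record { O-cong = λ _ → refl ; O-+ = λ _ _ → sym (+-identityˡ _) ; O-* = λ _ _ → sym (zeroʳ _) }

    +-linear : ∀ {O P} → IsLinear {I} O → IsLinear P → IsLinear (λ f → O f + P f)
    +-linear o p = record
      { O-cong = λ e → +-cong (O-cong o e) (O-cong p e)
      ; O-+ = λ f g → trans (+-cong (O-+ o f g) (O-+ p f g))
          (solve 4 (λ a b c d → (a :+ b) :+ (c :+ d) := (a :+ c) :+ (b :+ d)) refl _ _ _ _)
      ; O-* = λ c f → trans (+-cong (O-* o c f) (O-* p c f)) (sym (distribˡ c _ _)) }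

    *-linear : ∀ {O} c → IsLinear {I} O → IsLinear (λ f → c * O f)
    *-linear c o = record
      { O-cong = λ e → *-congˡ (O-cong o e)
      ; O-+ = λ f g → trans (*-congˡ (O-+ o f g)) (distribˡ c _ _)
      ; O-* = λ d f → trans (*-congˡ (O-* o d f)) (solve 3 (λ a b x → a :* (b :* x) := b :* (a :* x)) refl c d _) }

    reindex-linear : {J : Set} {O : (J → Carrier) → Carrier} (g : J → I) → IsLinear O → IsLinear (λ f → O (λ j → f (g j)))
    reindex-linear g o = record
      { O-cong = λ e → O-cong o (λ j → e (g j)) ; O-+ = λ _ _ → O-+ o _ _ ; O-* = λ c _ → O-* o c _ }

  -- Stands for "a finite combination of evaluations". Commuting with every linear `R` is the only
  -- consequence of finite support that the proof uses, and in this form no support has to be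
  -- carried along.
  record IsFinite {I : Set} (O : (I → Carrier) → Carrier) : Set₁ where
    field
      linear : IsLinear O
      swap   : ∀ {J : Set} {R : (J → Carrier) → Carrier} → IsLinear R → (k : I → J → Carrier) →
               R (λ j → O (λ i → k i j)) ≈ O (λ i → R (k i))
    open IsLinear linear public

  module _ {I : Set} where
    open IsFinite

    point-finite : ∀ c (i : I) → IsFinite (λ h → c * h i)
    point-finite c i = record
      { linear = *-linear c (at-linear i) ; swap = λ r k → IsLinear.O-* r c (k i) }

    +-finite : ∀ {O P : (I → Carrier) → Carrier} → IsFinite O → IsFinite P → IsFinite (λ h → O h + P h)
    +-finite o p = record
      { linear = +-linear (linear o) (linear p)
      ; swap = λ r k → trans (IsLinear.O-+ r _ _) (+-cong (swap o r k) (swap p r k)) }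

    0-finite : IsFinite {I} (λ _ → 0#)
    0-finite = record { linear = 0-linear ; swap = λ r k → IsLinear.O-0 r }

-- Quasi-shuffle characters

module QS (K : QAlg) (L : Set) (_⋄_ : L → L → L) (λ̂ : QAlg.Carrier K) where
  open Alg K
  open IsLinear
  open IsFinite using (linear; swap)

  Series : Set
  Series = List L → Carrier

  δ : {A : Set} → L → (List L → A) → List L → A
  δ a f w = f (a ∷ w)

  ∂ : L → Series → Series
  ∂ a f w = f (a ∷ w)

  -- The linear extension of `f`, evaluated on the quasi-shuffle product of `u` and `v`: the shuffle
  -- for `λ̂ = 0`, the stuffle for `λ̂ = 1` and addition of indices. Working on the dual side avoids
  -- formal sums of words.
  Q : Series → List L → List L → Carrier
  Q f []      v       = f v
  Q f (a ∷ u) []      = f (a ∷ u)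
  Q f (a ∷ u) (b ∷ v) = Q (∂ a f) u (b ∷ v) + Q (∂ b f) (a ∷ u) v + λ̂ * Q (∂ (a ⋄ b) f) u v

  Q-linear : ∀ u v → IsLinear (λ f → Q f u v)
  Q-linear []      v       = at-linear v
  Q-linear (a ∷ u) []      = at-linear (a ∷ u)
  Q-linear (a ∷ u) (b ∷ v) =
    +-linear (+-linear (reindex-linear (a ∷_) (Q-linear u (b ∷ v))) (reindex-linear (b ∷_) (Q-linear (a ∷ u) v)))
             (*-linear λ̂ (reindex-linear ((a ⋄ b) ∷_) (Q-linear u v)))

  Q-cong : ∀ {f g} → (∀ w → f w ≈ g w) → ∀ u v → Q f u v ≈ Q g u v
  Q-cong e u v = O-cong (Q-linear u v) e

  Q-[]ʳ : ∀ f u → Q f u [] ≈ f u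
  Q-[]ʳ f []      = refl
  Q-[]ʳ f (a ∷ u) = refl

  ε : Series
  ε []      = 1#
  ε (_ ∷ _) = 0#

  IsChar : Series → Set
  IsChar f = f [] ≈ 1# × (∀ u v → Q f u v ≈ f u * f v)

  -- A formal sum over `i` of series `P_i`, each tagged with `i`: at a word `w` it is the functional
  -- sending `h` to the sum of the `P_i(w) h(i)`. This makes sense for an infinite `I` if each word
  -- involves only finitely many `i`.
  Family : Set → Set
  Family I = List L → (I → Carrier) → Carrier

  module _ {I : Set} where
    infixr 7 _⊙_ _⊙₂_

    -- The sum over `i` of the concatenation products of `P_i` and `X i`, computed by cutting the
    -- word in all possible ways.
    _⊙_ : Family I → (I → Series) → Series
    (P ⊙ X) []      = P [] (λ i → X i [])
    (P ⊙ X) (a ∷ w) = P [] (λ i → X i (a ∷ w)) + (δ a P ⊙ X) w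

    _⊙₂_ : (List L → Family I) → (I → List L → Series) → List L → Series
    (P ⊙₂ Z) []      v = (P [] ⊙ (λ i → Z i [])) v
    (P ⊙₂ Z) (a ∷ u) v = (P [] ⊙ (λ i → Z i (a ∷ u))) v + (δ a P ⊙₂ Z) u v

    Linear : Family I → Set
    Linear P = ∀ w → IsLinear (P w)

    Linear₂ : (List L → Family I) → Set
    Linear₂ P = ∀ u v → IsLinear (P u v)

    Finite : Family I → Set₁
    Finite P = ∀ w → IsFinite (P w)

    ⊙-congˡ : ∀ {P P' : Family I} X → (∀ w h → P w h ≈ P' w h) → ∀ w → (P ⊙ X) w ≈ (P' ⊙ X) w
    ⊙-congˡ X e []      = e [] _
    ⊙-congˡ X e (a ∷ w) = +-cong (e [] _) (⊙-congˡ X (λ w → e (a ∷ w)) w)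

    ⊙-congʳ≤ : ∀ {P : Family I} {X X'} → Linear P → ∀ w →
               (∀ i v → length v ℕ.≤ length w → X i v ≈ X' i v) → (P ⊙ X) w ≈ (P ⊙ X') w
    ⊙-congʳ≤ l []      e = O-cong (l []) (λ i → e i [] ℕ.≤-refl)
    ⊙-congʳ≤ l (a ∷ w) e = +-cong (O-cong (l []) (λ i → e i (a ∷ w) ℕ.≤-refl))
      (⊙-congʳ≤ (λ w → l (a ∷ w)) w (λ i v v≤w → e i v (ℕ.m≤n⇒m≤1+n v≤w)))

    ⊙-congʳ< : ∀ {P : Family I} {X X'} → Linear P → (∀ h → P [] h ≈ 0#) → ∀ w →
               (∀ i v → length v ℕ.< length w → X i v ≈ X' i v) → (P ⊙ X) w ≈ (P ⊙ X') w
    ⊙-congʳ< l z []      e = trans (z _) (sym (z _))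
    ⊙-congʳ< l z (a ∷ w) e = +-cong (trans (z _) (sym (z _)))
      (⊙-congʳ≤ (λ w → l (a ∷ w)) w (λ i v v≤w → e i v (s≤s v≤w)))

    ⊙-congʳ : ∀ {P : Family I} {X X'} → Linear P → (∀ i v → X i v ≈ X' i v) → ∀ w → (P ⊙ X) w ≈ (P ⊙ X') w
    ⊙-congʳ l e w = ⊙-congʳ≤ l w (λ i v _ → e i v)

    ⊙-+ˡ : ∀ (P P' : Family I) X w → ((λ w h → P w h + P' w h) ⊙ X) w ≈ (P ⊙ X) w + (P' ⊙ X) w
    ⊙-+ˡ P P' X []      = refl
    ⊙-+ˡ P P' X (a ∷ w) = trans (+-congˡ (⊙-+ˡ (δ a P) (δ a P') X w))
      (solve 4 (λ a b c d → (a :+ b) :+ (c :+ d) := (a :+ c) :+ (b :+ d)) refl _ _ _ _)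

    ⊙-*ˡ : ∀ c (P : Family I) X w → ((λ w h → c * P w h) ⊙ X) w ≈ c * (P ⊙ X) w
    ⊙-*ˡ c P X []      = refl
    ⊙-*ˡ c P X (a ∷ w) = trans (+-congˡ (⊙-*ˡ c (δ a P) X w)) (sym (distribˡ c _ _))

    ⊙-finite : ∀ {P} → Finite P → ∀ w → IsFinite (λ (X : I × List L → Carrier) → (P ⊙ (λ i v → X (i , v))) w)
    ⊙-finite F []      = record
      { linear = reindex-linear (λ i → i , []) (linear (F [])) ; swap = λ r k → swap (F []) r _ }
    ⊙-finite F (a ∷ w) = +-finite
      (record { linear = reindex-linear (λ i → i , a ∷ w) (linear (F [])) ; swap = λ r k → swap (F []) r _ })
      (⊙-finite (λ w → F (a ∷ w)) w)

    ⊙-linear : ∀ {P} → Linear P → ∀ w → IsLinear (λ (X : I × List L → Carrier) → (P ⊙ (λ i v → X (i , v))) w)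
    ⊙-linear l []      = reindex-linear (λ i → i , []) (l [])
    ⊙-linear l (a ∷ w) = +-linear (reindex-linear (λ i → i , a ∷ w) (l [])) (⊙-linear (λ w → l (a ∷ w)) w)

    ⊙₂-congˡ : ∀ {P P' : List L → Family I} Z → (∀ u v h → P u v h ≈ P' u v h) → ∀ u v → (P ⊙₂ Z) u v ≈ (P' ⊙₂ Z) u v
    ⊙₂-congˡ Z e []      v = ⊙-congˡ _ (e []) v
    ⊙₂-congˡ Z e (a ∷ u) v = +-cong (⊙-congˡ _ (e []) v) (⊙₂-congˡ Z (λ u → e (a ∷ u)) u v)

    ⊙₂-+ˡ : ∀ (P P' : List L → Family I) Z u v →
            ((λ u v h → P u v h + P' u v h) ⊙₂ Z) u v ≈ (P ⊙₂ Z) u v + (P' ⊙₂ Z) u v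
    ⊙₂-+ˡ P P' Z []      v = ⊙-+ˡ _ _ _ v
    ⊙₂-+ˡ P P' Z (a ∷ u) v = trans (+-cong (⊙-+ˡ _ _ _ v) (⊙₂-+ˡ (δ a P) (δ a P') Z u v))
      (solve 4 (λ a b c d → (a :+ b) :+ (c :+ d) := (a :+ c) :+ (b :+ d)) refl _ _ _ _)

    ⊙₂-*ˡ : ∀ c (P : List L → Family I) Z u v → ((λ u v h → c * P u v h) ⊙₂ Z) u v ≈ c * (P ⊙₂ Z) u v
    ⊙₂-*ˡ c P Z []      v = ⊙-*ˡ c _ _ v
    ⊙₂-*ˡ c P Z (a ∷ u) v = trans (+-cong (⊙-*ˡ c _ _ v) (⊙₂-*ˡ c (δ a P) Z u v)) (sym (distribˡ c _ _))

    ⊙₂-[]ʳ : ∀ (P : List L → Family I) Z u → (P ⊙₂ Z) u [] ≈ ((λ w → P w []) ⊙ (λ i w → Z i w [])) u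
    ⊙₂-[]ʳ P Z []      = refl
    ⊙₂-[]ʳ P Z (a ∷ u) = +-congˡ (⊙₂-[]ʳ (δ a P) Z u)

    ⊙₂-∷ʳ : ∀ (P : List L → Family I) Z u b v →
            (P ⊙₂ Z) u (b ∷ v) ≈
            ((λ w → P w []) ⊙ (λ i w → Z i w (b ∷ v))) u + ((λ x y → P x (b ∷ y)) ⊙₂ Z) u v
    ⊙₂-∷ʳ P Z []      b v = refl
    ⊙₂-∷ʳ P Z (a ∷ u) b v = trans (+-congˡ (⊙₂-∷ʳ (δ a P) Z u b v))
      (solve 4 (λ a b c d → (a :+ b) :+ (c :+ d) := (a :+ c) :+ (b :+ d)) refl _ _ _ _)

    QF : Family I → List L → Family I
    QF P u v h = Q (λ w → P w h) u v

    -- Deconcatenation is multiplicative for the quasi-shuffle: cutting a term of the product of `u`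
    -- and `v` amounts to cutting `u` and `v` and multiplying the pieces. Finiteness of `P` moves it
    -- past the functional `Q`.
    Q-⊙ : ∀ {P : Family I} {X} → Finite P → ∀ u v → Q (P ⊙ X) u v ≈ (QF P ⊙₂ (λ i → Q (X i))) u v
    Q-⊙ F []      v  = refl
    Q-⊙ {P} {X} F (a ∷ u) [] = +-congˡ (begin
      (δ a P ⊙ X) u                                 ≈⟨ ⊙-congʳ (λ w → linear (F (a ∷ w))) (λ i v → sym (Q-[]ʳ (X i) v)) u ⟩
      (δ a P ⊙ (λ i w → Q (X i) w [])) u            ≈⟨ ⊙₂-[]ʳ (δ a (QF P)) (λ i → Q (X i)) u ⟨
      (δ a (QF P) ⊙₂ (λ i → Q (X i))) u []          ∎)
    Q-⊙ {P} {X} F (a ∷ u) (b ∷ v) = begin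
      Q (∂ a (P ⊙ X)) u (b ∷ v) + Q (∂ b (P ⊙ X)) (a ∷ u) v + λ̂ * Q (∂ c (P ⊙ X)) u v
        ≈⟨ +-cong (+-cong (step a u (b ∷ v)) (step b (a ∷ u) v)) (*-congˡ (step c u v)) ⟩
      (p a u (b ∷ v) + (r a ⊙₂ Z) u (b ∷ v)) + (p b (a ∷ u) v + (r b ⊙₂ Z) (a ∷ u) v) + λ̂ * (p c u v + (r c ⊙₂ Z) u v)
        -- The cuts to whose left part the second word contributes nothing are split off, so that
        -- all three recursive terms end in sums over the same cuts of `u` and `v`.
        ≈⟨ +-congʳ (+-congʳ (+-congˡ (trans (⊙₂-∷ʳ (r a) Z u b v) (+-congʳ (⊙-congˡ _ (λ w h → Q-[]ʳ _ w) u))))) ⟩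
      (p a u (b ∷ v) + (A + (ra ⊙₂ Z) u v)) + (p b (a ∷ u) v + (B + (rb ⊙₂ Z) u v)) + λ̂ * (p c u v + (r c ⊙₂ Z) u v)
        ≈⟨ solve 9 (λ l p1 A x1 p2 B x2 p3 x3 →
             (p1 :+ (A :+ x1)) :+ (p2 :+ (B :+ x2)) :+ l :* (p3 :+ x3) :=
             ((p1 :+ p2 :+ l :* p3) :+ B) :+ (A :+ (x1 :+ x2 :+ l :* x3))) refl λ̂ _ A _ _ B _ _ _ ⟩
      ((p a u (b ∷ v) + p b (a ∷ u) v + λ̂ * p c u v) + B) + (A + ((ra ⊙₂ Z) u v + (rb ⊙₂ Z) u v + λ̂ * (r c ⊙₂ Z) u v))
        ≈⟨ +-cong (+-congʳ (sym (trans (O-+ l0 _ _) (+-cong (O-+ l0 _ _) (O-* l0 λ̂ _)))))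
                  (+-congˡ (sym (trans (⊙₂-+ˡ (λ x y h → ra x y h + rb x y h) _ Z u v)
                             (+-cong (⊙₂-+ˡ ra rb Z u v) (⊙₂-*ˡ λ̂ (r c) Z u v))))) ⟩
      (P [] (λ i → Q (X i) (a ∷ u) (b ∷ v)) + B) + (A + ((λ x y → QF P (a ∷ x) (b ∷ y)) ⊙₂ Z) u v)
        ≈⟨ +-congˡ (⊙₂-∷ʳ (δ a (QF P)) Z u b v) ⟨
      (QF P ⊙₂ Z) (a ∷ u) (b ∷ v) ∎
      where
      c = a ⋄ b
      l0 = linear (F [])
      Z : I → List L → Series
      Z i = Q (X i)
      p : L → List L → List L → Carrier
      p d u' v' = P [] (λ i → Q (∂ d (X i)) u' v')
      r : L → List L → Family I
      r d = QF (δ d P)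
      ra rb : List L → Family I
      ra x y = r a x (b ∷ y)
      rb x y = r b (a ∷ x) y
      A = (δ a P ⊙ (λ i w → Q (X i) w (b ∷ v))) u
      B = (δ b P ⊙ (λ i → Q (X i) (a ∷ u))) v
      step : ∀ d u' v' → Q (∂ d (P ⊙ X)) u' v' ≈ p d u' v' + (r d ⊙₂ Z) u' v'
      step d u' v' = trans (O-+ (Q-linear u' v') _ _)
        (+-cong (swap (F []) (Q-linear u' v') _) (Q-⊙ (λ w → F (d ∷ w)) u' v'))

  ⊙₂-congʳ : ∀ {I} {P : List L → Family I} {Z Z'} → Linear₂ P → (∀ i u v → Z i u v ≈ Z' i u v) → ∀ u v →
             (P ⊙₂ Z) u v ≈ (P ⊙₂ Z') u v
  ⊙₂-congʳ l e []      v = ⊙-congʳ (l []) (λ i → e i []) v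
  ⊙₂-congʳ l e (a ∷ u) v = +-cong (⊙-congʳ (l []) (λ i → e i (a ∷ u)) v) (⊙₂-congʳ (λ u → l (a ∷ u)) e u v)

  ⊙₂-+ʳ : ∀ {I} {P : List L → Family I} {Z Z'} → Linear₂ P → ∀ u v →
          (P ⊙₂ (λ i x y → Z i x y + Z' i x y)) u v ≈ (P ⊙₂ Z) u v + (P ⊙₂ Z') u v
  ⊙₂-+ʳ l []      v = O-+ (⊙-linear (l []) v) _ _
  ⊙₂-+ʳ l (a ∷ u) v = trans (+-cong (O-+ (⊙-linear (l []) v) _ _) (⊙₂-+ʳ (λ u → l (a ∷ u)) u v))
    (solve 4 (λ a b c d → (a :+ b) :+ (c :+ d) := (a :+ c) :+ (b :+ d)) refl _ _ _ _)

  pt : Series → Family ⊤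
  pt f w h = f w * h tt

  pt-finite : ∀ f → Finite (pt f)
  pt-finite f w = point-finite (f w) tt

  pt-linear : ∀ f → Linear (pt f)
  pt-linear f w = linear (pt-finite f w)

  infixr 7 _·_
  _·_ : Series → Series → Series
  f · g = pt f ⊙ (λ _ → g)

  ·-cong : ∀ {f f' g g'} → (∀ w → f w ≈ f' w) → (∀ w → g w ≈ g' w) → ∀ w → (f · g) w ≈ (f' · g') w
  ·-cong e e' w = trans (⊙-congˡ _ (λ w h → *-congʳ (e w)) w) (⊙-congʳ (pt-linear _) (λ _ → e') w)

  ·-congˡ : ∀ {f g g'} → (∀ w → g w ≈ g' w) → ∀ w → (f · g) w ≈ (f · g') w
  ·-congˡ e = ·-cong (λ _ → refl) e

  ·-congʳ : ∀ {f f' g} → (∀ w → f w ≈ f' w) → ∀ w → (f · g) w ≈ (f' · g) w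
  ·-congʳ e = ·-cong e (λ _ → refl)

  ·-linearʳ : ∀ f w → IsLinear (λ g → (f · g) w)
  ·-linearʳ f []      = *-linear (f []) (at-linear [])
  ·-linearʳ f (a ∷ w) = +-linear (*-linear (f []) (at-linear (a ∷ w))) (·-linearʳ (∂ a f) w)

  ·-linearˡ : ∀ g w → IsLinear (λ f → (f · g) w)
  ·-linearˡ g []      = record
    { O-cong = λ e → *-congʳ (e []) ; O-+ = λ _ _ → distribʳ _ _ _ ; O-* = λ _ _ → *-assoc _ _ _ }
  ·-linearˡ g (a ∷ w) = +-linear
    (record { O-cong = λ e → *-congʳ (e []) ; O-+ = λ _ _ → distribʳ _ _ _ ; O-* = λ _ _ → *-assoc _ _ _ })
    (reindex-linear (a ∷_) (·-linearˡ g w))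

  ·-identityˡ : ∀ f w → (ε · f) w ≈ f w
  ·-identityˡ f []      = *-identityˡ _
  ·-identityˡ f (a ∷ w) = trans (+-cong (*-identityˡ _) (zero-· w)) (+-identityʳ _)
    where
    zero-· : ∀ w → ((λ _ → 0#) · f) w ≈ 0#
    zero-· w = O-0 (·-linearˡ f w)

  ·-identityʳ : ∀ f w → (f · ε) w ≈ f w
  ·-identityʳ f []      = *-identityʳ _
  ·-identityʳ f (a ∷ w) = trans (+-cong (zeroʳ _) (·-identityʳ (∂ a f) w)) (+-identityˡ _)

  ⊙-·-assoc : ∀ {I} {P : Family I} {X} → Finite P → ∀ g w → (P ⊙ (λ i → X i · g)) w ≈ ((P ⊙ X) · g) w
  ⊙-·-assoc F g [] = O-*ʳ (linear (F [])) _ _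
  ⊙-·-assoc {P = P} {X} F g (a ∷ w) = begin
    P [] (λ i → X i [] * g (a ∷ w) + (∂ a (X i) · g) w) + (δ a P ⊙ (λ i → X i · g)) w
      ≈⟨ +-cong (trans (O-+ (linear (F [])) _ _) (+-cong (O-*ʳ (linear (F [])) _ _) (sym (swap (F []) (·-linearˡ g w) _))))
                (⊙-·-assoc (λ w → F (a ∷ w)) g w) ⟩
    (P [] (λ i → X i []) * g (a ∷ w) + ((λ v → P [] (λ i → X i (a ∷ v))) · g) w) + ((δ a P ⊙ X) · g) w
      ≈⟨ trans (+-assoc _ _ _) (+-congˡ (sym (O-+ (·-linearˡ g w) _ _))) ⟩
    P [] (λ i → X i []) * g (a ∷ w) + (∂ a (P ⊙ X) · g) w ∎

  ·-assoc : ∀ f g h w → (f · g · h) w ≈ ((f · g) · h) w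
  ·-assoc f g h = ⊙-·-assoc (pt-finite f) h

  infixr 7 _·F_
  _·F_ : {I : Set} → Series → Family I → Family I
  (f ·F P) w h = (f · (λ v → P v h)) w

  ·-⊙-assoc : ∀ {I} f (P : Family I) X w → (f · (P ⊙ X)) w ≈ ((f ·F P) ⊙ X) w
  ·-⊙-assoc f P X []      = refl
  ·-⊙-assoc f P X (a ∷ w) = begin
    f [] * (P [] _ + (δ a P ⊙ X) w) + (∂ a f · (P ⊙ X)) w
      ≈⟨ +-cong (distribˡ _ _ _) (·-⊙-assoc (∂ a f) P X w) ⟩
    (f [] * P [] _ + f [] * (δ a P ⊙ X) w) + ((∂ a f ·F P) ⊙ X) w
      ≈⟨ trans (+-assoc _ _ _) (+-congˡ (sym (trans (⊙-+ˡ _ (∂ a f ·F P) X w) (+-congʳ (⊙-*ˡ (f []) (δ a P) X w))))) ⟩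
    ((f ·F P) ⊙ X) (a ∷ w) ∎

  ·F-finite : ∀ {I} f {P : Family I} → Finite P → Finite (f ·F P)
  ·F-finite f F []      = record
    { linear = *-linear (f []) (linear (F []))
    ; swap = λ r k → trans (O-* r _ _) (*-congˡ (swap (F []) r k)) }
  ·F-finite f F (a ∷ w) = +-finite
    (record { linear = *-linear (f []) (linear (F (a ∷ w)))
            ; swap = λ r k → trans (O-* r _ _) (*-congˡ (swap (F (a ∷ w)) r k)) })
    (·F-finite (∂ a f) F w)

  ·-** : ∀ c d f g w → ((λ v → c * f v) · (λ v → d * g v)) w ≈ c * d * (f · g) w
  ·-** c d f g w = trans (O-* (·-linearʳ _ w) d g) (trans (*-congˡ (O-* (·-linearˡ g w) c f))
    (solve 3 (λ c d x → d :* (c :* x) := c :* d :* x) refl c d _))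

  ⊗-⊙₂ : ∀ f f' g g' u v →
         ((λ x y (h : ⊤ → Carrier) → (f x * f' y) * h tt) ⊙₂ (λ _ x y → g x * g' y)) u v ≈ (f · g) u * (f' · g') v
  ⊗-⊙₂ f f' g g' [] v = ·-** (f []) (g []) f' g' v
  ⊗-⊙₂ f f' g g' (a ∷ u) v = trans (+-cong (·-** (f []) (g (a ∷ u)) f' g' v) (⊗-⊙₂ (∂ a f) f' g g' u v)) (sym (distribʳ _ _ _))

  QF-pt : ∀ f u v h → QF (pt f) u v h ≈ Q f u v * h tt
  QF-pt f u v h = O-*ʳ (Q-linear u v) _ _

  ·-char : ∀ {f g} → IsChar f → IsChar g → IsChar (f · g)
  ·-char {f} {g} (f1 , fm) (g1 , gm) = trans (*-cong f1 g1) (*-identityˡ _) , λ u v → begin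
    Q (f · g) u v
      ≈⟨ Q-⊙ (pt-finite f) u v ⟩
    (QF (pt f) ⊙₂ (λ _ → Q g)) u v
      ≈⟨ ⊙₂-congˡ _ (λ u v h → trans (QF-pt f u v h) (*-congʳ (fm u v))) u v ⟩
    ((λ x y (h : ⊤ → Carrier) → (f x * f y) * h tt) ⊙₂ (λ _ → Q g)) u v
      ≈⟨ ⊙₂-congʳ (λ x y → *-linear _ (at-linear tt)) (λ _ → gm) u v ⟩
    ((λ x y (h : ⊤ → Carrier) → (f x * f y) * h tt) ⊙₂ (λ _ x y → g x * g y)) u v
      ≈⟨ ⊗-⊙₂ f f g g u v ⟩
    (f · g) u * (f · g) v ∎

  ε-char : IsChar ε
  ε-char = refl , m
    where
    m : ∀ u v → Q ε u v ≈ ε u * ε v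
    m []      v       = sym (*-identityˡ _)
    m (a ∷ u) []      = sym (zeroˡ _)
    m (a ∷ u) (b ∷ v) = trans
      (+-cong (+-cong (O-0 (Q-linear u (b ∷ v))) (O-0 (Q-linear (a ∷ u) v))) (*-congˡ (O-0 (Q-linear u v))))
      (solve 1 (λ l → :0 :+ :0 :+ l :* :0 := :0 :* :0) refl λ̂)

  -- a one-letter word is primitive for deconcatenation, so quasi-shuffling with it is a derivation
  Q-leibniz : ∀ f g a v → Q (f · g) (a ∷ []) v ≈ (f · Q g (a ∷ [])) v + (Q f (a ∷ []) · g) v
  Q-leibniz f g a v = trans (Q-⊙ (pt-finite f) (a ∷ []) v) (+-congˡ
    (⊙-congˡ _ (λ w h → QF-pt f (a ∷ []) w h) v))

  module Commutative (⋄-comm : ∀ a b → a ⋄ b ≡ b ⋄ a) (⋄-assoc : ∀ a b c → (a ⋄ b) ⋄ c ≡ a ⋄ (b ⋄ c)) where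

    Q-comm : ∀ f u v → Q f u v ≈ Q f v u
    Q-comm f []      v       = sym (Q-[]ʳ f v)
    Q-comm f (a ∷ u) []      = refl
    Q-comm f (a ∷ u) (b ∷ v) = trans
      (+-cong (+-cong (Q-comm (∂ a f) u (b ∷ v)) (Q-comm (∂ b f) (a ∷ u) v))
        (*-congˡ (trans (Q-comm (∂ (a ⋄ b) f) u v) (reflexive (≡.cong (λ c → Q (∂ c f) v u) (⋄-comm a b))))))
      (+-congʳ (+-comm _ _))

    Q-assoc : ∀ f u v w → Q (λ x → Q f x w) u v ≈ Q (λ x → Q f u x) v w
    Q-assoc f []      v       w       = refl
    Q-assoc f (a ∷ u) []      w       = refl
    Q-assoc f (a ∷ u) (b ∷ v) []      = Q-cong (Q-[]ʳ f) (a ∷ u) (b ∷ v)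
    Q-assoc f (a ∷ u) (b ∷ v) (c ∷ w) = begin
      Q (λ x → Q f (a ∷ x) (c ∷ w)) u (b ∷ v) + Q (λ x → Q f (b ∷ x) (c ∷ w)) (a ∷ u) v
        + λ̂ * Q (λ x → Q f ((a ⋄ b) ∷ x) (c ∷ w)) u v
        ≈⟨ +-cong (+-cong (split a u (b ∷ v)) (split b (a ∷ u) v)) (*-congˡ (split (a ⋄ b) u v)) ⟩
      (A1 + M1 + λ̂ * A3) + (B1 + M2 + λ̂ * B3) + λ̂ * (C1 + M3 + λ̂ * C3)
        ≈⟨ solve 10 (λ l a1 m1 a3 b1 m2 b3 c1 m3 c3 →
             (a1 :+ m1 :+ l :* a3) :+ (b1 :+ m2 :+ l :* b3) :+ l :* (c1 :+ m3 :+ l :* c3) :=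
             a1 :+ b1 :+ (m1 :+ m2 :+ l :* m3) :+ l :* a3 :+ l :* b3 :+ l :* c1 :+ l :* l :* c3)
             refl λ̂ A1 M1 A3 B1 M2 B3 C1 M3 C3 ⟩
      A1 + B1 + (M1 + M2 + λ̂ * M3) + λ̂ * A3 + λ̂ * B3 + λ̂ * C1 + λ̂ * λ̂ * C3
        ≈⟨ +-cong (+-cong (+-cong (+-cong (+-cong (+-cong
             (Q-assoc (∂ a f) u (b ∷ v) (c ∷ w))
             (Q-assoc (∂ b f) (a ∷ u) v (c ∷ w)))
             (Q-assoc (∂ c f) (a ∷ u) (b ∷ v) w))
             (*-congˡ (Q-assoc (∂ (a ⋄ c) f) u (b ∷ v) w)))
             (*-congˡ (Q-assoc (∂ (b ⋄ c) f) (a ∷ u) v w)))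
             (*-congˡ (Q-assoc (∂ (a ⋄ b) f) u v (c ∷ w))))
             (*-congˡ (trans (Q-assoc (∂ ((a ⋄ b) ⋄ c) f) u v w)
                (reflexive (≡.cong (λ d → Q (λ x → Q (∂ d f) u x) v w) (⋄-assoc a b c))))) ⟩
      (A1' + A2' + λ̂ * A4') + Y1 + X1 + λ̂ * Y2 + λ̂ * Y3 + λ̂ * X2 + λ̂ * λ̂ * Y4
        ≈⟨ solve 10 (λ l a1 a2 a4 y1 x1 y2 y3 x2 y4 →
             (a1 :+ a2 :+ l :* a4) :+ y1 :+ x1 :+ l :* y2 :+ l :* y3 :+ l :* x2 :+ l :* l :* y4 :=
             (a1 :+ y1 :+ l :* x2) :+ (a2 :+ x1 :+ l :* y2) :+ l :* (a4 :+ y3 :+ l :* y4))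
             refl λ̂ A1' A2' A4' Y1 X1 Y2 Y3 X2 Y4 ⟩
      (A1' + Y1 + λ̂ * X2) + (A2' + X1 + λ̂ * Y2) + λ̂ * (A4' + Y3 + λ̂ * Y4)
        ≈⟨ +-cong (+-cong (split' b v (c ∷ w)) (split' c (b ∷ v) w)) (*-congˡ (split' (b ⋄ c) v w)) ⟨
      Q (λ x → Q f (a ∷ u) (b ∷ x)) v (c ∷ w) + Q (λ x → Q f (a ∷ u) (c ∷ x)) (b ∷ v) w
        + λ̂ * Q (λ x → Q f (a ∷ u) ((b ⋄ c) ∷ x)) v w ∎
      where
      split : ∀ d p q → Q (λ x → Q f (d ∷ x) (c ∷ w)) p q ≈
              Q (λ x → Q (∂ d f) x (c ∷ w)) p q + Q (λ x → Q (∂ c f) (d ∷ x) w) p q + λ̂ * Q (λ x → Q (∂ (d ⋄ c) f) x w) p q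
      split d p q = trans (O-+ (Q-linear p q) _ _) (+-cong (O-+ (Q-linear p q) _ _) (O-* (Q-linear p q) _ _))
      split' : ∀ d p q → Q (λ x → Q f (a ∷ u) (d ∷ x)) p q ≈
               Q (λ x → Q (∂ a f) u (d ∷ x)) p q + Q (λ x → Q (∂ d f) (a ∷ u) x) p q + λ̂ * Q (λ x → Q (∂ (a ⋄ d) f) u x) p q
      split' d p q = trans (O-+ (Q-linear p q) _ _) (+-cong (O-+ (Q-linear p q) _ _) (O-* (Q-linear p q) _ _))
      A1 = Q (λ x → Q (∂ a f) x (c ∷ w)) u (b ∷ v)
      M1 = Q (λ x → Q (∂ c f) (a ∷ x) w) u (b ∷ v)
      A3 = Q (λ x → Q (∂ (a ⋄ c) f) x w) u (b ∷ v)
      B1 = Q (λ x → Q (∂ b f) x (c ∷ w)) (a ∷ u) v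
      M2 = Q (λ x → Q (∂ c f) (b ∷ x) w) (a ∷ u) v
      B3 = Q (λ x → Q (∂ (b ⋄ c) f) x w) (a ∷ u) v
      C1 = Q (λ x → Q (∂ (a ⋄ b) f) x (c ∷ w)) u v
      M3 = Q (λ x → Q (∂ c f) ((a ⋄ b) ∷ x) w) u v
      C3 = Q (λ x → Q (∂ ((a ⋄ b) ⋄ c) f) x w) u v
      A1' = Q (λ x → Q (∂ a f) u (b ∷ x)) v (c ∷ w)
      A2' = Q (λ x → Q (∂ a f) u (c ∷ x)) (b ∷ v) w
      A4' = Q (λ x → Q (∂ a f) u ((b ⋄ c) ∷ x)) v w
      Y1 = Q (λ x → Q (∂ b f) (a ∷ u) x) v (c ∷ w)
      X1 = Q (λ x → Q (∂ c f) (a ∷ u) x) (b ∷ v) w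
      Y2 = Q (λ x → Q (∂ (a ⋄ c) f) u x) (b ∷ v) w
      Y3 = Q (λ x → Q (∂ (b ⋄ c) f) (a ∷ u) x) v w
      X2 = Q (λ x → Q (∂ (a ⋄ b) f) u x) v (c ∷ w)
      Y4 = Q (λ x → Q (∂ (a ⋄ (b ⋄ c)) f) u x) v w

  ∂ʳ : L → Series → Series
  ∂ʳ a f w = f (w ∷ʳ a)

  -- The quasi-shuffle satisfies the same recursion on last letters; this is what makes reversal
  -- compatible with it.
  Q-∷ʳ : ∀ f u a v b → Q f (u ∷ʳ a) (v ∷ʳ b) ≈
         Q (∂ʳ a f) u (v ∷ʳ b) + Q (∂ʳ b f) (u ∷ʳ a) v + λ̂ * Q (∂ʳ (a ⋄ b) f) u v
  Q-∷ʳ f [] a [] b = +-congʳ (+-comm _ _)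
  Q-∷ʳ f [] a (d ∷ v) b = trans (+-congʳ (+-congˡ (Q-∷ʳ (∂ d f) [] a v b)))
    (solve 6 (λ x y z w l t → x :+ (y :+ z :+ l :* w) :+ l :* t := y :+ (x :+ z :+ l :* t) :+ l :* w) refl
      _ _ _ _ λ̂ _)
  Q-∷ʳ f (c ∷ u) a [] b = trans
    (+-cong (+-congʳ (trans (Q-∷ʳ (∂ c f) u a [] b) (+-cong (+-congˡ (Q-[]ʳ _ (u ∷ʳ a))) (*-congˡ (Q-[]ʳ _ u)))))
            (*-congˡ (trans (Q-[]ʳ _ (u ∷ʳ a)) (sym (Q-[]ʳ _ u)))))
    (solve 6 (λ x y z w l t → (x :+ y :+ l :* z) :+ w :+ l :* t := x :+ w :+ l :* t :+ y :+ l :* z) refl _ _ _ _ λ̂ _)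
  Q-∷ʳ f (c ∷ u) a (d ∷ v) b = trans
    (+-cong (+-cong (Q-∷ʳ (∂ c f) u a (d ∷ v) b) (Q-∷ʳ (∂ d f) (c ∷ u) a v b)) (*-congˡ (Q-∷ʳ (∂ (c ⋄ d) f) u a v b)))
    (solve 10 (λ l a1 a2 a3 b1 b2 b3 c1 c2 c3 →
      (a1 :+ a2 :+ l :* a3) :+ (b1 :+ b2 :+ l :* b3) :+ l :* (c1 :+ c2 :+ l :* c3) :=
      (a1 :+ b1 :+ l :* c1) :+ (a2 :+ b2 :+ l :* c2) :+ l :* (a3 :+ b3 :+ l :* c3)) refl λ̂ _ _ _ _ _ _ _ _ _)

  rev : Series → Series
  rev f w = f (reverse w)

  Q-rev : ∀ f u v → Q (rev f) u v ≈ Q f (reverse u) (reverse v)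
  Q-rev f []      v       = refl
  Q-rev f (a ∷ u) []      = sym (Q-[]ʳ f _)
  Q-rev f (a ∷ u) (b ∷ v) = begin
    Q (λ w → f (reverse (a ∷ w))) u (b ∷ v) + Q (λ w → f (reverse (b ∷ w))) (a ∷ u) v
      + λ̂ * Q (λ w → f (reverse (a ⋄ b ∷ w))) u v
      ≈⟨ +-cong (+-cong (step a u (b ∷ v)) (step b (a ∷ u) v)) (*-congˡ (step (a ⋄ b) u v)) ⟩
    Q (∂ʳ a f) (reverse u) (reverse (b ∷ v)) + Q (∂ʳ b f) (reverse (a ∷ u)) (reverse v)
      + λ̂ * Q (∂ʳ (a ⋄ b) f) (reverse u) (reverse v)
      ≡⟨ ≡.cong₂ (λ x y → Q (∂ʳ a f) (reverse u) y + Q (∂ʳ b f) x (reverse v) + λ̂ * Q (∂ʳ (a ⋄ b) f) (reverse u) (reverse v))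
           (List.unfold-reverse a u) (List.unfold-reverse b v) ⟩
    Q (∂ʳ a f) (reverse u) (reverse v ∷ʳ b) + Q (∂ʳ b f) (reverse u ∷ʳ a) (reverse v)
      + λ̂ * Q (∂ʳ (a ⋄ b) f) (reverse u) (reverse v)
      ≈⟨ Q-∷ʳ f (reverse u) a (reverse v) b ⟨
    Q f (reverse u ∷ʳ a) (reverse v ∷ʳ b)
      ≡⟨ ≡.cong₂ (Q f) (List.unfold-reverse a u) (List.unfold-reverse b v) ⟨
    Q f (reverse (a ∷ u)) (reverse (b ∷ v)) ∎
    where
    step : ∀ c p q → Q (λ w → f (reverse (c ∷ w))) p q ≈ Q (∂ʳ c f) (reverse p) (reverse q)
    step c p q = trans (Q-cong (λ w → reflexive (≡.cong f (List.unfold-reverse c w))) p q) (Q-rev (∂ʳ c f) p q)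

  rev-char : ∀ {f} → IsChar f → IsChar (rev f)
  rev-char {f} (f1 , fm) = f1 , λ u v → trans (Q-rev f u v) (fm _ _)

  ·-∷ʳ : ∀ f g u a → (f · g) (u ∷ʳ a) ≈ (f · ∂ʳ a g) u + f (u ∷ʳ a) * g []
  ·-∷ʳ f g []      a = refl
  ·-∷ʳ f g (b ∷ u) a = trans (+-congˡ (·-∷ʳ (∂ b f) g u a)) (sym (+-assoc _ _ _))

  rev-· : ∀ f g u → rev (f · g) u ≈ (rev g · rev f) u
  rev-· f g []      = *-comm _ _
  rev-· f g (a ∷ u) = begin
    (f · g) (reverse (a ∷ u))                              ≡⟨ ≡.cong (f · g) (List.unfold-reverse a u) ⟩
    (f · g) (reverse u ∷ʳ a)                               ≈⟨ ·-∷ʳ f g (reverse u) a ⟩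
    (f · ∂ʳ a g) (reverse u) + f (reverse u ∷ʳ a) * g []   ≈⟨ +-cong (rev-· f (∂ʳ a g) u) (*-comm _ _) ⟩
    (rev (∂ʳ a g) · rev f) u + g [] * f (reverse u ∷ʳ a)   ≈⟨ +-comm _ _ ⟩
    g [] * f (reverse u ∷ʳ a) + (rev (∂ʳ a g) · rev f) u
      ≈⟨ +-cong (*-congˡ (reflexive (≡.cong f (List.unfold-reverse a u))))
                (·-congʳ (λ w → reflexive (≡.cong g (List.unfold-reverse a w))) u) ⟨
    (rev g · rev f) (a ∷ u)                                ∎

-- Substitution of series for letters

module Swap (K : QAlg) (L : Set) (_⋄_ : L → L → L) (λ̂ : QAlg.Carrier K) where
  open Alg K
  open IsFinite using (linear; swap)
  open QS K L _⋄_ λ̂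

  ⊙-swap : ∀ {I J} {P : Family I} → Finite P → {R : (J → Carrier) → Carrier} → IsLinear R → ∀ (X : I → List L → J → Carrier) w →
           R (λ j → (P ⊙ (λ i v → X i v j)) w) ≈ (P ⊙ (λ i v → R (X i v))) w
  ⊙-swap F r X w = swap (⊙-finite F w) r (λ (i , v) → X i v)

  ⊙-fubini : ∀ {I J} {P : Family I} {P' : Family J} → Finite P → Linear P' → ∀ (Z : I → J → List L → List L → Carrier) u v →
             (P' ⊙ (λ j y → (P ⊙ (λ i x → Z i j x y)) u)) v ≈ (P ⊙ (λ i x → (P' ⊙ (λ j y → Z i j x y)) v)) u
  ⊙-fubini F l Z u v = ⊙-swap F (⊙-linear l v) (λ i x (j , y) → Z i j x y) u

-- The substitution x_a ↦ 𝒜_a in a series, followed by multiplication by t on the right.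
module Substitution (K : QAlg) (L : Set) (_⋄_ : L → L → L) (λ̂ : QAlg.Carrier K)
  (𝒜 : QS.Family K L _⋄_ λ̂ L) (t : QS.Series K L _⋄_ λ̂)
  (𝒜-finite : QS.Finite K L _⋄_ λ̂ 𝒜) (𝒜[] : ∀ h → QAlg._≈_ K (𝒜 [] h) (QAlg.0# K)) where

  open Alg K
  open QS K L _⋄_ λ̂
  open IsLinear
  open IsFinite using (linear; swap)
  open Swap K L _⋄_ λ̂

  𝒜-linear : Linear 𝒜
  𝒜-linear w = linear (𝒜-finite w)

  mutual
    -- Since `𝒜 []` vanishes, each substituted letter consumes at least one letter of the word.
    -- Splitting that letter off before entering `tail` turns this into structural recursion.
    N : Series → Series
    N f []      = f [] * t []
    N f (a ∷ w) = f [] * t (a ∷ w) + tail (δ a 𝒜) f w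

    tail : Family L → Series → Series
    tail 𝓑 f []      = 𝓑 [] (λ n → N (∂ n f) [])
    tail 𝓑 f (b ∷ w) = 𝓑 [] (λ n → N (∂ n f) (b ∷ w)) + tail (δ b 𝓑) f w

  tail≈⊙ : ∀ 𝓑 f w → tail 𝓑 f w ≈ (𝓑 ⊙ (λ n → N (∂ n f))) w
  tail≈⊙ 𝓑 f []      = refl
  tail≈⊙ 𝓑 f (b ∷ w) = +-congˡ (tail≈⊙ (δ b 𝓑) f w)

  N-unfold : ∀ f w → N f w ≈ f [] * t w + (𝒜 ⊙ (λ n → N (∂ n f))) w
  N-unfold f []      = sym (trans (+-congˡ (𝒜[] _)) (+-identityʳ _))
  N-unfold f (a ∷ w) = +-congˡ (trans (tail≈⊙ (δ a 𝒜) f w)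
    (sym (trans (+-congʳ (𝒜[] _)) (+-identityˡ _))))

  private
    head-linear : ∀ w → IsLinear (λ (f : Series) → f [] * t w)
    head-linear w = record
      { O-cong = λ e → *-congʳ (e []) ; O-+ = λ _ _ → distribʳ _ _ _ ; O-* = λ _ _ → *-assoc _ _ _ }

    ∘-linear : ∀ {I J : Set} {O : (I → Carrier) → Carrier} {M : I → (J → Carrier) → Carrier} →
               IsLinear O → (∀ i → IsLinear (M i)) → IsLinear (λ f → O (λ i → M i f))
    ∘-linear o m = record
      { O-cong = λ e → O-cong o (λ i → O-cong (m i) e)
      ; O-+ = λ f g → trans (O-cong o (λ i → O-+ (m i) f g)) (O-+ o _ _)
      ; O-* = λ c f → trans (O-cong o (λ i → O-* (m i) c f)) (O-* o c _) }

  mutual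
    N-linear : ∀ w → IsLinear (λ f → N f w)
    N-linear []      = head-linear []
    N-linear (a ∷ w) = +-linear (head-linear (a ∷ w)) (tail-linear (λ w → 𝒜-linear (a ∷ w)) w)

    tail-linear : ∀ {𝓑} → Linear 𝓑 → ∀ w → IsLinear (λ f → tail 𝓑 f w)
    tail-linear l []      = ∘-linear (l []) (λ n → reindex-linear (n ∷_) (N-linear []))
    tail-linear l (b ∷ w) = +-linear
      (∘-linear (l []) (λ n → reindex-linear (n ∷_) (N-linear (b ∷ w))))
      (tail-linear (λ w → l (b ∷ w)) w)

  N-cong : ∀ {f g} → (∀ w → f w ≈ g w) → ∀ w → N f w ≈ N g w
  N-cong e w = O-cong (N-linear w) e

  -- Because `𝒜 []` vanishes, the right side of the equation involves `M` only at shorter words.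
  -- Different substitutions are compared through this.
  N-unique : (M : Series → Series) → (∀ f w → M f w ≈ f [] * t w + (𝒜 ⊙ (λ n → M (∂ n f))) w) →
             ∀ f w → M f w ≈ N f w
  N-unique M e f w = go (length w) f w ℕ.≤-refl
    where
    go : ∀ n f w → length w ℕ.≤ n → M f w ≈ N f w
    go zero f [] _ = trans (e f []) (trans (+-congˡ (𝒜[] _)) (+-identityʳ _))
    go (suc n) f w w≤ = trans (e f w) (trans
      (+-congˡ (⊙-congʳ< 𝒜-linear 𝒜[] w (λ i v v<w → go n (∂ i f) v (ℕ.≤-pred (ℕ.≤-trans v<w w≤)))))
      (sym (N-unfold f w)))

  N-ε : ∀ w → N ε w ≈ t w
  N-ε w = trans (N-unfold ε w) (trans
    (+-cong (*-identityˡ _) (trans (⊙-congʳ 𝒜-linear (λ n v → O-0 (N-linear v)) w) (O-0 (⊙-linear 𝒜-linear w))))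
    (+-identityʳ _))

  -- Δ(𝒜_c) = 𝒜_c ⊗ 1 + 1 ⊗ 𝒜_c + λ̂ Σ_{a ⋄ b = c} 𝒜_a ⊗ 𝒜_b, tested against functions of the letter c
  Compatible : Set
  Compatible = ∀ (h : L → Carrier) u v →
    Q (λ w → 𝒜 w h) u v ≈ 𝒜 u h * ε v + ε u * 𝒜 v h + λ̂ * 𝒜 u (λ a → 𝒜 v (λ b → h (a ⋄ b)))

  module _ (compat : Compatible) (t-char : IsChar t) where

    N₂ : (List L → Series) → List L → Series
    N₂ F u v = N (λ x → N (F x) v) u

    N₂-cong : ∀ {F G : List L → Series} → (∀ x y → F x y ≈ G x y) → ∀ u v → N₂ F u v ≈ N₂ G u v
    N₂-cong e u v = N-cong (λ x → N-cong (e x) v) u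

    N₂-+ : ∀ (F G : List L → Series) u v → N₂ (λ x y → F x y + G x y) u v ≈ N₂ F u v + N₂ G u v
    N₂-+ F G u v = trans (N-cong (λ x → O-+ (N-linear v) (F x) (G x)) u) (O-+ (N-linear u) _ _)

    N₂-* : ∀ c (F : List L → Series) u v → N₂ (λ x y → c * F x y) u v ≈ c * N₂ F u v
    N₂-* c F u v = trans (N-cong (λ x → O-* (N-linear v) c (F x)) u) (O-* (N-linear u) c _)

    N₂-unfoldʳ : ∀ F u v → N₂ F u v ≈
      N (λ x → F x []) u * t v + (𝒜 ⊙ (λ b y → N₂ (λ x → ∂ b (F x)) u y)) v
    N₂-unfoldʳ F u v = begin
      N (λ x → N (F x) v) u
        ≈⟨ N-cong (λ x → N-unfold (F x) v) u ⟩
      N (λ x → F x [] * t v + (𝒜 ⊙ (λ b → N (∂ b (F x)))) v) u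
        ≈⟨ O-+ (N-linear u) _ _ ⟩
      N (λ x → F x [] * t v) u + N (λ x → (𝒜 ⊙ (λ b → N (∂ b (F x)))) v) u
        ≈⟨ +-cong (O-*ʳ (N-linear u) _ _) (⊙-swap 𝒜-finite (N-linear u) (λ b y x → N (∂ b (F x)) y) v) ⟩
      N (λ x → F x []) u * t v + (𝒜 ⊙ (λ b y → N₂ (λ x → ∂ b (F x)) u y)) v ∎

    N₂-unfoldˡ : ∀ F u v → N₂ F u v ≈ N (F []) v * t u + (𝒜 ⊙ (λ a x → N₂ (δ a F) x v)) u
    N₂-unfoldˡ F u v = N-unfold (λ x → N (F x) v) u

    -- Once the left word starts with `a`, a term of the product starts with `a`, with the first
    -- letter `b` of the right word, or with the two merged; the case of an empty right word is
    -- absorbed into the first sum.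
    N₂-Q : ∀ f a u v → N₂ (δ a (Q f)) u v ≈
      N₂ (Q (∂ a f)) u v + (𝒜 ⊙ (λ b y → N₂ (δ a (Q (∂ b f))) u y)) v
        + λ̂ * (𝒜 ⊙ (λ b y → N₂ (Q (∂ (a ⋄ b) f)) u y)) v
    N₂-Q f a u v = begin
      N₂ (δ a (Q f)) u v
        ≈⟨ N₂-unfoldʳ (δ a (Q f)) u v ⟩
      N (∂ a f) u * t v + (𝒜 ⊙ (λ b y → N₂ (λ x → ∂ b (Q f (a ∷ x))) u y)) v
        ≈⟨ +-congˡ (trans (⊙-congʳ 𝒜-linear (λ b y → trans (N₂-+ _ _ u y) (+-cong (N₂-+ _ _ u y) (N₂-* λ̂ _ u y))) v)
             (trans (O-+ (⊙-linear 𝒜-linear v) _ _) (+-cong (O-+ (⊙-linear 𝒜-linear v) _ _) (O-* (⊙-linear 𝒜-linear v) λ̂ _)))) ⟩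
      N (∂ a f) u * t v + (X + Y + λ̂ * Z)
        ≈⟨ solve 4 (λ p x y z → p :+ (x :+ y :+ z) := (p :+ x) :+ y :+ z) refl _ X Y (λ̂ * Z) ⟩
      (N (∂ a f) u * t v + X) + Y + λ̂ * Z
        ≈⟨ +-congʳ (+-congʳ (trans (N₂-unfoldʳ (Q (∂ a f)) u v) (+-congʳ (*-congʳ (N-cong (λ x → Q-[]ʳ (∂ a f) x) u))))) ⟨
      N₂ (Q (∂ a f)) u v + Y + λ̂ * Z ∎
      where
      X = (𝒜 ⊙ (λ b y → N₂ (λ x → ∂ b (Q (∂ a f) x)) u y)) v
      Y = (𝒜 ⊙ (λ b y → N₂ (δ a (Q (∂ b f))) u y)) v
      Z = (𝒜 ⊙ (λ b y → N₂ (Q (∂ (a ⋄ b) f)) u y)) v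

    private
      -- `E₁`, `E₂` and `E₃` evaluate the three terms of `Compatible`: a factor `ε` forces the
      -- trivial cut of one word, and the last term becomes two independent sums over cuts.
      E₁ : ∀ (Z : L → List L → Series) u v →
           ((λ x y h → 𝒜 x h * ε y) ⊙₂ Z) u v ≈ (𝒜 ⊙ (λ n x → Z n x v)) u
      E₁ Z = go 𝒜 𝒜-linear
        where
        last : ∀ (P : (L → Carrier) → Carrier) (l : IsLinear P) (X : L → Series) v →
               ((λ y h → P h * ε y) ⊙ X) v ≈ P (λ n → X n v)
        last P l X []      = *-identityʳ _
        last P l X (b ∷ v) = trans (+-cong (*-identityʳ _) (rest v)) (+-identityʳ _)
          where
          rest : ∀ v → ((λ y h → P h * 0#) ⊙ (λ n → X n)) v ≈ 0#
          rest []      = zeroʳ _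
          rest (c ∷ v) = trans (+-cong (zeroʳ _) (rest v)) (+-identityʳ _)
        go : ∀ (P : Family L) → Linear P → ∀ u v → ((λ x y h → P x h * ε y) ⊙₂ Z) u v ≈ (P ⊙ (λ n x → Z n x v)) u
        go P l []      v = last (P []) (l []) _ v
        go P l (a ∷ u) v = +-cong (last (P []) (l []) _ v) (go (δ a P) (λ w → l (a ∷ w)) u v)

      E₂ : ∀ (Z : L → List L → Series) u v →
           ((λ x y h → ε x * 𝒜 y h) ⊙₂ Z) u v ≈ (𝒜 ⊙ (λ n → Z n u)) v
      E₂ Z []      v = ⊙-congˡ _ (λ w h → *-identityˡ _) v
      E₂ Z (a ∷ u) v = trans (+-cong (⊙-congˡ _ (λ w h → *-identityˡ _) v) (rest u)) (+-identityʳ _)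
        where
        z : ∀ (X : L → Series) v → ((λ y h → 0# * 𝒜 y h) ⊙ X) v ≈ 0#
        z X []      = zeroˡ _
        z X (b ∷ v) = trans (⊙-*ˡ 0# 𝒜 X (b ∷ v)) (zeroˡ _)
        rest : ∀ {Z'} u → ((λ x y h → 0# * 𝒜 y h) ⊙₂ Z') u v ≈ 0#
        rest []      = z _ v
        rest (c ∷ u) = trans (+-cong (z _ v) (rest u)) (+-identityʳ _)

      E₃ : ∀ (Z : L → List L → Series) u v →
           ((λ x y h → 𝒜 x (λ a → 𝒜 y (λ b → h (a ⋄ b)))) ⊙₂ Z) u v ≈
           (𝒜 ⊙ (λ a x → (𝒜 ⊙ (λ b y → Z (a ⋄ b) x y)) v)) u
      E₃ Z = go 𝒜 𝒜-finite
        where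
        inner : ∀ (P : (L → Carrier) → Carrier) → IsLinear P → ∀ (𝓑 : Family L) (X : L → Series) v →
                ((λ y h → P (λ a → 𝓑 y (λ b → h (a ⋄ b)))) ⊙ X) v ≈ P (λ a → (𝓑 ⊙ (λ b → X (a ⋄ b))) v)
        inner P l 𝓑 X []      = refl
        inner P l 𝓑 X (c ∷ v) = trans (+-congˡ (inner P l (δ c 𝓑) X v)) (sym (O-+ l _ _))
        go : ∀ (P : Family L) → Finite P → ∀ u v → ((λ x y h → P x (λ a → 𝒜 y (λ b → h (a ⋄ b)))) ⊙₂ Z) u v ≈
             (P ⊙ (λ a x → (𝒜 ⊙ (λ b y → Z (a ⋄ b) x y)) v)) u
        go P l []      v = inner (P []) (linear (l [])) 𝒜 _ v
        go P l (a ∷ u) v = +-cong (inner (P []) (linear (l [])) 𝒜 _ v) (go (δ a P) (λ w → l (a ∷ w)) u v)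

    -- Substitution respects the coproduct because it does so on letters, by `compat`. The induction
    -- is on the total length, since the three terms of `compat` shorten `u`, or `v`, or both.
    Q-N : ∀ f u v → Q (N f) u v ≈ N₂ (Q f) u v
    Q-N f u v = go (length u ℕ.+ length v) f u v ℕ.≤-refl
      where
      go : ∀ n f u v → length u ℕ.+ length v ℕ.≤ n → Q (N f) u v ≈ N₂ (Q f) u v
      go n f u v uv≤n = begin
        Q (N f) u v
          ≈⟨ Q-cong (N-unfold f) u v ⟩
        Q (λ w → f [] * t w + (𝒜 ⊙ X) w) u v
          ≈⟨ trans (O-+ (Q-linear u v) _ _) (+-cong (trans (O-* (Q-linear u v) _ _) (*-congˡ (proj₂ t-char u v))) (Q-⊙ 𝒜-finite u v)) ⟩
        f [] * (t u * t v) + (QF 𝒜 ⊙₂ (λ i → Q (X i))) u v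
          ≈⟨ +-congˡ (trans (⊙₂-congˡ _ (λ u v h → compat h u v) u v) (trans (⊙₂-+ˡ _ _ _ u v)
               (+-cong (⊙₂-+ˡ _ _ _ u v) (⊙₂-*ˡ λ̂ _ _ u v)))) ⟩
        f [] * (t u * t v) + (((λ x y h → 𝒜 x h * ε y) ⊙₂ (λ i → Q (X i))) u v
          + ((λ x y h → ε x * 𝒜 y h) ⊙₂ (λ i → Q (X i))) u v
          + λ̂ * ((λ x y h → 𝒜 x (λ a → 𝒜 y (λ b → h (a ⋄ b)))) ⊙₂ (λ i → Q (X i))) u v)
          ≈⟨ +-congˡ (+-cong (+-cong (E₁ _ u v) (E₂ _ u v)) (*-congˡ (E₃ _ u v))) ⟩
        f [] * (t u * t v) + ((𝒜 ⊙ (λ a x → Q (X a) x v)) u + (𝒜 ⊙ (λ b → Q (X b) u)) v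
          + λ̂ * (𝒜 ⊙ (λ a x → (𝒜 ⊙ (λ b y → Q (X (a ⋄ b)) x y)) v)) u)
          ≈⟨ +-congˡ (+-cong (+-cong
               (⊙-congʳ< 𝒜-linear 𝒜[] u (λ a x x<u → IH a x v (ℕ.+-monoˡ-< (length v) x<u)))
               (⊙-congʳ< 𝒜-linear 𝒜[] v (λ b y y<v → IH b u y (ℕ.+-monoʳ-< (length u) y<v))))
               (*-congˡ (⊙-congʳ< 𝒜-linear 𝒜[] u (λ a x x<u → ⊙-congʳ< 𝒜-linear 𝒜[] v
                  (λ b y y<v → IH (a ⋄ b) x y (ℕ.+-mono-< x<u y<v)))))) ⟩
        f [] * (t u * t v) + ((𝒜 ⊙ (λ a x → W a x v)) u + (𝒜 ⊙ (λ b → W b u)) v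
          + λ̂ * (𝒜 ⊙ (λ a x → (𝒜 ⊙ (λ b y → W (a ⋄ b) x y)) v)) u)
          -- The right side, unfolded in `u`, contains a mixed sum `C` over a letter substituted in
          -- `u` and one in `v`; here it is extracted from the terms that begin with a letter of
          -- `v`.
          ≈⟨ +-congˡ (+-congʳ (+-congˡ (begin
               (𝒜 ⊙ (λ b → W b u)) v
                 ≈⟨ ⊙-congʳ 𝒜-linear (λ b y → N₂-unfoldˡ (Q (∂ b f)) u y) v ⟩
               (𝒜 ⊙ (λ b y → N (∂ b f) y * t u + (𝒜 ⊙ (λ a x → N₂ (δ a (Q (∂ b f))) x y)) u)) v
                 ≈⟨ trans (O-+ (⊙-linear 𝒜-linear v) _ _) (+-cong (O-*ʳ (⊙-linear 𝒜-linear v) _ _)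
                      (⊙-fubini 𝒜-finite 𝒜-linear (λ a b x y → N₂ (δ a (Q (∂ b f))) x y) u v)) ⟩
               (𝒜 ⊙ (λ b → N (∂ b f))) v * t u + (𝒜 ⊙ (λ a x → (𝒜 ⊙ (λ b y → N₂ (δ a (Q (∂ b f))) x y)) v)) u ∎))) ⟩
        f [] * (t u * t v) + (A + (B * t u + C) + λ̂ * D)
          ≈⟨ solve 7 (λ f tu tv A B C D → f :* (tu :* tv) :+ (A :+ (B :* tu :+ C) :+ D) :=
               (f :* tv :+ B) :* tu :+ (A :+ C :+ D)) refl (f []) (t u) (t v) A B C (λ̂ * D) ⟩
        (f [] * t v + B) * t u + (A + C + λ̂ * D)
          ≈⟨ +-cong (*-congʳ (N-unfold f v)) (trans (⊙-congʳ 𝒜-linear (λ a x → N₂-Q f a x v) u)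
               (trans (O-+ (⊙-linear 𝒜-linear u) _ _) (+-cong (O-+ (⊙-linear 𝒜-linear u) _ _) (O-* (⊙-linear 𝒜-linear u) λ̂ _)))) ⟨
        N f v * t u + (𝒜 ⊙ (λ a x → N₂ (δ a (Q f)) x v)) u
          ≈⟨ N₂-unfoldˡ (Q f) u v ⟨
        N₂ (Q f) u v ∎
        where
        X : L → Series
        X n = N (∂ n f)
        W : L → List L → Series
        W c = N₂ (Q (∂ c f))
        A = (𝒜 ⊙ (λ a x → W a x v)) u
        B = (𝒜 ⊙ (λ b → N (∂ b f))) v
        C = (𝒜 ⊙ (λ a x → (𝒜 ⊙ (λ b y → N₂ (δ a (Q (∂ b f))) x y)) v)) u
        D = (𝒜 ⊙ (λ a x → (𝒜 ⊙ (λ b y → W (a ⋄ b) x y)) v)) u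
        below : ∀ n → length u ℕ.+ length v ℕ.≤ n → ∀ c x y → length x ℕ.+ length y ℕ.< length u ℕ.+ length v →
                Q (N (∂ c f)) x y ≈ N₂ (Q (∂ c f)) x y
        below (suc n) uv≤n c x y xy<uv = go n (∂ c f) x y (ℕ.≤-pred (ℕ.≤-trans xy<uv uv≤n))
        below zero uv≤n c x y xy<uv with () ← ℕ.≤-trans xy<uv uv≤n
        IH : ∀ c x y → length x ℕ.+ length y ℕ.< length u ℕ.+ length v → Q (N (∂ c f)) x y ≈ N₂ (Q (∂ c f)) x y
        IH = below n uv≤n

    N-char : ∀ {f} → IsChar f → IsChar (N f)
    N-char {f} (f1 , fm) = trans (*-cong f1 (proj₁ t-char)) (*-identityˡ _) , λ u v → begin
      Q (N f) u v                       ≈⟨ Q-N f u v ⟩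
      N₂ (Q f) u v                      ≈⟨ N₂-cong fm u v ⟩
      N (λ x → N (λ y → f x * f y) v) u ≈⟨ N-cong (λ x → O-* (N-linear v) (f x) f) u ⟩
      N (λ x → f x * N f v) u           ≈⟨ O-*ʳ (N-linear u) f (N f v) ⟩
      N f u * N f v                     ∎

module SubstitutionProduct (K : QAlg) (L : Set) (_⋄_ : L → L → L) (λ̂ : QAlg.Carrier K)
  (𝒜 : QS.Family K L _⋄_ λ̂ L) (t : QS.Series K L _⋄_ λ̂)
  (𝒜-finite : QS.Finite K L _⋄_ λ̂ 𝒜) (𝒜[] : ∀ h → QAlg._≈_ K (𝒜 [] h) (QAlg.0# K)) where

  open Alg K
  open QS K L _⋄_ λ̂
  open IsLinear
  open Substitution K L _⋄_ λ̂ 𝒜 t 𝒜-finite 𝒜[]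
  private module S = Substitution K L _⋄_ λ̂ 𝒜 ε 𝒜-finite 𝒜[]

  -- Substitution is multiplicative; the final multiplication by `t` must happen once, so it stays
  -- with the last factor and the first is substituted with `ε` in its place.
  N-· : ∀ g k w → N (g · k) w ≈ (S.N g · N k) w
  N-· g k w = go (length w) g w ℕ.≤-refl
    where
    expand : ∀ g w → N (g · k) w ≈ g [] * N k w + (𝒜 ⊙ (λ n → N (∂ n g · k))) w
    expand g w = begin
      N (g · k) w
        ≈⟨ N-unfold (g · k) w ⟩
      g [] * k [] * t w + (𝒜 ⊙ (λ n → N (λ v → g [] * k (n ∷ v) + (∂ n g · k) v))) w
        ≈⟨ +-congˡ (trans (⊙-congʳ 𝒜-linear (λ n v → trans (O-+ (N-linear v) _ _) (+-congʳ (O-* (N-linear v) _ _))) w)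
             (trans (O-+ (⊙-linear 𝒜-linear w) _ _) (+-congʳ (O-* (⊙-linear 𝒜-linear w) _ _)))) ⟩
      g [] * k [] * t w + (g [] * (𝒜 ⊙ (λ n → N (∂ n k))) w + (𝒜 ⊙ (λ n → N (∂ n g · k))) w)
        ≈⟨ solve 5 (λ a b c d e → a :* b :* c :+ (a :* d :+ e) := a :* (b :* c :+ d) :+ e) refl _ _ _ _ _ ⟩
      g [] * (k [] * t w + (𝒜 ⊙ (λ n → N (∂ n k))) w) + (𝒜 ⊙ (λ n → N (∂ n g · k))) w
        ≈⟨ +-congʳ (*-congˡ (N-unfold k w)) ⟨
      g [] * N k w + (𝒜 ⊙ (λ n → N (∂ n g · k))) w ∎

    expand' : ∀ g w → (S.N g · N k) w ≈ g [] * N k w + (𝒜 ⊙ (λ n → S.N (∂ n g) · N k)) w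
    expand' g w = begin
      (S.N g · N k) w
        ≈⟨ ·-congʳ (S.N-unfold g) w ⟩
      ((λ v → g [] * ε v + (𝒜 ⊙ (λ n → S.N (∂ n g))) v) · N k) w
        ≈⟨ trans (O-+ (·-linearˡ (N k) w) _ _) (+-cong (trans (O-* (·-linearˡ (N k) w) _ _) (*-congˡ (·-identityˡ (N k) w)))
             (sym (⊙-·-assoc 𝒜-finite (N k) w))) ⟩
      g [] * N k w + (𝒜 ⊙ (λ n → S.N (∂ n g) · N k)) w ∎

    go : ∀ n g w → length w ℕ.≤ n → N (g · k) w ≈ (S.N g · N k) w
    go zero g [] _ = trans (expand g []) (sym (trans (expand' g []) (+-congˡ (trans (𝒜[] _) (sym (𝒜[] _))))))
    go (suc n) g w w≤ = trans (expand g w) (trans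
      (+-congˡ (⊙-congʳ< 𝒜-linear 𝒜[] w (λ i v v<w → go n (∂ i g) v (ℕ.≤-pred (ℕ.≤-trans v<w w≤)))))
      (sym (expand' g w)))

-- The Ihara action on shuffle characters

module Shuffle (K : QAlg) where
  open Alg K
  open IsLinear
  open QS K Letter (λ _ _ → x0) 0# public

  anti : Series → Series
  anti f w = sgn (length w) * f (reverse w)

  Q-∷ : ∀ f a u b v → Q f (a ∷ u) (b ∷ v) ≈ Q (∂ a f) u (b ∷ v) + Q (∂ b f) (a ∷ u) v
  Q-∷ f a u b v = trans (+-congˡ (zeroˡ _)) (+-identityʳ _)

  Q-sgn : ∀ f u v → Q (λ w → sgn (length w) * f w) u v ≈ (sgn (length u) * sgn (length v)) * Q f u v
  Q-sgn f []      v       = *-congʳ (sym (*-identityˡ _))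
  Q-sgn f (a ∷ u) []      = *-congʳ (sym (*-identityʳ _))
  Q-sgn f (a ∷ u) (b ∷ v) = begin
    Q (λ w → sgn (length w) * f w) (a ∷ u) (b ∷ v)
      ≈⟨ Q-∷ (λ w → sgn (length w) * f w) a u b v ⟩
    Q (λ w → - sgn (length w) * f (a ∷ w)) u (b ∷ v) + Q (λ w → - sgn (length w) * f (b ∷ w)) (a ∷ u) v
      ≈⟨ +-cong (step a u (b ∷ v)) (step b (a ∷ u) v) ⟩
    - (sgn (length u) * - sgn (length v) * Q (∂ a f) u (b ∷ v)) + - (- sgn (length u) * sgn (length v) * Q (∂ b f) (a ∷ u) v)
      ≈⟨ solve 4 (λ x y p q → :- (x :* (:- y) :* p) :+ :- ((:- x) :* y :* q) := (:- x) :* (:- y) :* (:- p :+ :- q) :+ (x :* y :* (p :+ q) :+ x :* y :* (p :+ q))) refl _ _ _ _ ⟩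
    - sgn (length u) * - sgn (length v) * (- Q (∂ a f) u (b ∷ v) + - Q (∂ b f) (a ∷ u) v)
      + (sgn (length u) * sgn (length v) * (Q (∂ a f) u (b ∷ v) + Q (∂ b f) (a ∷ u) v) + sgn (length u) * sgn (length v) * (Q (∂ a f) u (b ∷ v) + Q (∂ b f) (a ∷ u) v))
      ≈⟨ solve 4 (λ x y p q → (:- x) :* (:- y) :* (:- p :+ :- q) :+ (x :* y :* (p :+ q) :+ x :* y :* (p :+ q)) := (:- x) :* (:- y) :* (p :+ q)) refl _ _ _ _ ⟩
    - sgn (length u) * - sgn (length v) * (Q (∂ a f) u (b ∷ v) + Q (∂ b f) (a ∷ u) v)
      ≈⟨ *-congˡ (Q-∷ f a u b v) ⟨
    (sgn (length (a ∷ u)) * sgn (length (b ∷ v))) * Q f (a ∷ u) (b ∷ v) ∎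
    where
    step : ∀ c p q → Q (λ w → - sgn (length w) * f (c ∷ w)) p q ≈ - (sgn (length p) * sgn (length q) * Q (∂ c f) p q)
    step c p q = trans (Q-cong (λ w → sym (-‿distribˡ-* _ _)) p q)
      (trans (O-neg (Q-linear p q) _) (-‿cong (Q-sgn (∂ c f) p q)))

  anti-char : ∀ {f} → IsChar f → IsChar (anti f)
  anti-char {f} fc = trans (*-identityˡ _) (proj₁ fc) , λ u v →
    trans (Q-sgn (rev f) u v) (trans (*-congˡ (proj₂ (rev-char fc) u v))
      (solve 4 (λ a b c d → (a :* b) :* (c :* d) := (a :* c) :* (b :* d)) refl _ _ _ _))

  anti-anti : ∀ f w → anti (anti f) w ≈ f w
  anti-anti f w = trans (*-congˡ (*-cong (reflexive (≡.cong sgn (List.length-reverse w)))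
                                         (reflexive (≡.cong f (List.reverse-involutive w)))))
    (trans (sym (*-assoc _ _ _)) (trans (*-congʳ (sgn² (length w))) (*-identityˡ _)))

  splits : (Word → Word → Carrier) → Word → Carrier
  splits G []      = G [] []
  splits G (a ∷ w) = G [] (a ∷ w) + splits (λ u v → G (a ∷ u) v) w

  splits-cong : ∀ {G H} → (∀ u v → G u v ≈ H u v) → ∀ w → splits G w ≈ splits H w
  splits-cong e []      = e [] []
  splits-cong e (a ∷ w) = +-cong (e [] (a ∷ w)) (splits-cong (λ u → e (a ∷ u)) w)

  splits-+ : ∀ G H w → splits (λ u v → G u v + H u v) w ≈ splits G w + splits H w
  splits-+ G H []      = refl
  splits-+ G H (a ∷ w) = trans (+-congˡ (splits-+ _ _ w))
    (solve 4 (λ a b c d → (a :+ b) :+ (c :+ d) := (a :+ c) :+ (b :+ d)) refl _ _ _ _)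

  splits-neg : ∀ G w → splits (λ u v → - G u v) w ≈ - splits G w
  splits-neg G []      = refl
  splits-neg G (a ∷ w) = trans (+-congˡ (splits-neg _ w)) (solve 2 (λ a b → :- a :+ :- b := :- (a :+ b)) refl _ _)

  splits-∷ʳ : ∀ G w b → splits G (w ∷ʳ b) ≈ splits (λ u v → G u (v ∷ʳ b)) w + G (w ∷ʳ b) []
  splits-∷ʳ G []      b = refl
  splits-∷ʳ G (a ∷ w) b = trans (+-congˡ (splits-∷ʳ _ w b)) (sym (+-assoc _ _ _))

  ·≈splits : ∀ f g w → (f · g) w ≈ splits (λ u v → f u * g v) w
  ·≈splits f g []      = refl
  ·≈splits f g (a ∷ w) = +-congˡ (·≈splits (∂ a f) g w)

  -- Σ_{w = uv} (-1)^{|v|} u ш rev(v) = 0 for w ≠ 1: by the recursion of ш on both first letters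
  -- the sum telescopes to the same sum for w without its first and without its last letter.
  private
    altern : Series → Word → Word → Carrier
    altern f u v = sgn (length v) * Q f u (reverse v)

    altern-end : ∀ f a u v b → altern f (a ∷ u) (v ∷ʳ b) ≈ altern (∂ a f) u (v ∷ʳ b) + - altern (∂ b f) (a ∷ u) v
    altern-end f a u v b = begin
      sgn (length (v ∷ʳ b)) * Q f (a ∷ u) (reverse (v ∷ʳ b))
        ≡⟨ ≡.cong₂ (λ n y → sgn n * Q f (a ∷ u) y) len (List.reverse-++ v (b ∷ [])) ⟩
      - sgn (length v) * Q f (a ∷ u) (b ∷ reverse v)
        ≈⟨ *-congˡ (Q-∷ f a u b (reverse v)) ⟩
      - sgn (length v) * (Q (∂ a f) u (b ∷ reverse v) + Q (∂ b f) (a ∷ u) (reverse v))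
        ≈⟨ solve 3 (λ s p q → (:- s) :* (p :+ q) := (:- s) :* p :+ :- (s :* q)) refl _ _ _ ⟩
      - sgn (length v) * Q (∂ a f) u (b ∷ reverse v) + - altern (∂ b f) (a ∷ u) v
        ≡⟨ ≡.cong₂ (λ n y → sgn n * Q (∂ a f) u y + - altern (∂ b f) (a ∷ u) v) len (List.reverse-++ v (b ∷ [])) ⟨
      altern (∂ a f) u (v ∷ʳ b) + - altern (∂ b f) (a ∷ u) v ∎
      where
      len : length (v ∷ʳ b) ≡ suc (length v)
      len = ≡.trans (List.length-++ v) (ℕ.+-comm _ 1)

    altern-vanish : ∀ n f a w → length w ℕ.≤ n → splits (altern f) (a ∷ w) ≈ 0#
    altern-vanish n f a w w≤n with initLast w
    ... | [] = solve 1 (λ x → (:- :1) :* x :+ :1 :* x := :0) refl _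
    altern-vanish zero f a .([] ∷ʳ b) () | [] ∷ʳ′ b
    altern-vanish zero f a .((c ∷ w) ∷ʳ b) () | (c ∷ w) ∷ʳ′ b
    altern-vanish (suc n) f a .(w ∷ʳ b) w≤n | w ∷ʳ′ b = begin
      altern f [] (a ∷ w ∷ʳ b) + splits (λ u v → altern f (a ∷ u) v) (w ∷ʳ b)
        ≈⟨ +-congˡ (trans (splits-∷ʳ _ w b) (+-congʳ (trans (splits-cong (λ u v → altern-end f a u v b) w)
             (trans (splits-+ _ _ w) (+-congˡ (splits-neg _ w)))))) ⟩
      altern f [] (a ∷ w ∷ʳ b) + ((A + - B) + altern f (a ∷ w ∷ʳ b) [])
        ≈⟨ +-congʳ first ⟩
      - altern (∂ b f) [] (a ∷ w) + ((A + - B) + 1# * f (a ∷ w ∷ʳ b))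
        ≈⟨ +-congˡ (+-congˡ (*-congˡ (sym (Q-[]ʳ (∂ a f) (w ∷ʳ b))))) ⟩
      - altern (∂ b f) [] (a ∷ w) + ((A + - B) + altern (∂ a f) (w ∷ʳ b) [])
        ≈⟨ solve 4 (λ x A B y → :- x :+ ((A :+ :- B) :+ y) := (A :+ y) :+ :- (x :+ B)) refl _ A B _ ⟩
      (A + altern (∂ a f) (w ∷ʳ b) []) + - (altern (∂ b f) [] (a ∷ w) + B)
        ≈⟨ +-congʳ (sym (splits-∷ʳ (altern (∂ a f)) w b)) ⟩
      splits (altern (∂ a f)) (w ∷ʳ b) + - splits (altern (∂ b f)) (a ∷ w)
        ≈⟨ +-cong (left w w≤n') (-‿cong (altern-vanish n (∂ b f) a w w≤n')) ⟩
      0# + - 0#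
        ≈⟨ -‿inverseʳ 0# ⟩
      0# ∎
      where
      A = splits (λ u v → altern (∂ a f) u (v ∷ʳ b)) w
      B = splits (λ u v → altern (∂ b f) (a ∷ u) v) w
      len : length (w ∷ʳ b) ≡ suc (length w)
      len = ≡.trans (List.length-++ w) (ℕ.+-comm _ 1)
      w≤n' : length w ℕ.≤ n
      w≤n' = ℕ.≤-pred (≡.subst (ℕ._≤ suc n) len w≤n)
      first : altern f [] (a ∷ w ∷ʳ b) ≈ - altern (∂ b f) [] (a ∷ w)
      first = trans (reflexive (≡.cong₂ (λ m y → sgn (suc m) * f y) len (List.reverse-++ (a ∷ w) (b ∷ []))))
                    (sym (-‿distribˡ-* _ _))
      left : ∀ w → length w ℕ.≤ n → splits (altern (∂ a f)) (w ∷ʳ b) ≈ 0#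
      left []      _   = altern-vanish n (∂ a f) b [] z≤n
      left (c ∷ w) w≤n = altern-vanish n (∂ a f) c (w ∷ʳ b)
        (≡.subst (ℕ._≤ n) (≡.sym (≡.trans (List.length-++ w) (ℕ.+-comm _ 1))) w≤n)

  anti-inverseʳ : ∀ {f} → IsChar f → ∀ w → (f · anti f) w ≈ ε w
  anti-inverseʳ {f} (f1 , fm) [] = trans (*-cong f1 (*-congˡ f1)) (trans (*-identityˡ _) (*-identityˡ _))
  anti-inverseʳ {f} (f1 , fm) (a ∷ w) = begin
    (f · anti f) (a ∷ w)                                   ≈⟨ ·≈splits f (anti f) (a ∷ w) ⟩
    splits (λ u v → f u * anti f v) (a ∷ w)                ≈⟨ splits-cong (λ u v → trans
                                                                (solve 3 (λ a b c → a :* (b :* c) := b :* (a :* c)) refl (f u) (sgn (length v)) (f (reverse v)))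
                                                                (*-congˡ (sym (fm u (reverse v))))) (a ∷ w) ⟩
    splits (altern f) (a ∷ w)                              ≈⟨ altern-vanish (length w) f a w ℕ.≤-refl ⟩
    0#                                                     ∎

  anti-inverseˡ : ∀ {f} → IsChar f → ∀ w → (anti f · f) w ≈ ε w
  anti-inverseˡ {f} fc w = trans (·-congˡ (λ w → sym (anti-anti f w)) w) (anti-inverseʳ (anti-char fc) w)

  letter : Letter → Series
  letter x0 (x0 ∷ []) = 1#
  letter x1 (x1 ∷ []) = 1#
  letter _  _         = 0#

  letter-∷ : ∀ a X b w → (letter a · X) (b ∷ w) ≈ letter a (b ∷ []) * X w
  letter-∷ x0 X x0 w = trans (+-congʳ (zeroˡ _)) (trans (+-identityˡ _) (trans (one w) (sym (*-identityˡ _))))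
    where one : ∀ w → (∂ x0 (letter x0) · X) w ≈ X w
          one w = trans (·-congʳ (λ { [] → refl ; (a ∷ w) → refl }) w) (·-identityˡ X w)
  letter-∷ x0 X x1 w = trans (+-cong (zeroˡ _) (O-0 (·-linearˡ X w))) (trans (+-identityˡ _) (sym (zeroˡ _)))
  letter-∷ x1 X x1 w = trans (+-congʳ (zeroˡ _)) (trans (+-identityˡ _) (trans (one w) (sym (*-identityˡ _))))
    where one : ∀ w → (∂ x1 (letter x1) · X) w ≈ X w
          one w = trans (·-congʳ (λ { [] → refl ; (a ∷ w) → refl }) w) (·-identityˡ X w)
  letter-∷ x1 X x0 w = trans (+-cong (zeroˡ _) (O-0 (·-linearˡ X w))) (trans (+-identityˡ _) (sym (zeroˡ _)))

  letter-[] : ∀ a X → (letter a · X) [] ≈ 0#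
  letter-[] x0 X = zeroˡ _
  letter-[] x1 X = zeroˡ _

  letter-sum : ∀ (X : Letter → Series) b w → (letter x0 · X x0) (b ∷ w) + (letter x1 · X x1) (b ∷ w) ≈ X b w
  letter-sum X x0 w = trans (+-cong (letter-∷ x0 (X x0) x0 w) (letter-∷ x1 (X x1) x0 w))
    (solve 2 (λ a b → :1 :* a :+ :0 :* b := a) refl _ _)
  letter-sum X x1 w = trans (+-cong (letter-∷ x0 (X x0) x1 w) (letter-∷ x1 (X x1) x1 w))
    (solve 2 (λ a b → :0 :* a :+ :1 :* b := b) refl _ _)

  Primitive : Series → Set
  Primitive g = ∀ u v → Q g u v ≈ g u * ε v + ε u * g v

  letter-primitive : ∀ a → Primitive (letter a)
  letter-primitive a []      v       = trans (sym (*-identityˡ _)) (trans (sym (+-identityˡ _)) (+-congʳ (sym (trans (*-congʳ (e a)) (zeroˡ _)))))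
    where e : ∀ a → letter a [] ≈ 0#
          e x0 = refl
          e x1 = refl
  letter-primitive a (b ∷ u) []      = solve 2 (λ x y → x := x :* :1 :+ :0 :* y) refl _ _
  letter-primitive a (b ∷ u) (c ∷ v) = trans (Q-∷ (letter a) b u c v) (trans (+-cong (short a b u c v) (Q-∂ a c b u v))
    (solve 2 (λ x y → :0 :+ :0 := x :* :0 :+ :0 :* y) refl _ _))
    where
    long : ∀ a b c w → letter a (b ∷ c ∷ w) ≈ 0#
    long x0 x0 c w = refl
    long x0 x1 c w = refl
    long x1 x0 c w = refl
    long x1 x1 c w = refl
    nonempty : ∀ (f : Series) → (∀ c w → f (c ∷ w) ≈ 0#) → ∀ u b v → Q f u (b ∷ v) ≈ 0#
    nonempty f z []      b v = z b v
    nonempty f z (a ∷ u) b v = trans (Q-∷ f a u b v)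
      (trans (+-cong (O-zero (Q-linear u (b ∷ v)) (z a)) (O-zero (Q-linear (a ∷ u) v) (z b))) (+-identityˡ _))
    short : ∀ a b u c v → Q (∂ b (letter a)) u (c ∷ v) ≈ 0#
    short a b u c v = nonempty (∂ b (letter a)) (long a b) u c v
    Q-∂ : ∀ a c b u v → Q (∂ c (letter a)) (b ∷ u) v ≈ 0#
    Q-∂ a c b u []      = long a c b u
    Q-∂ a c b u (d ∷ v) = nonempty (∂ c (letter a)) (long a c) (b ∷ u) d v

  private
    module Tensor (f f1 f2 g g1 g2 g3 g4 : Series) where
      right : (∀ u v → Q f u v ≈ f1 u * f2 v) → (∀ u v → Q g u v ≈ g1 u * g2 v + g3 u * g4 v) →
              ∀ u v → Q (f · g) u v ≈ (f1 · g1) u * (f2 · g2) v + (f1 · g3) u * (f2 · g4) v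
      right ef eg u v = begin
        Q (f · g) u v
          ≈⟨ Q-⊙ (pt-finite f) u v ⟩
        (QF (pt f) ⊙₂ (λ _ → Q g)) u v
          ≈⟨ ⊙₂-congˡ _ (λ u v h → trans (QF-pt f u v h) (*-congʳ (ef u v))) u v ⟩
        (P ⊙₂ (λ _ → Q g)) u v
          ≈⟨ ⊙₂-congʳ l (λ _ → eg) u v ⟩
        (P ⊙₂ (λ _ x y → g1 x * g2 y + g3 x * g4 y)) u v
          ≈⟨ ⊙₂-+ʳ l u v ⟩
        (P ⊙₂ (λ _ x y → g1 x * g2 y)) u v + (P ⊙₂ (λ _ x y → g3 x * g4 y)) u v
          ≈⟨ +-cong (⊗-⊙₂ f1 f2 g1 g2 u v) (⊗-⊙₂ f1 f2 g3 g4 u v) ⟩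
        (f1 · g1) u * (f2 · g2) v + (f1 · g3) u * (f2 · g4) v ∎
        where
        P : Word → Word → (⊤ → Carrier) → Carrier
        P x y h = (f1 x * f2 y) * h tt
        l : Linear₂ P
        l x y = *-linear _ (at-linear tt)

      left : (∀ u v → Q g u v ≈ g1 u * g2 v + g3 u * g4 v) → (∀ u v → Q f u v ≈ f1 u * f2 v) →
             ∀ u v → Q (g · f) u v ≈ (g1 · f1) u * (g2 · f2) v + (g3 · f1) u * (g4 · f2) v
      left eg ef u v = begin
        Q (g · f) u v
          ≈⟨ Q-⊙ (pt-finite g) u v ⟩
        (QF (pt g) ⊙₂ (λ _ → Q f)) u v
          ≈⟨ ⊙₂-congˡ _ (λ u v h → trans (QF-pt g u v h) (trans (*-congʳ (eg u v)) (distribʳ _ _ _))) u v ⟩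
        ((λ x y h → (g1 x * g2 y) * h tt + (g3 x * g4 y) * h tt) ⊙₂ (λ _ → Q f)) u v
          ≈⟨ ⊙₂-+ˡ _ _ _ u v ⟩
        ((λ x y h → (g1 x * g2 y) * h tt) ⊙₂ (λ _ → Q f)) u v + ((λ x y h → (g3 x * g4 y) * h tt) ⊙₂ (λ _ → Q f)) u v
          ≈⟨ +-cong (⊙₂-congʳ (λ x y → *-linear _ (at-linear tt)) (λ _ → ef) u v)
                    (⊙₂-congʳ (λ x y → *-linear _ (at-linear tt)) (λ _ → ef) u v) ⟩
        ((λ x y h → (g1 x * g2 y) * h tt) ⊙₂ (λ _ x y → f1 x * f2 y)) u v + ((λ x y h → (g3 x * g4 y) * h tt) ⊙₂ (λ _ x y → f1 x * f2 y)) u v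
          ≈⟨ +-cong (⊗-⊙₂ g1 g2 f1 f2 u v) (⊗-⊙₂ g3 g4 f1 f2 u v) ⟩
        (g1 · f1) u * (g2 · f2) v + (g3 · f1) u * (g4 · f2) v ∎

  -- The coproduct of the conjugate is `(f ⊗ f)(a ⊗ 1 + 1 ⊗ a)(f⁻¹ ⊗ f⁻¹)`, and `f f⁻¹` cancels in
  -- the tensor factor without `a`.
  conj-primitive : ∀ {f} → IsChar f → ∀ a → Primitive (f · letter a · anti f)
  conj-primitive {f} fc a u v = trans
    (Tensor.right f f f g g s s g (proj₂ fc) gs u v)
    (+-cong (*-congˡ (anti-inverseʳ fc v)) (*-congʳ (anti-inverseʳ fc u)))
    where
    s = anti f
    g = letter a · s
    gs : ∀ u v → Q g u v ≈ g u * s v + s u * g v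
    gs u v = trans (Tensor.left s s s (letter a) (letter a) ε ε (letter a) (letter-primitive a) (proj₂ (anti-char fc)) u v)
      (+-cong (*-congˡ (·-identityˡ s v)) (*-congʳ (·-identityˡ s u)))

-- The Ihara action of a grouplike Φ on series Ψ, i.e. Ψ ↦ Φ ⊛ Ψ = Φ Ψ(x0 , Φ⁻¹ x1 Φ) = Ψ(Φ x0 Φ⁻¹ , x1) Φ;
-- conj below is the substitution Ψ ↦ Ψ(Φ x0 Φ⁻¹ , x1).
module Ihara (K : QAlg) (Φ : Shuffle.Series K) (Φ-char : Shuffle.IsChar K Φ) where
  open Alg K
  open Shuffle K
  open IsLinear

  A0 : Series
  A0 = Φ · letter x0 · anti Φ

  A0[] : A0 [] ≈ 0#
  A0[] = solve 2 (λ a b → a :* (:0 :* b) := :0) refl _ _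

  𝒜 : Family Letter
  𝒜 w h = A0 w * h x0 + letter x1 w * h x1

  𝒜-finite : Finite 𝒜
  𝒜-finite w = +-finite (point-finite _ x0) (point-finite _ x1)

  𝒜[] : ∀ h → 𝒜 [] h ≈ 0#
  𝒜[] h = trans (+-cong (trans (*-congʳ A0[]) (zeroˡ _)) (zeroˡ _)) (+-identityʳ _)

  private
    module S (t : Series) = Substitution K Letter (λ _ _ → x0) 0# 𝒜 t 𝒜-finite 𝒜[]

  act conj : Series → Series
  act  = S.N Φ
  conj = S.N ε

  compat : S.Compatible Φ
  compat h u v = begin
    Q (λ w → A0 w * h x0 + letter x1 w * h x1) u v
      ≈⟨ trans (O-+ (Q-linear u v) _ _) (+-cong (O-*ʳ (Q-linear u v) A0 _) (O-*ʳ (Q-linear u v) (letter x1) _)) ⟩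
    Q A0 u v * h x0 + Q (letter x1) u v * h x1
      ≈⟨ +-cong (*-congʳ (conj-primitive Φ-char x0 u v)) (*-congʳ (letter-primitive x1 u v)) ⟩
    (A0 u * ε v + ε u * A0 v) * h x0 + (letter x1 u * ε v + ε u * letter x1 v) * h x1
      ≈⟨ solve 9 (λ a b c d e f g h k → (a :* b :+ c :* d) :* g :+ (e :* b :+ c :* f) :* h :=
           (a :* g :+ e :* h) :* b :+ c :* (d :* g :+ f :* h) :+ :0 :* k) refl _ _ _ _ _ _ _ _ _ ⟩
    𝒜 u h * ε v + ε u * 𝒜 v h + 0# * 𝒜 u (λ a → 𝒜 v (λ b → h x0)) ∎

  act-char : ∀ {f} → IsChar f → IsChar (act f)
  act-char = S.N-char Φ compat Φ-char

  act-linear : ∀ w → IsLinear (λ f → act f w)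
  act-linear = S.N-linear Φ

  act-cong : ∀ {f g} → (∀ w → f w ≈ g w) → ∀ w → act f w ≈ act g w
  act-cong = S.N-cong Φ

  conj-linear : ∀ w → IsLinear (λ f → conj f w)
  conj-linear = S.N-linear ε

  act-· : ∀ g k w → act (g · k) w ≈ (conj g · act k) w
  act-· = SubstitutionProduct.N-· K Letter (λ _ _ → x0) 0# 𝒜 Φ 𝒜-finite 𝒜[]

  conj-· : ∀ g k w → conj (g · k) w ≈ (conj g · conj k) w
  conj-· = SubstitutionProduct.N-· K Letter (λ _ _ → x0) 0# 𝒜 ε 𝒜-finite 𝒜[]

  act-ε : ∀ w → act ε w ≈ Φ w
  act-ε = S.N-ε Φ

  𝒜-⊙ : ∀ X w → (𝒜 ⊙ X) w ≈ (A0 · X x0) w + (letter x1 · X x1) w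
  𝒜-⊙ X w = trans (⊙-+ˡ (λ w h → A0 w * h x0) (λ w h → letter x1 w * h x1) X w) (+-cong (one A0 x0 w) (one (letter x1) x1 w))
    where
    one : ∀ f a w → ((λ w h → f w * h a) ⊙ X) w ≈ (f · X a) w
    one f a []      = refl
    one f a (b ∷ w) = +-congˡ (one (∂ b f) a w)

  act-unfold : ∀ f w → act f w ≈ f [] * Φ w + ((A0 · act (∂ x0 f)) w + (letter x1 · act (∂ x1 f)) w)
  act-unfold f w = trans (S.N-unfold Φ f w) (+-congˡ (𝒜-⊙ _ w))

  act-unique : (M : Series → Series) →
    (∀ f w → M f w ≈ f [] * Φ w + ((A0 · M (∂ x0 f)) w + (letter x1 · M (∂ x1 f)) w)) → ∀ f w → M f w ≈ act f w
  act-unique M e = S.N-unique Φ M (λ f w → trans (e f w) (+-congˡ (sym (𝒜-⊙ _ w))))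

  conj-letter : ∀ a w → conj (letter a) w ≈ 𝒜 w (λ b → letter a (b ∷ []))
  conj-letter a w = begin
    conj (letter a) w
      ≈⟨ trans (S.N-unfold ε (letter a) w) (+-cong (trans (*-congʳ (z a)) (zeroˡ _)) (𝒜-⊙ _ w)) ⟩
    0# + ((A0 · conj (∂ x0 (letter a))) w + (letter x1 · conj (∂ x1 (letter a))) w)
      ≈⟨ +-identityˡ _ ⟩
    (A0 · conj (∂ x0 (letter a))) w + (letter x1 · conj (∂ x1 (letter a))) w
      ≈⟨ +-cong (step A0 x0) (step (letter x1) x1) ⟩
    A0 w * letter a (x0 ∷ []) + letter x1 w * letter a (x1 ∷ []) ∎
    where
    z : ∀ a → letter a [] ≈ 0#
    z x0 = refl
    z x1 = refl
    d : ∀ a b v → ∂ b (letter a) v ≈ letter a (b ∷ []) * ε v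
    d x0 x0 []      = sym (*-identityˡ _)
    d x0 x0 (c ∷ v) = sym (zeroʳ _)
    d x0 x1 []      = sym (zeroˡ _)
    d x0 x1 (c ∷ v) = sym (zeroˡ _)
    d x1 x0 []      = sym (zeroˡ _)
    d x1 x0 (c ∷ v) = sym (zeroˡ _)
    d x1 x1 []      = sym (*-identityˡ _)
    d x1 x1 (c ∷ v) = sym (zeroʳ _)
    step : ∀ f b → (f · conj (∂ b (letter a))) w ≈ f w * letter a (b ∷ [])
    step f b = trans (·-congˡ (λ v → trans (O-cong (conj-linear v) (d a b)) (trans (O-* (conj-linear v) _ ε) (*-congˡ (S.N-ε ε v)))) w)
      (trans (O-* (·-linearʳ f w) _ ε) (trans (*-comm _ _) (*-congʳ (·-identityʳ f w))))

  conj-x1 : ∀ w → conj (letter x1) w ≈ letter x1 w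
  conj-x1 w = trans (conj-letter x1 w) (solve 2 (λ a b → a :* :0 :+ b :* :1 := b) refl _ _)

  conj-x0 : ∀ w → conj (letter x0) w ≈ A0 w
  conj-x0 w = trans (conj-letter x0 w) (solve 2 (λ a b → a :* :1 :+ b :* :0 := a) refl _ _)

  -- The recursion of Goncharov's coproduct, read off on coefficients: P e is the integral from
  -- the last chosen letter to e over the letters passed so far.
  path : Letter → Letter → Series
  path x1 x0 = Φ
  path x0 x1 = anti Φ
  path x0 x0 = ε
  path x1 x1 = ε

  gon : (Letter → Series) → Series → Series
  gon P Ψ []      = P x0 [] * Ψ []
  gon P Ψ (e ∷ w) = gon (λ b → ∂ e (P b)) Ψ w + P e [] * gon (path e) (∂ e Ψ) w

  -- Sorts the sum by the first chosen letter: none, `x0` or `x1`. In this form it can be compared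
  -- with `act-unfold`.
  gon-unfold : ∀ P Ψ w → gon P Ψ w ≈ Ψ [] * P x0 w +
    ((P x0 · letter x0 · gon (path x0) (∂ x0 Ψ)) w + (P x1 · letter x1 · gon (path x1) (∂ x1 Ψ)) w)
  gon-unfold P Ψ [] = solve 5 (λ a b c d e → a :* b := b :* a :+ (a :* (:0 :* c) :+ d :* (:0 :* e))) refl
    (P x0 []) (Ψ []) (gon (path x0) (∂ x0 Ψ) []) (P x1 []) (gon (path x1) (∂ x1 Ψ) [])
  gon-unfold P Ψ (e ∷ w) = trans (+-cong (gon-unfold (λ b → ∂ e (P b)) Ψ w) (sel e))
    (solve 5 (λ a b c p q → (a :+ (b :+ c)) :+ (p :+ q) := a :+ ((p :+ b) :+ (q :+ c))) refl _ _ _ _ _)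
    where
    X : Letter → Series
    X b = gon (path b) (∂ b Ψ)
    sel : ∀ e → P e [] * X e w ≈ P x0 [] * (letter x0 · X x0) (e ∷ w) + P x1 [] * (letter x1 · X x1) (e ∷ w)
    sel x0 = sym (trans (+-cong (*-congˡ (letter-∷ x0 (X x0) x0 w)) (*-congˡ (letter-∷ x1 (X x1) x0 w)))
      (solve 4 (λ a b c d → a :* (:1 :* b) :+ c :* (:0 :* d) := a :* b) refl _ _ _ _))
    sel x1 = sym (trans (+-cong (*-congˡ (letter-∷ x0 (X x0) x1 w)) (*-congˡ (letter-∷ x1 (X x1) x1 w)))
      (solve 4 (λ a b c d → a :* (:0 :* b) :+ c :* (:1 :* d) := c :* d) refl _ _ _ _))

  -- After a chosen `x0` the paths start at `x0`, so that case has to be proved along with this one;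
  -- its value is `Φ⁻¹ · act Ψ`. The two equations then close up, because `Φ x0 Φ⁻¹` is the series
  -- substituted for `x0`.
  gon≈act : ∀ Ψ w → gon (path x1) Ψ w ≈ act Ψ w
  gon≈act Ψ w = proj₂ (go (length w) Ψ w ℕ.≤-refl)
    where
    target : Letter → Series → Series
    target x0 Ψ = anti Φ · act Ψ
    target x1 Ψ = act Ψ

    shorter : ∀ n → (∀ a Ψ w → length w ℕ.≤ n → gon (path a) Ψ w ≈ target a Ψ w) → ∀ f a Ψ w → length w ℕ.≤ suc n →
              (f · letter a · gon (path a) Ψ) w ≈ (f · letter a · target a Ψ) w
    shorter n IH f a Ψ w w≤ = ⊙-congʳ≤ (pt-linear f) w (λ _ v v≤w → inner v (ℕ.≤-trans v≤w w≤))
      where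
      inner : ∀ v → length v ℕ.≤ suc n → (letter a · gon (path a) Ψ) v ≈ (letter a · target a Ψ) v
      inner []      _  = trans (letter-[] a (gon (path a) Ψ)) (sym (letter-[] a (target a Ψ)))
      inner (b ∷ v) v≤ = trans (letter-∷ a _ b v) (trans (*-congˡ (IH a Ψ v (ℕ.≤-pred v≤))) (sym (letter-∷ a _ b v)))

    zeroth : ∀ f a Ψ → (f · letter a · gon (path a) Ψ) [] ≈ (f · letter a · target a Ψ) []
    zeroth f a Ψ = *-congˡ (trans (letter-[] a (gon (path a) Ψ)) (sym (letter-[] a (target a Ψ))))

    -- the equations of gon for both kinds of paths, after replacing gon by its target on shorter words
    close : ∀ Ψ w → (∀ f a → (f · letter a · gon (path a) (∂ a Ψ)) w ≈ (f · letter a · target a (∂ a Ψ)) w) →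
            gon (path x0) Ψ w ≈ (anti Φ · act Ψ) w × gon (path x1) Ψ w ≈ act Ψ w
    close Ψ w e = sym (begin
      (s · act Ψ) w
        ≈⟨ trans (·-congˡ (act-unfold Ψ) w) (trans (O-+ (·-linearʳ s w) _ _)
             (+-cong (trans (O-* (·-linearʳ s w) (Ψ []) Φ) (*-congˡ (anti-inverseˡ Φ-char w))) (O-+ (·-linearʳ s w) _ _))) ⟩
      Ψ [] * ε w + ((s · A0 · M0) w + (s · letter x1 · M1) w)
        ≈⟨ +-congˡ (+-congʳ (begin
             (s · A0 · M0) w                             ≈⟨ ·-congˡ (λ v → trans (sym (·-assoc Φ _ M0 v)) (·-congˡ (λ v → sym (·-assoc (letter x0) s M0 v)) v)) w ⟩
             (s · Φ · letter x0 · s · M0) w              ≈⟨ ·-assoc s Φ _ w ⟩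
             ((s · Φ) · letter x0 · s · M0) w            ≈⟨ ·-congʳ (anti-inverseˡ Φ-char) w ⟩
             (ε · letter x0 · s · M0) w                  ∎)) ⟩
      Ψ [] * ε w + ((ε · letter x0 · s · M0) w + (s · letter x1 · M1) w)
        ≈⟨ trans (gon-unfold (path x0) Ψ w) (+-congˡ (+-cong (e ε x0) (e s x1))) ⟨
      gon (path x0) Ψ w ∎)
      , (begin
      gon (path x1) Ψ w
        ≈⟨ trans (gon-unfold (path x1) Ψ w) (+-congˡ (+-cong (e Φ x0) (e ε x1))) ⟩
      Ψ [] * Φ w + ((Φ · letter x0 · s · M0) w + (ε · letter x1 · M1) w)
        ≈⟨ +-congˡ (+-cong (trans (·-congˡ (λ v → ·-assoc (letter x0) s M0 v) w) (·-assoc Φ _ M0 w)) (·-identityˡ _ w)) ⟩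
      Ψ [] * Φ w + ((A0 · M0) w + (letter x1 · M1) w)
        ≈⟨ act-unfold Ψ w ⟨
      act Ψ w ∎)
      where
      s = anti Φ
      M0 = act (∂ x0 Ψ)
      M1 = act (∂ x1 Ψ)

    go : ∀ n Ψ w → length w ℕ.≤ n → gon (path x0) Ψ w ≈ (anti Φ · act Ψ) w × gon (path x1) Ψ w ≈ act Ψ w
    go zero    Ψ [] _  = close Ψ [] (λ f a → zeroth f a (∂ a Ψ))
    go (suc n) Ψ w  w≤ = close Ψ w (λ f a → shorter n IH f a (∂ a Ψ) w w≤)
      where
      IH : ∀ a Ψ w → length w ℕ.≤ n → gon (path a) Ψ w ≈ target a Ψ w
      IH x0 Ψ w w≤ = proj₁ (go n Ψ w w≤)
      IH x1 Ψ w w≤ = proj₂ (go n Ψ w w≤)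

module IharaLaws (K : QAlg) where
  open Alg K
  open Shuffle K
  open IsLinear

  act-identityˡ : ∀ f w → Ihara.act K ε ε-char f w ≈ f w
  act-identityˡ f w = sym (I.act-unique (λ f → f) rec f w)
    where
    module I = Ihara K ε ε-char
    anti-ε : ∀ w → anti ε w ≈ ε w
    anti-ε w = trans (sym (·-identityˡ (anti ε) w)) (anti-inverseʳ ε-char w)
    A0≈ : ∀ w → I.A0 w ≈ letter x0 w
    A0≈ w = trans (·-identityˡ _ w) (trans (·-congˡ anti-ε w) (·-identityʳ _ w))
    rec : ∀ f w → f w ≈ f [] * ε w + ((I.A0 · ∂ x0 f) w + (letter x1 · ∂ x1 f) w)
    rec f w = trans (rec' f w) (+-congˡ (+-congʳ (sym (·-congʳ A0≈ w))))
      where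
      rec' : ∀ f w → f w ≈ f [] * ε w + ((letter x0 · ∂ x0 f) w + (letter x1 · ∂ x1 f) w)
      rec' f []      = solve 3 (λ a b c → a := a :* :1 :+ (:0 :* b :+ :0 :* c)) refl _ _ _
      rec' f (b ∷ w) = trans (sym (letter-sum (λ a → ∂ a f) b w)) (trans (sym (+-identityˡ _)) (+-congʳ (sym (zeroʳ _))))

  act-identityʳ : ∀ Φ (Φc : IsChar Φ) w → Ihara.act K Φ Φc ε w ≈ Φ w
  act-identityʳ Φ Φc = Ihara.act-ε K Φ Φc

  module _ (Φ₁ Φ₂ : Series) (c₁ : IsChar Φ₁) (c₂ : IsChar Φ₂) where
    private
      module I₁ = Ihara K Φ₁ c₁
      module I₂ = Ihara K Φ₂ c₂
      module I₁₂ = Ihara K (I₁.act Φ₂) (I₁.act-char c₂)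
      Φ₁₂ = I₁.act Φ₂

    -- Both sides substitute for `x0`; by `act-unique` it suffices that the substituted series
    -- agree, which is `conj-A0`. That in turn rests on `Φ₁₂ = conj Φ₂ · Φ₁` and on uniqueness of
    -- inverses.
    act-assoc : ∀ f w → I₁.act (I₂.act f) w ≈ I₁₂.act f w
    act-assoc = I₁₂.act-unique (λ f → I₁.act (I₂.act f)) rec
      where
      Φ₁₂≈ : ∀ w → Φ₁₂ w ≈ (I₁.conj Φ₂ · Φ₁) w
      Φ₁₂≈ w = trans (I₁.act-cong (λ v → sym (·-identityʳ Φ₂ v)) w)
        (trans (I₁.act-· Φ₂ ε w) (·-congˡ I₁.act-ε w))

      conj-inverse : ∀ w → (I₁.conj Φ₂ · I₁.conj (anti Φ₂)) w ≈ ε w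
      conj-inverse w = trans (sym (I₁.conj-· Φ₂ (anti Φ₂) w))
        (trans (O-cong (I₁.conj-linear w) (anti-inverseʳ c₂)) (Substitution.N-ε K Letter (λ _ _ → x0) 0# I₁.𝒜 ε I₁.𝒜-finite I₁.𝒜[] w))

      cand : Series
      cand = anti Φ₁ · I₁.conj (anti Φ₂)

      cand-inverse : ∀ w → (Φ₁₂ · cand) w ≈ ε w
      cand-inverse w = begin
        (Φ₁₂ · cand) w                                             ≈⟨ ·-congʳ Φ₁₂≈ w ⟩
        ((I₁.conj Φ₂ · Φ₁) · anti Φ₁ · I₁.conj (anti Φ₂)) w        ≈⟨ ·-assoc (I₁.conj Φ₂) Φ₁ cand w ⟨
        (I₁.conj Φ₂ · Φ₁ · anti Φ₁ · I₁.conj (anti Φ₂)) w          ≈⟨ ·-congˡ (λ v → trans (·-assoc Φ₁ (anti Φ₁) _ v)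
                                                                        (trans (·-congʳ (anti-inverseʳ c₁) v) (·-identityˡ _ v))) w ⟩
        (I₁.conj Φ₂ · I₁.conj (anti Φ₂)) w                         ≈⟨ conj-inverse w ⟩
        ε w                                                        ∎

      anti-Φ₁₂ : ∀ w → anti Φ₁₂ w ≈ cand w
      anti-Φ₁₂ w = begin
        anti Φ₁₂ w                    ≈⟨ ·-identityʳ (anti Φ₁₂) w ⟨
        (anti Φ₁₂ · ε) w              ≈⟨ ·-congˡ cand-inverse w ⟨
        (anti Φ₁₂ · Φ₁₂ · cand) w     ≈⟨ ·-assoc (anti Φ₁₂) Φ₁₂ cand w ⟩
        ((anti Φ₁₂ · Φ₁₂) · cand) w   ≈⟨ ·-congʳ (anti-inverseˡ (I₁.act-char c₂)) w ⟩
        (ε · cand) w                  ≈⟨ ·-identityˡ cand w ⟩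
        cand w                        ∎

      conj-A0 : ∀ w → I₁.conj I₂.A0 w ≈ I₁₂.A0 w
      conj-A0 w = begin
        I₁.conj (Φ₂ · letter x0 · anti Φ₂) w
          ≈⟨ trans (I₁.conj-· Φ₂ _ w) (·-congˡ (λ v → trans (I₁.conj-· (letter x0) _ v) (·-congʳ I₁.conj-x0 v)) w) ⟩
        (I₁.conj Φ₂ · I₁.A0 · I₁.conj (anti Φ₂)) w
          ≈⟨ ·-congˡ (λ v → trans (sym (·-assoc Φ₁ _ (I₁.conj (anti Φ₂)) v)) (·-congˡ (λ v → sym (·-assoc (letter x0) (anti Φ₁) _ v)) v)) w ⟩
        (I₁.conj Φ₂ · Φ₁ · letter x0 · cand) w
          ≈⟨ ·-assoc (I₁.conj Φ₂) Φ₁ _ w ⟩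
        ((I₁.conj Φ₂ · Φ₁) · letter x0 · cand) w
          ≈⟨ ·-cong Φ₁₂≈ (·-congˡ anti-Φ₁₂) w ⟨
        I₁₂.A0 w ∎

      rec : ∀ f w → I₁.act (I₂.act f) w ≈ f [] * Φ₁₂ w +
            ((I₁₂.A0 · I₁.act (I₂.act (∂ x0 f))) w + (letter x1 · I₁.act (I₂.act (∂ x1 f))) w)
      rec f w = begin
        I₁.act (I₂.act f) w
          ≈⟨ I₁.act-cong (I₂.act-unfold f) w ⟩
        I₁.act (λ v → f [] * Φ₂ v + ((I₂.A0 · I₂.act (∂ x0 f)) v + (letter x1 · I₂.act (∂ x1 f)) v)) w
          ≈⟨ trans (O-+ (I₁.act-linear w) _ _) (+-cong (O-* (I₁.act-linear w) _ _) (O-+ (I₁.act-linear w) _ _)) ⟩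
        f [] * Φ₁₂ w + (I₁.act (I₂.A0 · I₂.act (∂ x0 f)) w + I₁.act (letter x1 · I₂.act (∂ x1 f)) w)
          ≈⟨ +-congˡ (+-cong (trans (I₁.act-· I₂.A0 _ w) (·-congʳ conj-A0 w))
                             (trans (I₁.act-· (letter x1) _ w) (·-congʳ I₁.conj-x1 w))) ⟩
        f [] * Φ₁₂ w + ((I₁₂.A0 · I₁.act (I₂.act (∂ x0 f))) w + (letter x1 · I₁.act (I₂.act (∂ x1 f))) w) ∎

-- Regularised stuffle characters

module PowerSeries (K : QAlg) where
  open Alg K

  PS : Set
  PS = ℕ → Carrier

  tl : PS → PS
  tl f n = f (suc n)

  infixl 7 _✶_
  _✶_ : PS → PS → PS
  (f ✶ g) zero    = f 0 * g 0
  (f ✶ g) (suc n) = f 0 * g (suc n) + (tl f ✶ g) n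

  const : Carrier → PS
  const c zero    = c
  const c (suc n) = 0#

  ✶-cong≤ : ∀ {f f' g g'} n → (∀ k → k ℕ.≤ n → f k ≈ f' k) → (∀ k → k ℕ.≤ n → g k ≈ g' k) → (f ✶ g) n ≈ (f' ✶ g') n
  ✶-cong≤ zero    e e' = *-cong (e 0 z≤n) (e' 0 z≤n)
  ✶-cong≤ (suc n) e e' = +-cong (*-cong (e 0 z≤n) (e' (suc n) ℕ.≤-refl))
    (✶-cong≤ n (λ k k≤ → e (suc k) (s≤s k≤)) (λ k k≤ → e' k (ℕ.m≤n⇒m≤1+n k≤)))

  ✶-cong : ∀ {f f' g g'} → (∀ k → f k ≈ f' k) → (∀ k → g k ≈ g' k) → ∀ n → (f ✶ g) n ≈ (f' ✶ g') n
  ✶-cong e e' n = ✶-cong≤ n (λ k _ → e k) (λ k _ → e' k)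

  ✶-linearˡ : ∀ g n → IsLinear (λ f → (f ✶ g) n)
  ✶-linearˡ g zero    = record
    { O-cong = λ e → *-congʳ (e 0) ; O-+ = λ _ _ → distribʳ _ _ _ ; O-* = λ _ _ → *-assoc _ _ _ }
  ✶-linearˡ g (suc n) = +-linear
    (record { O-cong = λ e → *-congʳ (e 0) ; O-+ = λ _ _ → distribʳ _ _ _ ; O-* = λ _ _ → *-assoc _ _ _ })
    (reindex-linear suc (✶-linearˡ g n))

  ✶-linearʳ : ∀ f n → IsLinear (λ g → (f ✶ g) n)
  ✶-linearʳ f zero    = *-linear (f 0) (at-linear 0)
  ✶-linearʳ f (suc n) = +-linear (*-linear (f 0) (at-linear (suc n))) (✶-linearʳ (tl f) n)

  open IsLinear

  ✶-sucʳ : ∀ f g n → (f ✶ g) (suc n) ≈ f (suc n) * g 0 + (f ✶ tl g) n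
  ✶-sucʳ f g zero    = +-comm _ _
  ✶-sucʳ f g (suc n) = trans (+-congˡ (✶-sucʳ (tl f) g n))
    (solve 3 (λ a b c → a :+ (b :+ c) := b :+ (a :+ c)) refl _ _ _)

  ✶-comm : ∀ f g n → (f ✶ g) n ≈ (g ✶ f) n
  ✶-comm f g zero    = *-comm _ _
  ✶-comm f g (suc n) = trans (+-cong (*-comm _ _) (✶-comm (tl f) g n)) (sym (✶-sucʳ g f n))

  ✶-assoc : ∀ f g h n → ((f ✶ g) ✶ h) n ≈ (f ✶ (g ✶ h)) n
  ✶-assoc f g h zero    = *-assoc _ _ _
  ✶-assoc f g h (suc n) = begin
    f 0 * g 0 * h (suc n) + ((λ k → f 0 * g (suc k) + (tl f ✶ g) k) ✶ h) n
      ≈⟨ +-congˡ (trans (O-+ (✶-linearˡ h n) _ _) (+-cong (O-* (✶-linearˡ h n) (f 0) (tl g)) (✶-assoc (tl f) g h n))) ⟩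
    f 0 * g 0 * h (suc n) + (f 0 * (tl g ✶ h) n + (tl f ✶ (g ✶ h)) n)
      ≈⟨ solve 5 (λ a b c d e → a :* b :* c :+ (a :* d :+ e) := a :* (b :* c :+ d) :+ e) refl _ _ _ _ _ ⟩
    (f ✶ (g ✶ h)) (suc n) ∎

  const-✶ : ∀ c f n → (const c ✶ f) n ≈ c * f n
  const-✶ c f zero    = refl
  const-✶ c f (suc n) = trans (+-congˡ (O-zero (✶-linearˡ f n) (λ _ → refl))) (+-identityʳ _)

  PSring : CommutativeRing _ _
  PSring = record
    { Carrier = PS
    ; _≈_ = λ f g → ∀ n → f n ≈ g n
    ; _+_ = λ f g n → f n + g n
    ; _*_ = _✶_
    ; -_ = λ f n → - f n
    ; 0# = λ _ → 0#
    ; 1# = const 1#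
    ; isCommutativeRing = record
      { isRing = record
        { +-isAbelianGroup = record
          { isGroup = record
            { isMonoid = record
              { isSemigroup = record
                { isMagma = record
                  { isEquivalence = record
                    { refl = λ _ → refl ; sym = λ e n → sym (e n) ; trans = λ e e' n → trans (e n) (e' n) }
                  ; ∙-cong = λ e e' n → +-cong (e n) (e' n) }
                ; assoc = λ f g h n → +-assoc _ _ _ }
              ; identity = (λ f n → +-identityˡ _) , (λ f n → +-identityʳ _) }
            ; inverse = (λ f n → -‿inverseˡ _) , (λ f n → -‿inverseʳ _)
            ; ⁻¹-cong = λ e n → -‿cong (e n) }
          ; comm = λ f g n → +-comm _ _ }
        ; *-cong = λ e e' → ✶-cong e e'
        ; *-assoc = ✶-assoc
        ; *-identity = (λ f n → trans (const-✶ 1# f n) (*-identityˡ _))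
                     , (λ f n → trans (✶-comm f (const 1#) n) (trans (const-✶ 1# f n) (*-identityˡ _)))
        ; distrib = (λ f g h n → O-+ (✶-linearʳ f n) g h) , (λ f g h n → O-+ (✶-linearˡ f n) g h) }
      ; *-comm = ✶-comm }
    }

  PSAlg : QAlg
  PSAlg = record
    { commutativeRing = PSring
    ; κ = λ q → const (κ q)
    ; κ-+ = λ { p q zero → κ-+ p q ; p q (suc n) → sym (+-identityˡ _) }
    ; κ-* = λ { p q zero → κ-* p q ; p q (suc n) → sym (trans (const-✶ (κ p) (const (κ q)) (suc n)) (zeroʳ _)) }
    ; κ-1 = λ { zero → κ-1 ; (suc n) → refl } }

  θ : PS → PS
  θ f n = nat n * f n

  θ-✶ : ∀ f g n → θ (f ✶ g) n ≈ (θ f ✶ g) n + (f ✶ θ g) n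
  θ-✶ f g zero    = solve 2 (λ a b → :0 :* (a :* b) := (:0 :* a) :* b :+ a :* (:0 :* b)) refl (f 0) (g 0)
  θ-✶ f g (suc n) = begin
    nat (suc n) * (f 0 * g (suc n) + (tl f ✶ g) n)
      ≈⟨ solve 4 (λ m a b x → (:1 :+ m) :* (a :* b :+ x) := (:0 :* a) :* b :+ x :+ a :* ((:1 :+ m) :* b) :+ m :* x) refl (nat n) (f 0) (g (suc n)) ((tl f ✶ g) n) ⟩
    0# * f 0 * g (suc n) + (tl f ✶ g) n + f 0 * (nat (suc n) * g (suc n)) + nat n * (tl f ✶ g) n
      ≈⟨ +-congˡ (θ-✶ (tl f) g n) ⟩
    0# * f 0 * g (suc n) + (tl f ✶ g) n + f 0 * (nat (suc n) * g (suc n)) + ((θ (tl f) ✶ g) n + (tl f ✶ θ g) n)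
      ≈⟨ solve 5 (λ a b c d e → a :+ b :+ c :+ (d :+ e) := (a :+ (b :+ d)) :+ (c :+ e)) refl _ _ _ _ _ ⟩
    (0# * f 0 * g (suc n) + ((tl f ✶ g) n + (θ (tl f) ✶ g) n)) + (f ✶ θ g) (suc n)
      ≈⟨ +-congʳ (+-congˡ (sym (trans (O-cong (✶-linearˡ g n) (λ k → trans (distribʳ _ _ _) (+-congʳ (*-identityˡ _))))
           (O-+ (✶-linearˡ g n) _ _)))) ⟩
    (θ f ✶ g) (suc n) + (f ✶ θ g) (suc n) ∎

  D : PS → PS
  D f n = nat (suc n) * f (suc n)

  D-✶ : ∀ f g n → D (f ✶ g) n ≈ (D f ✶ g) n + (f ✶ D g) n
  D-✶ f g n = trans (θ-✶ f g (suc n)) (+-cong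
    (trans (+-congʳ (trans (*-congʳ (zeroˡ _)) (zeroˡ _))) (+-identityˡ _))
    (trans (✶-sucʳ f (θ g) n) (trans (+-congʳ (trans (*-congˡ (zeroˡ _)) (zeroʳ _))) (+-identityˡ _))))

  -- approx h m is correct up to degree m, so the diagonal solves E′ = hE, E(0) = 1.
  private
    approx : PS → ℕ → PS
    approx h zero    = const 1#
    approx h (suc m) zero    = 1#
    approx h (suc m) (suc n) = 1/nat n * (h ✶ approx h m) n

    stable : ∀ h n m m' → n ℕ.≤ m → n ℕ.≤ m' → approx h m n ≈ approx h m' n
    stable h zero    zero    zero     _ _ = refl
    stable h zero    zero    (suc m') _ _ = refl
    stable h zero    (suc m) zero     _ _ = refl
    stable h zero    (suc m) (suc m') _ _ = refl
    stable h (suc n) (suc m) (suc m') (s≤s n≤m) (s≤s n≤m') = *-congˡ (✶-cong≤ n (λ _ _ → refl)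
      (λ k k≤n → stable h k m m' (ℕ.≤-trans k≤n n≤m) (ℕ.≤-trans k≤n n≤m')))

  expODE : PS → PS
  expODE h n = approx h n n

  D-expODE : ∀ h n → D (expODE h) n ≈ (h ✶ expODE h) n
  D-expODE h n = begin
    nat (suc n) * (1/nat n * (h ✶ approx h n) n)   ≈⟨ *-assoc _ _ _ ⟨
    (nat (suc n) * 1/nat n) * (h ✶ approx h n) n   ≈⟨ *-congʳ (trans (*-comm _ _) (1/nat-inv n)) ⟩
    1# * (h ✶ approx h n) n                        ≈⟨ *-identityˡ _ ⟩
    (h ✶ approx h n) n                             ≈⟨ ✶-cong≤ n (λ _ _ → refl) (λ k k≤n → stable h k n k k≤n ℕ.≤-refl) ⟩
    (h ✶ expODE h) n                               ∎

  ODE-unique : ∀ h f g → f 0 ≈ g 0 → (∀ n → D f n ≈ (h ✶ f) n) → (∀ n → D g n ≈ (h ✶ g) n) → ∀ n → f n ≈ g n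
  ODE-unique h f g e0 ef eg n = go n n ℕ.≤-refl
    where
    go : ∀ m n → n ℕ.≤ m → f n ≈ g n
    go m       zero    _         = e0
    go (suc m) (suc n) (s≤s n≤m) = nat-cancel n (trans (ef n) (trans
      (✶-cong≤ n (λ _ _ → refl) (λ k k≤n → go m k (ℕ.≤-trans k≤n n≤m))) (sym (eg n))))

  expODE-inverse : ∀ h n → (expODE (λ k → - h k) ✶ expODE h) n ≈ const 1# n
  expODE-inverse h = ODE-unique (λ _ → 0#) (E⁻ ✶ E) (const 1#) (*-identityˡ _)
    (λ n → trans (vanish n) (sym (O-zero (✶-linearˡ (E⁻ ✶ E) n) (λ _ → refl))))
    (λ n → trans (zeroʳ _) (sym (O-zero (✶-linearˡ (const 1#) n) (λ _ → refl))))
    where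
    E = expODE h
    E⁻ = expODE (λ k → - h k)
    vanish : ∀ n → D (E⁻ ✶ E) n ≈ 0#
    vanish n = begin
      D (E⁻ ✶ E) n
        ≈⟨ D-✶ E⁻ E n ⟩
      (D E⁻ ✶ E) n + (E⁻ ✶ D E) n
        ≈⟨ +-cong (O-cong (✶-linearˡ E n) (λ k → trans (D-expODE (λ k → - h k) k) (O-neg (✶-linearˡ E⁻ k) h)))
                  (O-cong (✶-linearʳ E⁻ n) (D-expODE h)) ⟩
      ((λ k → - (h ✶ E⁻) k) ✶ E) n + (E⁻ ✶ (h ✶ E)) n
        ≈⟨ +-cong (trans (O-neg (✶-linearˡ E n) _) (-‿cong (O-cong (✶-linearˡ E n) (✶-comm h E⁻)))) (sym (✶-assoc E⁻ h E n)) ⟩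
      - ((E⁻ ✶ h) ✶ E) n + ((E⁻ ✶ h) ✶ E) n
        ≈⟨ -‿inverseˡ _ ⟩
      0# ∎

  z^ : ℕ → PS → PS
  z^ zero    f n       = f n
  z^ (suc m) f zero    = 0#
  z^ (suc m) f (suc n) = z^ m f n

  z^-cong : ∀ m {f g} → (∀ n → f n ≈ g n) → ∀ n → z^ m f n ≈ z^ m g n
  z^-cong zero    e n       = e n
  z^-cong (suc m) e zero    = refl
  z^-cong (suc m) e (suc n) = z^-cong m e n

  z^-+ : ∀ m k f n → z^ (m ℕ.+ k) f n ≈ z^ m (z^ k f) n
  z^-+ zero    k f n       = refl
  z^-+ (suc m) k f zero    = refl
  z^-+ (suc m) k f (suc n) = z^-+ m k f n

  z^-✶ˡ : ∀ m f g n → (z^ m f ✶ g) n ≈ z^ m (f ✶ g) n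
  z^-✶ˡ zero    f g n       = refl
  z^-✶ˡ (suc m) f g zero    = zeroˡ _
  z^-✶ˡ (suc m) f g (suc n) = trans (+-congʳ (zeroˡ _)) (trans (+-identityˡ _) (z^-✶ˡ m f g n))

  z^-✶ʳ : ∀ m f g n → (f ✶ z^ m g) n ≈ z^ m (f ✶ g) n
  z^-✶ʳ m f g n = trans (✶-comm f (z^ m g) n) (trans (z^-✶ˡ m g f n) (z^-cong m (✶-comm g f) n))

  z^-low : ∀ m f n → n ℕ.< m → z^ m f n ≈ 0#
  z^-low (suc m) f zero    _         = refl
  z^-low (suc m) f (suc n) (s≤s n<m) = z^-low m f n n<m

  z^-at : ∀ m f n → z^ m f (m ℕ.+ n) ≈ f n
  z^-at zero    f n = refl
  z^-at (suc m) f n = z^-at m f n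

-- As in the definition of ι, the letter y_{k+1} is encoded by k.
infixl 6 _⋄_
_⋄_ : ℕ → ℕ → ℕ
a ⋄ b = suc (a ℕ.+ b)

⋄-comm : ∀ a b → a ⋄ b ≡ b ⋄ a
⋄-comm a b = ≡.cong suc (ℕ.+-comm a b)

⋄-assoc : ∀ a b c → a ⋄ b ⋄ c ≡ a ⋄ (b ⋄ c)
⋄-assoc a b c = ≡.cong suc (≡.trans (≡.cong suc (ℕ.+-assoc a b c)) (≡.sym (ℕ.+-suc a (b ℕ.+ c))))

y₁^ : ℕ → List ℕ
y₁^ zero    = []
y₁^ (suc n) = 0 ∷ y₁^ n

-- Words that do not start with `y₁`: exactly the admissible ones. Every word is a power of `y₁`
-- followed by such a word, and several inductions run over the exponent.
data Lead : List ℕ → Set where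
  lead-[] : Lead []
  lead-∷  : ∀ k w → Lead (suc k ∷ w)

data LeadView : List ℕ → Set where
  lead : ∀ n {u} → Lead u → LeadView (y₁^ n ++ u)

leadView : ∀ u → LeadView u
leadView []          = lead 0 lead-[]
leadView (suc k ∷ u) = lead 0 (lead-∷ k u)
leadView (zero ∷ u) with leadView u
... | lead n l = lead (suc n) l

module Stuffle (K : QAlg) where
  open Alg K
  open IsLinear
  open QS K ℕ _⋄_ 1# public
  open Commutative ⋄-comm ⋄-assoc public
  open PowerSeries K

  -- The series `h(y₁)` in one letter, with powers taken for concatenation.
  emb : PS → Series
  emb h []          = h 0
  emb h (zero ∷ w)  = emb (tl h) w
  emb h (suc k ∷ w) = 0#

  emb-linear : ∀ w → IsLinear (λ h → emb h w)
  emb-linear []          = at-linear 0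
  emb-linear (zero ∷ w)  = reindex-linear suc (emb-linear w)
  emb-linear (suc k ∷ w) = 0-linear

  emb-·-suc : ∀ h F k w → (emb h · F) (suc k ∷ w) ≈ h 0 * F (suc k ∷ w)
  emb-·-suc h F k w = trans (+-congˡ (O-0 (·-linearˡ F w))) (+-identityʳ _)

  emb-1 : ∀ w → emb (const 1#) w ≈ ε w
  emb-1 []          = refl
  emb-1 (zero ∷ w)  = O-0 (emb-linear w)
  emb-1 (suc k ∷ w) = refl

  emb-✶ : ∀ f g w → emb (f ✶ g) w ≈ (emb f · emb g) w
  emb-✶ f g []          = refl
  emb-✶ f g (zero ∷ w)  = trans (O-+ (emb-linear w) _ _)
    (+-cong (O-* (emb-linear w) (f 0) (tl g)) (emb-✶ (tl f) g w))
  emb-✶ f g (suc k ∷ w) = sym (trans (emb-·-suc f (emb g) k w) (zeroʳ _))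

  -- The stuffle of `y₁` with its n-th power contains the next power n + 1 times; its other words
  -- contain `y₂`, where `emb h` vanishes.
  emb-y₁ : ∀ h w → Q (emb h) (0 ∷ []) w ≈ emb (D h) w
  emb-y₁ h []          = solve 1 (λ a → a := (:1 :+ :0) :* a) refl _
  emb-y₁ h (zero ∷ w)  = begin
    emb (tl (tl h)) w + Q (emb (tl h)) (0 ∷ []) w + 1# * 0#
      ≈⟨ +-cong (+-congˡ (emb-y₁ (tl h) w)) (*-identityˡ _) ⟩
    emb (tl (tl h)) w + emb (D (tl h)) w + 0#
      ≈⟨ +-identityʳ _ ⟩
    emb (tl (tl h)) w + emb (D (tl h)) w
      ≈⟨ O-+ (emb-linear w) _ _ ⟨
    emb (λ n → h (suc (suc n)) + D (tl h) n) w
      ≈⟨ O-cong (emb-linear w) (λ n → solve 2 (λ a b → a :+ b :* a := (:1 :+ b) :* a) refl _ _) ⟩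
    emb (tl (D h)) w ∎
  emb-y₁ h (suc k ∷ w) = trans (+-cong (+-congˡ (O-0 (Q-linear (0 ∷ []) w))) (*-identityˡ _))
    (trans (+-congʳ (+-identityʳ _)) (+-identityʳ _))

  -- A prefix consisting of `y₁` only must come from `v`: the first word starts with a higher
  -- letter, and merging letters never produces `y₁`.
  emb-admissible : ∀ h F k u v → Q (emb h · F) (suc k ∷ u) v ≈ (emb h · Q F (suc k ∷ u)) v
  emb-admissible h F k u []          = emb-·-suc h F k u
  emb-admissible h F k u (zero ∷ v)  = begin
    Q (∂ (suc k) (emb h · F)) u (0 ∷ v) + Q (∂ 0 (emb h · F)) (suc k ∷ u) v + 1# * Q (∂ (suc k ⋄ 0) (emb h · F)) u v
      ≈⟨ +-cong (+-cong (trans (Q-cong (emb-·-suc h F k) u (0 ∷ v)) (O-* (Q-linear u (0 ∷ v)) _ _))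
                        (trans (O-+ (Q-linear (suc k ∷ u) v) _ _)
                          (+-cong (O-* (Q-linear (suc k ∷ u) v) _ _) (emb-admissible (tl h) F k u v))))
                (*-congˡ (trans (Q-cong (emb-·-suc h F (suc k ℕ.+ 0)) u v) (O-* (Q-linear u v) _ _))) ⟩
    h 0 * Q (∂ (suc k) F) u (0 ∷ v) + (h 0 * Q (∂ 0 F) (suc k ∷ u) v + (emb (tl h) · Q F (suc k ∷ u)) v) + 1# * (h 0 * Q (∂ (suc k ⋄ 0) F) u v)
      ≈⟨ solve 5 (λ a x y z r → a :* x :+ (a :* y :+ r) :+ :1 :* (a :* z) := a :* (x :+ y :+ :1 :* z) :+ r) refl _ _ _ _ _ ⟩
    (emb h · Q F (suc k ∷ u)) (0 ∷ v) ∎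
  emb-admissible h F k u (suc b ∷ v) = begin
    Q (∂ (suc k) (emb h · F)) u (suc b ∷ v) + Q (∂ (suc b) (emb h · F)) (suc k ∷ u) v + 1# * Q (∂ (suc k ⋄ suc b) (emb h · F)) u v
      ≈⟨ +-cong (+-cong (trans (Q-cong (emb-·-suc h F k) u (suc b ∷ v)) (O-* (Q-linear u (suc b ∷ v)) _ _))
                        (trans (Q-cong (emb-·-suc h F b) (suc k ∷ u) v) (O-* (Q-linear (suc k ∷ u) v) _ _)))
                (*-congˡ (trans (Q-cong (emb-·-suc h F (suc k ℕ.+ suc b)) u v) (O-* (Q-linear u v) _ _))) ⟩
    h 0 * Q (∂ (suc k) F) u (suc b ∷ v) + h 0 * Q (∂ (suc b) F) (suc k ∷ u) v + 1# * (h 0 * Q (∂ (suc k ⋄ suc b) F) u v)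
      ≈⟨ solve 4 (λ a x y z → a :* x :+ a :* y :+ :1 :* (a :* z) := a :* (x :+ y :+ :1 :* z)) refl _ _ _ _ ⟩
    h 0 * Q F (suc k ∷ u) (suc b ∷ v)
      ≈⟨ emb-·-suc h (Q F (suc k ∷ u)) b v ⟨
    (emb h · Q F (suc k ∷ u)) (suc b ∷ v) ∎

  Vanishes : ℕ → Series → Set
  Vanishes j P = ∀ i → i ℕ.< j → ∀ {u} → Lead u → P (y₁^ i ++ u) ≈ 0#

  -- Every other term of the product has fewer than `j` letters `y₁` before its first higher letter.
  y₁^-lead : ∀ j P k u → (∀ i → i ℕ.< j → ∀ k u → P (y₁^ i ++ suc k ∷ u) ≈ 0#) → Q P (suc k ∷ u) (y₁^ j) ≈ P (y₁^ j ++ suc k ∷ u)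
  y₁^-lead zero    P k u V = refl
  y₁^-lead (suc j) P k u V = trans
    (+-cong (+-cong (O-zero (Q-linear u (0 ∷ y₁^ j)) (V 0 (s≤s z≤n) k)) (y₁^-lead j (∂ 0 P) k u (λ i i<j → V (suc i) (s≤s i<j))))
            (*-congˡ (O-zero (Q-linear u (y₁^ j)) (V 0 (s≤s z≤n) (suc k ℕ.+ 0)))))
    (solve 1 (λ x → :0 :+ x :+ :1 :* :0 := x) refl _)

  -- The new `y₁` has k + 1 places among the leading ones; placed later, or merged, it leaves at
  -- most `k` leading `y₁`.
  y₁-lead : ∀ k B → Vanishes (suc k) B → ∀ {u} → Lead u → Q B (0 ∷ []) (y₁^ k ++ u) ≈ nat (suc k) * B (y₁^ (suc k) ++ u)
  y₁-lead zero    B V lead-[]      = solve 1 (λ a → a := (:1 :+ :0) :* a) refl _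
  y₁-lead zero    B V (lead-∷ b w) = trans
    (+-cong (+-congˡ (O-zero (Q-linear (0 ∷ []) w) (λ x → V 0 (s≤s z≤n) (lead-∷ b x))))
            (*-congˡ (V 0 (s≤s z≤n) (lead-∷ (suc b) w))))
    (solve 1 (λ a → a :+ :0 :+ :1 :* :0 := (:1 :+ :0) :* a) refl _)
  y₁-lead (suc k) B V {u} l        = trans
    (+-cong (+-congˡ (y₁-lead k (∂ 0 B) (λ i i<k → V (suc i) (s≤s i<k)) l)) (*-congˡ (V 0 (s≤s z≤n) (lead-∷ 0 (y₁^ k ++ u)))))
    (solve 2 (λ a n → a :+ n :* a :+ :1 :* :0 := (:1 :+ n) :* a) refl _ _)

  -- What survives of the stuffle relations under shuffle regularisation: the powers of `y₁` are set
  -- to zero, and multiplicativity is kept only when one factor is admissible.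
  record IsReg (f : Series) : Set where
    field
      reg-[]  : f [] ≈ 1#
      reg-y₁  : ∀ n → f (y₁^ (suc n)) ≈ 0#
      reg-adm : ∀ k u v → Q f (suc k ∷ u) v ≈ f (suc k ∷ u) * f v

  -- Every f with IsReg f is G(y₁) χ with χ a stuffle character killing y₁; here G′ = hG.
  module Reg (f : Series) (reg : IsReg f) where
    open IsReg reg

    -- `h` is the defect of multiplicativity on `y₁` times powers of `y₁`. It becomes the
    -- logarithmic derivative of the correction `G`, and `N` is the inverse of `G`.
    h N G : PS
    h j = Q f (0 ∷ []) (y₁^ j)
    N   = expODE (λ k → - h k)
    G   = expODE h

    private
      P : Series
      P w = Q f (0 ∷ []) w + - (emb h · f) w

      emb-·-y₁^ : ∀ (g : PS) j → (emb g · f) (y₁^ j) ≈ g j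
      emb-·-y₁^ g zero    = trans (*-congˡ reg-[]) (*-identityʳ _)
      emb-·-y₁^ g (suc j) = trans (+-cong (trans (*-congˡ (reg-y₁ j)) (zeroʳ _)) (emb-·-y₁^ (tl g) j)) (+-identityˡ _)

      P-y₁^ : ∀ j → P (y₁^ j) ≈ 0#
      P-y₁^ j = trans (+-congˡ (-‿cong (emb-·-y₁^ h j))) (-‿inverseʳ _)

      P-adm : ∀ k u v → Q P (suc k ∷ u) v ≈ f (suc k ∷ u) * P v
      P-adm k u v = begin
        Q P w₀ v
          ≈⟨ trans (O-+ (Q-linear w₀ v) _ _) (+-congˡ (O-neg (Q-linear w₀ v) _)) ⟩
        Q (Q f (0 ∷ [])) w₀ v + - Q (emb h · f) w₀ v
          ≈⟨ +-cong (begin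
               Q (Q f (0 ∷ [])) w₀ v              ≈⟨ Q-assoc f (0 ∷ []) w₀ v ⟨
               Q (λ x → Q f x v) (0 ∷ []) w₀      ≈⟨ Q-comm (λ x → Q f x v) (0 ∷ []) w₀ ⟩
               Q (λ x → Q f x v) w₀ (0 ∷ [])      ≈⟨ Q-assoc f w₀ (0 ∷ []) v ⟩
               Q (Q f w₀) (0 ∷ []) v              ≈⟨ Q-cong (reg-adm k u) (0 ∷ []) v ⟩
               Q (λ x → f w₀ * f x) (0 ∷ []) v    ≈⟨ O-* (Q-linear (0 ∷ []) v) (f w₀) f ⟩
               f w₀ * Q f (0 ∷ []) v              ∎)
             (-‿cong (trans (emb-admissible h f k u v) (trans (·-congˡ (reg-adm k u) v) (O-* (·-linearʳ (emb h) v) (f w₀) f)))) ⟩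
        f w₀ * Q f (0 ∷ []) v + - (f w₀ * (emb h · f) v)
          ≈⟨ solve 3 (λ a b c → a :* b :+ :- (a :* c) := a :* (b :+ :- c)) refl _ _ _ ⟩
        f w₀ * P v ∎
        where w₀ = suc k ∷ u

      P-lead : ∀ j i → i ℕ.< j → ∀ k u → P (y₁^ i ++ suc k ∷ u) ≈ 0#
      P-lead (suc j) i i<j k u = trans (sym (y₁^-lead i P k u (λ i' i'<i → P-lead j i' (ℕ.<-≤-trans i'<i (ℕ.≤-pred i<j)))))
        (trans (P-adm k u (y₁^ i)) (trans (*-congˡ (P-y₁^ i)) (zeroʳ _)))

      P-zero : ∀ w → P w ≈ 0#
      P-zero w with leadView w
      ... | lead n lead-[]      = trans (reflexive (≡.cong P (++-[] (y₁^ n)))) (P-y₁^ n)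
        where ++-[] : ∀ (w : List ℕ) → w ++ [] ≡ w
              ++-[] []      = ≡.refl
              ++-[] (a ∷ w) = ≡.cong (a ∷_) (++-[] w)
      ... | lead n (lead-∷ k u) = P-lead (suc n) n ℕ.≤-refl k u

    -- The difference `P` of the two sides vanishes on powers of `y₁` by the choice of `h`. By
    -- `P-adm` it also vanishes on products of such powers with admissible words, and `y₁^-lead`
    -- isolates one new word in each of these.
    y₁-derivative : ∀ w → Q f (0 ∷ []) w ≈ (emb h · f) w
    y₁-derivative w = trans (inverse-unique (P-zero w)) (-‿involutive _)

    χ : Series
    χ = emb N · f

    embG·embN : ∀ w → (emb G · emb N) w ≈ ε w
    embG·embN w = trans (sym (emb-✶ G N w)) (trans (O-cong (emb-linear w)
      (λ n → trans (✶-comm G N n) (expODE-inverse h n))) (emb-1 w))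

    embN·embG : ∀ w → (emb N · emb G) w ≈ ε w
    embN·embG w = trans (sym (emb-✶ N G w)) (trans (O-cong (emb-linear w) (expODE-inverse h)) (emb-1 w))

    f≈G·χ : ∀ w → f w ≈ (emb G · χ) w
    f≈G·χ w = sym (trans (·-assoc (emb G) (emb N) f w) (trans (·-congʳ embG·embN w) (·-identityˡ f w)))

    -- Stuffling with `y₁` is a derivation, and `N′ = -hN` cancels the contribution `h` of `f`.
    χ-y₁ : ∀ w → Q χ (0 ∷ []) w ≈ 0#
    χ-y₁ w = begin
      Q (emb N · f) (0 ∷ []) w
        ≈⟨ Q-leibniz (emb N) f 0 w ⟩
      (emb N · Q f (0 ∷ [])) w + (Q (emb N) (0 ∷ []) · f) w
        ≈⟨ +-cong (trans (·-congˡ y₁-derivative w) (trans (·-assoc (emb N) (emb h) f w) (·-congʳ (λ v → sym (emb-✶ N h v)) w)))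
                  (·-congʳ (λ v → trans (emb-y₁ N v) (trans (O-cong (emb-linear v)
                    (λ n → trans (D-expODE (λ k → - h k) n) (trans (O-neg (✶-linearˡ N n) h) (-‿cong (✶-comm h N n)))))
                    (O-neg (emb-linear v) (N ✶ h)))) w) ⟩
      (emb (N ✶ h) · f) w + ((λ v → - emb (N ✶ h) v) · f) w
        ≈⟨ +-congˡ (O-neg (·-linearˡ f w) (emb (N ✶ h))) ⟩
      (emb (N ✶ h) · f) w + - (emb (N ✶ h) · f) w
        ≈⟨ -‿inverseʳ _ ⟩
      0# ∎

    -- For fixed `v` the defect `B` vanishes on admissible words and is killed by stuffling with
    -- `y₁`. By `y₁-lead` the latter gives j + 1 times its value at one more leading `y₁`, so
    -- induction and division reach all words.
    χ-char : IsChar χ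
    χ-char = trans (*-identityˡ _) reg-[] , mult
      where
      χ[] : χ [] ≈ 1#
      χ[] = trans (*-identityˡ _) reg-[]

      χ-suc : ∀ k u → χ (suc k ∷ u) ≈ f (suc k ∷ u)
      χ-suc k u = trans (emb-·-suc N f k u) (*-identityˡ _)

      module _ (v : List ℕ) where
        B : Series
        B x = Q χ x v + - (χ x * χ v)

        B-y₁ : ∀ x → Q B (0 ∷ []) x ≈ 0#
        B-y₁ x = begin
          Q B (0 ∷ []) x
            ≈⟨ trans (O-+ (Q-linear (0 ∷ []) x) _ _) (+-cong (Q-assoc χ (0 ∷ []) x v)
                 (trans (O-neg (Q-linear (0 ∷ []) x) _) (-‿cong (O-*ʳ (Q-linear (0 ∷ []) x) _ _)))) ⟩
          Q (Q χ (0 ∷ [])) x v + - (Q χ (0 ∷ []) x * χ v)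
            ≈⟨ +-cong (O-zero (Q-linear x v) χ-y₁) (-‿cong (*-congʳ (χ-y₁ x))) ⟩
          0# + - (0# * χ v)
            ≈⟨ solve 1 (λ a → :0 :+ :- (:0 :* a) := :0) refl _ ⟩
          0# ∎

        B-vanishes : ∀ j → Vanishes (suc j) B
        B-vanishes zero zero _ lead-[]      = trans (+-congˡ (-‿cong (trans (*-congʳ χ[]) (*-identityˡ _)))) (-‿inverseʳ _)
        B-vanishes zero zero _ (lead-∷ k u) = trans (+-cong
          (trans (emb-admissible N f k u v) (trans (·-congˡ (reg-adm k u) v) (O-* (·-linearʳ (emb N) v) _ f)))
          (-‿cong (*-congʳ (χ-suc k u)))) (-‿inverseʳ _)
        B-vanishes (suc j) i i<j {u} l with ℕ.m≤n⇒m<n∨m≡n (ℕ.≤-pred i<j)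
        ... | inj₁ i<sj = B-vanishes j i i<sj l
        ... | inj₂ ≡.refl = nat-torsion-free j (trans (sym (y₁-lead j B (B-vanishes j) l)) (B-y₁ (y₁^ j ++ u)))
        B-vanishes zero (suc i) (s≤s ()) l

      mult : ∀ u v → Q χ u v ≈ χ u * χ v
      mult u v with leadView u
      ... | lead n l = trans (inverse-unique (B-vanishes v n n ℕ.≤-refl l)) (-‿involutive _)

-- Weights of words and the derivation raising letters

wt : List ℕ → ℕ
wt []      = 0
wt (k ∷ u) = suc k ℕ.+ wt u

wt-∷ʳ : ∀ u k → wt (u ∷ʳ k) ≡ suc k ℕ.+ wt u
wt-∷ʳ []      k = ≡.refl
wt-∷ʳ (a ∷ u) k = ≡.trans (≡.cong (suc a ℕ.+_) (wt-∷ʳ u k))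
  (≡.trans (≡.sym (ℕ.+-assoc (suc a) (suc k) (wt u))) (≡.trans (≡.cong (ℕ._+ wt u) (ℕ.+-comm (suc a) (suc k))) (ℕ.+-assoc (suc k) (suc a) (wt u))))

wt-reverse : ∀ u → wt (reverse u) ≡ wt u
wt-reverse []      = ≡.refl
wt-reverse (a ∷ u) = ≡.trans (≡.cong wt (List.unfold-reverse a u))
  (≡.trans (wt-∷ʳ (reverse u) a) (≡.cong (suc a ℕ.+_) (wt-reverse u)))

wt-y₁^ : ∀ n → wt (y₁^ n) ≡ n
wt-y₁^ zero    = ≡.refl
wt-y₁^ (suc n) = ≡.cong suc (wt-y₁^ n)

-- The derivation y_n ↦ n y_{n+1} of the stuffle algebra, which is what x0 ш - induces on
-- series vanishing at x0.
module Euler (K : QAlg) where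
  open Alg K
  open IsLinear
  open Stuffle K
  open PowerSeries K

  Q-wt-cong : ∀ {f g} u v → (∀ w → wt w ≡ wt u ℕ.+ wt v → f w ≈ g w) → Q f u v ≈ Q g u v
  Q-wt-cong []      v       e = e v ≡.refl
  Q-wt-cong (a ∷ u) []      e = e (a ∷ u) (≡.sym (ℕ.+-identityʳ _))
  Q-wt-cong (a ∷ u) (b ∷ v) e = +-cong (+-cong
    (Q-wt-cong u (b ∷ v) (λ w p → e (a ∷ w) (≡.trans (≡.cong (suc a ℕ.+_) p) (≡.sym (ℕ.+-assoc (suc a) (wt u) _)))))
    (Q-wt-cong (a ∷ u) v (λ w p → e (b ∷ w) (≡.trans (≡.cong (suc b ℕ.+_) p) (x∙yz≈y∙xz (suc b) (suc a ℕ.+ wt u) (wt v))))))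
    (*-congˡ (Q-wt-cong u v (λ w p → e (a ⋄ b ∷ w) (≡.trans (≡.cong (suc (a ⋄ b) ℕ.+_) p) (interchange-suc a b (wt u) (wt v))))))

  Eop : Series → Series
  Eop g []      = 0#
  Eop g (k ∷ u) = nat (suc k) * g (suc k ∷ u) + Eop (∂ k g) u

  Eop-linear : ∀ u → IsLinear (λ g → Eop g u)
  Eop-linear []      = 0-linear
  Eop-linear (k ∷ u) = +-linear (*-linear _ (at-linear (suc k ∷ u))) (reindex-linear (k ∷_) (Eop-linear u))

  Eop-wt-cong : ∀ {f g} u → (∀ w → wt w ≡ suc (wt u) → f w ≈ g w) → Eop f u ≈ Eop g u
  Eop-wt-cong []      e = refl
  Eop-wt-cong (k ∷ u) e = +-cong (*-congˡ (e (suc k ∷ u) ≡.refl))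
    (Eop-wt-cong u (λ w p → e (k ∷ w) (≡.trans (≡.cong (suc k ℕ.+_) p) (ℕ.+-suc (suc k) (wt u)))))

  Eop-wt-zero : ∀ {f} u → (∀ w → wt w ≡ suc (wt u) → f w ≈ 0#) → Eop f u ≈ 0#
  Eop-wt-zero u e = trans (Eop-wt-cong u e) (O-0 (Eop-linear u))

  -- The one point to check is a merged letter: raising it has the sum of the two weights as
  -- coefficient, and this splits into raising one or the other letter before merging.
  Q-Eop : ∀ g u v → Q (Eop g) u v ≈ Eop (λ x → Q g x v) u + Eop (Q g u) v
  Q-Eop g []      v       = sym (+-identityˡ _)
  Q-Eop g (a ∷ u) []      = trans (O-cong (Eop-linear (a ∷ u)) (λ w → sym (Q-[]ʳ g w))) (sym (+-identityʳ _))
  Q-Eop g (a ∷ u) (b ∷ v) = begin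
    Q (∂ a (Eop g)) u (b ∷ v) + Q (∂ b (Eop g)) (a ∷ u) v + 1# * Q (∂ c (Eop g)) u v
      ≈⟨ +-cong (+-cong (step a u (b ∷ v)) (step b (a ∷ u) v)) (*-congˡ (step c u v)) ⟩
    (na * X1 + (E1 + (nb * X2' + E2))) + (nb * X2 + ((na * X1' + E3) + E4)) + 1# * (nat (suc c) * X3 + (E5 + E6))
      ≈⟨ +-congˡ (*-congˡ (+-congʳ (*-congʳ nc))) ⟩
    (na * X1 + (E1 + (nb * X2' + E2))) + (nb * X2 + ((na * X1' + E3) + E4)) + 1# * ((na + nb) * X3 + (E5 + E6))
      ≈⟨ solve 13 (λ na nb X1 X2 X1' X2' X3 E1 E2 E3 E4 E5 E6 →
           (na :* X1 :+ (E1 :+ (nb :* X2' :+ E2))) :+ (nb :* X2 :+ ((na :* X1' :+ E3) :+ E4)) :+ :1 :* ((na :+ nb) :* X3 :+ (E5 :+ E6)) :=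
           (na :* (X1 :+ X1' :+ :1 :* X3) :+ (E1 :+ E3 :+ :1 :* E5)) :+ (nb :* (X2' :+ X2 :+ :1 :* X3) :+ (E2 :+ E4 :+ :1 :* E6)))
           refl na nb X1 X2 X1' X2' X3 E1 E2 E3 E4 E5 E6 ⟩
    (na * Q g (suc a ∷ u) (b ∷ v) + (E1 + E3 + 1# * E5)) + (nb * (X2' + X2 + 1# * X3) + (E2 + E4 + 1# * E6))
      ≈⟨ +-cong (+-congˡ (sym (trans (O-+ (Eop-linear u) _ _) (+-cong (O-+ (Eop-linear u) _ _) (O-* (Eop-linear u) _ _)))))
                (+-cong (*-congˡ (+-congˡ (*-congˡ (reflexive (≡.cong (λ d → Q (∂ d g) u v) (≡.cong suc (≡.sym (ℕ.+-suc a b))))))))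
                        (sym (trans (O-+ (Eop-linear v) _ _) (+-cong (O-+ (Eop-linear v) _ _) (O-* (Eop-linear v) _ _))))) ⟩
    Eop (λ x → Q g x (b ∷ v)) (a ∷ u) + Eop (Q g (a ∷ u)) (b ∷ v) ∎
    where
    c = a ⋄ b
    na = nat (suc a)
    nb = nat (suc b)
    nc : nat (suc c) ≈ na + nb
    nc = trans (reflexive (≡.cong (λ n → nat (suc n)) (≡.sym (ℕ.+-suc a b)))) (nat-+ (suc a) (suc b))
    X1 = Q (∂ (suc a) g) u (b ∷ v)
    X2' = Q (∂ a g) u (suc b ∷ v)
    X2 = Q (∂ (suc b) g) (a ∷ u) v
    X1' = Q (∂ b g) (suc a ∷ u) v
    X3 = Q (∂ (suc c) g) u v
    E1 = Eop (λ x → Q (∂ a g) x (b ∷ v)) u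
    E2 = Eop (λ y → Q (∂ a g) u (b ∷ y)) v
    E3 = Eop (λ x → Q (∂ b g) (a ∷ x) v) u
    E4 = Eop (Q (∂ b g) (a ∷ u)) v
    E5 = Eop (λ x → Q (∂ c g) x v) u
    E6 = Eop (Q (∂ c g) u) v
    step : ∀ d p q → Q (∂ d (Eop g)) p q ≈ nat (suc d) * Q (∂ (suc d) g) p q + (Eop (λ x → Q (∂ d g) x q) p + Eop (Q (∂ d g) p) q)
    step d p q = trans (O-+ (Q-linear p q) _ _) (+-cong (O-* (Q-linear p q) _ _) (Q-Eop (∂ d g) p q))

  -- A raised letter is never `y₁`, so it cannot lie in the prefix seen by `emb h`.
  Eop-emb-· : ∀ h F u → Eop (emb h · F) u ≈ (emb h · Eop F) u
  Eop-emb-· h F []          = sym (zeroʳ _)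
  Eop-emb-· h F (zero ∷ u)  = begin
    nat 1 * (emb h · F) (1 ∷ u) + Eop (λ w → h 0 * F (0 ∷ w) + (emb (tl h) · F) w) u
      ≈⟨ +-cong (*-congˡ (emb-·-suc h F 0 u)) (trans (O-+ (Eop-linear u) _ _) (+-cong (O-* (Eop-linear u) _ _) (Eop-emb-· (tl h) F u))) ⟩
    nat 1 * (h 0 * F (1 ∷ u)) + (h 0 * Eop (∂ 0 F) u + (emb (tl h) · Eop F) u)
      ≈⟨ solve 5 (λ n h f e r → n :* (h :* f) :+ (h :* e :+ r) := h :* (n :* f :+ e) :+ r) refl _ _ _ _ _ ⟩
    (emb h · Eop F) (0 ∷ u) ∎
  Eop-emb-· h F (suc k ∷ u) = begin
    nat (suc (suc k)) * (emb h · F) (suc (suc k) ∷ u) + Eop (λ w → (emb h · F) (suc k ∷ w)) u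
      ≈⟨ +-cong (*-congˡ (emb-·-suc h F (suc k) u)) (trans (O-cong (Eop-linear u) (emb-·-suc h F k)) (O-* (Eop-linear u) _ _)) ⟩
    nat (suc (suc k)) * (h 0 * F (suc (suc k) ∷ u)) + h 0 * Eop (∂ (suc k) F) u
      ≈⟨ solve 4 (λ n h f e → n :* (h :* f) :+ h :* e := h :* (n :* f :+ e)) refl _ _ _ _ ⟩
    h 0 * Eop F (suc k ∷ u)
      ≈⟨ emb-·-suc h (Eop F) k u ⟨
    (emb h · Eop F) (suc k ∷ u) ∎

  Eop-emb : ∀ h u → Eop (emb h) u ≈ 0#
  Eop-emb h []          = refl
  Eop-emb h (zero ∷ u)  = trans (+-cong (zeroʳ _) (Eop-emb (tl h) u)) (+-identityʳ _)
  Eop-emb h (suc k ∷ u) = trans (+-cong (zeroʳ _) (O-0 (Eop-linear u))) (+-identityʳ _)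

  Eop-∷ʳ : ∀ g u a → Eop g (u ∷ʳ a) ≈ Eop (∂ʳ a g) u + nat (suc a) * g (u ∷ʳ suc a)
  Eop-∷ʳ g []      a = +-comm _ _
  Eop-∷ʳ g (k ∷ u) a = trans (+-congˡ (Eop-∷ʳ (∂ k g) u a)) (sym (+-assoc _ _ _))

  Eop-rev : ∀ g u → Eop (rev g) u ≈ Eop g (reverse u)
  Eop-rev g []      = refl
  Eop-rev g (k ∷ u) = begin
    nat (suc k) * g (reverse (suc k ∷ u)) + Eop (λ w → g (reverse (k ∷ w))) u
      ≈⟨ +-cong (*-congˡ (reflexive (≡.cong g (List.unfold-reverse (suc k) u))))
                (trans (O-cong (Eop-linear u) (λ w → reflexive (≡.cong g (List.unfold-reverse k w)))) (Eop-rev (∂ʳ k g) u)) ⟩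
    nat (suc k) * g (reverse u ∷ʳ suc k) + Eop (∂ʳ k g) (reverse u)
      ≈⟨ trans (+-comm _ _) (sym (Eop-∷ʳ g (reverse u) k)) ⟩
    Eop g (reverse u ∷ʳ k)
      ≡⟨ ≡.cong (Eop g) (List.unfold-reverse k u) ⟨
    Eop g (reverse (k ∷ u)) ∎

  -- For a derivation θ of the ground ring, θ + Eop - weight is a derivation of the
  -- deconcatenation product.
  module Derivation (θ : Carrier → Carrier) (θ-cong : ∀ {x y} → x ≈ y → θ x ≈ θ y)
    (θ-+ : ∀ x y → θ (x + y) ≈ θ x + θ y) (θ-* : ∀ x y → θ (x * y) ≈ θ x * y + x * θ y) where

    𝔏 : Series → Series
    𝔏 F u = θ (F u) + Eop F u + - (nat (wt u) * F u)

    𝔏-∷ : ∀ F a u → 𝔏 F (a ∷ u) ≈ 𝔏 (∂ a F) u + nat (suc a) * F (suc a ∷ u) + - (nat (suc a) * F (a ∷ u))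
    𝔏-∷ F a u = trans (+-congˡ (-‿cong (*-congʳ (nat-+ (suc a) (wt u)))))
      (solve 6 (λ t n f e x w → t :+ (n :* f :+ e) :+ :- ((n :+ w) :* x) := t :+ e :+ :- (w :* x) :+ n :* f :+ :- (n :* x)) refl _ _ _ _ _ _)

    𝔏-+ : ∀ F G u → 𝔏 (λ w → F w + G w) u ≈ 𝔏 F u + 𝔏 G u
    𝔏-+ F G u = trans (+-congʳ (+-cong (θ-+ _ _) (O-+ (Eop-linear u) F G)))
      (solve 7 (λ a b c d n x y → (a :+ b) :+ (c :+ d) :+ :- (n :* (x :+ y)) := (a :+ c :+ :- (n :* x)) :+ (b :+ d :+ :- (n :* y))) refl _ _ _ _ _ _ _)

    𝔏-* : ∀ c F u → 𝔏 (λ w → c * F w) u ≈ θ c * F u + c * 𝔏 F u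
    𝔏-* c F u = trans (+-congʳ (+-cong (θ-* _ _) (O-* (Eop-linear u) c F)))
      (solve 6 (λ tc c x tx e n → (tc :* x :+ c :* tx) :+ c :* e :+ :- (n :* (c :* x)) := tc :* x :+ c :* (tx :+ e :+ :- (n :* x))) refl _ _ _ _ _ _)

    𝔏-· : ∀ F G u → 𝔏 (F · G) u ≈ (𝔏 F · G) u + (F · 𝔏 G) u
    𝔏-· F G [] = trans (+-congʳ (+-congʳ (θ-* _ _)))
      (solve 4 (λ tf f tg g → tf :* g :+ f :* tg :+ :0 :+ :- (:0 :* (f :* g)) :=
        (tf :+ :0 :+ :- (:0 :* f)) :* g :+ f :* (tg :+ :0 :+ :- (:0 :* g))) refl _ _ _ _)
    𝔏-· F G (a ∷ u) = begin
      𝔏 (F · G) (a ∷ u)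
        ≈⟨ 𝔏-∷ (F · G) a u ⟩
      𝔏 (λ w → F [] * G (a ∷ w) + (∂ a F · G) w) u + n * (F [] * G (suc a ∷ u) + (∂ (suc a) F · G) u) + - (n * (F [] * G (a ∷ u) + (∂ a F · G) u))
        ≈⟨ +-congʳ (+-congʳ (trans (𝔏-+ _ _ u) (+-cong (𝔏-* _ _ u) (𝔏-· (∂ a F) G u)))) ⟩
      ((θ (F []) * G (a ∷ u) + F [] * 𝔏 (∂ a G) u) + ((𝔏 (∂ a F) · G) u + (∂ a F · 𝔏 G) u)) + n * (F [] * G (suc a ∷ u) + (∂ (suc a) F · G) u) + - (n * (F [] * G (a ∷ u) + (∂ a F · G) u))
        ≈⟨ solve 10 (λ tf ga f lga lf fl n gs fs fa →
             ((tf :* ga :+ f :* lga) :+ (lf :+ fl)) :+ n :* (f :* gs :+ fs) :+ :- (n :* (f :* ga :+ fa)) :=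
             ((tf :+ :0 :+ :- (:0 :* f)) :* ga :+ (lf :+ n :* fs :+ (:- n) :* fa)) :+ (f :* (lga :+ n :* gs :+ :- (n :* ga)) :+ fl))
             refl _ _ _ _ _ _ _ _ _ _ ⟩
      (𝔏 F [] * G (a ∷ u) + ((𝔏 (∂ a F) · G) u + n * (∂ (suc a) F · G) u + - n * (∂ a F · G) u)) + (F [] * (𝔏 (∂ a G) u + n * G (suc a ∷ u) + - (n * G (a ∷ u))) + (∂ a F · 𝔏 G) u)
        ≈⟨ +-cong (+-congˡ (sym (trans (·-congʳ (λ w → trans (𝔏-∷ F a w) (+-congˡ (-‿distribˡ-* _ _))) u)
             (trans (O-+ (·-linearˡ G u) _ _) (+-cong (trans (O-+ (·-linearˡ G u) _ _) (+-congˡ (O-* (·-linearˡ G u) _ _))) (O-* (·-linearˡ G u) _ _))))))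
             (+-congʳ (*-congˡ (sym (𝔏-∷ G a u)))) ⟩
      (𝔏 F · G) (a ∷ u) + (F · 𝔏 G) (a ∷ u) ∎
      where n = nat (suc a)

-- Generating series in a central variable z

module OneLetter (K : QAlg) where
  open Alg K
  open Stuffle K
  open Euler K
  open IsLinear

  -- the sum 1 + y_1 + y_2 + ⋯
  Y : Series
  Y []      = 1#
  Y (a ∷ u) = ε u

  -- The stuffle of two nonempty words contains a word of length at most one only if both are
  -- letters, and then the merged letter occurs exactly once.
  Y-char : IsChar Y
  Y-char = refl , m
    where
    m : ∀ u v → Q Y u v ≈ Y u * Y v
    m []      v       = sym (*-identityˡ _)
    m (a ∷ u) []      = sym (*-identityʳ _)
    m (a ∷ u) (b ∷ v) = trans (+-cong (+-cong (proj₂ ε-char u (b ∷ v)) (proj₂ ε-char (a ∷ u) v)) (*-congˡ (proj₂ ε-char u v)))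
      (solve 2 (λ x y → x :* :0 :+ :0 :* y :+ :1 :* (x :* y) := x :* y) refl _ _)

  Eop-ε : ∀ u → Eop ε u ≈ 0#
  Eop-ε []      = refl
  Eop-ε (k ∷ u) = trans (+-cong (zeroʳ _) (O-0 (Eop-linear u))) (+-identityʳ _)

  Eop-Y : ∀ u → Eop Y u ≈ nat (wt u) * Y u
  Eop-Y []          = sym (zeroˡ _)
  Eop-Y (k ∷ [])    = trans (+-identityʳ _) (*-congʳ (reflexive (≡.cong nat (≡.sym (ℕ.+-identityʳ (suc k))))))
  Eop-Y (k ∷ l ∷ u) = trans (+-cong (zeroʳ _) (Eop-ε (l ∷ u))) (trans (+-identityʳ _) (sym (zeroʳ _)))

module Hats (K : QAlg) where
  open Alg K
  open IsLinear
  open Stuffle K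
  open Euler K
  open PowerSeries K
  module A′ = Alg PSAlg
  module S′ = Stuffle PSAlg
  module E′ = Euler PSAlg

  PSeries : Set
  PSeries = List ℕ → PS

  infixr 7 _·′_
  _·′_ : PSeries → PSeries → PSeries
  _·′_ = S′._·_

  lv : ℕ → PSeries → Series
  lv d F w = F w d

  Q-lv : ∀ F u v d → S′.Q F u v d ≈ Q (lv d F) u v
  Q-lv F []      v       d = refl
  Q-lv F (a ∷ u) []      d = refl
  Q-lv F (a ∷ u) (b ∷ v) d = +-cong (+-cong (Q-lv (S′.∂ a F) u (b ∷ v) d) (Q-lv (S′.∂ b F) (a ∷ u) v d))
    (trans (const-✶ 1# _ d) (*-congˡ (Q-lv (S′.∂ (a ⋄ b) F) u v d)))

  nat-✶ : ∀ n f d → (A′.nat n ✶ f) d ≈ nat n * f d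
  nat-✶ zero    f d = trans (O-zero (✶-linearˡ f d) (λ _ → refl)) (sym (zeroˡ _))
  nat-✶ (suc n) f d = trans (O-+ (✶-linearˡ f d) (const 1#) (A′.nat n)) (trans
    (+-cong (const-✶ 1# f d) (nat-✶ n f d)) (sym (distribʳ _ _ _)))

  Eop-lv : ∀ F u d → E′.Eop F u d ≈ Eop (lv d F) u
  Eop-lv F []      d = refl
  Eop-lv F (k ∷ u) d = +-cong (nat-✶ (suc k) _ d) (Eop-lv (S′.∂ k F) u d)

  z^-linear : ∀ m d → IsLinear (λ f → z^ m f d)
  z^-linear zero    d       = at-linear d
  z^-linear (suc m) zero    = 0-linear
  z^-linear (suc m) (suc d) = z^-linear m d

  z^-swap : ∀ {I : Set} {O : (I → Carrier) → Carrier} → IsLinear O → ∀ m d (p : I → PS) →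
            O (λ i → z^ m (p i) d) ≈ z^ m (λ k → O (λ i → p i k)) d
  z^-swap l zero    d       p = refl
  z^-swap l (suc m) zero    p = O-0 l
  z^-swap l (suc m) (suc d) p = z^-swap l m d p

  ✶-swap : ∀ {I : Set} {O : (I → Carrier) → Carrier} → IsLinear O → ∀ (p : I → PS) g d →
           ((λ k → O (λ i → p i k)) ✶ g) d ≈ O (λ i → (p i ✶ g) d)
  ✶-swap l p g zero    = sym (O-*ʳ l _ _)
  ✶-swap l p g (suc d) = trans (+-cong (sym (O-*ʳ l _ _)) (✶-swap l (λ i → tl (p i)) g d)) (sym (O-+ l _ _))

  z^1-✶ : ∀ m f d → (z^ m (const 1#) ✶ f) d ≈ z^ m f d
  z^1-✶ m f d = trans (z^-✶ˡ m (const 1#) f d) (z^-cong m (λ k → trans (const-✶ 1# f k) (*-identityˡ _)) d)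

  z^-·ˡ : ∀ m F G u d → ((λ w → z^ m (F w)) ·′ G) u d ≈ z^ m ((F ·′ G) u) d
  z^-·ˡ m F G u d = trans (S′.·-congʳ {g = G} (λ w n → sym (z^1-✶ m (F w) n)) u d)
    (trans (A′.IsLinear.O-* (S′.·-linearˡ G u) (z^ m (const 1#)) F d) (z^1-✶ m _ d))

  hat : PSeries → PSeries
  hat p u = z^ (wt u) (p u)

  hat-∂ : ∀ a p w d → S′.∂ a (hat p) w d ≈ z^ (suc a) (hat (S′.∂ a p) w) d
  hat-∂ a p w d = z^-+ (suc a) (wt w) (p (a ∷ w)) d

  hat-· : ∀ p q u d → (hat p ·′ hat q) u d ≈ hat (p ·′ q) u d
  hat-· p q []      d = refl
  hat-· p q (a ∷ u) d = trans (+-cong (z^-✶ʳ (wt (a ∷ u)) (p []) (q (a ∷ u)) d)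
    (trans (S′.·-congʳ {g = hat q} (hat-∂ a p) u d) (trans (z^-·ˡ (suc a) (hat (S′.∂ a p)) (hat q) u d)
      (trans (z^-cong (suc a) (hat-· (S′.∂ a p) q u) d) (sym (z^-+ (suc a) (wt u) _ d))))))
    (sym (O-+ (z^-linear (wt (a ∷ u)) d) _ _))

  hat-Q : ∀ p u v d → S′.Q (hat p) u v d ≈ z^ (wt u ℕ.+ wt v) (S′.Q p u v) d
  hat-Q p u v d = begin
    S′.Q (hat p) u v d                                   ≈⟨ Q-lv (hat p) u v d ⟩
    Q (lv d (hat p)) u v                                 ≈⟨ Q-wt-cong u v (λ w e → reflexive (≡.cong (λ m → z^ m (p w) d) e)) ⟩
    Q (λ w → z^ (wt u ℕ.+ wt v) (p w) d) u v             ≈⟨ z^-swap (Q-linear u v) (wt u ℕ.+ wt v) d p ⟩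
    z^ (wt u ℕ.+ wt v) (λ k → Q (lv k p) u v) d          ≈⟨ z^-cong (wt u ℕ.+ wt v) (λ k → sym (Q-lv p u v k)) d ⟩
    z^ (wt u ℕ.+ wt v) (S′.Q p u v) d                    ∎

  hat-char : ∀ {p} → S′.IsChar p → S′.IsChar (hat p)
  hat-char {p} (p1 , pm) = p1 , λ u v d → begin
    S′.Q (hat p) u v d                        ≈⟨ hat-Q p u v d ⟩
    z^ (wt u ℕ.+ wt v) (S′.Q p u v) d         ≈⟨ z^-cong (wt u ℕ.+ wt v) (pm u v) d ⟩
    z^ (wt u ℕ.+ wt v) (p u ✶ p v) d          ≈⟨ z^-+ (wt u) (wt v) _ d ⟩
    z^ (wt u) (z^ (wt v) (p u ✶ p v)) d       ≈⟨ z^-cong (wt u) (λ n → sym (z^-✶ʳ (wt v) (p u) (p v) n)) d ⟩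
    z^ (wt u) (p u ✶ z^ (wt v) (p v)) d       ≈⟨ z^-✶ˡ (wt u) (p u) (z^ (wt v) (p v)) d ⟨
    (hat p u ✶ hat p v) d                     ∎

  cst : Series → PSeries
  cst g w = const (g w)

  cst-·ˡ : ∀ g p u k → (cst g ·′ p) u k ≈ (g · lv k p) u
  cst-·ˡ g p []      k = const-✶ (g []) (p []) k
  cst-·ˡ g p (a ∷ u) k = +-cong (const-✶ (g []) (p (a ∷ u)) k) (cst-·ˡ (∂ a g) p u k)

  cst-· : ∀ f g u k → (cst f ·′ cst g) u k ≈ cst (f · g) u k
  cst-· f g u zero    = cst-·ˡ f (cst g) u 0
  cst-· f g u (suc k) = trans (cst-·ˡ f (cst g) u (suc k)) (O-0 (·-linearʳ f u))

  -- The differential equation `dp/dz = -Eop p`. For `p = ends φ` it is the shuffle relation with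
  -- `x0` when `φ` vanishes at `x0`.
  Flows : PSeries → Set
  Flows p = ∀ u k → D (p u) k ≈ - Eop (lv k p) u

  -- The flow of a derivation consists of automorphisms. On coefficients: by `Q-Eop`, k + 1 times
  -- the defect `B` in degree k + 1 is made of derivatives of the defect in degree `k`.
  flow-char : ∀ {p} → IsChar (lv 0 p) → Flows p → S′.IsChar p
  flow-char {p} (p1 , pm) flow = unit , λ u v d → trans (inverse-unique (zero-B d u v)) (-‿involutive _)
    where
    unit : ∀ d → p [] d ≈ const 1# d
    unit zero    = p1
    unit (suc d) = nat-torsion-free d (trans (flow [] d) -0#≈0#)
    B : ℕ → List ℕ → Series
    B d u v = S′.Q p u v d + - (p u ✶ p v) d
    B-step : ∀ k u v → nat (suc k) * B (suc k) u v ≈ - (Eop (λ x → B k x v) u + Eop (B k u) v)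
    B-step k u v = begin
      nat (suc k) * (S′.Q p u v (suc k) + - (p u ✶ p v) (suc k))
        ≈⟨ solve 3 (λ n a b → n :* (a :+ :- b) := n :* a :+ :- (n :* b)) refl _ _ _ ⟩
      nat (suc k) * S′.Q p u v (suc k) + - D (p u ✶ p v) k
        ≈⟨ +-cong (begin
             nat (suc k) * S′.Q p u v (suc k)               ≈⟨ *-congˡ (Q-lv p u v (suc k)) ⟩
             nat (suc k) * Q (lv (suc k) p) u v             ≈⟨ O-* (Q-linear u v) _ _ ⟨
             Q (λ w → D (p w) k) u v                        ≈⟨ Q-cong (λ w → flow w k) u v ⟩
             Q (λ w → - Eop (lv k p) w) u v                 ≈⟨ O-neg (Q-linear u v) _ ⟩
             - Q (Eop (lv k p)) u v                         ≈⟨ -‿cong (Q-Eop (lv k p) u v) ⟩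
             - (Eop (λ x → Q (lv k p) x v) u + Eop (Q (lv k p) u) v)
               ≈⟨ -‿cong (+-cong (O-cong (Eop-linear u) (λ x → sym (Q-lv p x v k))) (O-cong (Eop-linear v) (λ y → sym (Q-lv p u y k)))) ⟩
             - (Eop (λ x → S′.Q p x v k) u + Eop (λ y → S′.Q p u y k) v) ∎)
           (-‿cong (begin
             D (p u ✶ p v) k
               ≈⟨ D-✶ (p u) (p v) k ⟩
             (D (p u) ✶ p v) k + (p u ✶ D (p v)) k
               ≈⟨ +-cong (✶-cong {g = p v} (flow u) (λ _ → refl) k)
                         (trans (✶-cong {f = p u} (λ _ → refl) (flow v) k) (✶-comm (p u) _ k)) ⟩
             ((λ i → - Eop (lv i p) u) ✶ p v) k + ((λ i → - Eop (lv i p) v) ✶ p u) k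
               ≈⟨ +-cong (trans (O-neg (✶-linearˡ (p v) k) _) (-‿cong (✶-swap (Eop-linear u) p (p v) k)))
                         (trans (O-neg (✶-linearˡ (p u) k) _) (-‿cong (trans (✶-swap (Eop-linear v) p (p u) k)
                           (O-cong (Eop-linear v) (λ y → ✶-comm (p y) (p u) k))))) ⟩
             - Eop (λ x → (p x ✶ p v) k) u + - Eop (λ y → (p u ✶ p y) k) v ∎)) ⟩
      - (Eop (λ x → S′.Q p x v k) u + Eop (λ y → S′.Q p u y k) v) + - (- Eop (λ x → (p x ✶ p v) k) u + - Eop (λ y → (p u ✶ p y) k) v)
        ≈⟨ solve 4 (λ a b c d → :- (a :+ b) :+ :- (:- c :+ :- d) := :- ((a :+ :- c) :+ (b :+ :- d))) refl _ _ _ _ ⟩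
      - ((Eop (λ x → S′.Q p x v k) u + - Eop (λ x → (p x ✶ p v) k) u) + (Eop (λ y → S′.Q p u y k) v + - Eop (λ y → (p u ✶ p y) k) v))
        ≈⟨ -‿cong (+-cong (trans (O-+ (Eop-linear u) _ _) (+-congˡ (O-neg (Eop-linear u) _)))
                          (trans (O-+ (Eop-linear v) _ _) (+-congˡ (O-neg (Eop-linear v) _)))) ⟨
      - (Eop (λ x → B k x v) u + Eop (B k u) v) ∎
    zero-B : ∀ d u v → B d u v ≈ 0#
    zero-B zero    u v = trans (+-congʳ (trans (Q-lv p u v 0) (pm u v))) (-‿inverseʳ _)
    zero-B (suc k) u v = nat-torsion-free k (trans (B-step k u v) (trans
      (-‿cong (+-cong (O-zero (Eop-linear u) (λ x → zero-B k x v)) (O-zero (Eop-linear v) (zero-B k u))))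
      (solve 1 (λ a → :- (:0 :+ :0) := :0) refl 0#)))

  -- The equation `z dF/dz + Eop F = wt F`. It is the form of the flow equation shared by the three
  -- factors of `T`: `hat` produces it from the flow, and `Ŷ`, constant in `z`, satisfies it too.
  Homogeneous : PSeries → Set
  Homogeneous F = ∀ u d → nat d * F u d + Eop (lv d F) u ≈ nat (wt u) * F u d

  hat-homogeneous : ∀ {p} → Flows p → Homogeneous (hat p)
  hat-homogeneous {p} flow u d with ℕ.<-≤-connex d (suc (wt u))
  -- Here `d` is at most the weight of `u`, so raised words have weight above `d` and contribute
  -- nothing; what is left vanishes below the weight and is trivial at `d = wt u`.
  ... | inj₁ d<sw = trans (+-cong (z d d<sw) (Eop-wt-zero u (λ w e → z^-low (wt w) (p w) d (≡.subst (d ℕ.<_) (≡.sym e) d<sw)))) (+-identityʳ _)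
    where
    z : ∀ d → d ℕ.< suc (wt u) → nat d * hat p u d ≈ nat (wt u) * hat p u d
    z d d<sw with ℕ.m≤n⇒m<n∨m≡n (ℕ.≤-pred d<sw)
    ... | inj₁ d<w   = trans (*-congˡ (z^-low (wt u) (p u) d d<w)) (trans (zeroʳ _) (sym (trans (*-congˡ (z^-low (wt u) (p u) d d<w)) (zeroʳ _))))
    ... | inj₂ ≡.refl = refl
  ... | inj₂ sw≤d with ℕ.m≤n⇒∃[o]m+o≡n sw≤d
  ...   | k , ≡.refl = begin
    nat (suc (wt u ℕ.+ k)) * hat p u (suc (wt u ℕ.+ k)) + Eop (lv (suc (wt u ℕ.+ k)) (hat p)) u
      ≈⟨ +-cong (*-cong n+ at) (Eop-wt-cong {g = lv k p} u (λ w e → trans (reflexive (≡.cong₂ (λ m n → z^ m (p w) n) e ≡.refl)) (z^-at (suc (wt u)) (p w) k))) ⟩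
    (nat (wt u) + nat (suc k)) * p u (suc k) + Eop (lv k p) u
      ≈⟨ trans (+-congʳ (distribʳ _ _ _)) (+-assoc _ _ _) ⟩
    nat (wt u) * p u (suc k) + (nat (suc k) * p u (suc k) + Eop (lv k p) u)
      ≈⟨ +-congˡ (trans (+-congʳ (flow u k)) (-‿inverseˡ _)) ⟩
    nat (wt u) * p u (suc k) + 0#
      ≈⟨ +-identityʳ _ ⟩
    nat (wt u) * p u (suc k)
      ≈⟨ *-congˡ at ⟨
    nat (wt u) * hat p u (suc (wt u ℕ.+ k)) ∎
    where
    idx : suc (wt u ℕ.+ k) ≡ wt u ℕ.+ suc k
    idx = ≡.sym (ℕ.+-suc (wt u) k)
    at : hat p u (suc (wt u ℕ.+ k)) ≈ p u (suc k)
    at = trans (reflexive (≡.cong (hat p u) idx)) (z^-at (wt u) (p u) (suc k))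
    n+ : nat (suc (wt u ℕ.+ k)) ≈ nat (wt u) + nat (suc k)
    n+ = trans (reflexive (≡.cong nat idx)) (nat-+ (wt u) (suc k))

  θ-cong : ∀ {f g : PS} → (∀ n → f n ≈ g n) → ∀ n → θ f n ≈ θ g n
  θ-cong e n = *-congˡ (e n)

  open E′.Derivation θ θ-cong (λ f g n → distribˡ _ _ _) θ-✶

  homogeneous⇒𝔏 : ∀ {F} → Homogeneous F → ∀ u d → 𝔏 F u d ≈ 0#
  homogeneous⇒𝔏 {F} H u d = trans (+-cong (trans (+-congˡ (Eop-lv F u d)) (H u d)) (-‿cong (nat-✶ (wt u) (F u) d))) (-‿inverseʳ _)

  𝔏⇒homogeneous : ∀ {F} → (∀ u d → 𝔏 F u d ≈ 0#) → Homogeneous F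
  𝔏⇒homogeneous {F} e u d = trans (+-congˡ (sym (Eop-lv F u d))) (trans (inverse-unique (e u d))
    (trans (-‿involutive _) (nat-✶ (wt u) (F u) d)))

  homogeneous-· : ∀ {F G} → Homogeneous F → Homogeneous G → Homogeneous (F ·′ G)
  homogeneous-· {F} {G} HF HG = 𝔏⇒homogeneous (λ u d → trans (𝔏-· F G u d) (trans
    (+-cong (A′.IsLinear.O-zero (S′.·-linearˡ G u) (homogeneous⇒𝔏 HF) d)
            (A′.IsLinear.O-zero (S′.·-linearʳ F u) (homogeneous⇒𝔏 HG) d)) (+-identityʳ _)))

  open OneLetter PSAlg using () renaming (Y to Ŷ; Y-char to Ŷ-char; Eop-Y to Eop-Ŷ) public

  θ-Ŷ : ∀ u d → θ (Ŷ u) d ≈ 0#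
  θ-Ŷ []          zero    = zeroˡ _
  θ-Ŷ []          (suc d) = zeroʳ _
  θ-Ŷ (a ∷ [])    zero    = zeroˡ _
  θ-Ŷ (a ∷ [])    (suc d) = zeroʳ _
  θ-Ŷ (a ∷ b ∷ u) d       = zeroʳ _

  Ŷ-homogeneous : Homogeneous Ŷ
  Ŷ-homogeneous = 𝔏⇒homogeneous (λ u d → trans (+-congʳ (+-cong (θ-Ŷ u d) (Eop-Ŷ u d)))
    (trans (+-congʳ (+-identityˡ _)) (-‿inverseʳ _)))

  σ : PS → PS
  σ f d = sgn d * f d

  sgn-✶ : ∀ f g d → σ (f ✶ g) d ≈ (σ f ✶ σ g) d
  sgn-✶ f g zero    = solve 2 (λ a b → :1 :* (a :* b) := (:1 :* a) :* (:1 :* b)) refl (f 0) (g 0)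
  sgn-✶ f g (suc d) = begin
    - sgn d * (f 0 * g (suc d) + (tl f ✶ g) d)
      ≈⟨ solve 4 (λ s a b c → (:- s) :* (a :* b :+ c) := (:1 :* a) :* ((:- s) :* b) :+ :- (s :* c)) refl (sgn d) (f 0) (g (suc d)) ((tl f ✶ g) d) ⟩
    (1# * f 0) * (- sgn d * g (suc d)) + - (sgn d * (tl f ✶ g) d)
      ≈⟨ +-congˡ (trans (-‿cong (sgn-✶ (tl f) g d)) (sym (O-neg (✶-linearˡ (σ g) d) (σ (tl f))))) ⟩
    (1# * f 0) * (- sgn d * g (suc d)) + ((λ k → - (sgn k * f (suc k))) ✶ σ g) d
      ≈⟨ +-congˡ (✶-cong {g = σ g} (λ k → -‿distribˡ-* _ _) (λ _ → refl) d) ⟩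
    (σ f ✶ σ g) (suc d) ∎

  σrev : PSeries → PSeries
  σrev F u = σ (F (reverse u))

  σ-· : ∀ F G u d → σ ((F ·′ G) u) d ≈ ((λ w → σ (F w)) ·′ (λ w → σ (G w))) u d
  σ-· F G []      d = sgn-✶ (F []) (G []) d
  σ-· F G (a ∷ u) d = trans (distribˡ _ _ _) (+-cong (sgn-✶ (F []) (G (a ∷ u)) d) (σ-· (S′.∂ a F) G u d))

  σrev-· : ∀ F G u d → σrev (F ·′ G) u d ≈ (σrev G ·′ σrev F) u d
  σrev-· F G u d = trans (*-congˡ (S′.rev-· F G u d)) (σ-· (S′.rev G) (S′.rev F) u d)

  σrev-char : ∀ {F} → S′.IsChar F → S′.IsChar (σrev F)
  σrev-char {F} c = (λ { zero → trans (*-identityˡ _) (proj₁ c 0) ; (suc d) → trans (*-congˡ (proj₁ c (suc d))) (zeroʳ _) }) , λ u v d → begin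
    S′.Q (σrev F) u v d                            ≈⟨ Q-lv (σrev F) u v d ⟩
    Q (λ w → sgn d * F (reverse w) d) u v          ≈⟨ O-* (Q-linear u v) _ _ ⟩
    sgn d * Q (lv d (S′.rev F)) u v                ≈⟨ *-congˡ (sym (Q-lv (S′.rev F) u v d)) ⟩
    sgn d * S′.Q (S′.rev F) u v d                  ≈⟨ *-congˡ (proj₂ (S′.rev-char c) u v d) ⟩
    σ (F (reverse u) ✶ F (reverse v)) d            ≈⟨ sgn-✶ (F (reverse u)) (F (reverse v)) d ⟩
    (σrev F u ✶ σrev F v) d                        ∎

  σrev-homogeneous : ∀ {F} → Homogeneous F → Homogeneous (σrev F)
  σrev-homogeneous {F} H u d = begin
    nat d * (sgn d * F (reverse u) d) + Eop (λ w → sgn d * F (reverse w) d) u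
      ≈⟨ +-congˡ (trans (O-* (Eop-linear u) _ _) (*-congˡ (Eop-rev (lv d F) u))) ⟩
    nat d * (sgn d * F (reverse u) d) + sgn d * Eop (lv d F) (reverse u)
      ≈⟨ solve 4 (λ n s x e → n :* (s :* x) :+ s :* e := s :* (n :* x :+ e)) refl _ _ _ _ ⟩
    sgn d * (nat d * F (reverse u) d + Eop (lv d F) (reverse u))
      ≈⟨ *-congˡ (H (reverse u) d) ⟩
    sgn d * (nat (wt (reverse u)) * F (reverse u) d)
      ≈⟨ solve 3 (λ n s x → s :* (n :* x) := n :* (s :* x)) refl _ _ _ ⟩
    nat (wt (reverse u)) * (sgn d * F (reverse u) d)
      ≡⟨ ≡.cong (λ n → nat n * (sgn d * F (reverse u) d)) (wt-reverse u) ⟩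
    nat (wt u) * σrev F u d ∎

-- Coefficients whose degree is close to the weight

module Diagonal (K : QAlg) where
  open Alg K
  open IsLinear
  open Stuffle K
  open PowerSeries K
  open Hats K

  -- the coefficient of z^{w-n}, read as 0 if w < n
  dg : ℕ → ℕ → PS → Carrier
  dg zero    w       p = p w
  dg (suc n) zero    p = 0#
  dg (suc n) (suc w) p = dg n w p

  dg-linear : ∀ n w → IsLinear (dg n w)
  dg-linear zero    w       = at-linear w
  dg-linear (suc n) zero    = 0-linear
  dg-linear (suc n) (suc w) = dg-linear n w

  dg-z^1 : ∀ n w q → dg n (suc w) (z^ 1 q) ≈ dg n w q
  dg-z^1 zero          w       q = refl
  dg-z^1 (suc zero)    zero    q = refl
  dg-z^1 (suc (suc n)) zero    q = refl
  dg-z^1 (suc n)       (suc w) q = dg-z^1 n w q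

  dg-z^ : ∀ n m w p → dg n (m ℕ.+ w) (z^ m p) ≈ dg n w p
  dg-z^ n zero    w p = refl
  dg-z^ n (suc m) w p = trans (O-cong (dg-linear n (suc m ℕ.+ w)) (z^-+ 1 m p))
    (trans (dg-z^1 n (m ℕ.+ w) (z^ m p)) (dg-z^ n m w p))

  -- In `hat (cst g)` the degree equals the weight, so multiplying by it does not mix the diagonals
  -- on which degree minus weight is `m - n`.
  dg-·ˡ : ∀ n m g F u → dg n (m ℕ.+ wt u) ((hat (cst g) ·′ F) u) ≈ (g · (λ w → dg n (m ℕ.+ wt w) (F w))) u
  dg-·ˡ n m g F []      = trans (O-cong (dg-linear n (m ℕ.+ 0)) (const-✶ (g []) (F []))) (O-* (dg-linear n (m ℕ.+ 0)) _ _)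
  dg-·ˡ n m g F (a ∷ u) = trans (O-+ (dg-linear n (m ℕ.+ wt (a ∷ u))) _ _) (+-cong
    (trans (O-cong (dg-linear n (m ℕ.+ wt (a ∷ u))) (const-✶ (g []) (F (a ∷ u)))) (O-* (dg-linear n (m ℕ.+ wt (a ∷ u))) _ _))
    (begin
      dg n (m ℕ.+ wt (a ∷ u)) ((S′.∂ a (hat (cst g)) ·′ F) u)
        ≈⟨ O-cong (dg-linear n (m ℕ.+ wt (a ∷ u))) (λ d → trans (S′.·-congʳ {g = F} (hat-∂ a (cst g)) u d) (z^-·ˡ (suc a) (hat (cst (∂ a g))) F u d)) ⟩
      dg n (m ℕ.+ wt (a ∷ u)) (z^ (suc a) ((hat (cst (∂ a g)) ·′ F) u))
        ≡⟨ ≡.cong (λ k → dg n k (z^ (suc a) ((hat (cst (∂ a g)) ·′ F) u))) (x∙yz≈y∙xz m (suc a) (wt u)) ⟩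
      dg n (suc a ℕ.+ (m ℕ.+ wt u)) (z^ (suc a) ((hat (cst (∂ a g)) ·′ F) u))
        ≈⟨ dg-z^ n (suc a) (m ℕ.+ wt u) _ ⟩
      dg n (m ℕ.+ wt u) ((hat (cst (∂ a g)) ·′ F) u)
        ≈⟨ dg-·ˡ n m (∂ a g) F u ⟩
      (∂ a g · (λ w → dg n (m ℕ.+ wt w) (F w))) u ∎))

  dg-·ʳ : ∀ n m F g u → dg n (m ℕ.+ wt u) ((F ·′ hat (cst g)) u) ≈ ((λ w → dg n (m ℕ.+ wt w) (F w)) · g) u
  dg-·ʳ n m F g []      = trans (O-cong (dg-linear n (m ℕ.+ 0)) (λ d → trans (✶-comm (F []) (const (g [])) d) (trans (const-✶ (g []) (F []) d) (*-comm _ _))))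
    (O-*ʳ (dg-linear n (m ℕ.+ 0)) _ _)
  dg-·ʳ n m F g (a ∷ u) = trans (O-+ (dg-linear n (m ℕ.+ W)) _ _) (+-cong
    (begin
      dg n (m ℕ.+ W) (F [] ✶ z^ W (const (g (a ∷ u))))
        ≈⟨ O-cong (dg-linear n (m ℕ.+ W)) (λ d → trans (z^-✶ʳ W (F []) (const (g (a ∷ u))) d)
             (z^-cong W (λ d → trans (✶-comm (F []) _ d) (trans (const-✶ _ (F []) d) (*-comm _ _))) d)) ⟩
      dg n (m ℕ.+ W) (z^ W (λ d → F [] d * g (a ∷ u)))
        ≡⟨ ≡.cong (λ k → dg n k (z^ W (λ d → F [] d * g (a ∷ u)))) (≡.trans (ℕ.+-comm m W) (≡.cong (W ℕ.+_) (≡.sym (ℕ.+-identityʳ m)))) ⟩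
      dg n (W ℕ.+ (m ℕ.+ 0)) (z^ W (λ d → F [] d * g (a ∷ u)))
        ≈⟨ trans (dg-z^ n W (m ℕ.+ 0) _) (O-*ʳ (dg-linear n (m ℕ.+ 0)) _ _) ⟩
      dg n (m ℕ.+ 0) (F []) * g (a ∷ u) ∎)
    (begin
      dg n (m ℕ.+ (suc a ℕ.+ wt u)) ((S′.∂ a F ·′ hat (cst g)) u)
        ≡⟨ ≡.cong (λ k → dg n k ((S′.∂ a F ·′ hat (cst g)) u)) (≡.sym (ℕ.+-assoc m (suc a) (wt u))) ⟩
      dg n (m ℕ.+ suc a ℕ.+ wt u) ((S′.∂ a F ·′ hat (cst g)) u)
        ≈⟨ dg-·ʳ n (m ℕ.+ suc a) (S′.∂ a F) g u ⟩
      ((λ w → dg n (m ℕ.+ suc a ℕ.+ wt w) (F (a ∷ w))) · g) u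
        ≈⟨ ·-congʳ (λ w → reflexive (≡.cong (λ k → dg n k (F (a ∷ w))) (ℕ.+-assoc m (suc a) (wt w)))) u ⟩
      ((λ w → dg n (m ℕ.+ wt (a ∷ w)) (F (a ∷ w))) · g) u ∎))
    where W = wt (a ∷ u)

  lv0-· : ∀ F G u → (F ·′ G) u 0 ≈ (lv 0 F · lv 0 G) u
  lv0-· F G []      = refl
  lv0-· F G (a ∷ u) = +-congˡ (lv0-· (S′.∂ a F) G u)

  lv0-hat : ∀ p u → p [] 0 ≈ 1# → hat p u 0 ≈ ε u
  lv0-hat p []      e = e
  lv0-hat p (a ∷ u) e = refl

-- T = p Ŷ σrev(p) factors as G (X Ŷ X⁻) G⁻ with X Ŷ X⁻ a stuffle character and G, G⁻ series in y₁.
-- Once its part of degree < weight is known to vanish on words of degree weight - 1 ≠ 1, the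
-- equation for stuffling with y₁ and the homogeneity equation force the rest of the structure.
module Twist (K : QAlg) (p : Hats.PSeries K) (reg : Stuffle.IsReg K (Hats.lv K 0 p)) (flow : Hats.Flows K p)
  (p-[] : ∀ k → QAlg._≈_ K (p [] (suc k)) (QAlg.0# K)) (p-y₁ : QAlg._≈_ K (p (0 ∷ []) 1) (QAlg.0# K)) where
  open Alg K
  open Stuffle K
  open PowerSeries K
  open Hats K
  open IsLinear
  open Euler K
  open Reg (lv 0 p) reg public

  χz : PSeries
  χz u k = (emb N · lv k p) u

  -- At `z = 0` this is `χ-char`; the flow is kept because `Eop` commutes with multiplication by
  -- `emb N` on the left.
  χz-char : S′.IsChar χz
  χz-char = flow-char χ-char (λ u k → begin
    nat (suc k) * (emb N · lv (suc k) p) u    ≈⟨ O-* (·-linearʳ (emb N) u) _ _ ⟨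
    (emb N · (λ w → D (p w) k)) u             ≈⟨ ·-congˡ (λ w → flow w k) u ⟩
    (emb N · (λ w → - Eop (lv k p) w)) u      ≈⟨ O-neg (·-linearʳ (emb N) u) _ ⟩
    - (emb N · Eop (lv k p)) u                ≈⟨ -‿cong (Eop-emb-· N (lv k p) u) ⟨
    - Eop (lv k χz) u                         ∎)

  X X⁻ Ĝ Ĝ⁻ T ĝ : PSeries
  X  = hat χz
  X⁻ = σrev X
  Ĝ  = hat (cst (emb G))
  Ĝ⁻ = σrev Ĝ
  T  = hat p ·′ Ŷ ·′ σrev (hat p)
  ĝ  = X ·′ Ŷ ·′ X⁻

  X-char : S′.IsChar X
  X-char = hat-char χz-char

  X⁻-char : S′.IsChar X⁻
  X⁻-char = σrev-char X-char

  ĝ-char : S′.IsChar ĝ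
  ĝ-char = S′.·-char X-char (S′.·-char Ŷ-char X⁻-char)

  T-homogeneous : Homogeneous T
  T-homogeneous = homogeneous-· (hat-homogeneous flow) (homogeneous-· Ŷ-homogeneous (σrev-homogeneous (hat-homogeneous flow)))

  p̂≈ : ∀ u d → hat p u d ≈ (Ĝ ·′ X) u d
  p̂≈ u d = sym (trans (hat-· (cst (emb G)) χz u d) (z^-cong (wt u) (λ k →
    trans (cst-·ˡ (emb G) χz u k) (trans (·-assoc (emb G) (emb N) (lv k p) u)
      (trans (·-congʳ embG·embN u) (·-identityˡ (lv k p) u)))) d))

  T≈ : ∀ u d → T u d ≈ (Ĝ ·′ ĝ ·′ Ĝ⁻) u d
  T≈ u = A′.trans (S′.·-cong {g = Ŷ ·′ σrev (hat p)} {g' = Ŷ ·′ (X⁻ ·′ Ĝ⁻)} p̂≈ (S′.·-congˡ {f = Ŷ} (λ w d →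
           trans (*-congˡ (p̂≈ (reverse w) d)) (σrev-· Ĝ X w d))) u)
         (A′.trans (A′.sym (S′.·-assoc Ĝ X (Ŷ ·′ X⁻ ·′ Ĝ⁻) u)) (S′.·-congˡ {f = Ĝ} (λ w →
           A′.trans (S′.·-congˡ {f = X} (S′.·-assoc Ŷ X⁻ Ĝ⁻) w) (S′.·-assoc X (Ŷ ·′ X⁻) Ĝ⁻ w)) u))

  h⁻ G⁻ : PS
  h⁻ = σ h
  G⁻ = σ G

  private
    emb-∷ʳ0 : ∀ g w → emb g (w ∷ʳ 0) ≈ emb (tl g) w
    emb-∷ʳ0 g []          = refl
    emb-∷ʳ0 g (zero ∷ w)  = emb-∷ʳ0 (tl g) w
    emb-∷ʳ0 g (suc k ∷ w) = refl

    emb-∷ʳsuc : ∀ g w k → emb g (w ∷ʳ suc k) ≈ 0#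
    emb-∷ʳsuc g []          k = refl
    emb-∷ʳsuc g (zero ∷ w)  k = emb-∷ʳsuc (tl g) w k
    emb-∷ʳsuc g (suc l ∷ w) k = refl

    emb-reverse : ∀ g w → emb g (reverse w) ≈ emb g w
    emb-reverse g []          = refl
    emb-reverse g (zero ∷ w)  = trans (reflexive (≡.cong (emb g) (List.unfold-reverse 0 w))) (trans (emb-∷ʳ0 g (reverse w)) (emb-reverse (tl g) w))
    emb-reverse g (suc k ∷ w) = trans (reflexive (≡.cong (emb g) (List.unfold-reverse (suc k) w))) (emb-∷ʳsuc g (reverse w) k)

    emb-σ : ∀ g w → emb (σ g) w ≈ sgn (wt w) * emb g w
    emb-σ g []          = refl
    emb-σ g (zero ∷ w)  = trans (O-cong (emb-linear w) (λ n → sym (-‿distribˡ-* _ _))) (trans (O-neg (emb-linear w) _)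
      (trans (-‿cong (emb-σ (tl g) w)) (-‿distribˡ-* _ _)))
    emb-σ g (suc k ∷ w) = sym (zeroʳ _)

    sgn-z^ : ∀ m c d → sgn d * z^ m (const c) d ≈ sgn m * z^ m (const c) d
    sgn-z^ zero    c zero    = refl
    sgn-z^ zero    c (suc d) = trans (zeroʳ _) (sym (zeroʳ _))
    sgn-z^ (suc m) c zero    = trans (zeroʳ _) (sym (zeroʳ _))
    sgn-z^ (suc m) c (suc d) = trans (sym (-‿distribˡ-* _ _)) (trans (-‿cong (sgn-z^ m c d)) (-‿distribˡ-* _ _))

  -- Powers of `y₁` are palindromes and carry a power of `z` equal to their exponent, so `σrev` only
  -- changes the signs of the odd coefficients.
  Ĝ⁻≈ : ∀ u d → Ĝ⁻ u d ≈ hat (cst (emb G⁻)) u d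
  Ĝ⁻≈ u d = begin
    sgn d * z^ (wt (reverse u)) (const (emb G (reverse u))) d
      ≡⟨ ≡.cong (λ m → sgn d * z^ m (const (emb G (reverse u))) d) (wt-reverse u) ⟩
    sgn d * z^ (wt u) (const (emb G (reverse u))) d
      ≈⟨ sgn-z^ (wt u) _ d ⟩
    sgn (wt u) * z^ (wt u) (const (emb G (reverse u))) d
      ≈⟨ O-* (z^-linear (wt u) d) _ _ ⟨
    z^ (wt u) (λ n → sgn (wt u) * const (emb G (reverse u)) n) d
      ≈⟨ z^-cong (wt u) (λ { zero → trans (*-congˡ (emb-reverse G u)) (sym (emb-σ G u)) ; (suc n) → zeroʳ _ }) d ⟩
    hat (cst (emb G⁻)) u d ∎

  D-G⁻ : ∀ n → D G⁻ n ≈ - (G⁻ ✶ h⁻) n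
  D-G⁻ n = begin
    nat (suc n) * (- sgn n * G (suc n))   ≈⟨ solve 3 (λ a s x → a :* ((:- s) :* x) := :- (s :* (a :* x))) refl _ _ _ ⟩
    - (sgn n * D G n)                     ≈⟨ -‿cong (trans (*-congˡ (D-expODE h n)) (trans (sgn-✶ h G n) (✶-comm h⁻ G⁻ n))) ⟩
    - (G⁻ ✶ h⁻) n                         ∎

  Ĥ Ĥ⁻ : PSeries
  Ĥ  = hat (cst (emb h))
  Ĥ⁻ = hat (cst (emb h⁻))

  z : PS
  z = z^ 1 (const 1#)

  private
    -- Stuffling with `y₁` raises the weight by one; this is the extra factor `z`.
    Q-emb : ∀ g u d → S′.Q (hat (cst (emb g))) (0 ∷ []) u d ≈ (z ✶ hat (cst (emb (D g))) u) d
    Q-emb g u d = trans (hat-Q (cst (emb g)) (0 ∷ []) u d) (trans (z^-cong (suc (wt u)) inner d)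
      (trans (z^-+ 1 (wt u) _ d) (sym (z^1-✶ 1 _ d))))
      where
      inner : ∀ k → S′.Q (cst (emb g)) (0 ∷ []) u k ≈ cst (emb (D g)) u k
      inner zero    = trans (Q-lv (cst (emb g)) (0 ∷ []) u 0) (emb-y₁ g u)
      inner (suc k) = trans (Q-lv (cst (emb g)) (0 ∷ []) u (suc k)) (O-0 (Q-linear (0 ∷ []) u))

    hat-emb-✶ : ∀ f g u d → hat (cst (emb (f ✶ g))) u d ≈ (hat (cst (emb f)) ·′ hat (cst (emb g))) u d
    hat-emb-✶ f g u d = sym (trans (hat-· (cst (emb f)) (cst (emb g)) u d) (z^-cong (wt u) (λ k → trans (cst-· (emb f) (emb g) u k)
      (c k)) d))
      where c : ∀ k → cst (emb f · emb g) u k ≈ cst (emb (f ✶ g)) u k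
            c zero    = sym (emb-✶ f g u)
            c (suc k) = refl

    Q-Ĝ : ∀ u → S′.Q Ĝ (0 ∷ []) u A′.≈ z ✶ (Ĥ ·′ Ĝ) u
    Q-Ĝ u d = trans (Q-emb G u d) (✶-cong {f = z} (λ _ → refl) (λ n → trans (z^-cong (wt u) (c u) n) (hat-emb-✶ h G u n)) d)
      where c : ∀ u k → cst (emb (D G)) u k ≈ cst (emb (h ✶ G)) u k
            c u zero    = O-cong (emb-linear u) (D-expODE h)
            c u (suc k) = refl

    Q-Ĝ⁻ : ∀ u → S′.Q Ĝ⁻ (0 ∷ []) u A′.≈ A′.- (z ✶ (Ĝ⁻ ·′ Ĥ⁻) u)
    Q-Ĝ⁻ u d = begin
      S′.Q Ĝ⁻ (0 ∷ []) u d
        ≈⟨ S′.Q-cong Ĝ⁻≈ (0 ∷ []) u d ⟩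
      S′.Q (hat (cst (emb G⁻))) (0 ∷ []) u d
        ≈⟨ Q-emb G⁻ u d ⟩
      (z ✶ hat (cst (emb (D G⁻))) u) d
        ≈⟨ ✶-cong {f = z} (λ _ → refl) (λ n → trans (z^-cong (wt u) (c u) n) (O-neg (z^-linear (wt u) n) _)) d ⟩
      (z ✶ (λ n → - hat (cst (emb (G⁻ ✶ h⁻))) u n)) d
        ≈⟨ O-neg (✶-linearʳ z d) _ ⟩
      - (z ✶ hat (cst (emb (G⁻ ✶ h⁻))) u) d
        ≈⟨ -‿cong (✶-cong {f = z} (λ _ → refl) (λ n → trans (hat-emb-✶ G⁻ h⁻ u n) (S′.·-congʳ {g = Ĥ⁻} (λ w k → sym (Ĝ⁻≈ w k)) u n)) d) ⟩
      - (z ✶ (Ĝ⁻ ·′ Ĥ⁻) u) d ∎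
      where c : ∀ u k → cst (emb (D G⁻)) u k ≈ - cst (emb (G⁻ ✶ h⁻)) u k
            c u zero    = trans (O-cong (emb-linear u) D-G⁻) (O-neg (emb-linear u) _)
            c u (suc k) = sym -0#≈0#

  ν : PS
  ν = ĝ (0 ∷ [])

  -- The Leibniz rule on `Ĝ ĝ Ĝ⁻`: the outer factors contribute their logarithmic derivatives, and
  -- the character `ĝ` contributes its value `ν` at `y₁`.
  T-y₁ : ∀ u → S′.Q T (0 ∷ []) u A′.≈ (z ✶ (Ĥ ·′ T) u A′.+ ν ✶ T u) A′.+ A′.- (z ✶ (T ·′ Ĥ⁻) u)
  T-y₁ u = A′.begin
    S′.Q T (0 ∷ []) u
      A′.≈⟨ S′.Q-cong T≈ (0 ∷ []) u ⟩
    S′.Q (Ĝ ·′ R) (0 ∷ []) u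
      A′.≈⟨ S′.Q-leibniz Ĝ R 0 u ⟩
    (Ĝ ·′ S′.Q R (0 ∷ [])) u A′.+ (S′.Q Ĝ (0 ∷ []) ·′ R) u
      A′.≈⟨ A′.+-cong second first ⟩
    (ν ✶ T u A′.+ A′.- (z ✶ (T ·′ Ĥ⁻) u)) A′.+ z ✶ (Ĥ ·′ T) u
      A′.≈⟨ A′.solve 3 (λ a b c → (a A′.:+ b) A′.:+ c A′.:= (c A′.:+ a) A′.:+ b) A′.refl (ν ✶ T u) (A′.- (z ✶ (T ·′ Ĥ⁻) u)) (z ✶ (Ĥ ·′ T) u) ⟩
    (z ✶ (Ĥ ·′ T) u A′.+ ν ✶ T u) A′.+ A′.- (z ✶ (T ·′ Ĥ⁻) u) A′.∎
    where
    module L = A′.IsLinear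
    R = ĝ ·′ Ĝ⁻
    first : (S′.Q Ĝ (0 ∷ []) ·′ R) u A′.≈ z ✶ (Ĥ ·′ T) u
    first = A′.trans (S′.·-congʳ {g = R} Q-Ĝ u) (A′.trans (L.O-* (S′.·-linearˡ R u) z (Ĥ ·′ Ĝ))
      (A′.*-congˡ {z} (A′.trans (A′.sym (S′.·-assoc Ĥ Ĝ R u)) (S′.·-congˡ {f = Ĥ} (λ w → A′.sym (T≈ w)) u))))
    Q-R : ∀ w → S′.Q R (0 ∷ []) w A′.≈ ν ✶ R w A′.+ A′.- (z ✶ (R ·′ Ĥ⁻) w)
    Q-R w = A′.trans (S′.Q-leibniz ĝ Ĝ⁻ 0 w) (A′.trans (A′.+-comm _ _) (A′.+-cong
      (A′.trans (S′.·-congʳ {g = Ĝ⁻} (proj₂ ĝ-char (0 ∷ [])) w) (L.O-* (S′.·-linearˡ Ĝ⁻ w) ν ĝ))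
      (A′.trans (S′.·-congˡ {f = ĝ} Q-Ĝ⁻ w) (A′.trans (L.O-neg (S′.·-linearʳ ĝ w) _)
        (A′.-‿cong (A′.trans (L.O-* (S′.·-linearʳ ĝ w) z (Ĝ⁻ ·′ Ĥ⁻)) (A′.*-congˡ {z} (S′.·-assoc ĝ Ĝ⁻ Ĥ⁻ w))))))))
    second : (Ĝ ·′ S′.Q R (0 ∷ [])) u A′.≈ ν ✶ T u A′.+ A′.- (z ✶ (T ·′ Ĥ⁻) u)
    second = A′.trans (S′.·-congˡ {f = Ĝ} Q-R u) (A′.trans (L.O-+ (S′.·-linearʳ Ĝ u) _ _) (A′.+-cong
      (A′.trans (L.O-* (S′.·-linearʳ Ĝ u) ν R) (A′.*-congˡ {ν} (A′.sym (T≈ u))))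
      (A′.trans (L.O-neg (S′.·-linearʳ Ĝ u) _) (A′.-‿cong (A′.trans (L.O-* (S′.·-linearʳ Ĝ u) z (R ·′ Ĥ⁻))
        (A′.*-congˡ {z} (A′.trans (S′.·-assoc Ĝ R Ĥ⁻ u) (S′.·-congʳ {g = Ĥ⁻} (λ w → A′.sym (T≈ w)) u))))))))

-- The hypothesis `T-1` is what `Φ Φ⁻¹ x1 = x1` says about `T`: just below the diagonal only the
-- word `y₁` survives.
module Rigidity (K : QAlg) (p : Hats.PSeries K) (reg : Stuffle.IsReg K (Hats.lv K 0 p)) (flow : Hats.Flows K p)
  (p-[] : ∀ k → QAlg._≈_ K (p [] (suc k)) (QAlg.0# K)) (p-y₁ : QAlg._≈_ K (p (0 ∷ []) 1) (QAlg.0# K))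
  (T-1 : ∀ u → QAlg._≈_ K (Diagonal.dg K 1 (wt u) (Twist.T K p reg flow p-[] p-y₁ u)) (Stuffle.emb K (Twist.z K p reg flow p-[] p-y₁) u)) where
  open Alg K
  open Stuffle K
  open PowerSeries K
  open Hats K
  open Diagonal K
  open Twist K p reg flow p-[] p-y₁
  open IsLinear
  open Euler K
  open IsReg reg

  -- Twice the odd part of `h`, hence the logarithmic derivative of `G(z) G(-z)`; it measures how
  -- far `G⁻` is from the inverse of `G`.
  δh : PS
  δh n = h n + - h⁻ n

  private
    X[] : ∀ d → X [] d ≈ const 1# d
    X[] = proj₁ X-char

    X⁻[] : ∀ d → X⁻ [] d ≈ const 1# d
    X⁻[] = proj₁ X⁻-char

  -- `X⁻` at `y₁` is `X` at `y₁` with `-z` for `z`, so `ν` is 1 plus twice the part of even degree;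
  -- `ν = 1` thus says that the depth one coefficients of even weight vanish.
  ν≈ : ∀ d → ν d ≈ X⁻ (0 ∷ []) d + const 1# d + X (0 ∷ []) d
  ν≈ d = begin
    (X [] ✶ (1′ ✶ X⁻ (0 ∷ []) A′.+ 1′ ✶ X⁻ []) A′.+ X (0 ∷ []) ✶ (1′ ✶ X⁻ [])) d
      ≈⟨ A′.+-cong (A′.*-cong X[] (A′.+-congˡ {1′ ✶ X⁻ (0 ∷ [])} (A′.*-congˡ {1′} X⁻[])))
                   (A′.*-congˡ {X (0 ∷ [])} (A′.*-congˡ {1′} X⁻[])) d ⟩
    (1′ ✶ (1′ ✶ X⁻ (0 ∷ []) A′.+ 1′ ✶ 1′) A′.+ X (0 ∷ []) ✶ (1′ ✶ 1′)) d
      ≈⟨ A′.solve 2 (λ a b → (A′.:1 A′.:* (A′.:1 A′.:* a A′.:+ A′.:1 A′.:* A′.:1)) A′.:+ b A′.:* (A′.:1 A′.:* A′.:1) A′.:= a A′.:+ A′.:1 A′.:+ b) A′.refl (X⁻ (0 ∷ [])) (X (0 ∷ [])) d ⟩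
    X⁻ (0 ∷ []) d + const 1# d + X (0 ∷ []) d ∎
    where 1′ = const 1#

  private
    X-y₁ : ∀ d → d ℕ.≤ 2 → X (0 ∷ []) d ≈ 0#
    X-y₁ 0 _ = refl
    X-y₁ 1 _ = χ-y₁ []
    -- Degree 2 is the weight of `ζ(2)`, whose vanishing enters through `p-y₁`. The recursion of
    -- `ν-step` starts from this degree.
    X-y₁ 2 _ = trans (+-cong (trans (*-congˡ p-y₁) (zeroʳ _)) (trans (*-congˡ (p-[] 0)) (zeroʳ _))) (+-identityˡ _)
    X-y₁ (suc (suc (suc d))) (s≤s (s≤s ()))

    ν-low : ∀ d → d ℕ.≤ 2 → ν d ≈ const 1# d
    ν-low d d≤2 = trans (ν≈ d) (trans (+-cong (+-congʳ (trans (*-congˡ (X-y₁ d d≤2)) (zeroʳ _))) (X-y₁ d d≤2))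
      (trans (+-identityʳ _) (+-identityˡ _)))

  -- The coefficients of z^{-1}, z^0 and z^1 of the equation T-y₁, after rescaling by the weight
  equation-1 : ∀ u n → wt u ≡ n → (ν ✶ T u) n ≈ ε u + - emb (z ✶ δh) u
  equation-1 u n ≡.refl = begin
    (ν ✶ T u) (wt u)
      ≈⟨ solve 3 (λ a b x → x := (a :+ x :+ :- b) :+ :- (a :+ :- b)) refl a b ((ν ✶ T u) (wt u)) ⟩
    (a + (ν ✶ T u) (wt u) + - b) + - (a + - b)
      ≈⟨ +-cong (sym (trans (T-y₁ u (wt u)) (+-cong (+-congʳ za) (-‿cong zb)))) (-‿cong ab) ⟩
    S′.Q T (0 ∷ []) u (wt u) + - emb (z ✶ δh) u
      ≈⟨ +-congʳ (begin
           S′.Q T (0 ∷ []) u (wt u)       ≈⟨ Q-lv T (0 ∷ []) u (wt u) ⟩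
           -- The terms of the product with `y₁` have weight `wt u + 1`, so degree `wt u` is one
           -- below their weight and `T-1` applies.
           Q (lv (wt u) T) (0 ∷ []) u     ≈⟨ Q-wt-cong (0 ∷ []) u (λ w e → trans (reflexive (≡.cong (λ m → dg 1 m (T w)) (≡.sym e))) (T-1 w)) ⟩
           Q (emb z) (0 ∷ []) u           ≈⟨ emb-y₁ z u ⟩
           emb (D z) u                    ≈⟨ O-cong (emb-linear u) (λ { zero → solve 0 ((:1 :+ :0) :* :1 := :1) refl ; (suc n) → zeroʳ _ }) ⟩
           emb (const 1#) u               ≈⟨ emb-1 u ⟩
           ε u                            ∎) ⟩
    ε u + - emb (z ✶ δh) u ∎
    where
    a = (emb h · emb z) u
    b = (emb z · emb h⁻) u
    za : (z ✶ (Ĥ ·′ T) u) (wt u) ≈ a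
    za = trans (z^1-✶ 1 ((Ĥ ·′ T) u) (wt u)) (trans (shift (wt u) ((Ĥ ·′ T) u)) (trans (dg-·ˡ 1 0 (emb h) T u) (·-congˡ T-1 u)))
      where shift : ∀ w q → z^ 1 q w ≈ dg 1 w q
            shift zero    q = refl
            shift (suc w) q = refl
    zb : (z ✶ (T ·′ Ĥ⁻) u) (wt u) ≈ b
    zb = trans (z^1-✶ 1 ((T ·′ Ĥ⁻) u) (wt u)) (trans (shift (wt u) ((T ·′ Ĥ⁻) u)) (trans (dg-·ʳ 1 0 T (emb h⁻) u) (·-congʳ T-1 u)))
      where shift : ∀ w q → z^ 1 q w ≈ dg 1 w q
            shift zero    q = refl
            shift (suc w) q = refl
    ab : a + - b ≈ emb (z ✶ δh) u
    ab = begin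
      (emb h · emb z) u + - (emb z · emb h⁻) u   ≈⟨ +-cong (trans (sym (emb-✶ h z u)) (O-cong (emb-linear u) (✶-comm h z))) (-‿cong (sym (emb-✶ z h⁻ u))) ⟩
      emb (z ✶ h) u + - emb (z ✶ h⁻) u           ≈⟨ trans (+-congˡ (sym (O-neg (emb-linear u) (z ✶ h⁻)))) (sym (O-+ (emb-linear u) _ _)) ⟩
      emb (λ n → (z ✶ h) n + - (z ✶ h⁻) n) u     ≈⟨ O-cong (emb-linear u) (λ n → trans (+-congˡ (sym (O-neg (✶-linearʳ z n) h⁻))) (sym (O-+ (✶-linearʳ z n) _ _))) ⟩
      emb (z ✶ δh) u                             ∎

  diag : Series
  diag w = T w (wt w)

  equation-0 : ∀ u n → wt u ≡ n → Q (lv (suc n) T) (0 ∷ []) u ≈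
    ((emb h · diag) u + (ν ✶ T u) (suc n)) + - (diag · emb h⁻) u
  equation-0 u n ≡.refl = trans (sym (Q-lv T (0 ∷ []) u (suc (wt u)))) (trans (T-y₁ u (suc (wt u))) (+-cong (+-congʳ
    (trans (z^1-✶ 1 ((Ĥ ·′ T) u) (suc (wt u))) (dg-·ˡ 0 0 (emb h) T u)))
    (-‿cong (trans (z^1-✶ 1 ((T ·′ Ĥ⁻) u) (suc (wt u))) (dg-·ʳ 0 0 T (emb h⁻) u)))))

  private
    -- At `z = 0` the two outer factors of `T` reduce to the empty word.
    T-0 : ∀ u → T u 0 ≈ lv 0 Ŷ u
    T-0 u = begin
      (hat p ·′ (Ŷ ·′ σrev (hat p))) u 0                      ≈⟨ lv0-· (hat p) (Ŷ ·′ σrev (hat p)) u ⟩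
      (lv 0 (hat p) · lv 0 (Ŷ ·′ σrev (hat p))) u             ≈⟨ ·-cong (λ w → lv0-hat p w reg-[]) (lv0-· Ŷ (σrev (hat p))) u ⟩
      (ε · lv 0 Ŷ · lv 0 (σrev (hat p))) u                    ≈⟨ ·-identityˡ _ u ⟩
      (lv 0 Ŷ · lv 0 (σrev (hat p))) u                        ≈⟨ ·-congˡ (λ w → trans (*-identityˡ _) (trans (lv0-hat p (reverse w) reg-[]) (ε-rev w))) u ⟩
      (lv 0 Ŷ · ε) u                                          ≈⟨ ·-identityʳ _ u ⟩
      lv 0 Ŷ u                                                ∎
      where
      ε-rev : ∀ w → ε (reverse w) ≈ ε w
      ε-rev []      = refl
      ε-rev (a ∷ w) = trans (reflexive (≡.cong ε (List.unfold-reverse a w))) (ε-∷ʳ (reverse w))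
        where ε-∷ʳ : ∀ w → ε (w ∷ʳ a) ≈ 0#
              ε-∷ʳ []      = refl
              ε-∷ʳ (b ∷ w) = refl

    ✶-gap : ∀ m (f q : PS) → (∀ j → j ℕ.< m → f j ≈ 0#) → (f ✶ q) m ≈ f m * q 0
    ✶-gap zero    f q e = refl
    ✶-gap (suc m) f q e = trans (+-cong (trans (*-congʳ (e 0 (s≤s z≤n))) (zeroˡ _)) (✶-gap m (tl f) q (λ j j<m → e (suc j) (s≤s j<m)))) (+-identityˡ _)

    ν-gap : ∀ m q → (∀ j → j ℕ.< m → ν (suc j) ≈ 0#) → (ν ✶ q) (suc m) ≈ q (suc m) + ν (suc m) * q 0
    ν-gap m q e = +-cong (trans (*-congʳ (ν-low 0 z≤n)) (*-identityˡ _)) (✶-gap m (tl ν) q e)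

    -- The even part of the depth one coefficients vanishes: with y = y_{m}, compare the equations
    -- at y₁ * y and at y, and use homogeneity; this yields (m + 2) ν_{m+1} = 0.
    ν-step : ∀ n → (∀ j → j ℕ.< n → ν (suc j) ≈ 0#) → ν (suc n) ≈ 0#
    ν-step zero          e = ν-low 1 (s≤s z≤n)
    ν-step (suc zero)    e = ν-low 2 (s≤s (s≤s z≤n))
    ν-step (suc (suc n)) e = nat-torsion-free (suc m) (begin
      nat (suc (suc m)) * ν (suc m)
        ≈⟨ solve 3 (λ v m x → (:1 :+ (:1 :+ m)) :* v := (m :* v :+ v) :+ v) refl (ν (suc m)) (nat m) 0# ⟩
      (nat m * ν (suc m) + ν (suc m)) + ν (suc m)
        ≈⟨ +-congʳ eq ⟨
      - ν (suc m) + ν (suc m)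
        ≈⟨ -‿inverseˡ _ ⟩
      0# ∎)
      where
      m = suc (suc n)
      y : List ℕ
      y = suc n ∷ []
      at : ∀ u → wt u ≡ suc m → emb (z ✶ δh) u ≈ 0# → ε u ≈ 0# → T u (suc m) ≈ - (ν (suc m) * T u 0)
      at u w e0 e1 = inverse-unique (trans (sym (ν-gap m (T u) e)) (trans (equation-1 u (suc m) w)
        (trans (+-cong e1 (-‿cong e0)) (-‿inverseʳ 0#))))
      single : T (suc (suc n) ∷ []) (suc m) ≈ - ν (suc m)
      single = trans (at (suc (suc n) ∷ []) (ℕ.+-identityʳ _) refl refl) (-‿cong (trans (*-congˡ (T-0 (suc (suc n) ∷ []))) (*-identityʳ _)))
      -- In degree 0 the series `T` is `Ŷ`, which vanishes on words of length two; only the merged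
      -- letter will contribute to `lhs`.
      double : ∀ a b → wt (a ∷ b ∷ []) ≡ suc m → emb (z ✶ δh) (a ∷ b ∷ []) ≈ 0# → T (a ∷ b ∷ []) (suc m) ≈ 0#
      double a b w e0 = trans (at (a ∷ b ∷ []) w e0 refl) (trans (-‿cong (trans (*-congˡ (T-0 (a ∷ b ∷ []))) (zeroʳ _))) -0#≈0#)
      lhs : Q (lv (suc m) T) (0 ∷ []) y ≈ - ν (suc m)
      lhs = trans (+-cong (+-cong (double 0 (suc n) (≡.cong suc (ℕ.+-identityʳ _)) refl)
          (double (suc n) 0 (≡.trans (ℕ.+-comm m 1) ≡.refl) refl)) (trans (*-identityˡ _) single))
        (trans (+-congʳ (+-identityˡ _)) (+-identityˡ _))
      -- In degree m + 1 at a word of weight `m`, homogeneity leaves the term raising `y_m` with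
      -- coefficient `m`, and its value is known from `single`.
      homog : T y (suc m) ≈ nat m * ν (suc m)
      homog = begin
        T y (suc m)
          ≈⟨ solve 3 (λ n t e → t := ((:1 :+ n) :* t :+ e) :+ :- (n :* t) :+ :- e) refl (nat m) (T y (suc m)) (Eop (lv (suc m) T) y) ⟩
        (nat (suc m) * T y (suc m) + Eop (lv (suc m) T) y) + - (nat m * T y (suc m)) + - Eop (lv (suc m) T) y
          ≈⟨ +-cong (+-congʳ (trans (T-homogeneous y (suc m)) (*-congʳ (reflexive (≡.cong nat (ℕ.+-identityʳ m))))))
                    (-‿cong (trans (+-identityʳ _) (*-congˡ single))) ⟩
        nat m * T y (suc m) + - (nat m * T y (suc m)) + - (nat m * - ν (suc m))
          ≈⟨ solve 3 (λ n t v → n :* t :+ :- (n :* t) :+ :- (n :* :- v) := n :* v) refl _ _ _ ⟩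
        nat m * ν (suc m) ∎
      h₀ : h⁻ 0 ≈ h 0
      h₀ = *-identityˡ _
      rhs : ((emb h · diag) y + (ν ✶ T y) (suc m)) + - (diag · emb h⁻) y ≈ nat m * ν (suc m) + ν (suc m)
      rhs = begin
        ((emb h · diag) y + (ν ✶ T y) (suc m)) + - (diag · emb h⁻) y
          ≈⟨ +-cong (+-cong (emb-·-suc h diag n []) (ν-gap m (T y) e)) (-‿cong (+-cong (zeroʳ _) (*-congˡ h₀))) ⟩
        (h 0 * diag y + (T y (suc m) + ν (suc m) * T y 0)) + - (0# + diag y * h 0)
          ≈⟨ solve 4 (λ a b c d → (a :* b :+ (c :+ d)) :+ :- (:0 :+ b :* a) := c :+ d) refl _ _ _ _ ⟩
        T y (suc m) + ν (suc m) * T y 0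
          ≈⟨ +-cong homog (trans (*-congˡ (T-0 y)) (*-identityʳ _)) ⟩
        nat m * ν (suc m) + ν (suc m) ∎
      eq : - ν (suc m) ≈ nat m * ν (suc m) + ν (suc m)
      eq = trans (sym lhs) (trans (equation-0 y m (ℕ.+-identityʳ m)) rhs)

    ν-suc : ∀ n → ν (suc n) ≈ 0#
    ν-suc n = go (suc n) n ℕ.≤-refl
      where
      go : ∀ b n → n ℕ.< b → ν (suc n) ≈ 0#
      go (suc b) n n<b = ν-step n (λ j j<n → go b j (ℕ.<-≤-trans j<n (ℕ.≤-pred n<b)))

    ν-✶ : ∀ q n → (ν ✶ q) n ≈ q n
    ν-✶ q zero    = trans (*-congʳ (ν-low 0 z≤n)) (*-identityˡ _)
    ν-✶ q (suc n) = trans (ν-gap n q (λ j _ → ν-suc j)) (trans (+-congˡ (trans (*-congʳ (ν-suc n)) (zeroˡ _))) (+-identityʳ _))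

    τ : PS
    τ n = const 1# n + - (z ✶ δh) n

    -- With `ν = 1`, `equation-1` determines the diagonal: a series in `y₁` alone, trivial as soon
    -- as `δh` vanishes.
    diag≈τ : ∀ u → diag u ≈ emb τ u
    diag≈τ u = trans (sym (ν-✶ (T u) (wt u))) (trans (equation-1 u (wt u) ≡.refl)
      (sym (trans (O-+ (emb-linear u) _ _) (+-cong (emb-1 u) (O-neg (emb-linear u) _)))))

    τ-suc : ∀ j → τ (suc j) ≈ - δh j
    τ-suc j = trans (+-identityˡ _) (-‿cong (z^1-✶ 1 δh (suc j)))

    emb-y₁^ : ∀ g j → emb g (y₁^ j) ≈ g j
    emb-y₁^ g zero    = refl
    emb-y₁^ g (suc j) = emb-y₁^ (tl g) j

    -- The same comparison at powers of y₁ yields (j + 2) δh_j = 0.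
    δh-step : ∀ j → (∀ i → i ℕ.< j → δh i ≈ 0#) → δh j ≈ 0#
    δh-step j e = nat-torsion-free (suc j) (begin
      nat (suc (suc j)) * δh j
        ≈⟨ solve 2 (λ n x → (:1 :+ n) :* x := x :+ n :* x) refl (nat (suc j)) (δh j) ⟩
      δh j + nat (suc j) * δh j
        ≈⟨ +-congʳ (trans (sym rhs) (trans (sym (equation-0 u j (wt-y₁^ j))) lhs)) ⟩
      - (nat (suc j) * δh j) + nat (suc j) * δh j
        ≈⟨ -‿inverseˡ _ ⟩
      0# ∎)
      where
      u = y₁^ j
      lhs : Q (lv (suc j) T) (0 ∷ []) u ≈ - (nat (suc j) * δh j)
      lhs = begin
        Q (lv (suc j) T) (0 ∷ []) u    ≈⟨ Q-wt-cong (0 ∷ []) u (λ w e → trans (reflexive (≡.cong (T w) (≡.sym (≡.trans e (≡.cong suc (wt-y₁^ j)))))) (diag≈τ w)) ⟩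
        Q (emb τ) (0 ∷ []) u           ≈⟨ emb-y₁ τ u ⟩
        emb (D τ) u                    ≈⟨ emb-y₁^ (D τ) j ⟩
        nat (suc j) * τ (suc j)        ≈⟨ trans (*-congˡ (τ-suc j)) (sym (-‿distribʳ-* _ _)) ⟩
        - (nat (suc j) * δh j)         ∎
      T-next : T u (suc j) ≈ 0#
      T-next = begin
        T u (suc j)
          ≈⟨ solve 3 (λ n t e → t := ((:1 :+ n) :* t :+ e) :+ :- (n :* t) :+ :- e) refl (nat j) (T u (suc j)) (Eop (lv (suc j) T) u) ⟩
        (nat (suc j) * T u (suc j) + Eop (lv (suc j) T) u) + - (nat j * T u (suc j)) + - Eop (lv (suc j) T) u
          ≈⟨ +-cong (+-congʳ (trans (T-homogeneous u (suc j)) (*-congʳ (reflexive (≡.cong nat (wt-y₁^ j))))))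
               (-‿cong (trans (Eop-wt-cong u (λ w e → trans (reflexive (≡.cong (T w) (≡.sym (≡.trans e (≡.cong suc (wt-y₁^ j)))))) (diag≈τ w))) (Eop-emb τ u))) ⟩
        nat j * T u (suc j) + - (nat j * T u (suc j)) + - 0#
          ≈⟨ solve 1 (λ x → x :+ :- x :+ :- :0 := :0) refl _ ⟩
        0# ∎
      rhs : ((emb h · diag) u + (ν ✶ T u) (suc j)) + - (diag · emb h⁻) u ≈ δh j
      rhs = begin
        ((emb h · diag) u + (ν ✶ T u) (suc j)) + - (diag · emb h⁻) u
          ≈⟨ +-cong (+-cong (trans (·-congˡ diag≈τ u) (trans (sym (emb-✶ h τ u)) (emb-y₁^ (h ✶ τ) j))) (trans (ν-✶ (T u) (suc j)) T-next))
               (-‿cong (trans (·-congʳ diag≈τ u) (trans (sym (emb-✶ τ h⁻ u)) (trans (emb-y₁^ (τ ✶ h⁻) j) (✶-comm τ h⁻ j))))) ⟩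
        ((h ✶ τ) j + 0#) + - (h⁻ ✶ τ) j
          ≈⟨ trans (+-congʳ (+-identityʳ _)) (sym (trans (O-+ (✶-linearˡ τ j) h _) (+-congˡ (O-neg (✶-linearˡ τ j) h⁻)))) ⟩
        (δh ✶ τ) j
          ≈⟨ ✶-gap j δh τ e ⟩
        δh j * τ 0
          ≈⟨ trans (*-congˡ (trans (+-congˡ (-‿cong (zeroˡ _))) (trans (+-congˡ -0#≈0#) (+-identityʳ _)))) (*-identityʳ _) ⟩
        δh j ∎

    δh-zero : ∀ n → δh n ≈ 0#
    δh-zero n = go (suc n) n ℕ.≤-refl
      where
      go : ∀ b n → n ℕ.< b → δh n ≈ 0#
      go (suc b) n n<b = δh-step n (λ j j<n → go b j (ℕ.<-≤-trans j<n (ℕ.≤-pred n<b)))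

  T-diagonal : ∀ u → T u (wt u) ≈ ε u
  T-diagonal u = trans (sym (ν-✶ (T u) (wt u))) (trans (equation-1 u (wt u) ≡.refl)
    (trans (+-congˡ (trans (-‿cong (O-zero (emb-linear u) (λ n → O-zero (✶-linearʳ z n) δh-zero))) -0#≈0#)) (+-identityʳ _)))

  -- By homogeneity, k + 1 times this coefficient is a combination of coefficients in the same
  -- degree at words of weight one higher, where the excess over the weight is only `k`; the
  -- induction ends on the diagonal.
  T-above : ∀ k u → T u (suc k ℕ.+ wt u) ≈ 0#
  T-above k u = nat-torsion-free k (begin
    nat (suc k) * t
      ≈⟨ solve 4 (λ a b t e → a :* t := ((a :+ b) :* t :+ e) :+ :- (b :* t) :+ :- e) refl (nat (suc k)) (nat (wt u)) t (Eop (lv (suc k ℕ.+ wt u) T) u) ⟩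
    ((nat (suc k) + nat (wt u)) * t + Eop (lv (suc k ℕ.+ wt u) T) u) + - (nat (wt u) * t) + - Eop (lv (suc k ℕ.+ wt u) T) u
      ≈⟨ +-cong (+-congʳ (trans (+-congʳ (*-congʳ (sym (nat-+ (suc k) (wt u))))) (T-homogeneous u (suc k ℕ.+ wt u))))
           (-‿cong (Eop-wt-zero u (below k))) ⟩
    nat (wt u) * t + - (nat (wt u) * t) + - 0#
      ≈⟨ solve 1 (λ x → x :+ :- x :+ :- :0 := :0) refl _ ⟩
    0# ∎)
    where
    t = T u (suc k ℕ.+ wt u)
    below : ∀ k w → wt w ≡ suc (wt u) → T w (suc k ℕ.+ wt u) ≈ 0#
    below zero    (a ∷ w) e = trans (reflexive (≡.cong (T (a ∷ w)) (≡.sym e))) (T-diagonal (a ∷ w))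
    below (suc k) w       e = trans (reflexive (≡.cong (T w) (≡.trans (≡.cong suc (≡.sym (ℕ.+-suc k (wt u)))) (≡.cong (suc k ℕ.+_) (≡.sym e))))) (T-above k w)

  -- As `δh` vanishes, `h` is even, and then `G⁻` solves the equation `N′ = -hN` of the inverse of
  -- `G`.
  G⁻≈N : ∀ n → G⁻ n ≈ N n
  G⁻≈N = ODE-unique (λ k → - h k) G⁻ N (*-identityˡ _)
    (λ n → trans (D-G⁻ n) (trans (-‿cong (trans (✶-comm G⁻ h⁻ n) (✶-cong {g = G⁻} (λ k → sym (h≈ k)) (λ _ → refl) n)))
      (sym (O-neg (✶-linearˡ G⁻ n) h))))
    (D-expODE (λ k → - h k))
    where h≈ : ∀ k → h k ≈ h⁻ k
          h≈ k = trans (inverse-unique (δh-zero k)) (-‿involutive _)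

  private
    N̂ : PSeries
    N̂ = hat (cst (emb N))

    Ĝ⁻≈N̂ : ∀ u d → Ĝ⁻ u d ≈ N̂ u d
    Ĝ⁻≈N̂ u d = trans (Ĝ⁻≈ u d) (z^-cong (wt u) (λ { zero → O-cong (emb-linear u) G⁻≈N ; (suc n) → refl }) d)

    cancel : ∀ f g → (∀ w → (f · g) w ≈ ε w) → ∀ u d → (hat (cst f) ·′ hat (cst g)) u d ≈ S′.ε u d
    cancel f g e u d = trans (hat-· (cst f) (cst g) u d) (trans (z^-cong (wt u) (cst-· f g u) d) (c u d))
      where
      c : ∀ u d → hat (cst (f · g)) u d ≈ S′.ε u d
      c []      zero    = e []
      c []      (suc d) = refl
      c (a ∷ u) d       = trans (z^-cong (wt (a ∷ u)) (λ { zero → e (a ∷ u) ; (suc n) → refl }) d) (O-0 (z^-linear (wt (a ∷ u)) d))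

  T·Ĝ : ∀ u d → (T ·′ Ĝ) u d ≈ (Ĝ ·′ ĝ) u d
  T·Ĝ u = A′.trans (S′.·-congʳ {g = Ĝ} T≈ u) (A′.trans (A′.sym (S′.·-assoc Ĝ (ĝ ·′ Ĝ⁻) Ĝ u)) (S′.·-congˡ {f = Ĝ} (λ w →
    A′.trans (A′.sym (S′.·-assoc ĝ Ĝ⁻ Ĝ w)) (A′.trans (S′.·-congˡ {f = ĝ} (λ v →
      A′.trans (S′.·-congʳ {g = Ĝ} Ĝ⁻≈N̂ v) (cancel (emb N) (emb G) embN·embG v)) w) (S′.·-identityʳ ĝ w))) u))

  ĝ≈ : ∀ u d → ĝ u d ≈ (N̂ ·′ T ·′ Ĝ) u d
  ĝ≈ u = A′.sym (A′.trans (S′.·-congˡ {f = N̂} T·Ĝ u) (A′.trans (S′.·-assoc N̂ Ĝ ĝ u)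
    (A′.trans (S′.·-congʳ {g = ĝ} (cancel (emb N) (emb G) embN·embG) u) (S′.·-identityˡ ĝ u))))

  private
    ĝ-index : ∀ m u → ĝ u (m ℕ.+ wt u) ≈ (emb N · (λ w → T w (m ℕ.+ wt w)) · emb G) u
    ĝ-index m u = trans (ĝ≈ u (m ℕ.+ wt u)) (trans (dg-·ˡ 0 m (emb N) (T ·′ Ĝ) u) (·-congˡ (dg-·ʳ 0 m T (emb G)) u))

  -- `ĝ` is `T` conjugated by `Ĝ`, and multiplication by `Ĝ` and its inverse preserves each
  -- diagonal.
  ĝ-diagonal : ∀ u → ĝ u (wt u) ≈ ε u
  ĝ-diagonal u = trans (ĝ-index 0 u) (trans (·-congˡ (λ w → trans (·-congʳ T-diagonal w) (·-identityˡ (emb G) w)) u) (embN·embG u))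

  ĝ-above : ∀ k u → ĝ u (suc k ℕ.+ wt u) ≈ 0#
  ĝ-above k u = trans (ĝ-index (suc k) u) (O-zero (·-linearʳ (emb N) u) (λ w → O-zero (·-linearˡ (emb G) w) (T-above k)))

-- Racinet's theorem

ι-++ : ∀ k u w → ι (k ∷ u) ++ w ≡ x0pow k ++ x1 ∷ (ι u ++ w)
ι-++ k u w = List.++-assoc (x0pow k) (x1 ∷ ι u) w

x0pow-suc : ∀ k → x0pow k ++ x0 ∷ [] ≡ x0pow (suc k)
x0pow-suc zero    = ≡.refl
x0pow-suc (suc k) = ≡.cong (x0 ∷_) (x0pow-suc k)

x0pow-reverse : ∀ k → reverse (x0pow k) ≡ x0pow k
x0pow-reverse zero    = ≡.refl
x0pow-reverse (suc k) = ≡.trans (List.unfold-reverse x0 (x0pow k))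
  (≡.trans (≡.cong (_++ x0 ∷ []) (x0pow-reverse k)) (x0pow-suc k))

ι-∷ʳ : ∀ u k → ι (u ∷ʳ k) ≡ ι u ++ x0pow k ++ x1 ∷ []
ι-∷ʳ []      k = ≡.refl
ι-∷ʳ (a ∷ u) k = ≡.trans (≡.cong (λ w → x0pow a ++ x1 ∷ w) (ι-∷ʳ u k)) (≡.sym (ι-++ a u _))

-- Reversal turns blocks `x0^k x1` into `x1 x0^k`; the additional `x1` in front shifts the block
-- boundaries back into place.
x1-ι-reverse : ∀ u → reverse (x1 ∷ ι u) ≡ x1 ∷ ι (reverse u)
x1-ι-reverse []      = ≡.refl
x1-ι-reverse (k ∷ u) = begin
  reverse (x1 ∷ x0pow k ++ x1 ∷ ι u)                  ≡⟨ List.unfold-reverse x1 (x0pow k ++ x1 ∷ ι u) ⟩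
  reverse (x0pow k ++ x1 ∷ ι u) ++ x1 ∷ []            ≡⟨ ≡.cong (_++ x1 ∷ []) (List.reverse-++ (x0pow k) (x1 ∷ ι u)) ⟩
  (reverse (x1 ∷ ι u) ++ reverse (x0pow k)) ++ x1 ∷ [] ≡⟨ ≡.cong₂ (λ a b → (a ++ b) ++ x1 ∷ []) (x1-ι-reverse u) (x0pow-reverse k) ⟩
  x1 ∷ (ι (reverse u) ++ x0pow k) ++ x1 ∷ []          ≡⟨ ≡.cong (x1 ∷_) (List.++-assoc (ι (reverse u)) (x0pow k) _) ⟩
  x1 ∷ ι (reverse u) ++ x0pow k ++ x1 ∷ []            ≡⟨ ≡.cong (x1 ∷_) (ι-∷ʳ (reverse u) k) ⟨
  x1 ∷ ι (reverse u ∷ʳ k)                             ≡⟨ ≡.cong (λ v → x1 ∷ ι v) (List.unfold-reverse k u) ⟨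
  x1 ∷ ι (reverse (k ∷ u))                            ∎
  where open ≡.≡-Reasoning

x1-ι : ∀ u → x1 ∷ ι u ≡ reverse (ι (reverse u)) ∷ʳ x1
x1-ι u = ≡.trans (≡.sym (List.reverse-involutive (x1 ∷ ι u)))
  (≡.trans (≡.cong reverse (x1-ι-reverse u)) (List.unfold-reverse x1 (ι (reverse u))))

length-x0pow : ∀ k → length (x0pow k) ≡ k
length-x0pow zero    = ≡.refl
length-x0pow (suc k) = ≡.cong suc (length-x0pow k)

length-ι : ∀ u → length (ι u) ≡ wt u
length-ι []      = ≡.refl
length-ι (k ∷ u) = ≡.trans (List.length-++ (x0pow k)) (≡.trans (≡.cong₂ (λ a b → a ℕ.+ suc b) (length-x0pow k) (length-ι u))
  (ℕ.+-suc k (wt u)))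

module Words (K : QAlg) where
  open Alg K
  module X = Shuffle K
  module Y = Stuffle K
  open PowerSeries K
  open Hats K
  open Euler K
  open IsLinear

  ends : X.Series → PSeries
  ends f u k = f (ι u ++ x0pow k)

  x0-block : ∀ f m r → X.Q f (x0 ∷ []) (x0pow m ++ x1 ∷ r) ≈
             nat (suc m) * f (x0pow (suc m) ++ x1 ∷ r) + X.Q (λ w → f (x0pow m ++ x1 ∷ w)) (x0 ∷ []) r
  x0-block f zero    r = trans (X.Q-∷ f x0 [] x1 r) (+-congʳ (solve 1 (λ a → a := (:1 :+ :0) :* a) refl _))
  x0-block f (suc m) r = trans (X.Q-∷ f x0 [] x0 (x0pow m ++ x1 ∷ r)) (trans (+-congˡ (x0-block (X.∂ x0 f) m r))
    (solve 3 (λ a n b → a :+ (n :* a :+ b) := (:1 :+ n) :* a :+ b) refl _ _ _))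

  -- A new `x0` enters a block with `m` letters `x0` in m + 1 ways and raises it, as in `Eop`; in
  -- the final power of `x0` it gives the derivative in `z`.
  x0-ends : ∀ f u k → X.Q f (x0 ∷ []) (ι u ++ x0pow k) ≈ Eop (λ w → ends f w k) u + nat (suc k) * ends f u (suc k)
  x0-ends f [] zero    = solve 1 (λ a → a := :0 :+ (:1 :+ :0) :* a) refl _
  x0-ends f [] (suc k) = trans (X.Q-∷ f x0 [] x0 (x0pow k)) (trans (+-congˡ (x0-ends (X.∂ x0 f) [] k))
    (solve 2 (λ a n → a :+ (:0 :+ n :* a) := :0 :+ (:1 :+ n) :* a) refl _ _))
  x0-ends f (m ∷ u) k = begin
    X.Q f (x0 ∷ []) (ι (m ∷ u) ++ x0pow k)
      ≡⟨ ≡.cong (X.Q f (x0 ∷ [])) (ι-++ m u (x0pow k)) ⟩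
    X.Q f (x0 ∷ []) (x0pow m ++ x1 ∷ (ι u ++ x0pow k))
      ≈⟨ trans (x0-block f m _) (+-congˡ (x0-ends (λ w → f (x0pow m ++ x1 ∷ w)) u k)) ⟩
    nat (suc m) * f (x0pow (suc m) ++ x1 ∷ (ι u ++ x0pow k)) + (Eop (λ w → ends (λ v → f (x0pow m ++ x1 ∷ v)) w k) u + nat (suc k) * f (x0pow m ++ x1 ∷ (ι u ++ x0pow (suc k))))
      ≈⟨ +-cong (*-congˡ (reflexive (≡.cong f (≡.sym (ι-++ (suc m) u (x0pow k))))))
           (+-cong (O-cong (Eop-linear u) (λ w → reflexive (≡.cong f (≡.sym (ι-++ m w (x0pow k))))))
                   (*-congˡ (reflexive (≡.cong f (≡.sym (ι-++ m u (x0pow (suc k)))))))) ⟩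
    nat (suc m) * ends f (suc m ∷ u) k + (Eop (λ w → ends f (m ∷ w) k) u + nat (suc k) * ends f (m ∷ u) (suc k))
      ≈⟨ sym (+-assoc _ _ _) ⟩
    Eop (λ w → ends f w k) (m ∷ u) + nat (suc k) * ends f (m ∷ u) (suc k) ∎

  x1-power : ∀ f n → X.Q f (x1 ∷ []) (ι (y₁^ n)) ≈ nat (suc n) * f (ι (y₁^ (suc n)))
  x1-power f zero    = solve 1 (λ a → a := (:1 :+ :0) :* a) refl _
  x1-power f (suc n) = trans (X.Q-∷ f x1 [] x1 (ι (y₁^ n))) (trans (+-congˡ (x1-power (X.∂ x1 f) n))
    (solve 2 (λ a n → a :+ n :* a := (:1 :+ n) :* a) refl _ _))

  ·letter-x1 : ∀ g v → (g X.· X.letter x1) (v ∷ʳ x1) ≈ g v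
  ·letter-x1 g v = trans (X.·-∷ʳ g (X.letter x1) v x1) (trans (+-cong
    (trans (X.·-congˡ {f = g} {g' = X.ε} (λ { [] → refl ; (x0 ∷ []) → refl ; (x1 ∷ []) → refl ; (x0 ∷ a ∷ w) → refl ; (x1 ∷ a ∷ w) → refl }) v) (X.·-identityʳ g v))
    (zeroʳ _)) (+-identityʳ _))

  ·letter-x0 : ∀ g v → (g X.· X.letter x1) (v ∷ʳ x0) ≈ 0#
  ·letter-x0 g v = trans (X.·-∷ʳ g (X.letter x1) v x0) (trans (+-cong
    (O-zero (X.·-linearʳ g v) (λ { [] → refl ; (x0 ∷ []) → refl ; (x1 ∷ []) → refl ; (x0 ∷ a ∷ w) → refl ; (x1 ∷ a ∷ w) → refl }))
    (zeroʳ _)) (+-identityʳ _))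

  -- the defining relations of A^f, as conditions on a grouplike series
  record IsDMR (φ : X.Series) : Set where
    field
      char : X.IsChar φ
      φ-x0 : φ (x0 ∷ []) ≈ 0#
      φ-x1 : φ (x1 ∷ []) ≈ 0#
      φ-x0x1 : φ (x0 ∷ x1 ∷ []) ≈ 0#
      stuffle : ∀ k u v → Y.Q (λ w → φ (ι w)) (suc k ∷ u) v ≈ φ (ι (suc k ∷ u)) * φ (ι v)

  module DMR (φ : X.Series) (dmr : IsDMR φ) where
    open IsDMR dmr

    p : PSeries
    p = ends φ

    p-0 : ∀ u → p u 0 ≈ φ (ι u)
    p-0 u = reflexive (≡.cong φ (List.++-identityʳ (ι u)))

    flow : Flows p
    flow u k = inverse-unique (begin
      nat (suc k) * p u (suc k) + Eop (lv k p) u    ≈⟨ +-comm _ _ ⟩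
      Eop (lv k p) u + nat (suc k) * p u (suc k)    ≈⟨ x0-ends φ u k ⟨
      X.Q φ (x0 ∷ []) (ι u ++ x0pow k)              ≈⟨ proj₂ char (x0 ∷ []) _ ⟩
      φ (x0 ∷ []) * φ (ι u ++ x0pow k)              ≈⟨ trans (*-congʳ φ-x0) (zeroˡ _) ⟩
      0#                                            ∎)

    p-[] : ∀ k → p [] (suc k) ≈ 0#
    p-[] k = nat-torsion-free k (trans (flow [] k) -0#≈0#)

    p-y₁ : p (0 ∷ []) 1 ≈ 0#
    p-y₁ = begin
      φ (x1 ∷ x0 ∷ [])                          ≈⟨ +-identityˡ _ ⟨
      0# + φ (x1 ∷ x0 ∷ [])                     ≈⟨ +-congʳ φ-x0x1 ⟨
      φ (x0 ∷ x1 ∷ []) + φ (x1 ∷ x0 ∷ [])       ≈⟨ X.Q-∷ φ x0 [] x1 [] ⟨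
      X.Q φ (x0 ∷ []) (x1 ∷ [])                 ≈⟨ proj₂ char (x0 ∷ []) (x1 ∷ []) ⟩
      φ (x0 ∷ []) * φ (x1 ∷ [])                 ≈⟨ trans (*-congʳ φ-x0) (zeroˡ _) ⟩
      0#                                        ∎

    reg : Y.IsReg (lv 0 p)
    reg = record
      { reg-[]  = proj₁ char
      ; reg-y₁  = λ n → nat-torsion-free n (trans (*-congˡ (p-0 (y₁^ (suc n)))) (trans (sym (x1-power φ n))
          (trans (proj₂ char (x1 ∷ []) (ι (y₁^ n))) (trans (*-congʳ φ-x1) (zeroˡ _)))))
      ; reg-adm = λ k u v → trans (Y.Q-cong p-0 (suc k ∷ u) v) (trans (stuffle k u v)
          (sym (*-cong (p-0 (suc k ∷ u)) (p-0 v)))) }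

    open Twist K p reg flow p-[] p-y₁ public
    open Diagonal K public

    s : X.Series
    s = X.anti φ X.· X.letter x1

    -- R h = Σ_k h_k x0^k Φ⁻¹ x1
    R : PS → X.Series
    R h []       = h 0 * s []
    R h (x0 ∷ w) = h 0 * s (x0 ∷ w) + R (tl h) w
    R h (x1 ∷ w) = h 0 * s (x1 ∷ w)

    s[] : s [] ≈ 0#
    s[] = zeroʳ _

    R-linear : ∀ w → IsLinear (λ h → R h w)
    R-linear []       = *ʳ-linear (s [])
      where *ʳ-linear : ∀ c → IsLinear (λ (h : PS) → h 0 * c)
            *ʳ-linear c = record { O-cong = λ e → *-congʳ (e 0) ; O-+ = λ _ _ → distribʳ _ _ _ ; O-* = λ _ _ → *-assoc _ _ _ }
    R-linear (x0 ∷ w) = +-linear (*ʳ-linear (s (x0 ∷ w))) (reindex-linear suc (R-linear w))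
      where *ʳ-linear : ∀ c → IsLinear (λ (h : PS) → h 0 * c)
            *ʳ-linear c = record { O-cong = λ e → *-congʳ (e 0) ; O-+ = λ _ _ → distribʳ _ _ _ ; O-* = λ _ _ → *-assoc _ _ _ }
    R-linear (x1 ∷ w) = *ʳ-linear (s (x1 ∷ w))
      where *ʳ-linear : ∀ c → IsLinear (λ (h : PS) → h 0 * c)
            *ʳ-linear c = record { O-cong = λ e → *-congʳ (e 0) ; O-+ = λ _ _ → distribʳ _ _ _ ; O-* = λ _ _ → *-assoc _ _ _ }

    R-finite : X.Finite (λ w h → R h w)
    R-finite []       = record { linear = R-linear [] ; swap = λ r k → O-*ʳ r _ _ }
    R-finite (x0 ∷ w) = record { linear = R-linear (x0 ∷ w) ; swap = λ r k → trans (O-+ r _ _) (+-cong (O-*ʳ r _ _) (IsFinite.swap (R-finite w) r _)) }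
    R-finite (x1 ∷ w) = record { linear = R-linear (x1 ∷ w) ; swap = λ r k → O-*ʳ r _ _ }

    R-const : ∀ w → R (const 1#) w ≈ s w
    R-const []       = *-identityˡ _
    R-const (x0 ∷ w) = trans (+-cong (*-identityˡ _) (O-0 (R-linear w))) (+-identityʳ _)
    R-const (x1 ∷ w) = *-identityˡ _

    private
      σ-z^ : ∀ m f d → sgn d * z^ m f d ≈ z^ m (λ j → sgn (m ℕ.+ j) * f j) d
      σ-z^ zero    f d       = refl
      σ-z^ (suc m) f zero    = zeroʳ _
      σ-z^ (suc m) f (suc d) = trans (sym (-‿distribˡ-* _ _)) (trans (-‿cong (σ-z^ m f d))
        (trans (sym (O-neg (z^-linear m d) _)) (z^-cong m (λ j → -‿distribˡ-* _ _) d)))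

      û : PSeries
      û = σrev (hat p)

      û≈ : ∀ u d → û u d ≈ z^ (wt u) (λ j → sgn (wt u ℕ.+ j) * p (reverse u) j) d
      û≈ u d = trans (σ-z^ (wt (reverse u)) (p (reverse u)) d)
        (reflexive (≡.cong (λ m → z^ m (λ j → sgn (m ℕ.+ j) * p (reverse u) j) d) (wt-reverse u)))

      c : List ℕ → PS
      c u j = sgn (wt u ℕ.+ j) * p (reverse u) j

      -- The antipode reverses the word with a sign, and by `x1-ι` the reversed word is again of the
      -- form seen by `ends`. This is the origin of the last factor `σrev (hat p)` of `T`.
      s-c : ∀ u j → s (x0pow j ++ x1 ∷ ι u) ≈ c u j
      s-c u j = begin
        s (x0pow j ++ x1 ∷ ι u)
          ≡⟨ ≡.cong (λ w → s (x0pow j ++ w)) (x1-ι u) ⟩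
        s (x0pow j ++ v ∷ʳ x1)
          ≡⟨ ≡.cong s (List.++-assoc (x0pow j) v (x1 ∷ [])) ⟨
        s ((x0pow j ++ v) ∷ʳ x1)
          ≈⟨ ·letter-x1 (X.anti φ) (x0pow j ++ v) ⟩
        sgn (length (x0pow j ++ v)) * φ (reverse (x0pow j ++ v))
          ≡⟨ ≡.cong₂ (λ n w → sgn n * φ w) len rv ⟩
        c u j ∎
        where
        v = reverse (ι (reverse u))
        len : length (x0pow j ++ v) ≡ wt u ℕ.+ j
        len = ≡.trans (List.length-++ (x0pow j)) (≡.trans (≡.cong₂ ℕ._+_ (length-x0pow j)
          (≡.trans (List.length-reverse (ι (reverse u))) (≡.trans (length-ι (reverse u)) (wt-reverse u)))) (ℕ.+-comm j (wt u)))
        rv : reverse (x0pow j ++ v) ≡ ι (reverse u) ++ x0pow j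
        rv = ≡.trans (List.reverse-++ (x0pow j) v) (≡.cong₂ _++_ (List.reverse-involutive (ι (reverse u))) (x0pow-reverse j))

      R-block : ∀ h m u → R h (x0pow m ++ x1 ∷ ι u) ≈ (h ✶ c u) m
      R-block h zero    u = *-congˡ (s-c u 0)
      R-block h (suc m) u = +-cong (*-congˡ (s-c u (suc m))) (R-block (tl h) m u)

      ·R-block : ∀ f h k u → (f X.· R h) (x0pow k ++ x1 ∷ ι u) ≈
                 ((λ i → f (x0pow i)) ✶ (h ✶ c u)) k + ((λ v → f (x0pow k ++ x1 ∷ v)) X.· R h) (ι u)
      ·R-block f h zero    u = +-congʳ (*-congˡ (R-block h 0 u))
      ·R-block f h (suc k) u = trans (+-cong (*-congˡ (R-block h (suc k) u)) (·R-block (X.∂ x0 f) h k u)) (sym (+-assoc _ _ _))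

      V : PSeries
      V = Ŷ ·′ û

      V-∷ : ∀ k u d → V (k ∷ u) d ≈ û (k ∷ u) d + û u d
      V-∷ k u d = +-cong (trans (const-✶ 1# (û (k ∷ u)) d) (*-identityˡ _)) (S′.·-identityˡ û u d)

      -- In `f · x0^k Φ⁻¹ x1` the middle `x0^k` lies inside one block of `ι u`, and the letter of
      -- `Ŷ` marks that block: the missing `x0^k x1` lowers the degree to k + 1 below the weight.
      -- The term 1 of `Ŷ` starts at the weight, out of reach of `dg 1`. The recursion replaces `f`
      -- by its derivatives, so it must be arbitrary.
      family-T′ : ∀ f u h → dg 1 (wt u) ((hat (ends f) ·′ V) u ✶ h) ≈ (f X.· R h) (ι u)
      family-T′ f []      h = sym (trans (*-congˡ (trans (*-congˡ s[]) (zeroʳ _))) (zeroʳ _))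
      family-T′ f (k ∷ u) h = begin
        ((a ✶ V (k ∷ u) A′.+ (S′.∂ k (hat (ends f)) ·′ V) u) ✶ h) n
          ≈⟨ O-+ (✶-linearˡ h n) _ _ ⟩
        ((a ✶ V (k ∷ u)) ✶ h) n + ((S′.∂ k (hat (ends f)) ·′ V) u ✶ h) n
          ≈⟨ +-cong first second ⟩
        (a ✶ (h ✶ c u)) k + ((λ v → f (x0pow k ++ x1 ∷ v)) X.· R h) (ι u)
          ≈⟨ ·R-block f h k u ⟨
        (f X.· R h) (ι (k ∷ u)) ∎
        where
        n = k ℕ.+ wt u
        a = ends f []
        f′ : X.Series
        f′ v = f (x0pow k ++ x1 ∷ v)
        second : ((S′.∂ k (hat (ends f)) ·′ V) u ✶ h) n ≈ (f′ X.· R h) (ι u)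
        second = begin
          ((S′.∂ k (hat (ends f)) ·′ V) u ✶ h) n
            ≈⟨ ✶-cong {g = h} (λ d → trans (S′.·-congʳ {g = V} (λ w d → trans (z^-cong (wt (k ∷ w)) (λ j → reflexive (≡.cong f (ι-++ k w (x0pow j)))) d)
                 (z^-+ (suc k) (wt w) (ends f′ w) d)) u d) (z^-·ˡ (suc k) (hat (ends f′)) V u d)) (λ _ → refl) n ⟩
          (z^ (suc k) ((hat (ends f′) ·′ V) u) ✶ h) n
            ≈⟨ z^-✶ˡ (suc k) _ h n ⟩
          dg 1 (suc k ℕ.+ wt u) (z^ (suc k) ((hat (ends f′) ·′ V) u ✶ h))
            ≈⟨ dg-z^ 1 (suc k) (wt u) _ ⟩
          dg 1 (wt u) ((hat (ends f′) ·′ V) u ✶ h)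
            ≈⟨ family-T′ f′ u h ⟩
          (f′ X.· R h) (ι u) ∎
        first : ((a ✶ V (k ∷ u)) ✶ h) n ≈ (a ✶ (h ✶ c u)) k
        first = begin
          ((a ✶ V (k ∷ u)) ✶ h) n
            ≈⟨ A′.*-congʳ {h} (A′.*-congˡ {a} (λ d → trans (V-∷ k u d) (+-cong (û≈ (k ∷ u) d) (û≈ u d)))) n ⟩
          ((a ✶ (z^ (wt (k ∷ u)) (c (k ∷ u)) A′.+ z^ (wt u) (c u))) ✶ h) n
            ≈⟨ A′.solve 4 (λ a x y h → (a A′.:* (x A′.:+ y)) A′.:* h A′.:= x A′.:* (a A′.:* h) A′.:+ y A′.:* (a A′.:* h)) A′.refl a (z^ (wt (k ∷ u)) (c (k ∷ u))) (z^ (wt u) (c u)) h n ⟩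
          (z^ (wt (k ∷ u)) (c (k ∷ u)) ✶ (a ✶ h)) n + (z^ (wt u) (c u) ✶ (a ✶ h)) n
            ≈⟨ +-cong (trans (z^-✶ˡ (wt (k ∷ u)) _ _ n) (z^-low (wt (k ∷ u)) _ n ℕ.≤-refl))
                 (trans (z^-✶ˡ (wt u) _ _ n) (trans (reflexive (≡.cong (z^ (wt u) (c u ✶ (a ✶ h))) (ℕ.+-comm k (wt u)))) (z^-at (wt u) _ k))) ⟩
          0# + (c u ✶ (a ✶ h)) k
            ≈⟨ trans (+-identityˡ _) (A′.solve 3 (λ c a h → c A′.:* (a A′.:* h) A′.:= a A′.:* (h A′.:* c)) A′.refl (c u) a h k) ⟩
          (a ✶ (h ✶ c u)) k ∎

    family-T : ∀ u h → dg 1 (wt u) (T u ✶ h) ≈ (φ X.· R h) (ι u)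
    family-T = family-T′ φ

    T-1 : ∀ u → dg 1 (wt u) (T u) ≈ Y.emb z u
    T-1 u = begin
      dg 1 (wt u) (T u)                            ≈⟨ O-cong (dg-linear 1 (wt u)) (λ d → sym (A′.*-identityʳ (T u) d)) ⟩
      dg 1 (wt u) (T u ✶ const 1#)                 ≈⟨ family-T u (const 1#) ⟩
      (φ X.· R (const 1#)) (ι u)                   ≈⟨ X.·-congˡ R-const (ι u) ⟩
      (φ X.· X.anti φ X.· X.letter x1) (ι u)       ≈⟨ X.·-assoc φ (X.anti φ) (X.letter x1) (ι u) ⟩
      ((φ X.· X.anti φ) X.· X.letter x1) (ι u)     ≈⟨ X.·-congʳ (X.anti-inverseʳ char) (ι u) ⟩
      (X.ε X.· X.letter x1) (ι u)                  ≈⟨ X.·-identityˡ (X.letter x1) (ι u) ⟩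
      X.letter x1 (ι u)                            ≈⟨ x1-ι-z u ⟩
      Y.emb z u                                    ∎
      where
      x1-ι-z : ∀ u → X.letter x1 (ι u) ≈ Y.emb z u
      x1-ι-z []                 = refl
      x1-ι-z (zero ∷ [])        = refl
      x1-ι-z (zero ∷ zero ∷ u)  = sym (O-0 (Y.emb-linear u))
      x1-ι-z (zero ∷ suc k ∷ u) = refl
      x1-ι-z (suc k ∷ u)        = refl

    open Rigidity K p reg flow p-[] p-y₁ T-1 public

-- Letter substitutions read off from the diagonals of a series in z

module FamilyProduct (K : QAlg) (L : Set) (_⋄_ : L → L → L) (λ̂ : QAlg.Carrier K) where
  open Alg K
  open IsLinear
  open IsFinite using (linear; swap)
  open QS K L _⋄_ λ̂

  infixl 7 _F·_
  _F·_ : {I : Set} → Family I → Series → Family I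
  (P F· g) w h = ((λ v → P v h) · g) w

  F·-⊙ : ∀ {I} {P : Family I} → Finite P → ∀ g X w → ((P F· g) ⊙ X) w ≈ (P ⊙ (λ i → g · X i)) w
  F·-⊙ F g X []      = trans (*-comm _ _) (sym (O-* (linear (F [])) _ _))
  F·-⊙ {P = P} F g X (a ∷ w) = begin
    P [] (λ i → X i (a ∷ w)) * g [] + (δ a (P F· g) ⊙ X) w
      ≈⟨ +-congˡ (trans (⊙-+ˡ (λ w h → P [] h * g (a ∷ w)) (δ a P F· g) X w) (+-cong (head (∂ a g) w) (F·-⊙ (λ w → F (a ∷ w)) g X w))) ⟩
    P [] (λ i → X i (a ∷ w)) * g [] + (P [] (λ i → (∂ a g · X i) w) + (δ a P ⊙ (λ i → g · X i)) w)
      ≈⟨ trans (sym (+-assoc _ _ _)) (+-congʳ (+-congʳ (trans (*-comm _ _) (sym (O-* (linear (F [])) _ _))))) ⟩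
    (P [] (λ i → g [] * X i (a ∷ w)) + P [] (λ i → (∂ a g · X i) w)) + (δ a P ⊙ (λ i → g · X i)) w
      ≈⟨ +-congʳ (O-+ (linear (F [])) _ _) ⟨
    (P ⊙ (λ i → g · X i)) (a ∷ w) ∎
    where
    head : ∀ k w → ((λ w h → P [] h * k w) ⊙ X) w ≈ P [] (λ i → (k · X i) w)
    head k []      = trans (*-comm _ _) (sym (O-* (linear (F [])) _ _))
    head k (b ∷ w) = trans (+-cong (trans (*-comm _ _) (sym (O-* (linear (F [])) _ _))) (head (∂ b k) w)) (sym (O-+ (linear (F [])) _ _))

module DiagonalFamily (K : QAlg) where
  open Alg K
  open Stuffle K
  open PowerSeries K
  open Hats K
  open IsLinear
  open IsFinite using (linear; swap)
  open Euler K
  open Diagonal K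
  open FamilyProduct K ℕ _⋄_ 1#

  ✶-finite : ∀ q n → IsFinite (λ (h : PS) → (q ✶ h) n)
  ✶-finite q zero    = point-finite (q 0) 0
  ✶-finite q (suc n) = +-finite (point-finite (q 0) (suc n)) (✶-finite (tl q) n)

  -- the family of letter coefficients F_{k+1} = [coefficient of z^{w-k-1}] F
  fam : PSeries → Family ℕ
  fam F u h = dg 1 (wt u) (F u ✶ h)

  fam-finite : ∀ F → Finite (fam F)
  fam-finite F []      = 0-finite
  fam-finite F (k ∷ u) = ✶-finite (F (k ∷ u)) (k ℕ.+ wt u)

  fam-[] : ∀ F h → fam F [] h ≈ 0#
  fam-[] F h = refl

  fam-·ˡ : ∀ g F u h → (emb g ·F fam F) u h ≈ fam (hat (cst (emb g)) ·′ F) u h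
  fam-·ˡ g F u h = trans (sym (dg-·ˡ 1 0 (emb g) (λ w → F w ✶ h) u)) (O-cong (dg-linear 1 (wt u)) (λ d →
    trans (A′.IsLinear.O-cong (S′.·-linearʳ (hat (cst (emb g))) u) (λ w → A′.*-comm (F w) h) d)
      (trans (A′.IsLinear.O-* (S′.·-linearʳ (hat (cst (emb g))) u) h F d) (✶-comm h _ d))))

  fam-·ʳ : ∀ g F u h → (fam F F· emb g) u h ≈ fam (F ·′ hat (cst (emb g))) u h
  fam-·ʳ g F u h = trans (sym (dg-·ʳ 1 0 (λ w → F w ✶ h) (emb g) u)) (O-cong (dg-linear 1 (wt u)) (λ d →
    trans (S′.·-congʳ {g = hat (cst (emb g))} (λ w → A′.*-comm (F w) h) u d)
      (trans (A′.IsLinear.O-* (S′.·-linearˡ (hat (cst (emb g))) u) h F d) (✶-comm h _ d))))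

  fam-cong : ∀ {F F'} → (∀ u d → F u d ≈ F' u d) → ∀ u h → fam F u h ≈ fam F' u h
  fam-cong e u h = O-cong (dg-linear 1 (wt u)) (✶-cong {g = h} (e u) (λ _ → refl))

  -- As `q` stops at degree `n`, every term of the product uses `h` at an index of at least `s`.
  ✶-degree : ∀ n s q h → (∀ d → n ℕ.< d → q d ≈ 0#) → (q ✶ h) (n ℕ.+ s) ≈ (q ✶ (λ a → h (a ℕ.+ s))) n
  ✶-degree zero    zero    q h e = refl
  ✶-degree zero    (suc s) q h e = trans (+-congˡ (O-zero (✶-linearˡ' h s) (λ d → e (suc d) (s≤s z≤n)))) (+-identityʳ _)
    where
    ✶-linearˡ' : ∀ h s → IsLinear (λ f → (f ✶ h) s)
    ✶-linearˡ' = ✶-linearˡ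
  ✶-degree (suc n) s       q h e = +-congˡ (✶-degree n s (tl q) h (λ d n<d → e (suc d) (s≤s n<d)))

  module _ (F : PSeries) (F-char : S′.IsChar F) (F-diagonal : ∀ u → F u (wt u) ≈ ε u) (F-above : ∀ k u → F u (suc k ℕ.+ wt u) ≈ 0#) where

    F-degree : ∀ a u d → a ℕ.+ wt u ℕ.< d → F (a ∷ u) d ≈ 0#
    F-degree a u d lt with ℕ.m≤n⇒∃[o]m+o≡n lt
    ... | zero  , ≡.refl = trans (reflexive (≡.cong (F (a ∷ u)) (ℕ.+-identityʳ _))) (F-diagonal (a ∷ u))
    ... | suc k , ≡.refl = trans (reflexive (≡.cong (F (a ∷ u)) (ℕ.+-comm (suc a ℕ.+ wt u) (suc k)))) (F-above k (a ∷ u))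

    -- Relative to the weight, the letters coded `i` and `j` sit at `z^(-i-1)` and `z^(-j-1)`, whose
    -- product is `z^(-(i ⋄ j)-1)`: multiplicativity of `F` becomes the merging term. For nonempty
    -- words `F-degree` excludes nonnegative powers, which would otherwise contribute to the
    -- product.
    fam-compatible : ∀ (h : ℕ → Carrier) u v →
      Q (λ w → fam F w h) u v ≈ fam F u h * ε v + ε u * fam F v h + 1# * fam F u (λ a → fam F v (λ b → h (a ⋄ b)))
    fam-compatible h [] v = solve 2 (λ x e → x := :0 :* e :+ :1 :* x :+ :1 :* :0) refl (fam F v h) (ε v)
    fam-compatible h (a ∷ u) [] = sym (trans (+-congˡ (trans (*-identityˡ _) (O-0 (linear (fam-finite F (a ∷ u))))))
      (solve 2 (λ x e → x :* :1 :+ :0 :* :0 :+ :0 := x) refl (fam F (a ∷ u) h) 0#))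
    fam-compatible h (a ∷ u) (b ∷ v) = begin
      Q (λ w → fam F w h) (a ∷ u) (b ∷ v)
        ≈⟨ Q-wt-cong (a ∷ u) (b ∷ v) (λ w e → reflexive (≡.cong (λ m → dg 1 m (F w ✶ h)) e)) ⟩
      Q (λ w → (F w ✶ h) (m ℕ.+ wt (b ∷ v))) (a ∷ u) (b ∷ v)
        ≈⟨ ✶-swap (Q-linear (a ∷ u) (b ∷ v)) F h (m ℕ.+ wt (b ∷ v)) ⟨
      ((λ k → Q (lv k F) (a ∷ u) (b ∷ v)) ✶ h) (m ℕ.+ wt (b ∷ v))
        ≈⟨ ✶-cong {g = h} (λ k → trans (sym (Q-lv F (a ∷ u) (b ∷ v) k)) (proj₂ F-char (a ∷ u) (b ∷ v) k)) (λ _ → refl) (m ℕ.+ wt (b ∷ v)) ⟩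
      ((F (a ∷ u) ✶ F (b ∷ v)) ✶ h) (m ℕ.+ wt (b ∷ v))
        ≈⟨ ✶-assoc (F (a ∷ u)) (F (b ∷ v)) h (m ℕ.+ wt (b ∷ v)) ⟩
      (F (a ∷ u) ✶ (F (b ∷ v) ✶ h)) (m ℕ.+ wt (b ∷ v))
        ≈⟨ ✶-degree m (wt (b ∷ v)) (F (a ∷ u)) (F (b ∷ v) ✶ h) (F-degree a u) ⟩
      (F (a ∷ u) ✶ (λ i → (F (b ∷ v) ✶ h) (i ℕ.+ suc m'))) m
        ≈⟨ ✶-cong {f = F (a ∷ u)} (λ _ → refl) (λ i → trans
             (reflexive (≡.cong (F (b ∷ v) ✶ h) (≡.trans (ℕ.+-suc i m') (≡.trans (≡.cong suc (ℕ.+-comm i m')) (≡.sym (ℕ.+-suc m' i))))))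
             (trans (✶-degree m' (suc i) (F (b ∷ v)) h (F-degree b v))
               (✶-cong {f = F (b ∷ v)} (λ _ → refl) (λ j → reflexive (≡.cong h (≡.trans (ℕ.+-suc j i) (≡.cong suc (ℕ.+-comm j i))))) m'))) m ⟩
      fam F (a ∷ u) (λ i → fam F (b ∷ v) (λ j → h (i ⋄ j)))
        ≈⟨ solve 3 (λ x y t → t := x :* :0 :+ :0 :* y :+ :1 :* t) refl (fam F (a ∷ u) h) (fam F (b ∷ v) h) _ ⟩
      fam F (a ∷ u) h * 0# + 0# * fam F (b ∷ v) h + 1# * fam F (a ∷ u) (λ i → fam F (b ∷ v) (λ j → h (i ⋄ j))) ∎
      where
      m = a ℕ.+ wt u
      m' = b ℕ.+ wt v

module Racinet (K : QAlg) (Φ Ψ : Shuffle.Series K) (dΦ : Words.IsDMR K Φ) (dΨ : Words.IsDMR K Ψ) where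
  open Alg K
  open Words K
  open IsLinear
  open PowerSeries K
  open Hats K
  open DiagonalFamily K
  open FamilyProduct K ℕ _⋄_ 1#
  private
    module dΦ = IsDMR dΦ
    module dΨ = IsDMR dΨ
    module P = DMR Φ dΦ
    module P' = DMR Ψ dΨ
    module I = Ihara K Φ dΦ.char

  open P using (R; R-finite; s; s[])

  private
    -- the part of Θ in x0 alone, invisible after ∘ ι
    pure : X.Series → X.Series
    pure Θ []       = Θ []
    pure Θ (x0 ∷ w) = pure (X.∂ x0 Θ) w
    pure Θ (x1 ∷ w) = 0#

    AX : X.Series → ℕ → X.Series
    AX Θ k = I.act (λ v → Θ (x0pow k ++ x1 ∷ v))

    RF : X.Family ℕ
    RF w h = R h w

    RF-x0 : ∀ X w → (X.δ x0 RF X.⊙ X) w ≈ (X.∂ x0 s X.· X 0) w + (RF X.⊙ (λ k → X (suc k))) w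
    RF-x0 X w = trans (X.⊙-+ˡ (λ v h → h 0 * s (x0 ∷ v)) (λ v h → R (tl h) v) X w)
      (+-cong (pt0 (X.∂ x0 s) w) (tail-shift RF w))
      where
      pt0 : ∀ f w → ((λ v h → h 0 * f v) X.⊙ X) w ≈ (f X.· X 0) w
      pt0 f []      = *-comm _ _
      pt0 f (a ∷ w) = +-cong (*-comm _ _) (pt0 (X.∂ a f) w)
      tail-shift : ∀ (P : X.Family ℕ) w → ((λ v h → P v (tl h)) X.⊙ X) w ≈ (P X.⊙ (λ k → X (suc k))) w
      tail-shift P []      = refl
      tail-shift P (a ∷ w) = +-congˡ (tail-shift (X.δ a P) w)

    RF-x1 : ∀ X w → (X.δ x1 RF X.⊙ X) w ≈ (X.∂ x1 s X.· X 0) w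
    RF-x1 X w = pt0 (X.∂ x1 s) w
      where
      pt0 : ∀ f w → ((λ v h → h 0 * f v) X.⊙ X) w ≈ (f X.· X 0) w
      pt0 f []      = *-comm _ _
      pt0 f (a ∷ w) = +-cong (*-comm _ _) (pt0 (X.∂ a f) w)

    E0 : X.Series → X.Series
    E0 Θ = X.anti Φ X.· I.act Θ

    act≈E0 : ∀ Θ w → I.act Θ w ≈ (Φ X.· E0 Θ) w
    act≈E0 Θ w = sym (trans (X.·-assoc Φ (X.anti Φ) (I.act Θ) w) (trans (X.·-congʳ (X.anti-inverseʳ dΦ.char) w) (X.·-identityˡ _ w)))

    E0-unfold : ∀ Θ w → E0 Θ w ≈ Θ [] * X.ε w + ((X.letter x0 X.· E0 (X.∂ x0 Θ)) w + (s X.· AX Θ 0) w)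
    E0-unfold Θ w = begin
      (X.anti Φ X.· I.act Θ) w
        ≈⟨ trans (X.·-congˡ (I.act-unfold Θ) w) (trans (O-+ (X.·-linearʳ (X.anti Φ) w) _ _)
             (+-cong (trans (O-* (X.·-linearʳ (X.anti Φ) w) (Θ []) Φ) (*-congˡ (X.anti-inverseˡ dΦ.char w))) (O-+ (X.·-linearʳ (X.anti Φ) w) _ _))) ⟩
      Θ [] * X.ε w + ((X.anti Φ X.· I.A0 X.· M0) w + (X.anti Φ X.· X.letter x1 X.· M1) w)
        ≈⟨ +-congˡ (+-cong (begin
             (X.anti Φ X.· I.A0 X.· M0) w
               ≈⟨ X.·-congˡ (λ v → trans (sym (X.·-assoc Φ _ M0 v)) (X.·-congˡ (λ v → sym (X.·-assoc (X.letter x0) (X.anti Φ) M0 v)) v)) w ⟩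
             (X.anti Φ X.· Φ X.· X.letter x0 X.· E0 (X.∂ x0 Θ)) w
               ≈⟨ trans (X.·-assoc (X.anti Φ) Φ _ w) (trans (X.·-congʳ (X.anti-inverseˡ dΦ.char) w) (X.·-identityˡ _ w)) ⟩
             (X.letter x0 X.· E0 (X.∂ x0 Θ)) w ∎)
           (X.·-assoc (X.anti Φ) (X.letter x1) M1 w)) ⟩
      Θ [] * X.ε w + ((X.letter x0 X.· E0 (X.∂ x0 Θ)) w + (s X.· AX Θ 0) w) ∎
      where
      M0 = I.act (X.∂ x0 Θ)
      M1 = I.act (X.∂ x1 Θ)

    -- Sorts `Θ` by its first block `x0^k x1`. Between consecutive copies of `Φ x0 Φ⁻¹` the factors
    -- cancel, so the block becomes `Φ x0^k Φ⁻¹ x1`, with the leading `Φ` removed in `E0`.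
    E0-blocks : ∀ Θ w → E0 Θ w ≈ pure Θ w + (RF X.⊙ AX Θ) w
    E0-blocks Θ []       = trans (E0-unfold Θ []) (trans (+-cong (*-identityʳ _) (+-cong (zeroˡ _) (trans (*-congʳ s[]) (zeroˡ _))))
      (+-congˡ (trans (+-identityˡ _) (sym (trans (*-congˡ s[]) (zeroʳ _))))))
    E0-blocks Θ (x0 ∷ w) = begin
      E0 Θ (x0 ∷ w)
        ≈⟨ trans (E0-unfold Θ (x0 ∷ w)) (trans (+-cong (zeroʳ _) (+-congʳ (trans (X.letter-∷ x0 _ x0 w) (*-identityˡ _)))) (+-identityˡ _)) ⟩
      E0 (X.∂ x0 Θ) w + (s X.· AX Θ 0) (x0 ∷ w)
        ≈⟨ +-cong (E0-blocks (X.∂ x0 Θ) w) (trans (+-congʳ (trans (*-congʳ s[]) (zeroˡ _))) (+-identityˡ _)) ⟩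
      (pure (X.∂ x0 Θ) w + (RF X.⊙ AX (X.∂ x0 Θ)) w) + (X.∂ x0 s X.· AX Θ 0) w
        ≈⟨ trans (+-assoc _ _ _) (+-congˡ (+-comm _ _)) ⟩
      pure Θ (x0 ∷ w) + ((X.∂ x0 s X.· AX Θ 0) w + (RF X.⊙ (λ k → AX Θ (suc k))) w)
        ≈⟨ +-congˡ (trans (+-congʳ (trans (*-congˡ s[]) (zeroʳ _))) (trans (+-identityˡ _) (RF-x0 (AX Θ) w))) ⟨
      pure Θ (x0 ∷ w) + (RF X.⊙ AX Θ) (x0 ∷ w) ∎
    E0-blocks Θ (x1 ∷ w) = begin
      E0 Θ (x1 ∷ w)
        ≈⟨ trans (E0-unfold Θ (x1 ∷ w)) (trans (+-cong (zeroʳ _) (+-congʳ (trans (X.letter-∷ x0 _ x1 w) (zeroˡ _)))) (trans (+-identityˡ _) (+-identityˡ _))) ⟩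
      (s X.· AX Θ 0) (x1 ∷ w)
        ≈⟨ trans (+-congʳ (trans (*-congʳ s[]) (zeroˡ _))) (+-identityˡ _) ⟩
      (X.∂ x1 s X.· AX Θ 0) w
        ≈⟨ trans (+-identityˡ _) (trans (+-congʳ (trans (*-congˡ s[]) (zeroʳ _))) (trans (+-identityˡ _) (RF-x1 (AX Θ) w))) ⟨
      0# + (RF X.⊙ AX Θ) (x1 ∷ w) ∎

    pure-ι : ∀ Θ k u → pure Θ (x0pow k ++ x1 ∷ ι u) ≈ 0#
    pure-ι Θ zero    u = refl
    pure-ι Θ (suc k) u = pure-ι (X.∂ x0 Θ) k u

    ·pure-ι : ∀ g Θ u → (g X.· pure Θ) (ι u) ≈ Θ [] * g (ι u)
    ·pure-ι g Θ []      = *-comm _ _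
    ·pure-ι g Θ (k ∷ u) = block g k
      where
      block : ∀ g k → (g X.· pure Θ) (x0pow k ++ x1 ∷ ι u) ≈ Θ [] * g (x0pow k ++ x1 ∷ ι u)
      block g zero    = trans (+-cong (zeroʳ _) (·pure-ι (X.∂ x1 g) Θ u)) (+-identityˡ _)
      block g (suc k) = trans (+-cong (trans (*-congˡ (pure-ι Θ (suc k) u)) (zeroʳ _)) (block (X.∂ x0 g) k)) (+-identityˡ _)

    -- A cut inside a block would leave a prefix ending in `x0`; the remaining cuts are those of the
    -- word in the `y_k`.
    ⊙-ι : ∀ (P : X.Family ℕ) X → (∀ w h → P (w ∷ʳ x0) h ≈ 0#) → ∀ u →
          (P X.⊙ X) (ι u) ≈ ((λ u → P (ι u)) Y.⊙ (λ k u → X k (ι u))) u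
    ⊙-ι P X e []      = refl
    ⊙-ι P X e (k ∷ u) = trans (block P k e) (+-congˡ (⊙-ι (λ v → P (x0pow k ++ x1 ∷ v)) X
      (λ w h → trans (reflexive (≡.cong (λ v → P v h) (≡.sym (List.++-assoc (x0pow k) (x1 ∷ w) (x0 ∷ []))))) (e (x0pow k ++ x1 ∷ w) h)) u))
      where
      block : ∀ (P : X.Family ℕ) k → (∀ w h → P (w ∷ʳ x0) h ≈ 0#) → (P X.⊙ X) (x0pow k ++ x1 ∷ ι u) ≈
              P [] (λ i → X i (x0pow k ++ x1 ∷ ι u)) + ((λ v → P (x0pow k ++ x1 ∷ v)) X.⊙ X) (ι u)
      block P zero    e = refl
      block P (suc k) e = +-congˡ (trans (block (X.δ x0 P) k (λ w → e (x0 ∷ w))) (trans (+-congʳ (e [] _)) (+-identityˡ _)))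

    R-x0 : ∀ w h → R h (w ∷ʳ x0) ≈ 0#
    R-x0 []       h = trans (+-cong (trans (*-congˡ (·letter-x0 (X.anti Φ) [])) (zeroʳ _)) (trans (*-congˡ s[]) (zeroʳ _))) (+-identityˡ _)
    R-x0 (x0 ∷ w) h = trans (+-cong (trans (*-congˡ (·letter-x0 (X.anti Φ) (x0 ∷ w))) (zeroʳ _)) (R-x0 w (tl h))) (+-identityˡ _)
    R-x0 (x1 ∷ w) h = trans (*-congˡ (·letter-x0 (X.anti Φ) (x1 ∷ w))) (zeroʳ _)

    W : X.Family ℕ
    W = Φ X.·F RF

    W-x0 : ∀ w h → W (w ∷ʳ x0) h ≈ 0#
    W-x0 w h = trans (X.·-∷ʳ Φ (R h) w x0) (trans (+-cong (O-zero (X.·-linearʳ Φ w) (λ v → R-x0 v h)) (trans (*-congˡ (trans (*-congˡ s[]) (zeroʳ _))) (zeroʳ _))) (+-identityˡ _))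

  act-ι : ∀ Θ u → I.act Θ (ι u) ≈ Θ [] * Φ (ι u) + (fam P.T Y.⊙ (λ k u → AX Θ k (ι u))) u
  act-ι Θ u = begin
    I.act Θ (ι u)
      ≈⟨ trans (act≈E0 Θ (ι u)) (X.·-congˡ (E0-blocks Θ) (ι u)) ⟩
    (Φ X.· (λ w → pure Θ w + (RF X.⊙ AX Θ) w)) (ι u)
      ≈⟨ trans (O-+ (X.·-linearʳ Φ (ι u)) _ _) (+-cong (·pure-ι Φ Θ u) (X.·-⊙-assoc Φ RF (AX Θ) (ι u))) ⟩
    Θ [] * Φ (ι u) + (W X.⊙ AX Θ) (ι u)
      ≈⟨ +-congˡ (trans (⊙-ι W (AX Θ) W-x0 u) (Y.⊙-congˡ _ (λ v h → sym (P.family-T v h)) u)) ⟩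
    Θ [] * Φ (ι u) + (fam P.T Y.⊙ (λ k u → AX Θ k (ι u))) u ∎

  private
    fΦ : Y.Series
    fΦ = lv 0 P.p

    -- `Nb` substitutes the letters of `T`, which describe the Ihara product; `Nβ` substitutes those
    -- of `ĝ`, for which the coproduct rule is available.
    module Nb = Substitution K ℕ _⋄_ 1# (fam P.T) fΦ (fam-finite P.T) (fam-[] P.T)
    module Nbε = Substitution K ℕ _⋄_ 1# (fam P.T) Y.ε (fam-finite P.T) (fam-[] P.T)
    module Nβ = Substitution K ℕ _⋄_ 1# (fam P.ĝ) P.χ (fam-finite P.ĝ) (fam-[] P.ĝ)

    act≈Nb : ∀ Θ u → I.act Θ (ι u) ≈ Nb.N (λ v → Θ (ι v)) u
    act≈Nb Θ u = go (length u) Θ u ℕ.≤-refl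
      where
      go : ∀ n Θ u → length u ℕ.≤ n → I.act Θ (ι u) ≈ Nb.N (λ v → Θ (ι v)) u
      go zero    Θ [] _  = trans (act-ι Θ []) (trans (+-identityʳ _) (*-congˡ (sym (P.p-0 []))))
      go (suc n) Θ u  u≤ = trans (act-ι Θ u) (trans (+-cong (*-congˡ (sym (P.p-0 u)))
        (Y.⊙-congʳ< Nb.𝒜-linear (fam-[] P.T) u (λ i v v<u → go n (λ w → Θ (x0pow i ++ x1 ∷ w)) v (ℕ.≤-pred (ℕ.≤-trans v<u u≤)))))
        (sym (Nb.N-unfold (λ v → Θ (ι v)) u)))

    fam-0 : ∀ c u → fam P.T u (const c) ≈ c * Y.emb P.z u
    fam-0 c u = trans (O-cong (P.dg-linear 1 (wt u)) (λ d → trans (✶-comm (P.T u) (const c) d) (const-✶ c (P.T u) d)))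
      (trans (O-* (P.dg-linear 1 (wt u)) c (P.T u)) (*-congˡ (P.T-1 u)))

    first : (ℕ → Y.Series) → ℕ → Y.Series
    first X zero    = X 0
    first X (suc k) = λ _ → 0#

    fam-emb : ∀ X u → (∀ k v → X (suc k) v ≈ 0#) → (fam P.T Y.⊙ X) u ≈ (Y.emb P.z Y.· X 0) u
    fam-emb X u e = trans (Y.⊙-congʳ {X' = first X} Nb.𝒜-linear (λ { zero v → refl ; (suc k) v → e k v }) u)
      (go (fam P.T) (Y.emb P.z) Nb.𝒜-linear (λ v c → fam-0 c v) u)
      where
      go : ∀ (P' : Y.Family ℕ) g → Y.Linear P' → (∀ v c → P' v (const c) ≈ c * g v) → ∀ u →
           (P' Y.⊙ first X) u ≈ (g Y.· X 0) u
      at : ∀ (P' : Y.Family ℕ) g → Y.Linear P' → (∀ v c → P' v (const c) ≈ c * g v) → ∀ u →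
           P' [] (λ i → first X i u) ≈ g [] * X 0 u
      at P' g l e u = trans (O-cong (l []) (λ { zero → refl ; (suc k) → refl })) (trans (e [] (X 0 u)) (*-comm _ _))
      go P' g l e []      = at P' g l e []
      go P' g l e (a ∷ u) = +-cong (at P' g l e (a ∷ u)) (go (λ v → P' (a ∷ v)) (λ v → g (a ∷ v)) (λ v → l (a ∷ v)) (λ v → e (a ∷ v)) u)

    -- By `T-1` the letter `y₁` is substituted by itself.
    Nbε-emb : ∀ g u → Nbε.N (Y.emb g) u ≈ Y.emb g u
    Nbε-emb g u = go (length u) g u ℕ.≤-refl
      where
      unfold : ∀ g u → Nbε.N (Y.emb g) u ≈ g 0 * Y.ε u + (Y.emb P.z Y.· Nbε.N (Y.emb (tl g))) u
      unfold g u = trans (Nbε.N-unfold (Y.emb g) u) (+-congˡ (fam-emb (λ n → Nbε.N (Y.∂ n (Y.emb g))) u (λ k v → O-0 (Nbε.N-linear v))))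
      fold : ∀ g u → Y.emb g u ≈ g 0 * Y.ε u + (Y.emb P.z Y.· Y.emb (tl g)) u
      fold g u = begin
        Y.emb g u
          ≈⟨ O-cong (Y.emb-linear u) (λ { zero → solve 2 (λ a b → a := a :* :1 :+ :0 :* b) refl _ _
               ; (suc n) → sym (trans (+-cong (zeroʳ _) (z^1-✶ 1 (tl g) (suc n))) (+-identityˡ _)) }) ⟩
        Y.emb (λ n → g 0 * const 1# n + (P.z ✶ tl g) n) u
          ≈⟨ trans (O-+ (Y.emb-linear u) _ _) (+-cong (trans (O-* (Y.emb-linear u) _ _) (*-congˡ (Y.emb-1 u))) (Y.emb-✶ P.z (tl g) u)) ⟩
        g 0 * Y.ε u + (Y.emb P.z Y.· Y.emb (tl g)) u ∎
      go : ∀ n g u → length u ℕ.≤ n → Nbε.N (Y.emb g) u ≈ Y.emb g u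
      go zero    g [] _  = *-identityʳ _
      go (suc n) g u  u≤ = trans (unfold g u) (trans (+-congˡ (Y.⊙-congʳ< (Y.pt-linear (Y.emb P.z)) (λ h → zeroˡ _) u
        (λ _ v v<u → go n (tl g) v (ℕ.≤-pred (ℕ.≤-trans v<u u≤))))) (sym (fold g u)))

    -- The factor `G` of `fΦ = G χ` travels to the left through all substituted letters, by
    -- `T Ĝ = Ĝ ĝ`; this requires the two outer factors of `T` to be inverse to each other.
    Nβ≈Nb : ∀ f u → (Y.emb P.G Y.· Nβ.N f) u ≈ Nb.N f u
    Nβ≈Nb = Nb.N-unique (λ f → Y.emb P.G Y.· Nβ.N f) (λ f u → begin
      (Y.emb P.G Y.· Nβ.N f) u
        ≈⟨ trans (Y.·-congˡ (Nβ.N-unfold f) u) (trans (O-+ (Y.·-linearʳ (Y.emb P.G) u) _ _)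
             (+-cong (trans (O-* (Y.·-linearʳ (Y.emb P.G) u) (f []) P.χ) (*-congˡ (sym (P.f≈G·χ u))))
                     (Y.·-⊙-assoc (Y.emb P.G) (fam P.ĝ) _ u))) ⟩
      f [] * fΦ u + ((Y.emb P.G Y.·F fam P.ĝ) Y.⊙ (λ n → Nβ.N (Y.∂ n f))) u
        ≈⟨ +-congˡ (trans (Y.⊙-congˡ _ (λ v h → trans (fam-·ˡ P.G P.ĝ v h) (trans (fam-cong (λ w d → sym (P.T·Ĝ w d)) v h) (sym (fam-·ʳ P.G P.T v h)))) u)
             (F·-⊙ (fam-finite P.T) (Y.emb P.G) _ u)) ⟩
      f [] * fΦ u + (fam P.T Y.⊙ (λ n → Y.emb P.G Y.· Nβ.N (Y.∂ n f))) u ∎)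

  χ′ : Y.Series
  χ′ = Nβ.N P'.χ

  χ′-char : Y.IsChar χ′
  χ′-char = Nβ.N-char (fam-compatible P.ĝ P.ĝ-char P.ĝ-diagonal P.ĝ-above) P.χ-char P'.χ-char

  g′ : PS
  g′ = P'.G ✶ P.G

  act-ι-factor : ∀ u → I.act Ψ (ι u) ≈ (Y.emb g′ Y.· χ′) u
  act-ι-factor u = begin
    I.act Ψ (ι u)                                  ≈⟨ act≈Nb Ψ u ⟩
    Nb.N (λ v → Ψ (ι v)) u                         ≈⟨ Nb.N-cong (λ v → trans (sym (P'.p-0 v)) (P'.f≈G·χ v)) u ⟩
    Nb.N (Y.emb P'.G Y.· P'.χ) u                   ≈⟨ SubstitutionProduct.N-· K ℕ _⋄_ 1# (fam P.T) fΦ (fam-finite P.T) (fam-[] P.T) (Y.emb P'.G) P'.χ u ⟩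
    (Nbε.N (Y.emb P'.G) Y.· Nb.N P'.χ) u           ≈⟨ Y.·-cong (Nbε-emb P'.G) (λ v → sym (Nβ≈Nb P'.χ v)) u ⟩
    (Y.emb P'.G Y.· Y.emb P.G Y.· χ′) u            ≈⟨ Y.·-assoc (Y.emb P'.G) (Y.emb P.G) χ′ u ⟩
    ((Y.emb P'.G Y.· Y.emb P.G) Y.· χ′) u          ≈⟨ Y.·-congʳ (λ v → sym (Y.emb-✶ P'.G P.G v)) u ⟩
    (Y.emb g′ Y.· χ′) u                            ∎

  -- The stuffle relations have one admissible factor: `emb-admissible` moves `g′` past it, and on
  -- an admissible word `g′` acts by its constant term 1. The remaining conditions are read off from
  -- `gon` on words of length at most two.
  act-DMR : IsDMR (I.act Ψ)
  act-DMR = record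
    { char = I.act-char dΨ.char
    ; φ-x0 = trans (sym (I.gon≈act Ψ (x0 ∷ []))) (trans
        (+-cong (trans (*-congʳ dΦ.φ-x0) (zeroˡ _)) (trans (*-congˡ (trans (*-congˡ dΨ.φ-x0) (zeroʳ _))) (zeroʳ _))) (+-identityˡ _))
    ; φ-x1 = trans (sym (I.gon≈act Ψ (x1 ∷ []))) (trans
        (+-cong (trans (*-congʳ dΦ.φ-x1) (zeroˡ _)) (trans (*-congˡ (trans (*-congˡ dΨ.φ-x1) (zeroʳ _))) (zeroʳ _))) (+-identityˡ _))
    ; φ-x0x1 = trans (sym (I.gon≈act Ψ (x0 ∷ x1 ∷ []))) (trans
        (+-cong (+-cong (trans (*-congʳ dΦ.φ-x0x1) (zeroˡ _)) (zeroˡ _))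
                (*-congˡ (+-cong (zeroˡ _) (trans (*-congˡ (trans (*-congˡ dΨ.φ-x0x1) (zeroʳ _))) (zeroʳ _)))))
        (solve 1 (λ a → (:0 :+ :0) :+ a :* (:0 :+ :0) := :0) refl _))
    ; stuffle = λ k u v → begin
        Y.Q (λ w → I.act Ψ (ι w)) (suc k ∷ u) v        ≈⟨ Y.Q-cong act-ι-factor (suc k ∷ u) v ⟩
        Y.Q (Y.emb g′ Y.· χ′) (suc k ∷ u) v            ≈⟨ Y.emb-admissible g′ χ′ k u v ⟩
        (Y.emb g′ Y.· Y.Q χ′ (suc k ∷ u)) v            ≈⟨ Y.·-congˡ (proj₂ χ′-char (suc k ∷ u)) v ⟩
        (Y.emb g′ Y.· (λ w → χ′ (suc k ∷ u) * χ′ w)) v ≈⟨ O-* (Y.·-linearʳ (Y.emb g′) v) _ χ′ ⟩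
        χ′ (suc k ∷ u) * (Y.emb g′ Y.· χ′) v           ≈⟨ *-cong (sym (adm k u)) (sym (act-ι-factor v)) ⟩
        I.act Ψ (ι (suc k ∷ u)) * I.act Ψ (ι v)        ∎ }
    where
    adm : ∀ k u → I.act Ψ (ι (suc k ∷ u)) ≈ χ′ (suc k ∷ u)
    adm k u = trans (act-ι-factor (suc k ∷ u)) (trans (Y.emb-·-suc g′ χ′ k u) (trans (*-congʳ (*-identityˡ _)) (*-identityˡ _)))

-- Quotients of formal linear combinations

module Eval (K : QAlg) where
  open Alg K
  open IsLinear

  ev : {B : Set} → (B → Carrier) → Lin B → Carrier
  ev f p = Σ p (λ t → κ (proj₁ t) * f (proj₂ t))

  ev-linear : {B : Set} (p : Lin B) → IsLinear (λ f → ev f p)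
  ev-linear p = record
    { O-cong = λ e → Σ-cong p (λ t → *-congˡ (e (proj₂ t)))
    ; O-+ = λ f g → trans (Σ-cong p (λ t → distribˡ _ _ _)) (Σ-+ p)
    ; O-* = λ c f → trans (Σ-cong p (λ t → solve 3 (λ a b x → a :* (b :* x) := b :* (a :* x)) refl _ c _)) (Σ-* p c) }

  ev-cong : {B : Set} {f g : B → Carrier} (p : Lin B) → (∀ b → f b ≈ g b) → ev f p ≈ ev g p
  ev-cong p = O-cong (ev-linear p)

  ev-++ : {B : Set} (f : B → Carrier) (p q : Lin B) → ev f (p ++ q) ≈ ev f p + ev f q
  ev-++ f p q = Σ-++ p q

  ev-scale : {B : Set} (f : B → Carrier) (c : ℚ) (p : Lin B) → ev f (scale c p) ≈ κ c * ev f p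
  ev-scale f c p = trans (Σ-map _ p) (trans (Σ-cong p (λ t → trans (*-congʳ (κ-* c (proj₁ t))) (*-assoc _ _ _))) (Σ-* p (κ c)))

  ev-⊝ : {B : Set} (f : B → Carrier) (p q : Lin B) → ev f (p ⊝ q) ≈ ev f p + - ev f q
  ev-⊝ f p q = trans (ev-++ f p _) (+-congˡ (trans (ev-scale f (ℚ.- 1ℚ) q)
    (trans (*-congʳ (trans (κ-neg 1ℚ) (-‿cong κ-1))) (solve 1 (λ x → :- :1 :* x := :- x) refl _))))

  ev-map : {B C : Set} (f : C → Carrier) (g : B → C) (p : Lin B) →
           ev f (map (λ t → proj₁ t , g (proj₂ t)) p) ≈ ev (λ b → f (g b)) p
  ev-map f g p = Σ-map _ p

  ev-mono : {B : Set} (f : B → Carrier) (b : B) → ev f ((1ℚ , b) ∷ []) ≈ f b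
  ev-mono f b = trans (+-identityʳ _) (trans (*-congʳ κ-1) (*-identityˡ _))

  ev-concatMap : {B C : Set} (f : C → Carrier) (F : ℚ × B → Lin C) (p : Lin B) →
                 ev f (concatMap F p) ≈ Σ p (λ t → ev f (F t))
  ev-concatMap f F p = Σ-concatMap F p

  ev-linExt : {B C : Set} (f : C → Carrier) (F : B → Lin C) (p : Lin B) →
              ev f (linExt F p) ≈ ev (λ b → ev f (F b)) p
  ev-linExt f F p = trans (ev-concatMap f _ p) (Σ-cong p (λ t → ev-scale f (proj₁ t) (F (proj₂ t))))

  module _ {B : Set} (_≟_ : DecidableEquality B) where
    private
      without : B → Lin B → Lin B
      without b [] = []
      without b ((c , b') ∷ p) with b' ≟ b
      ... | yes _ = without b p
      ... | no  _ = (c , b') ∷ without b p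

      length-without : ∀ b p → length (without b p) ℕ.≤ length p
      length-without b [] = z≤n
      length-without b ((c , b') ∷ p) with b' ≟ b
      ... | yes _ = ℕ.m≤n⇒m≤1+n (length-without b p)
      ... | no  _ = s≤s (length-without b p)

      ev-without : ∀ f b p → ev f p ≈ κ (coeff _≟_ p b) * f b + ev f (without b p)
      ev-without f b [] = sym (trans (+-identityʳ _) (trans (*-congʳ κ-0) (zeroˡ _)))
      ev-without f b ((c , b') ∷ p) with b' ≟ b
      ... | yes ≡.refl = trans (+-congˡ (ev-without f b p)) (trans (sym (+-assoc _ _ _))
              (+-congʳ (trans (sym (distribʳ _ _ _)) (*-congʳ (sym (κ-+ c _))))))
      ... | no  _ = trans (+-congˡ (ev-without f b p)) (solve 3 (λ a b c → a :+ (b :+ c) := b :+ (a :+ c)) refl _ _ _)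

      coeff-without : ∀ b p b' → coeff _≟_ p b' ≡ 0ℚ → coeff _≟_ (without b p) b' ≡ 0ℚ
      coeff-without b p b' e with b ≟ b'
      ... | yes ≡.refl = same p
        where
        same : ∀ p → coeff _≟_ (without b p) b ≡ 0ℚ
        same [] = ≡.refl
        same ((c , b'') ∷ p) with b'' ≟ b
        ... | yes _ = same p
        ... | no ne with b'' ≟ b
        ...   | yes eq = ⊥-elim (ne eq)
        ...   | no  _  = same p
      ... | no b≢b' = ≡.trans (other p) e
        where
        other : ∀ p → coeff _≟_ (without b p) b' ≡ coeff _≟_ p b'
        other [] = ≡.refl
        other ((c , b'') ∷ p) with b'' ≟ b
        other ((c , b'') ∷ p) | yes ≡.refl with b'' ≟ b'
        ... | yes eq = ⊥-elim (b≢b' eq)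
        ... | no  _  = other p
        other ((c , b'') ∷ p) | no _ with b'' ≟ b'
        ... | yes _ = ≡.cong (c ℚ.+_) (other p)
        ... | no  _ = other p

    -- A list may mention a basis element several times, so cancellation is not visible termwise:
    -- all occurrences of the first element are collected and removed together, which shortens the
    -- list.
    ev-zero-coeff : ∀ f p → (∀ b → coeff _≟_ p b ≡ 0ℚ) → ev f p ≈ 0#
    ev-zero-coeff f p e = go (length p) p ℕ.≤-refl e
      where
      go : ∀ n p → length p ℕ.≤ n → (∀ b → coeff _≟_ p b ≡ 0ℚ) → ev f p ≈ 0#
      go n [] _ _ = refl
      go (suc n) ((c , b) ∷ p) (s≤s len) e = trans (ev-without f b ((c , b) ∷ p)) (trans
        (+-cong (trans (*-congʳ (trans (reflexive (≡.cong κ (e b))) κ-0)) (zeroˡ _))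
                (go n (without b ((c , b) ∷ p)) (drop-head) (λ b' → coeff-without b ((c , b) ∷ p) b' (e b'))))
        (+-identityˡ _))
        where
        drop-head : length (without b ((c , b) ∷ p)) ℕ.≤ n
        drop-head with b ≟ b
        ... | yes _  = ℕ.≤-trans (length-without b p) len
        ... | no ne  = ⊥-elim (ne ≡.refl)

ℚAlg : QAlg
ℚAlg = record
  { commutativeRing = ℚ.+-*-commutativeRing
  ; κ = λ q → q ; κ-+ = λ _ _ → ≡.refl ; κ-* = λ _ _ → ≡.refl ; κ-1 = ≡.refl }

module ℚE = Eval ℚAlg
module ℚA = Alg ℚAlg

evℚ : {B : Set} → (B → ℚ) → Lin B → ℚ
evℚ = ℚE.ev

module Coefficients {B : Set} (_≟_ : DecidableEquality B) where

  indicator : B → B → ℚ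
  indicator b b' with b' ≟ b
  ... | yes _ = 1ℚ
  ... | no  _ = 0ℚ

  coeff≡ev : ∀ p b → coeff _≟_ p b ≡ evℚ (indicator b) p
  coeff≡ev [] b = ≡.refl
  coeff≡ev ((c , b') ∷ p) b with b' ≟ b
  ... | yes _ = ≡.cong₂ ℚ._+_ (≡.sym (ℚ.*-identityʳ c)) (coeff≡ev p b)
  ... | no  _ = ≡.trans (coeff≡ev p b) (≡.sym (≡.trans (≡.cong (ℚ._+ evℚ (indicator b) p) (ℚ.*-zeroʳ c)) (ℚ.+-identityˡ _)))

  coeff-ext : ∀ p q → (∀ f → evℚ f p ≡ evℚ f q) → ∀ b → coeff _≟_ p b ≡ coeff _≟_ q b
  coeff-ext p q e b = ≡.trans (coeff≡ev p b) (≡.trans (e _) (≡.sym (coeff≡ev q b)))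

  module _ (K : QAlg) where
    open Alg K
    open Eval K

    ev-resp : ∀ f p q → (∀ b → coeff _≟_ p b ≡ coeff _≟_ q b) → ev f p ≈ ev f q
    ev-resp f p q e = trans (inverse-unique (trans (sym (trans (ev-⊝ f p q) refl)) (ev-zero-coeff _≟_ f (p ⊝ q) zero-diff))) (-‿involutive _)
      where
      zero-diff : ∀ b → coeff _≟_ (p ⊝ q) b ≡ 0ℚ
      zero-diff b = ≡.trans (coeff≡ev (p ⊝ q) b) (≡.trans (ℚE.ev-⊝ (indicator b) p q)
        (≡.trans (≡.cong₂ (λ x y → x ℚ.+ ℚ.- y) (≡.trans (≡.sym (coeff≡ev p b)) (e b)) (≡.sym (coeff≡ev q b))) (ℚ.+-inverseʳ (coeff _≟_ q b))))

  module _ (G : Lin B → Set) where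
    span-ext : ∀ {p q} → (∀ f → evℚ f p ≡ evℚ f q) → Span _≟_ G p → Span _≟_ G q
    span-ext {p} {q} e = sp-resp (coeff-ext p q e)

    span-zero : ∀ {p} → (∀ f → evℚ f p ≡ 0ℚ) → Span _≟_ G p
    span-zero e = span-ext (λ f → ≡.sym (e f)) sp-zero

    span-linExt : {C : Set} (F : C → Lin B) → (∀ c → Span _≟_ G (F c)) → ∀ q → Span _≟_ G (linExt F q)
    span-linExt F s []            = sp-zero
    span-linExt F s ((c , b) ∷ q) = sp-add (sp-scale c (s b)) (span-linExt F s q)

  span-mono : ∀ {G G' : Lin B → Set} → (∀ {g} → G g → Span _≟_ G' g) → ∀ {p} → Span _≟_ G p → Span _≟_ G' p
  span-mono i sp-zero        = sp-zero
  span-mono i (sp-gen g)     = i g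
  span-mono i (sp-add s t)   = sp-add (span-mono i s) (span-mono i t)
  span-mono i (sp-scale c s) = sp-scale c (span-mono i s)
  span-mono i (sp-resp e s)  = sp-resp e (span-mono i s)

  span-kill : ∀ (K : QAlg) {G : Lin B → Set} f → (∀ {g} → G g → QAlg._≈_ K (Eval.ev K f g) (QAlg.0# K)) →
              ∀ {p} → Span _≟_ G p → QAlg._≈_ K (Eval.ev K f p) (QAlg.0# K)
  span-kill K f z sp-zero        = QAlg.refl K
  span-kill K f z (sp-gen g)     = z g
  span-kill K f z (sp-add {p} {q} s t) = trans (ev-++ f p q) (trans (+-cong (span-kill K f z s) (span-kill K f z t)) (+-identityˡ _))
    where open Alg K
          open Eval K
  span-kill K f z (sp-scale {p} c s) = trans (ev-scale f c p) (trans (*-congˡ (span-kill K f z s)) (zeroʳ _))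
    where open Alg K
          open Eval K
  span-kill K f z (sp-resp {p} {q} e s)  = trans (sym (ev-resp K f p q e)) (span-kill K f z s)
    where open Alg K

-- Identities are tested against all linear functionals.
module LinProduct {B : Set} (_≟_ : DecidableEquality B) (mul : B → B → Lin B) (e : B)
  (mul-comm : ∀ f u v → evℚ f (mul u v) ≡ evℚ f (mul v u))
  (mul-assoc : ∀ f u v w → evℚ (λ x → evℚ f (mul x w)) (mul u v) ≡ evℚ (λ x → evℚ f (mul u x)) (mul v w))
  (mul-e : ∀ f u → evℚ f (mul e u) ≡ f u) where

  open Coefficients _≟_
  open ℚE
  open ℚA.IsLinear
  open ≡.≡-Reasoning

  infixl 7 _*L_
  _*L_ : Lin B → Lin B → Lin B
  p *L q = concatMap (λ s → concatMap (λ t → scale (proj₁ s ℚ.* proj₁ t) (mul (proj₂ s) (proj₂ t))) q) p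

  ev-*L : ∀ f p q → evℚ f (p *L q) ≡ evℚ (λ u → evℚ (λ v → evℚ f (mul u v)) q) p
  ev-*L f p q = ≡.trans (ev-concatMap f _ p) (ℚA.Σ-cong p (λ s → ≡.trans (ev-concatMap f _ q)
    (≡.trans (ℚA.Σ-cong q (λ t → ≡.trans (ev-scale f (proj₁ s ℚ.* proj₁ t) (mul (proj₂ s) (proj₂ t))) (ℚ.*-assoc (proj₁ s) (proj₁ t) _))) (ℚA.Σ-* q (proj₁ s)))))

  ev-swap : {C D : Set} (k : C → D → ℚ) (p : Lin C) (q : Lin D) → evℚ (λ u → evℚ (k u) q) p ≡ evℚ (λ v → evℚ (λ u → k u v) p) q
  ev-swap k p [] = O-0 (ev-linear p)
  ev-swap k p ((c , v) ∷ q) = ≡.trans (O-+ (ev-linear p) _ _) (≡.cong₂ ℚ._+_ (O-* (ev-linear p) c _) (ev-swap k p q))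

  *L-comm : ∀ f p q → evℚ f (p *L q) ≡ evℚ f (q *L p)
  *L-comm f p q = ≡.trans (ev-*L f p q) (≡.trans (ev-swap _ p q)
    (≡.trans (ev-cong q (λ v → ev-cong p (λ u → mul-comm f u v))) (≡.sym (ev-*L f q p))))

  *L-assoc : ∀ f p q r → evℚ f ((p *L q) *L r) ≡ evℚ f (p *L (q *L r))
  *L-assoc f p q r = begin
    evℚ f ((p *L q) *L r)
      ≡⟨ ≡.trans (ev-*L f (p *L q) r) (ev-*L _ p q) ⟩
    evℚ (λ u → evℚ (λ v → evℚ (λ x → evℚ (λ w → evℚ f (mul x w)) r) (mul u v)) q) p
      ≡⟨ ev-cong p (λ u → ev-cong q (λ v → ≡.trans (ev-swap _ (mul u v) r) (ev-cong r (λ w → mul-assoc f u v w)))) ⟩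
    evℚ (λ u → evℚ (λ v → evℚ (λ w → evℚ (λ x → evℚ f (mul u x)) (mul v w)) r) q) p
      ≡⟨ ≡.trans (ev-*L f p (q *L r)) (ev-cong p (λ u → ev-*L _ q r)) ⟨
    evℚ f (p *L (q *L r)) ∎

  one : Lin B
  one = (1ℚ , e) ∷ []

  mono : B → Lin B
  mono b = (1ℚ , b) ∷ []

  *L-mono : ∀ f b q → evℚ f (((1ℚ , b) ∷ []) *L q) ≡ evℚ (λ v → evℚ f (mul b v)) q
  *L-mono f b q = ≡.trans (ev-*L f ((1ℚ , b) ∷ []) q) (ev-mono (λ u → evℚ (λ v → evℚ f (mul u v)) q) b)

  *L-identityˡ : ∀ f p → evℚ f (one *L p) ≡ evℚ f p
  *L-identityˡ f p = ≡.trans (*L-mono f e p) (ev-cong p (mul-e f))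

  *L-const : ∀ f c p → evℚ f (((c , e) ∷ []) *L p) ≡ c ℚ.* evℚ f p
  *L-const f c p = ≡.trans (ev-*L f ((c , e) ∷ []) p) (≡.trans (ℚ.+-identityʳ _) (≡.cong (c ℚ.*_) (ev-cong p (mul-e f))))

  *L-distribʳ : ∀ f p q r → evℚ f ((p ++ q) *L r) ≡ evℚ f (p *L r ++ q *L r)
  *L-distribʳ f p q r = ≡.trans (ev-*L f (p ++ q) r) (≡.trans (ev-++ _ p q)
    (≡.sym (≡.trans (ev-++ f (p *L r) (q *L r)) (≡.cong₂ ℚ._+_ (ev-*L f p r) (ev-*L f q r)))))

  *L-distribˡ : ∀ f p q r → evℚ f (p *L (q ++ r)) ≡ evℚ f (p *L q ++ p *L r)
  *L-distribˡ f p q r = ≡.trans (*L-comm f p (q ++ r)) (≡.trans (*L-distribʳ f q r p) (≡.trans (ev-++ f (q *L p) (r *L p))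
    (≡.trans (≡.cong₂ ℚ._+_ (*L-comm f q p) (*L-comm f r p)) (≡.sym (ev-++ f (p *L q) (p *L r))))))

  *L-scale : ∀ f c p q → evℚ f (scale c p *L q) ≡ c ℚ.* evℚ f (p *L q)
  *L-scale f c p q = ≡.trans (ev-*L f (scale c p) q) (≡.trans (ev-scale (λ u → evℚ (λ v → evℚ f (mul u v)) q) c p) (≡.cong (c ℚ.*_) (≡.sym (ev-*L f p q))))

  module Quotient (G : Lin B → Set) (G-ideal : ∀ {g} → G g → ∀ b → Span _≟_ G (g *L mono b)) where

    infix 4 _∼_
    -- A record, because `p` and `q` cannot be recovered from the list `p ⊝ q`.
    record _∼_ (p q : Lin B) : Set where
      constructor mod
      field difference : Span _≟_ G (p ⊝ q)
    open _∼_ public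

    ext⇒∼ : ∀ {p q} → (∀ f → evℚ f p ≡ evℚ f q) → p ∼ q
    ext⇒∼ {p} {q} x = mod (span-zero G (λ f → ≡.trans (ev-⊝ f p q) (≡.trans (≡.cong (ℚ._+ (ℚ.- evℚ f q)) (x f)) (ℚ.+-inverseʳ (evℚ f q)))))

    zero⇒∼ : ∀ {p} → Span _≟_ G p → p ∼ []
    zero⇒∼ {p} s = mod (span-ext G (λ f → ≡.sym (≡.trans (ev-⊝ f p []) (ℚ.+-identityʳ _))) s)

    ∼⇒zero : ∀ {p} → p ∼ [] → Span _≟_ G p
    ∼⇒zero {p} (mod s) = span-ext G (λ f → ≡.trans (ev-⊝ f p []) (ℚ.+-identityʳ _)) s

    ideal : ∀ {p} → Span _≟_ G p → ∀ q → Span _≟_ G (p *L q)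
    ideal sp-zero        q = sp-zero
    ideal (sp-gen {g} x) q = span-ext G
      (λ f → begin
        evℚ f (linExt (λ b → g *L ((1ℚ , b) ∷ [])) q)         ≡⟨ ev-linExt f _ q ⟩
        evℚ (λ b → evℚ f (g *L ((1ℚ , b) ∷ []))) q            ≡⟨ ev-cong q (λ b → ≡.trans (ev-*L f g ((1ℚ , b) ∷ [])) (ev-cong g (λ u → ev-mono (λ v → evℚ f (mul u v)) b))) ⟩
        evℚ (λ b → evℚ (λ u → evℚ f (mul u b)) g) q           ≡⟨ ev-swap _ q g ⟩
        evℚ (λ u → evℚ (λ b → evℚ f (mul u b)) q) g           ≡⟨ ev-*L f g q ⟨
        evℚ f (g *L q)                                        ∎)
      (span-linExt G (λ b → g *L ((1ℚ , b) ∷ [])) (G-ideal x) q)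
    ideal (sp-add {p} {p'} s t) q = span-ext G (λ f → ≡.sym (*L-distribʳ f p p' q)) (sp-add (ideal s q) (ideal t q))
    ideal (sp-scale {p} c s)    q = span-ext G (λ f → ≡.trans (ev-scale f c (p *L q)) (≡.sym (*L-scale f c p q))) (sp-scale c (ideal s q))
    ideal (sp-resp {p} {p'} x s) q = span-ext G (λ f → ≡.trans (ev-*L f p q) (≡.trans (ev-resp ℚAlg (λ u → evℚ (λ v → evℚ f (mul u v)) q) p p' x) (≡.sym (ev-*L f p' q)))) (ideal s q)

    ring : CommutativeRing 0ℓ 0ℓ
    ring = record
      { Carrier = Lin B ; _≈_ = _∼_ ; _+_ = _++_ ; _*_ = _*L_ ; -_ = scale (ℚ.- 1ℚ) ; 0# = [] ; 1# = one
      ; isCommutativeRing = record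
        { isRing = record
          { +-isAbelianGroup = record
            { isGroup = record
              { isMonoid = record
                { isSemigroup = record
                  { isMagma = record
                    { isEquivalence = record { refl = λ {p} → ext⇒∼ {p} {p} (λ f → ≡.refl) ; sym = ∼sym ; trans = ∼trans }
                    ; ∙-cong = λ {p} {q} {r} {s} → ++-cong p q r s }
                  ; assoc = λ p q r → ext⇒∼ (λ f → ≡.trans (ev-++ f (p ++ q) r) (≡.trans (≡.cong (ℚ._+ evℚ f r) (ev-++ f p q))
                      (≡.trans (ℚ.+-assoc (evℚ f p) (evℚ f q) (evℚ f r)) (≡.sym (≡.trans (ev-++ f p (q ++ r)) (≡.cong (evℚ f p ℚ.+_) (ev-++ f q r))))))) }
                ; identity = (λ p → ext⇒∼ (λ f → ≡.refl)) , (λ p → ext⇒∼ (λ f → ≡.trans (ev-++ f p []) (ℚ.+-identityʳ _))) }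
              ; inverse = (λ p → ext⇒∼ (λ f → ≡.trans (ev-++ f (scale (ℚ.- 1ℚ) p) p) (≡.trans (≡.cong (ℚ._+ evℚ f p) (neg f p)) (ℚ.+-inverseˡ (evℚ f p)))))
                        , (λ p → ext⇒∼ (λ f → ≡.trans (ev-⊝ f p p) (ℚ.+-inverseʳ (evℚ f p))))
              ; ⁻¹-cong = λ {p} {q} s → mod (span-ext G (λ f → ≡.trans (ev-scale f (ℚ.- 1ℚ) (p ⊝ q)) (≡.trans (≡.cong ((ℚ.- 1ℚ) ℚ.*_) (ev-⊝ f p q))
                  (≡.trans (ℚA.solve 2 (λ a b → ℚA.con (ℚ.- 1ℚ) ℚA.:* (a ℚA.:+ ℚA.:- b) ℚA.:= ℚA.con (ℚ.- 1ℚ) ℚA.:* a ℚA.:+ ℚA.:- (ℚA.con (ℚ.- 1ℚ) ℚA.:* b)) ≡.refl (evℚ f p) (evℚ f q))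
                    (≡.sym (≡.trans (ev-⊝ f (scale (ℚ.- 1ℚ) p) (scale (ℚ.- 1ℚ) q)) (≡.cong₂ (λ x y → x ℚ.+ ℚ.- y) (ev-scale f (ℚ.- 1ℚ) p) (ev-scale f (ℚ.- 1ℚ) q)))))))
                  (sp-scale (ℚ.- 1ℚ) (difference s))) }
            ; comm = λ p q → ext⇒∼ (λ f → ≡.trans (ev-++ f p q) (≡.trans (ℚ.+-comm (evℚ f p) (evℚ f q)) (≡.sym (ev-++ f q p)))) }
          ; *-cong = λ {p} {q} {r} {s} → *L-cong p q r s
          ; *-assoc = λ p q r → ext⇒∼ (λ f → *L-assoc f p q r)
          ; *-identity = (λ p → ext⇒∼ (λ f → *L-identityˡ f p)) , (λ p → ext⇒∼ (λ f → ≡.trans (*L-comm f p one) (*L-identityˡ f p)))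
          ; distrib = (λ p q r → ext⇒∼ (λ f → *L-distribˡ f p q r)) , (λ p q r → ext⇒∼ (λ f → *L-distribʳ f q r p)) }
        ; *-comm = λ p q → ext⇒∼ (λ f → *L-comm f p q) }
      }
      where
      neg : ∀ f p → evℚ f (scale (ℚ.- 1ℚ) p) ≡ ℚ.- evℚ f p
      neg f p = ≡.trans (ev-scale f (ℚ.- 1ℚ) p) (ℚA.solve 1 (λ a → ℚA.:- ℚA.:1 ℚA.:* a ℚA.:= ℚA.:- a) ≡.refl (evℚ f p))

      ∼sym : ∀ {p q} → p ∼ q → q ∼ p
      ∼sym {p} {q} (mod s) = mod (span-ext G (λ f → ≡.trans (neg f (p ⊝ q)) (≡.trans (≡.cong ℚ.-_ (ev-⊝ f p q))
        (≡.trans (ℚA.solve 2 (λ a b → ℚA.:- (a ℚA.:+ ℚA.:- b) ℚA.:= b ℚA.:+ ℚA.:- a) ≡.refl (evℚ f p) (evℚ f q)) (≡.sym (ev-⊝ f q p))))) (sp-scale (ℚ.- 1ℚ) s))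

      ∼trans : ∀ {p q r} → p ∼ q → q ∼ r → p ∼ r
      ∼trans {p} {q} {r} (mod s) (mod t) = mod (span-ext G (λ f → ≡.trans (ev-++ f (p ⊝ q) (q ⊝ r)) (≡.trans (≡.cong₂ ℚ._+_ (ev-⊝ f p q) (ev-⊝ f q r))
        (≡.trans (ℚA.solve 3 (λ a b c → (a ℚA.:+ ℚA.:- b) ℚA.:+ (b ℚA.:+ ℚA.:- c) ℚA.:= a ℚA.:+ ℚA.:- c) ≡.refl (evℚ f p) (evℚ f q) (evℚ f r)) (≡.sym (ev-⊝ f p r))))) (sp-add s t))

      ++-cong : ∀ p q r s → p ∼ q → r ∼ s → p ++ r ∼ q ++ s
      ++-cong p q r s (mod x) (mod y) = mod (span-ext G (λ f → ≡.trans (ev-++ f (p ⊝ q) (r ⊝ s)) (≡.trans (≡.cong₂ ℚ._+_ (ev-⊝ f p q) (ev-⊝ f r s))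
        (≡.trans (ℚA.solve 4 (λ a b c d → (a ℚA.:+ ℚA.:- b) ℚA.:+ (c ℚA.:+ ℚA.:- d) ℚA.:= (a ℚA.:+ c) ℚA.:+ ℚA.:- (b ℚA.:+ d)) ≡.refl (evℚ f p) (evℚ f q) (evℚ f r) (evℚ f s))
          (≡.sym (≡.trans (ev-⊝ f (p ++ r) (q ++ s)) (≡.cong₂ (λ x y → x ℚ.+ ℚ.- y) (ev-++ f p r) (ev-++ f q s))))))) (sp-add x y))

      -- pr - qs = (p - q) r + (r - s) q
      *L-cong : ∀ p q r s → p ∼ q → r ∼ s → p *L r ∼ q *L s
      *L-cong p q r s (mod x) (mod y) = mod (span-ext G (λ f → begin
          evℚ f ((p ⊝ q) *L r ++ (r ⊝ s) *L q)
            ≡⟨ ≡.trans (ev-++ f ((p ⊝ q) *L r) _) (≡.cong₂ ℚ._+_ (split f p q r) (split f r s q)) ⟩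
          (evℚ f (p *L r) ℚ.+ ℚ.- evℚ f (q *L r)) ℚ.+ (evℚ f (r *L q) ℚ.+ ℚ.- evℚ f (s *L q))
            ≡⟨ ≡.cong₂ (λ a b → (evℚ f (p *L r) ℚ.+ ℚ.- evℚ f (q *L r)) ℚ.+ (a ℚ.+ ℚ.- b)) (*L-comm f r q) (*L-comm f s q) ⟩
          (evℚ f (p *L r) ℚ.+ ℚ.- evℚ f (q *L r)) ℚ.+ (evℚ f (q *L r) ℚ.+ ℚ.- evℚ f (q *L s))
            ≡⟨ ℚA.solve 3 (λ a b c → (a ℚA.:+ ℚA.:- b) ℚA.:+ (b ℚA.:+ ℚA.:- c) ℚA.:= a ℚA.:+ ℚA.:- c) ≡.refl (evℚ f (p *L r)) (evℚ f (q *L r)) (evℚ f (q *L s)) ⟩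
          evℚ f (p *L r) ℚ.+ ℚ.- evℚ f (q *L s)
            ≡⟨ ev-⊝ f (p *L r) (q *L s) ⟨
          evℚ f ((p *L r) ⊝ (q *L s)) ∎)
        (sp-add (ideal x r) (ideal y q)))
        where
        split : ∀ f a b c → evℚ f ((a ⊝ b) *L c) ≡ evℚ f (a *L c) ℚ.+ ℚ.- evℚ f (b *L c)
        split f a b c = ≡.trans (*L-distribʳ f a (scale (ℚ.- 1ℚ) b) c) (≡.trans (ev-++ f (a *L c) _) (≡.cong (evℚ f (a *L c) ℚ.+_)
          (≡.trans (*L-scale f (ℚ.- 1ℚ) b c) (ℚA.solve 1 (λ x → ℚA.:- ℚA.:1 ℚA.:* x ℚA.:= ℚA.:- x) ≡.refl (evℚ f (b *L c))))))

    alg : QAlg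
    alg = record
      { commutativeRing = ring
      ; κ = λ q → (q , e) ∷ []
      ; κ-+ = λ p q → ext⇒∼ (λ f → ℚA.solve 3 (λ p q x → (p ℚA.:+ q) ℚA.:* x ℚA.:+ ℚA.:0 ℚA.:= p ℚA.:* x ℚA.:+ (q ℚA.:* x ℚA.:+ ℚA.:0)) ≡.refl p q (f e))
      ; κ-* = λ p q → ext⇒∼ (λ f → ≡.sym (≡.trans (*L-const f p ((q , e) ∷ []))
          (ℚA.solve 3 (λ p q x → p ℚA.:* (q ℚA.:* x ℚA.:+ ℚA.:0) ℚA.:= (p ℚA.:* q) ℚA.:* x ℚA.:+ ℚA.:0) ≡.refl p q (f e))))
      ; κ-1 = ext⇒∼ (λ f → ≡.refl) }

    open Eval alg public using () renaming (ev to evL)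

    test-evL : {C : Set} (f : B → ℚ) (g : C → Lin B) (p : Lin C) → evℚ f (evL g p) ≡ evℚ (λ c → evℚ f (g c)) p
    test-evL f g []            = ≡.refl
    test-evL f g ((c , b) ∷ p) = ≡.trans (ev-++ f (((c , e) ∷ []) *L g b) (evL g p)) (≡.cong₂ ℚ._+_ (*L-const f c (g b)) (test-evL f g p))

    evL-mono : ∀ p → evL mono p ∼ p
    evL-mono p = ext⇒∼ (λ f → ≡.trans (test-evL f mono p) (ev-cong p (ev-mono f)))

-- The shuffle algebra and its tensor powers

module EvalProducts (K : QAlg) where
  open Alg K
  open Eval K
  module X = Shuffle K
  module Y = Stuffle K

  ev-sh : ∀ f u v → ev f (sh u v) ≈ X.Q f u v
  ev-sh f []      v       = ev-mono f v
  ev-sh f (a ∷ u) []      = ev-mono f (a ∷ u)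
  ev-sh f (a ∷ u) (b ∷ v) = trans (ev-++ f (prepend a (sh u (b ∷ v))) _) (trans
    (+-cong (trans (ev-map f (a ∷_) (sh u (b ∷ v))) (ev-sh (X.∂ a f) u (b ∷ v)))
            (trans (ev-map f (b ∷_) (sh (a ∷ u) v)) (ev-sh (X.∂ b f) (a ∷ u) v)))
    (sym (X.Q-∷ f a u b v)))

  ev-st : ∀ f u v → ev f (st u v) ≈ Y.Q f u v
  ev-st f []      v       = ev-mono f v
  ev-st f (a ∷ u) []      = ev-mono f (a ∷ u)
  ev-st f (a ∷ u) (b ∷ v) = trans (ev-++ f (prependY a (st u (b ∷ v))) _) (trans (+-cong
      (trans (ev-map f (a ∷_) (st u (b ∷ v))) (ev-st (Y.∂ a f) u (b ∷ v)))
      (trans (ev-++ f (prependY b (st (a ∷ u) v)) _) (+-cong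
        (trans (ev-map f (b ∷_) (st (a ∷ u) v)) (ev-st (Y.∂ b f) (a ∷ u) v))
        (trans (ev-map f (suc (a ℕ.+ b) ∷_) (st u v)) (trans (ev-st (Y.∂ (a ⋄ b) f) u v) (sym (*-identityˡ _)))))))
    (sym (+-assoc _ _ _)))

module QX = Shuffle ℚAlg
open QX.Commutative (λ _ _ → ≡.refl) (λ _ _ _ → ≡.refl) using (Q-comm; Q-assoc)
open EvalProducts ℚAlg using () renaming (ev-sh to evℚ-sh)

sh-comm : ∀ f u v → evℚ f (sh u v) ≡ evℚ f (sh v u)
sh-comm f u v = ≡.trans (evℚ-sh f u v) (≡.trans (Q-comm f u v) (≡.sym (evℚ-sh f v u)))

sh-assoc : ∀ f u v w → evℚ (λ x → evℚ f (sh x w)) (sh u v) ≡ evℚ (λ x → evℚ f (sh u x)) (sh v w)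
sh-assoc f u v w = ≡.trans (ℚE.ev-cong (sh u v) (λ x → evℚ-sh f x w)) (≡.trans (evℚ-sh _ u v) (≡.trans (Q-assoc f u v w)
  (≡.sym (≡.trans (ℚE.ev-cong (sh v w) (λ x → evℚ-sh f u x)) (evℚ-sh _ v w)))))

module WordProduct = LinProduct _≟W_ sh [] sh-comm sh-assoc (λ f u → ℚE.ev-mono f u)

-- A generator already has the form `g ш w`, and `(g ш w) ш b` is `g` times a combination of the
-- words of `w ш b`.
ideal-closed : ∀ {g} → IdealGen g → ∀ b → InI (shP g (word b))
ideal-closed (idg {g} x w) b = span-ext IdealGen
  (λ f → begin
    evℚ f (linExt (λ x → shP g (word x)) (sh w b))          ≡⟨ ℚE.ev-linExt f _ (sh w b) ⟩
    evℚ (λ x → evℚ f (shP g (word x))) (sh w b)             ≡⟨ ℚE.ev-cong (sh w b) (λ x → *L-comm f g (word x)) ⟩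
    evℚ (λ x → evℚ f (shP (word x) g)) (sh w b)             ≡⟨ ℚE.ev-cong (sh w b) (λ x → *L-mono f x g) ⟩
    evℚ (λ x → evℚ (λ v → evℚ f (sh x v)) g) (sh w b)       ≡⟨ ≡.trans (*L-mono (λ x → evℚ (λ v → evℚ f (sh x v)) g) w (word b))
                                                                  (ℚE.ev-mono (λ v → evℚ (λ x → evℚ (λ v → evℚ f (sh x v)) g) (sh w v)) b) ⟨
    evℚ (λ x → evℚ (λ v → evℚ f (sh x v)) g) (shP (word w) (word b)) ≡⟨ ev-*L f (shP (word w) (word b)) g ⟨
    evℚ f (shP (shP (word w) (word b)) g)                   ≡⟨ *L-comm f (shP (word w) (word b)) g ⟩
    evℚ f (shP g (shP (word w) (word b)))                   ≡⟨ *L-assoc f g (word w) (word b) ⟨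
    evℚ f (shP (shP g (word w)) (word b))                   ∎)
  (span-linExt IdealGen (λ x → shP g (word x)) (λ x → sp-gen (idg x' x)) (sh w b))
  where
  open ≡.≡-Reasoning
  open WordProduct
  open Coefficients _≟W_
  x' = x

module A = WordProduct.Quotient IdealGen ideal-closed

GenA⇒InI : ∀ {g} → GenA g → InI g
GenA⇒InI {g} x = Coefficients.span-ext _≟W_ IdealGen (λ f → ≡.trans (WordProduct.*L-comm f g (word [])) (WordProduct.*L-identityˡ f g)) (sp-gen (idg x []))

mulV : ∀ {n} → Vec Word n → Vec Word n → PolyT n
mulV []       []       = (1ℚ , []) ∷ []
mulV (u ∷ us) (v ∷ vs) = concatMap (λ s → map (λ t → proj₁ s ℚ.* proj₁ t , proj₂ s ∷ proj₂ t) (mulV us vs)) (sh u v)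

unitV : ∀ n → Vec Word n
unitV n = Vec.replicate n []

ev-mulV : ∀ {n} (f : Vec Word (suc n) → ℚ) u us v vs →
          evℚ f (mulV (u ∷ us) (v ∷ vs)) ≡ evℚ (λ x → evℚ (λ xs → f (x ∷ xs)) (mulV us vs)) (sh u v)
ev-mulV f u us v vs = ≡.trans (ℚE.ev-concatMap f _ (sh u v)) (ℚA.Σ-cong (sh u v) (λ s → ≡.trans (ℚA.Σ-map _ (mulV us vs))
  (≡.trans (ℚA.Σ-cong (mulV us vs) (λ t → ℚ.*-assoc (proj₁ s) (proj₁ t) _)) (ℚA.Σ-* (mulV us vs) (proj₁ s)))))

ev-swap : {C D : Set} (k : C → D → ℚ) (p : Lin C) (q : Lin D) → evℚ (λ u → evℚ (k u) q) p ≡ evℚ (λ v → evℚ (λ u → k u v) p) q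
ev-swap k p [] = ℚA.IsLinear.O-0 (ℚE.ev-linear p)
ev-swap k p ((c , v) ∷ q) = ≡.trans (ℚA.IsLinear.O-+ (ℚE.ev-linear p) _ _) (≡.cong₂ ℚ._+_ (ℚA.IsLinear.O-* (ℚE.ev-linear p) c _) (ev-swap k p q))

mulV-comm : ∀ {n} (f : Vec Word n → ℚ) u v → evℚ f (mulV u v) ≡ evℚ f (mulV v u)
mulV-comm f []       []       = ≡.refl
mulV-comm f (u ∷ us) (v ∷ vs) = ≡.trans (ev-mulV f u us v vs) (≡.trans (ℚE.ev-cong (sh u v) (λ x → mulV-comm (λ xs → f (x ∷ xs)) us vs))
  (≡.trans (sh-comm _ u v) (≡.sym (ev-mulV f v vs u us))))

mulV-assoc : ∀ {n} (f : Vec Word n → ℚ) u v w →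
             evℚ (λ x → evℚ f (mulV x w)) (mulV u v) ≡ evℚ (λ x → evℚ f (mulV u x)) (mulV v w)
mulV-assoc f []       []       []       = ≡.refl
mulV-assoc f (u ∷ us) (v ∷ vs) (w ∷ ws) = begin
  evℚ (λ z → evℚ f (mulV z (w ∷ ws))) (mulV (u ∷ us) (v ∷ vs))
    ≡⟨ ≡.trans (ev-mulV _ u us v vs) (ℚE.ev-cong (sh u v) (λ x → ≡.trans (ℚE.ev-cong (mulV us vs) (λ xs → ev-mulV f x xs w ws))
         (≡.trans (ev-swap _ (mulV us vs) (sh x w)) (ℚE.ev-cong (sh x w) (λ y → mulV-assoc (λ ys → f (y ∷ ys)) us vs ws))))) ⟩
  evℚ (λ x → evℚ g (sh x w)) (sh u v)
    ≡⟨ sh-assoc g u v w ⟩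
  evℚ (λ x → evℚ g (sh u x)) (sh v w)
    ≡⟨ ≡.trans (ev-mulV _ v vs w ws) (ℚE.ev-cong (sh v w) (λ x → ≡.trans (ℚE.ev-cong (mulV vs ws) (λ xs → ev-mulV f u us x xs))
         (ev-swap _ (mulV vs ws) (sh u x)))) ⟨
  evℚ (λ z → evℚ f (mulV (u ∷ us) z)) (mulV (v ∷ vs) (w ∷ ws)) ∎
  where
  open ≡.≡-Reasoning
  g : Word → ℚ
  g y = evℚ (λ xs → evℚ (λ ys → f (y ∷ ys)) (mulV us xs)) (mulV vs ws)

mulV-unit : ∀ {n} (f : Vec Word n → ℚ) u → evℚ f (mulV (unitV n) u) ≡ f u
mulV-unit f []       = ℚE.ev-mono f []
mulV-unit {suc n} f (u ∷ us) = ≡.trans (ev-mulV f [] (unitV n) u us) (≡.trans (ℚE.ev-mono (λ x → evℚ (λ xs → f (x ∷ xs)) (mulV (unitV n) us)) u) (mulV-unit (λ xs → f (u ∷ xs)) us))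

module TensorProduct (n : ℕ) = LinProduct (_≟V_ {n}) mulV (unitV n) mulV-comm mulV-assoc mulV-unit
module Tensor2 = TensorProduct 2
module Tensor3 = TensorProduct 3

ev-mulV₂ : ∀ f u u' v v' → evℚ f (mulV (u ∷ u' ∷ []) (v ∷ v' ∷ [])) ≡ evℚ (λ x → evℚ (λ x' → f (x ∷ x' ∷ [])) (sh u' v')) (sh u v)
ev-mulV₂ f u u' v v' = ≡.trans (ev-mulV f u (u' ∷ []) v (v' ∷ [])) (ℚE.ev-cong (sh u v) (λ x → ≡.trans (ev-mulV (λ xs → f (x ∷ xs)) u' [] v' [])
  (ℚE.ev-cong (sh u' v') (λ x' → ℚE.ev-mono (λ xs → f (x ∷ x' ∷ xs)) []))))

-- The product is taken factor by factor: one factor stays in the ideal by `A.ideal`, and the other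
-- is expanded into words.
tensor-closed : ∀ {g} → TensorGen 1 g → ∀ b → InIT 1 (g Tensor2.*L Tensor2.mono b)
tensor-closed (tg {r} s (w ∷ []) zero) (b₁ ∷ b₂ ∷ []) = Coefficients.span-ext _≟V_ (TensorGen 1)
  (λ f → begin
    evℚ f (linExt F (sh w b₂))
      ≡⟨ ≡.trans (ℚE.ev-linExt f F (sh w b₂)) (ℚE.ev-cong (sh w b₂) (λ x → ≡.trans (ℚE.ev-map f (λ y → y ∷ x ∷ []) (shP r (word b₁)))
           (≡.trans (WordProduct.ev-*L _ r (word b₁)) (ℚE.ev-cong r (λ u → ℚE.ev-mono (λ v → evℚ (λ y → f (y ∷ x ∷ [])) (sh u v)) b₁))))) ⟩
    evℚ (λ x → evℚ (λ u → evℚ (λ y → f (y ∷ x ∷ [])) (sh u b₁)) r) (sh w b₂)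
      ≡⟨ ≡.trans (ev-swap _ (sh w b₂) r) (ℚE.ev-cong r (λ u → ev-swap _ (sh w b₂) (sh u b₁))) ⟩
    evℚ (λ u → evℚ (λ y → evℚ (λ x → f (y ∷ x ∷ [])) (sh w b₂)) (sh u b₁)) r
      ≡⟨ ℚE.ev-cong r (λ u → ≡.trans (ℚE.ev-mono (λ z → evℚ f (mulV (u ∷ w ∷ []) z)) (b₁ ∷ b₂ ∷ [])) (ev-mulV₂ f u w b₁ b₂)) ⟨
    evℚ (λ u → evℚ (λ z → evℚ f (mulV (u ∷ w ∷ []) z)) (Tensor2.mono (b₁ ∷ b₂ ∷ []))) r
      ≡⟨ ≡.trans (Tensor2.ev-*L f (map (λ t → proj₁ t , proj₂ t ∷ w ∷ []) r) (Tensor2.mono (b₁ ∷ b₂ ∷ []))) (ℚE.ev-map _ (λ x → x ∷ w ∷ []) r) ⟨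
    evℚ f (map (λ t → proj₁ t , proj₂ t ∷ w ∷ []) r Tensor2.*L Tensor2.mono (b₁ ∷ b₂ ∷ [])) ∎)
  (Coefficients.span-linExt _≟V_ (TensorGen 1) F (λ x → sp-gen (tg (A.ideal s (word b₁)) (x ∷ []) zero)) (sh w b₂))
  where
  open ≡.≡-Reasoning
  F : Word → PolyT 2
  F x = map (λ t → proj₁ t , proj₂ t ∷ x ∷ []) (shP r (word b₁))
tensor-closed (tg {r} s (w ∷ []) (suc zero)) (b₁ ∷ b₂ ∷ []) = Coefficients.span-ext _≟V_ (TensorGen 1)
  (λ f → begin
    evℚ f (linExt F (sh w b₁))
      ≡⟨ ≡.trans (ℚE.ev-linExt f F (sh w b₁)) (ℚE.ev-cong (sh w b₁) (λ x → ≡.trans (ℚE.ev-map f (λ y → x ∷ y ∷ []) (shP r (word b₂)))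
           (≡.trans (WordProduct.ev-*L _ r (word b₂)) (ℚE.ev-cong r (λ u → ℚE.ev-mono (λ v → evℚ (λ y → f (x ∷ y ∷ [])) (sh u v)) b₂))))) ⟩
    evℚ (λ x → evℚ (λ u → evℚ (λ y → f (x ∷ y ∷ [])) (sh u b₂)) r) (sh w b₁)
      ≡⟨ ev-swap _ (sh w b₁) r ⟩
    evℚ (λ u → evℚ (λ x → evℚ (λ y → f (x ∷ y ∷ [])) (sh u b₂)) (sh w b₁)) r
      ≡⟨ ℚE.ev-cong r (λ u → ≡.trans (ℚE.ev-mono (λ z → evℚ f (mulV (w ∷ u ∷ []) z)) (b₁ ∷ b₂ ∷ [])) (ev-mulV₂ f w u b₁ b₂)) ⟨
    evℚ (λ u → evℚ (λ z → evℚ f (mulV (w ∷ u ∷ []) z)) (Tensor2.mono (b₁ ∷ b₂ ∷ []))) r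
      ≡⟨ ≡.trans (Tensor2.ev-*L f (map (λ t → proj₁ t , w ∷ proj₂ t ∷ []) r) (Tensor2.mono (b₁ ∷ b₂ ∷ []))) (ℚE.ev-map _ (λ x → w ∷ x ∷ []) r) ⟨
    evℚ f (map (λ t → proj₁ t , w ∷ proj₂ t ∷ []) r Tensor2.*L Tensor2.mono (b₁ ∷ b₂ ∷ [])) ∎)
  (Coefficients.span-linExt _≟V_ (TensorGen 1) F (λ x → sp-gen (tg (A.ideal s (word b₂)) (x ∷ []) (suc zero))) (sh w b₁))
  where
  open ≡.≡-Reasoning
  F : Word → PolyT 2
  F x = map (λ t → proj₁ t , x ∷ proj₂ t ∷ []) (shP r (word b₂))

module A⊗A = Tensor2.Quotient (TensorGen 1) tensor-closed
-- An empty set of relations: coassociativity of `ΔGon` holds already on words, before passing to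
-- the quotient.
module X⊗X⊗X = Tensor3.Quotient (λ _ → ⊥) (λ ())

-- Goncharov's coproduct

fst snd : Vec Word 2 → Word
fst t = Vec.head t
snd t = Vec.head (Vec.tail t)

module Characters (K : QAlg) where
  open Alg K
  open Eval K
  open EvalProducts K
  open IsLinear
  open Words K using (IsDMR)

  ev-shP : ∀ {φ} → X.IsChar φ → ∀ p q → ev φ (shP p q) ≈ ev φ p * ev φ q
  ev-shP {φ} (_ , φm) p q = begin
    ev φ (shP p q)
      ≈⟨ trans (ev-concatMap φ _ p) (Σ-cong p (λ s → trans (ev-concatMap φ _ q) (Σ-cong q (λ t →
           trans (ev-scale φ (proj₁ s ℚ.* proj₁ t) (sh (proj₂ s) (proj₂ t)))
             (*-cong (κ-* (proj₁ s) (proj₁ t)) (trans (ev-sh φ (proj₂ s) (proj₂ t)) (φm (proj₂ s) (proj₂ t)))))))) ⟩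
    Σ p (λ s → Σ q (λ t → (κ (proj₁ s) * κ (proj₁ t)) * (φ (proj₂ s) * φ (proj₂ t))))
      ≈⟨ Σ-cong p (λ s → trans (Σ-cong q (λ t → solve 4 (λ a b c d → (a :* b) :* (c :* d) := (a :* c) :* (b :* d)) refl _ _ _ _)) (Σ-* q _)) ⟩
    Σ p (λ s → (κ (proj₁ s) * φ (proj₂ s)) * ev φ q)
      ≈⟨ O-*ʳ (Σ-linear p) _ _ ⟩
    ev φ p * ev φ q ∎

  kills⇒DMR : ∀ {φ} → X.IsChar φ → (∀ {g} → GenA g → ev φ g ≈ 0#) → IsDMR φ
  kills⇒DMR {φ} c z = record
    { char = c
    ; φ-x0 = trans (sym (ev-mono φ _)) (z gen-x0)
    ; φ-x1 = trans (sym (ev-mono φ _)) (z gen-x1)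
    ; φ-x0x1 = trans (sym (ev-mono φ _)) (z gen-z2)
    ; stuffle = λ k u v → begin
        Y.Q (λ w → φ (ι w)) (suc k ∷ u) v
          ≈⟨ trans (sym (ev-st (λ w → φ (ι w)) (suc k ∷ u) v)) (sym (ev-map φ ι (st (suc k ∷ u) v))) ⟩
        ev φ (ιL (st (suc k ∷ u) v))
          ≈⟨ trans (sym (-‿involutive _)) (sym (inverse-unique (trans (sym (ev-⊝ φ (sh (ι (suc k ∷ u)) (ι v)) (ιL (st (suc k ∷ u) v))))
               (z (gen-ds (suc k ∷ u) v (adm-cons k u)))))) ⟩
        ev φ (sh (ι (suc k ∷ u)) (ι v))
          ≈⟨ trans (ev-sh φ (ι (suc k ∷ u)) (ι v)) (proj₂ c (ι (suc k ∷ u)) (ι v)) ⟩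
        φ (ι (suc k ∷ u)) * φ (ι v) ∎ }

  DMR⇒kills : ∀ {φ} → IsDMR φ → ∀ {p} → InI p → ev φ p ≈ 0#
  DMR⇒kills {φ} d = Coefficients.span-kill _≟W_ K φ (λ { (idg {g} x w) →
    trans (ev-shP D.char g (word w)) (trans (*-congʳ (gen x)) (zeroˡ _)) })
    where
    module D = IsDMR d
    gen : ∀ {g} → GenA g → ev φ g ≈ 0#
    gen gen-x0 = trans (ev-mono φ _) D.φ-x0
    gen gen-x1 = trans (ev-mono φ _) D.φ-x1
    gen gen-z2 = trans (ev-mono φ _) D.φ-x0x1
    gen (gen-ds p q adm) = trans (ev-⊝ φ (sh (ι p) (ι q)) (ιL (st p q))) (trans (+-cong
        (trans (ev-sh φ (ι p) (ι q)) (proj₂ D.char (ι p) (ι q)))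
        (-‿cong (trans (ev-map φ ι (st p q)) (trans (ev-st (λ w → φ (ι w)) p q) (rel p adm)))))
      (-‿inverseʳ _))
      where
      rel : ∀ p → Admissible p → Y.Q (λ w → φ (ι w)) p q ≈ φ (ι p) * φ (ι q)
      rel []          adm-nil        = sym (trans (*-congʳ (proj₁ D.char)) (*-identityˡ _))
      rel (suc k ∷ u) (adm-cons _ _) = D.stuffle k u q

  act-kills : ∀ φ ψ (cφ : X.IsChar φ) (cψ : X.IsChar ψ) → (∀ {g} → GenA g → ev φ g ≈ 0#) → (∀ {g} → GenA g → ev ψ g ≈ 0#) →
              ∀ {p} → InI p → ev (Ihara.act K φ cφ ψ) p ≈ 0#
  act-kills φ ψ cφ cψ kφ kψ = DMR⇒kills (Racinet.act-DMR K φ ψ (kills⇒DMR cφ kφ) (kills⇒DMR cψ kψ))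

  ev₂ : (Word → Carrier) → (Word → Carrier) → PolyT 2 → Carrier
  ev₂ f g = ev (λ t → f (fst t) * g (snd t))

  κ-sgn : ∀ n → κ (signQ n) ≈ sgn n
  κ-sgn zero    = κ-1
  κ-sgn (suc n) = trans (κ-neg (signQ n)) (-‿cong (κ-sgn n))

  module _ (φ : Word → Carrier) (c : X.IsChar φ) where
    open Ihara K φ c

    gon-cong : ∀ {P P'} Ψ w → (∀ b v → P b v ≈ P' b v) → gon P Ψ w ≈ gon P' Ψ w
    gon-cong Ψ []      e = *-congʳ (e x0 [])
    gon-cong Ψ (a ∷ w) e = +-cong (gon-cong Ψ w (λ b v → e b (a ∷ v))) (*-congʳ (e a []))

    ev-Iab : ∀ a s b → ev φ (Iab a s b) ≈ path a b s
    ev-Iab x1 s x0 = ev-mono φ s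
    ev-Iab x0 s x1 = trans (+-identityʳ _) (*-congʳ (κ-sgn (length s)))
    ev-Iab x0 []      x0 = trans (ev-mono φ []) (proj₁ c)
    ev-Iab x0 (_ ∷ _) x0 = refl
    ev-Iab x1 []      x1 = trans (ev-mono φ []) (proj₁ c)
    ev-Iab x1 (_ ∷ _) x1 = refl

    ev₂-combine : ∀ Ψ P e T → ev₂ φ Ψ (combine P e T) ≈ ev φ P * ev₂ φ (X.∂ e Ψ) T
    ev₂-combine Ψ P e T = begin
      ev₂ φ Ψ (combine P e T)
        ≈⟨ trans (ev-concatMap _ _ P) (Σ-cong P (λ s → trans (ev-concatMap _ _ T) (Σ-cong T (λ t → trans (Σ-map _ (sh (proj₂ s) (fst (proj₂ t)))) (begin
             Σ (sh (proj₂ s) (fst (proj₂ t))) (λ r → κ (proj₁ s ℚ.* proj₁ t ℚ.* proj₁ r) * (φ (proj₂ r) * Ψ (e ∷ snd (proj₂ t))))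
               ≈⟨ Σ-cong (sh (proj₂ s) (fst (proj₂ t))) (λ r → trans
                    (*-congʳ (trans (κ-* (proj₁ s ℚ.* proj₁ t) (proj₁ r)) (*-congʳ (κ-* (proj₁ s) (proj₁ t)))))
                    (solve 5 (λ a b c d e → ((a :* b) :* c) :* (d :* e) := ((a :* b) :* e) :* (c :* d)) refl _ _ _ _ _)) ⟩
             Σ (sh (proj₂ s) (fst (proj₂ t))) (λ r → ((κ (proj₁ s) * κ (proj₁ t)) * Ψ (e ∷ snd (proj₂ t))) * (κ (proj₁ r) * φ (proj₂ r)))
               ≈⟨ Σ-* (sh (proj₂ s) (fst (proj₂ t))) _ ⟩
             ((κ (proj₁ s) * κ (proj₁ t)) * Ψ (e ∷ snd (proj₂ t))) * ev φ (sh (proj₂ s) (fst (proj₂ t)))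
               ≈⟨ *-congˡ (trans (ev-sh φ (proj₂ s) (fst (proj₂ t))) (proj₂ c (proj₂ s) (fst (proj₂ t)))) ⟩
             ((κ (proj₁ s) * κ (proj₁ t)) * Ψ (e ∷ snd (proj₂ t))) * (φ (proj₂ s) * φ (fst (proj₂ t)))
               ≈⟨ solve 5 (λ a b x y z → ((a :* b) :* x) :* (y :* z) := (a :* y) :* (b :* (z :* x))) refl _ _ _ _ _ ⟩
             (κ (proj₁ s) * φ (proj₂ s)) * (κ (proj₁ t) * (φ (fst (proj₂ t)) * Ψ (e ∷ snd (proj₂ t)))) ∎))))) ⟩
      Σ P (λ s → Σ T (λ t → (κ (proj₁ s) * φ (proj₂ s)) * (κ (proj₁ t) * (φ (fst (proj₂ t)) * Ψ (e ∷ snd (proj₂ t))))))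
        ≈⟨ trans (Σ-cong P (λ s → Σ-* T _)) (O-*ʳ (Σ-linear P) _ _) ⟩
      ev φ P * ev₂ φ (X.∂ e Ψ) T ∎

    -- The accumulated letters `seg` correspond to the derivatives that `gon` has already applied to
    -- the paths.
    ev₂-gonAux : ∀ Ψ a seg w → ev₂ φ Ψ (gonAux a seg w) ≈ gon (λ b v → path a b (seg ++ v)) Ψ w
    ev₂-gonAux Ψ a seg [] = begin
      ev₂ φ Ψ (map (λ t → proj₁ t , proj₂ t ∷ [] ∷ []) (Iab a seg x0))
        ≈⟨ trans (ev-map _ (λ x → x ∷ [] ∷ []) (Iab a seg x0)) (O-*ʳ (ev-linear (Iab a seg x0)) φ (Ψ [])) ⟩
      ev φ (Iab a seg x0) * Ψ []
        ≈⟨ *-congʳ (trans (ev-Iab a seg x0) (reflexive (≡.cong (path a x0) (≡.sym (List.++-identityʳ seg))))) ⟩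
      path a x0 (seg ++ []) * Ψ [] ∎
    ev₂-gonAux Ψ a seg (e ∷ w) = trans (ev-++ _ (gonAux a (seg ++ [ e ]) w) _) (+-cong
      (trans (ev₂-gonAux Ψ a (seg ++ [ e ]) w) (gon-cong Ψ w (λ b v → reflexive (≡.cong (path a b) (List.++-assoc seg [ e ] v)))))
      (trans (ev₂-combine Ψ (Iab a seg e) e (gonAux e [] w)) (*-cong
        (trans (ev-Iab a seg e) (reflexive (≡.cong (path a e) (≡.sym (List.++-identityʳ seg)))))
        (ev₂-gonAux (X.∂ e Ψ) e [] w))))

    ev₂-ΔGon : ∀ Ψ w → ev₂ φ Ψ (ΔGon w) ≈ act Ψ w
    ev₂-ΔGon Ψ w = trans (ev₂-gonAux Ψ x1 [] w) (gon≈act Ψ w)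

    ev₂-ΔGon-ε : ∀ w → ev₂ φ X.ε (ΔGon w) ≈ φ w
    ev₂-ΔGon-ε w = trans (ev₂-ΔGon X.ε w) (IharaLaws.act-identityʳ K φ c w)

  ev₂-ε-ΔGon : ∀ ψ w → ev₂ X.ε ψ (ΔGon w) ≈ ψ w
  ev₂-ε-ΔGon ψ w = trans (ev₂-ΔGon X.ε X.ε-char ψ w) (IharaLaws.act-identityˡ K ψ w)

-- The two universal characters of A ⊗ A, whose Ihara product is the class of Δ.
module UniversalPair where
  K = A⊗A.alg
  open Alg K hiding (zero)
  open Eval K
  open Characters K
  open EvalProducts K
  open A⊗A using (ext⇒∼; test-evL; zero⇒∼; ∼⇒zero; evL-mono)
  open Tensor2 using (mono; *L-mono)

  i₁ i₂ : Word → PolyT 2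
  i₁ w = mono (w ∷ [] ∷ [])
  i₂ w = mono ([] ∷ w ∷ [])

  test-*mono : ∀ f u v → evℚ f (mono u Tensor2.*L mono v) ≡ evℚ f (mulV u v)
  test-*mono f u v = ≡.trans (*L-mono f u (mono v)) (ℚE.ev-mono (λ v → evℚ f (mulV u v)) v)

  i₁*i₂ : ∀ u v → i₁ u * i₂ v ≈ mono (u ∷ v ∷ [])
  i₁*i₂ u v = ext⇒∼ (λ f → ≡.trans (test-*mono f (u ∷ [] ∷ []) ([] ∷ v ∷ [])) (≡.trans (ev-mulV₂ f u [] [] v)
    (≡.trans (sh-comm (λ x → evℚ (λ x' → f (x ∷ x' ∷ [])) (word v)) u [])
      (≡.trans (ℚE.ev-mono (λ x → evℚ (λ x' → f (x ∷ x' ∷ [])) (word v)) u) (≡.trans (ℚE.ev-mono (λ x' → f (u ∷ x' ∷ [])) v) (≡.sym (ℚE.ev-mono f (u ∷ v ∷ []))))))))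

  i₁-char : X.IsChar i₁
  i₁-char = refl , λ u v → trans (sym (ev-sh i₁ u v)) (ext⇒∼ (λ f → ≡.trans (test-evL f i₁ (sh u v))
    (≡.trans (ℚE.ev-cong (sh u v) (λ x → ≡.trans (ℚE.ev-mono f (x ∷ [] ∷ [])) (≡.sym (ℚE.ev-mono (λ x' → f (x ∷ x' ∷ [])) []))))
      (≡.sym (≡.trans (test-*mono f (u ∷ [] ∷ []) (v ∷ [] ∷ [])) (ev-mulV₂ f u [] v []))))))

  i₂-char : X.IsChar i₂
  i₂-char = refl , λ u v → trans (sym (ev-sh i₂ u v)) (ext⇒∼ (λ f → ≡.trans (test-evL f i₂ (sh u v))
    (≡.trans (ℚE.ev-cong (sh u v) (λ x → ℚE.ev-mono f ([] ∷ x ∷ [])))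
      (≡.sym (≡.trans (test-*mono f ([] ∷ u ∷ []) ([] ∷ v ∷ [])) (≡.trans (ev-mulV₂ f [] u [] v)
        (ℚE.ev-mono (λ x → evℚ (λ x' → f (x ∷ x' ∷ [])) (sh u v)) [])))))))

  i₁-kills : ∀ {p} → InI p → ev i₁ p ≈ 0#
  i₁-kills {p} s = zero⇒∼ (Coefficients.span-ext _≟V_ (TensorGen 1)
    (λ f → ≡.trans (ℚE.ev-map f (λ x → x ∷ [] ∷ []) p) (≡.sym (≡.trans (test-evL f i₁ p) (ℚE.ev-cong p (λ x → ℚE.ev-mono f (x ∷ [] ∷ []))))))
    (sp-gen (tg s ([] ∷ []) zero)))

  i₂-kills : ∀ {p} → InI p → ev i₂ p ≈ 0#
  i₂-kills {p} s = zero⇒∼ (Coefficients.span-ext _≟V_ (TensorGen 1)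
    (λ f → ≡.trans (ℚE.ev-map f (λ x → [] ∷ x ∷ []) p) (≡.sym (≡.trans (test-evL f i₂ p) (ℚE.ev-cong p (λ x → ℚE.ev-mono f ([] ∷ x ∷ []))))))
    (sp-gen (tg s ([] ∷ []) (suc zero))))

  module I = Ihara K i₁ i₁-char

  -- `i₁ u * i₂ v` is the class of `u ⊗ v`, so a statement about all pairs of characters, applied to
  -- this pair, becomes one about the tensor itself.
  class : ∀ T → ev₂ i₁ i₂ T ≈ T
  class T = trans (ev-cong {f = λ t → i₁ (fst t) * i₂ (snd t)} {g = mono} T (λ { (u ∷ v ∷ []) → i₁*i₂ u v })) (evL-mono T)

  ΔGon≈act : ∀ w → ΔGon w ≈ I.act i₂ w
  ΔGon≈act w = trans (sym (class (ΔGon w))) (ev₂-ΔGon i₁ i₁-char i₂ w)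

  ΔGonL≈ev : ∀ p → ΔGonL p ≈ ev (I.act i₂) p
  ΔGonL≈ev p = trans (ext⇒∼ (λ f → ≡.trans (ℚE.ev-linExt f ΔGon p) (≡.sym (test-evL f ΔGon p)))) (ev-cong p ΔGon≈act)

  ΔGonL-ideal : ∀ {p} → InI p → InIT 1 (ΔGonL p)
  ΔGonL-ideal {p} s = ∼⇒zero (trans (ΔGonL≈ev p) (act-kills i₁ i₂ i₁-char i₂-char (λ x → i₁-kills (GenA⇒InI x)) (λ x → i₂-kills (GenA⇒InI x)) s))

  Δ-welldef : ∀ p q → p ∼A q → ΔGonL p ∼T[ 1 ] ΔGonL q
  Δ-welldef p q s = Coefficients.span-ext _≟V_ (TensorGen 1)
    (λ f → ≡.trans (ℚE.ev-linExt f ΔGon (p ⊝ q)) (≡.trans (ℚE.ev-⊝ _ p q)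
      (≡.sym (≡.trans (ℚE.ev-⊝ f (ΔGonL p) (ΔGonL q)) (≡.cong₂ (λ x y → x ℚ.+ ℚ.- y) (ℚE.ev-linExt f ΔGon p) (ℚE.ev-linExt f ΔGon q))))))
    (ΔGonL-ideal s)

  mul2≈* : ∀ P Q → mul2 P Q ≈ P * Q
  mul2≈* P Q = ext⇒∼ (λ f → ≡.trans (ℚE.ev-concatMap f _ P) (≡.trans
    (ℚA.Σ-cong P (λ s → ≡.trans (ℚE.ev-concatMap f _ Q) (≡.trans
      (ℚA.Σ-cong Q (λ t → ≡.trans (inner f s t) (ℚ.*-assoc (proj₁ s) (proj₁ t) _))) (ℚA.Σ-* Q (proj₁ s)))))
    (≡.sym (Tensor2.ev-*L f P Q))))
    where
    inner : ∀ f (s t : ℚ × Vec Word 2) →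
            evℚ f (concatMap (λ a → map (λ b → proj₁ s ℚ.* proj₁ t ℚ.* proj₁ a ℚ.* proj₁ b , proj₂ a ∷ proj₂ b ∷ [])
              (sh (snd (proj₂ s)) (snd (proj₂ t)))) (sh (fst (proj₂ s)) (fst (proj₂ t)))) ≡
            (proj₁ s ℚ.* proj₁ t) ℚ.* evℚ f (mulV (proj₂ s) (proj₂ t))
    inner f (c , u ∷ u' ∷ []) (d , v ∷ v' ∷ []) = ≡.trans
      (≡.trans (ℚE.ev-concatMap f _ (sh u v)) (ℚA.Σ-cong (sh u v) (λ a → ≡.trans (ℚA.Σ-map _ (sh u' v'))
        (≡.trans (ℚA.Σ-cong (sh u' v') (λ b → ℚ.*-assoc (c ℚ.* d ℚ.* proj₁ a) (proj₁ b) _))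
          (≡.trans (ℚA.Σ-* (sh u' v') (c ℚ.* d ℚ.* proj₁ a)) (ℚ.*-assoc (c ℚ.* d) (proj₁ a) _))))))
      (≡.trans (ℚA.Σ-* (sh u v) (c ℚ.* d)) (≡.cong ((c ℚ.* d) ℚ.*_) (≡.sym (ev-mulV₂ f u u' v v'))))

  Δ-mult : ∀ u v → ΔGonL (sh u v) ∼T[ 1 ] mul2 (ΔGon u) (ΔGon v)
  Δ-mult u v = A⊗A.difference (begin
    ΔGonL (sh u v)            ≈⟨ ΔGonL≈ev (sh u v) ⟩
    ev (I.act i₂) (sh u v)    ≈⟨ ev-sh (I.act i₂) u v ⟩
    X.Q (I.act i₂) u v        ≈⟨ proj₂ (I.act-char i₂-char) u v ⟩
    I.act i₂ u * I.act i₂ v   ≈⟨ *-cong (ΔGon≈act u) (ΔGon≈act v) ⟨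
    ΔGon u * ΔGon v           ≈⟨ mul2≈* (ΔGon u) (ΔGon v) ⟨
    mul2 (ΔGon u) (ΔGon v)    ∎)

module UniversalTriple where
  K = X⊗X⊗X.alg
  open Alg K hiding (zero)
  open Eval K
  open Characters K
  open EvalProducts K
  open X⊗X⊗X using (ext⇒∼; test-evL; evL-mono; difference)
  open Tensor3 using (mono; *L-mono)

  i₁ i₂ i₃ : Word → PolyT 3
  i₁ w = mono (w ∷ [] ∷ [] ∷ [])
  i₂ w = mono ([] ∷ w ∷ [] ∷ [])
  i₃ w = mono ([] ∷ [] ∷ w ∷ [])

  test-*mono : ∀ f u v → evℚ f (mono u Tensor3.*L mono v) ≡ evℚ f (mulV u v)
  test-*mono f u v = ≡.trans (*L-mono f u (mono v)) (ℚE.ev-mono (λ v → evℚ f (mulV u v)) v)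

  ev-mulV₃ : ∀ f u u' u'' v v' v'' → evℚ f (mulV (u ∷ u' ∷ u'' ∷ []) (v ∷ v' ∷ v'' ∷ [])) ≡
             evℚ (λ x → evℚ (λ x' → evℚ (λ x'' → f (x ∷ x' ∷ x'' ∷ [])) (sh u'' v'')) (sh u' v')) (sh u v)
  ev-mulV₃ f u u' u'' v v' v'' = ≡.trans (ev-mulV f u (u' ∷ u'' ∷ []) v (v' ∷ v'' ∷ []))
    (ℚE.ev-cong (sh u v) (λ x → ev-mulV₂ (λ xs → f (x ∷ xs)) u' u'' v' v''))

  ev-sh-[] : ∀ (g : Word → ℚ) u → evℚ g (sh u []) ≡ g u
  ev-sh-[] g u = ≡.trans (sh-comm g u []) (ℚE.ev-mono g u)

  i₁*i₂ : ∀ u v → i₁ u * i₂ v ≈ mono (u ∷ v ∷ [] ∷ [])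
  i₁*i₂ u v = ext⇒∼ (λ f → ≡.trans (test-*mono f (u ∷ [] ∷ [] ∷ []) ([] ∷ v ∷ [] ∷ [])) (≡.trans (ev-mulV₃ f u [] [] [] v [])
    (≡.trans (ev-sh-[] (λ x → evℚ (λ x' → evℚ (λ x'' → f (x ∷ x' ∷ x'' ∷ [])) (word [])) (word v)) u)
      (≡.trans (ℚE.ev-mono (λ x' → evℚ (λ x'' → f (u ∷ x' ∷ x'' ∷ [])) (word [])) v)
        (≡.trans (ℚE.ev-mono (λ x'' → f (u ∷ v ∷ x'' ∷ [])) []) (≡.sym (ℚE.ev-mono f (u ∷ v ∷ [] ∷ []))))))))

  i₁₂*i₃ : ∀ u v w → mono (u ∷ v ∷ [] ∷ []) * i₃ w ≈ mono (u ∷ v ∷ w ∷ [])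
  i₁₂*i₃ u v w = ext⇒∼ (λ f → ≡.trans (test-*mono f (u ∷ v ∷ [] ∷ []) ([] ∷ [] ∷ w ∷ [])) (≡.trans (ev-mulV₃ f u v [] [] [] w)
    (≡.trans (ev-sh-[] (λ x → evℚ (λ x' → evℚ (λ x'' → f (x ∷ x' ∷ x'' ∷ [])) (word w)) (sh v [])) u)
      (≡.trans (ev-sh-[] (λ x' → evℚ (λ x'' → f (u ∷ x' ∷ x'' ∷ [])) (word w)) v)
        (≡.trans (ℚE.ev-mono (λ x'' → f (u ∷ v ∷ x'' ∷ [])) w) (≡.sym (ℚE.ev-mono f (u ∷ v ∷ w ∷ []))))))))

  i₁-char : X.IsChar i₁
  i₁-char = refl , λ u v → trans (sym (ev-sh i₁ u v)) (ext⇒∼ (λ f → ≡.trans (test-evL f i₁ (sh u v))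
    (≡.trans (ℚE.ev-cong (sh u v) (λ x → ≡.trans (ℚE.ev-mono f (x ∷ [] ∷ [] ∷ []))
        (≡.sym (≡.trans (ℚE.ev-mono (λ x' → evℚ (λ x'' → f (x ∷ x' ∷ x'' ∷ [])) (word [])) []) (ℚE.ev-mono (λ x'' → f (x ∷ [] ∷ x'' ∷ [])) [])))))
      (≡.sym (≡.trans (test-*mono f (u ∷ [] ∷ [] ∷ []) (v ∷ [] ∷ [] ∷ [])) (ev-mulV₃ f u [] [] v [] []))))))

  i₂-char : X.IsChar i₂
  i₂-char = refl , λ u v → trans (sym (ev-sh i₂ u v)) (ext⇒∼ (λ f → ≡.trans (test-evL f i₂ (sh u v))
    (≡.trans (ℚE.ev-cong (sh u v) (λ x → ≡.trans (ℚE.ev-mono f ([] ∷ x ∷ [] ∷ []))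
        (≡.sym (ℚE.ev-mono (λ x'' → f ([] ∷ x ∷ x'' ∷ [])) []))))
      (≡.sym (≡.trans (test-*mono f ([] ∷ u ∷ [] ∷ []) ([] ∷ v ∷ [] ∷ [])) (≡.trans (ev-mulV₃ f [] u [] [] v [])
        (ℚE.ev-mono (λ x → evℚ (λ x' → evℚ (λ x'' → f (x ∷ x' ∷ x'' ∷ [])) (word [])) (sh u v)) [])))))))

  module I₁ = Ihara K i₁ i₁-char
  module I₂ = Ihara K i₂ i₂-char
  module I₁₂ = Ihara K (I₁.act i₂) (I₁.act-char i₂-char)

  Δ⊗id≈ : ∀ T → Δ⊗id T ≈ ev₂ (I₁.act i₂) i₃ T
  Δ⊗id≈ T = trans (sym (evL-mono (Δ⊗id T))) (trans (ev-linExt mono _ T) (ev-cong T (λ uv → begin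
    ev mono (map (λ t → proj₁ t , fst (proj₂ t) ∷ snd (proj₂ t) ∷ snd uv ∷ []) (ΔGon (fst uv)))
      ≈⟨ ev-map mono (λ t → fst t ∷ snd t ∷ snd uv ∷ []) (ΔGon (fst uv)) ⟩
    ev (λ t → mono (fst t ∷ snd t ∷ snd uv ∷ [])) (ΔGon (fst uv))
      ≈⟨ ev-cong {f = λ t → (i₁ (fst t) * i₂ (snd t)) * i₃ (snd uv)} {g = λ t → mono (fst t ∷ snd t ∷ snd uv ∷ [])} (ΔGon (fst uv))
           (λ t → trans (*-congʳ {i₃ (snd uv)} (i₁*i₂ (fst t) (snd t))) (i₁₂*i₃ (fst t) (snd t) (snd uv))) ⟨
    ev (λ t → (i₁ (fst t) * i₂ (snd t)) * i₃ (snd uv)) (ΔGon (fst uv))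
      ≈⟨ IsLinear.O-*ʳ (ev-linear (ΔGon (fst uv))) (λ t → i₁ (fst t) * i₂ (snd t)) (i₃ (snd uv)) ⟩
    ev₂ i₁ i₂ (ΔGon (fst uv)) * i₃ (snd uv)
      ≈⟨ *-congʳ {i₃ (snd uv)} (ev₂-ΔGon i₁ i₁-char i₂ (fst uv)) ⟩
    I₁.act i₂ (fst uv) * i₃ (snd uv) ∎)))

  id⊗Δ≈ : ∀ T → id⊗Δ T ≈ ev₂ i₁ (I₂.act i₃) T
  id⊗Δ≈ T = trans (sym (evL-mono (id⊗Δ T))) (trans (ev-linExt mono _ T) (ev-cong T (λ uv → begin
    ev mono (map (λ t → proj₁ t , fst uv ∷ fst (proj₂ t) ∷ snd (proj₂ t) ∷ []) (ΔGon (snd uv)))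
      ≈⟨ ev-map mono (λ t → fst uv ∷ fst t ∷ snd t ∷ []) (ΔGon (snd uv)) ⟩
    ev (λ t → mono (fst uv ∷ fst t ∷ snd t ∷ [])) (ΔGon (snd uv))
      ≈⟨ ev-cong {f = λ t → i₁ (fst uv) * (i₂ (fst t) * i₃ (snd t))} {g = λ t → mono (fst uv ∷ fst t ∷ snd t ∷ [])} (ΔGon (snd uv))
           (λ t → trans (sym (*-assoc (i₁ (fst uv)) (i₂ (fst t)) (i₃ (snd t)))) (trans (*-congʳ {i₃ (snd t)} (i₁*i₂ (fst uv) (fst t))) (i₁₂*i₃ (fst uv) (fst t) (snd t)))) ⟨
    ev (λ t → i₁ (fst uv) * (i₂ (fst t) * i₃ (snd t))) (ΔGon (snd uv))
      ≈⟨ IsLinear.O-* (ev-linear (ΔGon (snd uv))) (i₁ (fst uv)) (λ t → i₂ (fst t) * i₃ (snd t)) ⟩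
    i₁ (fst uv) * ev₂ i₂ i₃ (ΔGon (snd uv))
      ≈⟨ *-congˡ {i₁ (fst uv)} (ev₂-ΔGon i₂ i₂-char i₃ (snd uv)) ⟩
    i₁ (fst uv) * I₂.act i₃ (snd uv) ∎)))

  coassoc : ∀ w → Δ⊗id (ΔGon w) ≈ id⊗Δ (ΔGon w)
  coassoc w = begin
    Δ⊗id (ΔGon w)                         ≈⟨ Δ⊗id≈ (ΔGon w) ⟩
    ev₂ (I₁.act i₂) i₃ (ΔGon w)           ≈⟨ ev₂-ΔGon (I₁.act i₂) (I₁.act-char i₂-char) i₃ w ⟩
    I₁₂.act i₃ w                          ≈⟨ IharaLaws.act-assoc K i₁ i₂ i₁-char i₂-char i₃ w ⟨
    I₁.act (I₂.act i₃) w                  ≈⟨ ev₂-ΔGon i₁ i₁-char (I₂.act i₃) w ⟨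
    ev₂ i₁ (I₂.act i₃) (ΔGon w)           ≈⟨ id⊗Δ≈ (ΔGon w) ⟨
    id⊗Δ (ΔGon w)                         ∎

  Δ-coassoc : ∀ w → Δ⊗id (ΔGon w) ∼T[ 2 ] id⊗Δ (ΔGon w)
  Δ-coassoc w = Coefficients.span-mono _≟V_ (λ ()) (difference (coassoc w))

  -- Associativity of convolution tests the identity against products of arbitrary maps, not of
  -- characters; with no relations imposed, any function on triples of words may be used.
  ev-coassoc : ∀ (L : QAlg) f w → QAlg._≈_ L (Eval.ev L f (Δ⊗id (ΔGon w))) (Eval.ev L f (id⊗Δ (ΔGon w)))
  ev-coassoc L f w = L.trans (L.inverse-unique (L.trans (L.sym (Eval.ev-⊝ L f (Δ⊗id (ΔGon w)) (id⊗Δ (ΔGon w))))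
    (Coefficients.span-kill _≟V_ L f (λ ()) (difference (coassoc w))))) (L.-‿involutive _)
    where module L = Alg L

-- Weights of formal linear combinations

Weighted : {B : Set} → (B → ℕ) → ℕ → Lin B → Set
Weighted ∣_∣ n = All (λ t → ∣ proj₂ t ∣ ≡ n)

weighted-coeff : {B : Set} (_≟_ : DecidableEquality B) (∣_∣ : B → ℕ) → ∀ {n p} → Weighted ∣_∣ n p → ∀ b → ∣ b ∣ ≢ n → coeff _≟_ p b ≡ 0ℚ
weighted-coeff _≟_ ∣_∣ [] b ne = ≡.refl
weighted-coeff _≟_ ∣_∣ {p = (c , b') ∷ p} (e ∷ es) b ne with b' ≟ b
... | yes ≡.refl = ⊥-elim (ne e)
... | no  _      = weighted-coeff _≟_ ∣_∣ es b ne

weighted-map : {B C : Set} {∣_∣ : B → ℕ} {∥_∥ : C → ℕ} {m n : ℕ} (F : ℚ × B → ℚ × C) → (∀ t → ∣ proj₂ t ∣ ≡ m → ∥ proj₂ (F t) ∥ ≡ n) →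
               ∀ {p} → Weighted ∣_∣ m p → Weighted ∥_∥ n (map F p)
weighted-map F e []       = []
weighted-map F e (x ∷ xs) = e _ x ∷ weighted-map F e xs

weighted-concatMap : {B C : Set} {∣_∣ : B → ℕ} {∥_∥ : C → ℕ} {m n : ℕ} (F : ℚ × B → Lin C) → (∀ t → ∣ proj₂ t ∣ ≡ m → Weighted ∥_∥ n (F t)) →
                     ∀ {p} → Weighted ∣_∣ m p → Weighted ∥_∥ n (concatMap F p)
weighted-concatMap F e []       = []
weighted-concatMap F e (x ∷ xs) = All.++⁺ (e _ x) (weighted-concatMap F e xs)

weighted-scale : {B : Set} {∣_∣ : B → ℕ} {n : ℕ} (c : ℚ) {p : Lin B} → Weighted ∣_∣ n p → Weighted ∣_∣ n (scale c p)
weighted-scale c = weighted-map _ (λ _ e → e)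

wHom : ℕ → Poly → Set
wHom = Weighted length

sh-weighted : ∀ u v → wHom (length u ℕ.+ length v) (sh u v)
sh-weighted []      v       = ≡.refl ∷ []
sh-weighted (a ∷ u) []      = ≡.cong suc (≡.sym (ℕ.+-identityʳ _)) ∷ []
sh-weighted (a ∷ u) (b ∷ v) = All.++⁺
  (weighted-map _ (λ _ e → ≡.cong suc e) (sh-weighted u (b ∷ v)))
  (weighted-map _ (λ _ e → ≡.trans (≡.cong suc e) (≡.cong suc (≡.sym (ℕ.+-suc (length u) (length v))))) (sh-weighted (a ∷ u) v))

shP-weighted : ∀ {m n p q} → wHom m p → wHom n q → wHom (m ℕ.+ n) (shP p q)
shP-weighted P Q = weighted-concatMap _ (λ s es → weighted-concatMap _ (λ t et →
  weighted-scale (proj₁ s ℚ.* proj₁ t) (≡.subst₂ (λ a b → wHom (a ℕ.+ b) (sh (proj₂ s) (proj₂ t))) es et (sh-weighted (proj₂ s) (proj₂ t)))) Q) P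

size : Vec Word 2 → ℕ
size t = length (fst t) ℕ.+ length (snd t)

Iab-weighted : ∀ a s b → wHom (length s) (Iab a s b)
Iab-weighted x1 s       x0 = ≡.refl ∷ []
Iab-weighted x0 s       x1 = List.length-reverse s ∷ []
Iab-weighted x0 []      x0 = ≡.refl ∷ []
Iab-weighted x0 (_ ∷ _) x0 = []
Iab-weighted x1 []      x1 = ≡.refl ∷ []
Iab-weighted x1 (_ ∷ _) x1 = []

gonAux-weighted : ∀ a s w → Weighted size (length s ℕ.+ length w) (gonAux a s w)
gonAux-weighted a s []      = weighted-map _ (λ _ e → ≡.cong (ℕ._+ 0) e) (Iab-weighted a s x0)
gonAux-weighted a s (e ∷ w) = All.++⁺
  (≡.subst (λ n → Weighted size n (gonAux a (s ++ [ e ]) w))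
    (≡.trans (≡.cong (ℕ._+ length w) (List.length-++ s)) (ℕ.+-assoc (length s) 1 (length w))) (gonAux-weighted a (s ++ [ e ]) w))
  (weighted-concatMap _ (λ s' es → weighted-concatMap _ (λ t et → weighted-map _ (λ r er → begin
      length (proj₂ r) ℕ.+ suc (length (snd (proj₂ t)))
        ≡⟨ ≡.trans (ℕ.+-suc (length (proj₂ r)) _) (≡.cong (λ n → suc (n ℕ.+ length (snd (proj₂ t)))) er) ⟩
      suc (length (proj₂ s') ℕ.+ length (fst (proj₂ t)) ℕ.+ length (snd (proj₂ t)))
        ≡⟨ ≡.cong suc (≡.trans (ℕ.+-assoc (length (proj₂ s')) _ _) (≡.cong₂ ℕ._+_ es et)) ⟩
      suc (length s ℕ.+ length w)
        ≡⟨ ℕ.+-suc (length s) (length w) ⟨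
      length s ℕ.+ suc (length w) ∎) (sh-weighted (proj₂ s') (fst (proj₂ t)))) (gonAux-weighted e [] w)) (Iab-weighted a s e))
  where open ≡.≡-Reasoning

ΔGon-weighted : ∀ w → Weighted size (length w) (ΔGon w)
ΔGon-weighted w = gonAux-weighted x1 [] w

wtY : List ℕ → ℕ
wtY u = length (ι u)

length-x0pow-++ : ∀ k w → length (x0pow k ++ x1 ∷ w) ≡ suc k ℕ.+ length w
length-x0pow-++ zero    w = ≡.refl
length-x0pow-++ (suc k) w = ≡.cong suc (length-x0pow-++ k w)

st-weighted : ∀ u v → Weighted wtY (wtY u ℕ.+ wtY v) (st u v)
st-weighted []      v       = ≡.refl ∷ []
st-weighted (a ∷ u) []      = ≡.sym (ℕ.+-identityʳ _) ∷ []
st-weighted (a ∷ u) (b ∷ v) = All.++⁺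
  (weighted-map _ (λ t e → ≡.trans (length-x0pow-++ a (ι (proj₂ t))) (≡.trans (≡.cong (suc a ℕ.+_) e)
    (≡.trans (≡.sym (ℕ.+-assoc (suc a) (wtY u) _)) (≡.cong (ℕ._+ wtY (b ∷ v)) (≡.sym (length-x0pow-++ a (ι u))))))) (st-weighted u (b ∷ v)))
  (All.++⁺
    (weighted-map _ (λ t e → ≡.trans (length-x0pow-++ b (ι (proj₂ t))) (≡.trans (≡.cong (suc b ℕ.+_) e)
      (≡.trans (x∙yz≈y∙xz (suc b) (wtY (a ∷ u)) (wtY v)) (≡.cong (wtY (a ∷ u) ℕ.+_) (≡.sym (length-x0pow-++ b (ι v))))))) (st-weighted (a ∷ u) v))
    (weighted-map _ (λ t e → ≡.trans (length-x0pow-++ (suc (a ℕ.+ b)) (ι (proj₂ t))) (≡.trans (≡.cong (suc (suc (a ℕ.+ b)) ℕ.+_) e)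
      (≡.trans (interchange-suc a b (wtY u) (wtY v)) (≡.cong₂ ℕ._+_ (≡.sym (length-x0pow-++ a (ι u))) (≡.sym (length-x0pow-++ b (ι v))))))) (st-weighted u v)))

component-weighted : ∀ n {m p} → wHom m p → InI p → InI (component n p)
component-weighted n {m} {p} h s with m ℕ.≟ n
... | yes ≡.refl = ≡.subst InI (≡.sym (List.filter-all (λ t → length (proj₂ t) ℕ.≟ n) h)) s
... | no  m≢n    = ≡.subst InI (≡.sym (List.filter-none (λ t → length (proj₂ t) ℕ.≟ n) (All.map (λ e e' → m≢n (≡.trans (≡.sym e) e')) h))) sp-zero

gen-weighted : ∀ {g} → GenA g → Data.Product.Σ ℕ (λ n → wHom n g)
gen-weighted gen-x0 = 1 , ≡.refl ∷ []
gen-weighted gen-x1 = 1 , ≡.refl ∷ []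
gen-weighted gen-z2 = 2 , ≡.refl ∷ []
gen-weighted (gen-ds p q _) = wtY p ℕ.+ wtY q , All.++⁺ (sh-weighted (ι p) (ι q))
  (weighted-scale (ℚ.- 1ℚ) (weighted-map _ (λ _ e → e) (st-weighted p q)))

component-accept : ∀ n c w p → length w ≡ n → component n ((c , w) ∷ p) ≡ (c , w) ∷ component n p
component-accept n c w p e = List.filter-accept (λ t → length (proj₂ t) ℕ.≟ n) {(c , w)} {p} e

component-reject : ∀ n c w p → length w ≢ n → component n ((c , w) ∷ p) ≡ component n p
component-reject n c w p e = List.filter-reject (λ t → length (proj₂ t) ℕ.≟ n) {(c , w)} {p} e

component-scale : ∀ n c p → component n (scale c p) ≡ scale c (component n p)
component-scale n c [] = ≡.refl
component-scale n c ((d , w) ∷ p) with length w ℕ.≟ n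
... | yes e = ≡.trans (component-accept n (c ℚ.* d) w (scale c p) e) (≡.trans (≡.cong ((c ℚ.* d , w) ∷_) (component-scale n c p)) (≡.cong (scale c) (≡.sym (component-accept n d w p e))))
... | no  e = ≡.trans (component-reject n (c ℚ.* d) w (scale c p) e) (≡.trans (component-scale n c p) (≡.cong (scale c) (≡.sym (component-reject n d w p e))))

coeff-component-≡ : ∀ n p w → length w ≡ n → coeff _≟W_ (component n p) w ≡ coeff _≟W_ p w
coeff-component-≡ n [] w e = ≡.refl
coeff-component-≡ n ((c , v) ∷ p) w e = go (length v ℕ.≟ n)
  where
  tail-coeff : ∀ q → coeff _≟W_ q w ≡ coeff _≟W_ p w → coeff _≟W_ ((c , v) ∷ q) w ≡ coeff _≟W_ ((c , v) ∷ p) w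
  tail-coeff q eq with v ≟W w
  ... | yes _ = ≡.cong (c ℚ.+_) eq
  ... | no  _ = eq
  go : Dec (length v ≡ n) → coeff _≟W_ (component n ((c , v) ∷ p)) w ≡ coeff _≟W_ ((c , v) ∷ p) w
  go (yes l) = ≡.trans (≡.cong (λ q → coeff _≟W_ q w) (component-accept n c v p l)) (tail-coeff (component n p) (coeff-component-≡ n p w e))
  go (no  l) = ≡.trans (≡.cong (λ q → coeff _≟W_ q w) (component-reject n c v p l)) (≡.trans (coeff-component-≡ n p w e) skip)
    where
    skip : coeff _≟W_ p w ≡ coeff _≟W_ ((c , v) ∷ p) w
    skip with v ≟W w
    ... | yes ≡.refl = ⊥-elim (l e)
    ... | no  _      = ≡.refl

component-hom : ∀ n p → wHom n (component n p)
component-hom n p = All.all-filter (λ t → length (proj₂ t) ℕ.≟ n) p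

coeff-component : ∀ n p q → (∀ w → coeff _≟W_ p w ≡ coeff _≟W_ q w) → ∀ w → coeff _≟W_ (component n p) w ≡ coeff _≟W_ (component n q) w
coeff-component n p q e w with length w ℕ.≟ n
... | yes l = ≡.trans (coeff-component-≡ n p w l) (≡.trans (e w) (≡.sym (coeff-component-≡ n q w l)))
... | no  l = ≡.trans (weighted-coeff _≟W_ length (component-hom n p) w l) (≡.sym (weighted-coeff _≟W_ length (component-hom n q) w l))

-- All listed terms of a generator have the same weight, so `component` keeps or drops it as a
-- whole. For `sp-resp` it matters that the coefficients of a component depend only on those of `p`.
ideal-homog : ∀ n p → InI p → InI (component n p)
ideal-homog n _ sp-zero = sp-zero
ideal-homog n _ (sp-gen (idg x w)) = component-weighted n (shP-weighted (proj₂ (gen-weighted x)) (≡.refl ∷ [])) (sp-gen (idg x w))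
ideal-homog n _ (sp-add {p} {q} s t) = ≡.subst InI (≡.sym (List.filter-++ (λ t → length (proj₂ t) ℕ.≟ n) p q)) (sp-add (ideal-homog n p s) (ideal-homog n q t))
ideal-homog n _ (sp-scale {p} c s) = ≡.subst InI (≡.sym (component-scale n c p)) (sp-scale c (ideal-homog n p s))
ideal-homog n _ (sp-resp {p} {q} e s) = sp-resp (coeff-component n p q e) (ideal-homog n p s)

-- Counit and antipode

module Counit (K : QAlg) where
  open Alg K
  open EvalProducts K
  open Words K using (IsDMR)

  ε-DMR : IsDMR X.ε
  ε-DMR = record
    { char = X.ε-char ; φ-x0 = refl ; φ-x1 = refl ; φ-x0x1 = refl
    ; stuffle = λ k u v → trans (Y.Q-cong ε-ι (suc k ∷ u) v) (trans (proj₂ Y.ε-char (suc k ∷ u) v) (*-congˡ (sym (ε-ι v)))) }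
    where
    ε-ι : ∀ u → X.ε (ι u) ≈ Y.ε u
    ε-ι []          = refl
    ε-ι (zero ∷ u)  = refl
    ε-ι (suc k ∷ u) = refl

  κ-ε : ∀ w → κ (QX.ε w) ≈ X.ε w
  κ-ε []      = κ-1
  κ-ε (_ ∷ _) = κ-0

linForm≡ev : ∀ {B : Set} (f : B → ℚ) p → linForm f p ≡ evℚ f p
linForm≡ev f []            = ≡.refl
linForm≡ev f ((c , b) ∷ p) = ≡.cong (c ℚ.* f b ℚ.+_) (linForm≡ev f p)

module Antipode where
  K = A.alg
  open Alg K hiding (zero)
  open Eval K
  open Characters K
  open EvalProducts K
  open IsLinear
  open A using (ext⇒∼; test-evL; zero⇒∼; ∼⇒zero; evL-mono; difference; mod)
  open WordProduct using (mono; *L-mono)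
  open Counit K

  mono-char : X.IsChar mono
  mono-char = refl , λ u v → trans (sym (ev-sh mono u v)) (trans (evL-mono (sh u v))
    (ext⇒∼ (λ f → ≡.sym (≡.trans (*L-mono f u (mono v)) (ℚE.ev-mono (λ v → evℚ f (sh u v)) v)))))

  linExt≈ev : ∀ {C : Set} (F : C → Poly) p → linExt F p ≈ ev F p
  linExt≈ev F p = ext⇒∼ (λ f → ≡.trans (ℚE.ev-linExt f F p) (≡.sym (test-evL f F p)))

  ev-All : {B : Set} {P : B → Set} {f g : B → Poly} {p : Lin B} → All (λ t → P (proj₂ t)) p → (∀ b → P b → f b ≈ g b) → ev f p ≈ ev g p
  ev-All []                    e = refl
  ev-All {f = f} {g} {(c , b) ∷ p} (x ∷ xs) e = +-cong (*-congˡ {κ c} (e b x)) (ev-All {f = f} {g} {p} xs e)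

  counitˡ : ∀ w → ε⊗id QX.ε (ΔGon w) ≈ mono w
  counitˡ w = begin
    ε⊗id QX.ε (ΔGon w)                        ≈⟨ linExt≈ev (λ uv → [ (QX.ε (fst uv) , snd uv) ]) (ΔGon w) ⟩
    ev (λ uv → [ (QX.ε (fst uv) , snd uv) ]) (ΔGon w)
      ≈⟨ ev-cong {f = λ uv → [ (QX.ε (fst uv) , snd uv) ]} {g = λ uv → X.ε (fst uv) * mono (snd uv)} (ΔGon w) (λ uv → trans
           (ext⇒∼ (λ f → ≡.sym (≡.trans (WordProduct.*L-const f (QX.ε (fst uv)) (mono (snd uv))) (≡.trans (≡.cong (QX.ε (fst uv) ℚ.*_) (ℚE.ev-mono f (snd uv))) (≡.sym (ℚ.+-identityʳ _))))))
           (*-congʳ {mono (snd uv)} (κ-ε (fst uv)))) ⟩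
    ev₂ X.ε mono (ΔGon w)                     ≈⟨ ev₂-ε-ΔGon mono w ⟩
    mono w                                    ∎

  counitʳ : ∀ w → id⊗ε QX.ε (ΔGon w) ≈ mono w
  counitʳ w = begin
    id⊗ε QX.ε (ΔGon w)                        ≈⟨ linExt≈ev (λ uv → [ (QX.ε (snd uv) , fst uv) ]) (ΔGon w) ⟩
    ev (λ uv → [ (QX.ε (snd uv) , fst uv) ]) (ΔGon w)
      ≈⟨ ev-cong {f = λ uv → [ (QX.ε (snd uv) , fst uv) ]} {g = λ uv → mono (fst uv) * X.ε (snd uv)} (ΔGon w) (λ uv → trans
           (ext⇒∼ (λ f → ≡.sym (≡.trans (WordProduct.*L-const f (QX.ε (snd uv)) (mono (fst uv))) (≡.trans (≡.cong (QX.ε (snd uv) ℚ.*_) (ℚE.ev-mono f (fst uv))) (≡.sym (ℚ.+-identityʳ _))))))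
           (trans (*-congʳ {mono (fst uv)} (κ-ε (snd uv))) (*-comm (X.ε (snd uv)) (mono (fst uv))))) ⟩
    ev₂ mono X.ε (ΔGon w)                     ≈⟨ ev₂-ΔGon-ε mono mono-char w ⟩
    mono w                                    ∎

  Descends : (Word → Poly) → Set
  Descends f = ∀ {p} → InI p → ev f p ≈ 0#

  mono-descends : Descends mono
  mono-descends {p} s = trans (evL-mono p) (zero⇒∼ s)

  ε-descends : Descends X.ε
  ε-descends = DMR⇒kills ε-DMR

  ∼-descends : ∀ {f} → Descends f → ∀ {p q} → p ≈ q → ev f p ≈ ev f q
  ∼-descends {f} d {p} {q} (mod s) = trans (inverse-unique (trans (sym (ev-⊝ f p q)) (d s))) (-‿involutive _)

  infixl 7 _⋆_
  _⋆_ : (Word → Poly) → (Word → Poly) → Word → Poly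
  (f ⋆ g) w = ev₂ f g (ΔGon w)

  -- Well-definedness of the coproduct sends the ideal to tensors with one factor in the ideal,
  -- which `f` or `g` kills.
  ⋆-descends : ∀ {f g} → Descends f → Descends g → Descends (f ⋆ g)
  ⋆-descends {f} {g} df dg {p} s = trans (sym (ev-linExt (λ t → f (fst t) * g (snd t)) ΔGon p))
    (Coefficients.span-kill _≟V_ K (λ t → f (fst t) * g (snd t)) gen (UniversalPair.ΔGonL-ideal s))
    where
    gen : ∀ {h} → TensorGen 1 h → ev (λ t → f (fst t) * g (snd t)) h ≈ 0#
    gen (tg {r} s (w ∷ []) zero)       = trans (ev-map (λ t → f (fst t) * g (snd t)) (λ x → x ∷ w ∷ []) r)
      (trans (O-*ʳ (ev-linear r) f (g w)) (trans (*-congʳ {g w} (df s)) (zeroˡ (g w))))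
    gen (tg {r} s (w ∷ []) (suc zero)) = trans (ev-map (λ t → f (fst t) * g (snd t)) (λ x → w ∷ x ∷ []) r)
      (trans (O-* (ev-linear r) (f w) g) (trans (*-congˡ {f w} (dg s)) (zeroʳ (f w))))

  ⋆-cong : ∀ {f f' g g'} → (∀ w → f w ≈ f' w) → (∀ w → g w ≈ g' w) → ∀ w → (f ⋆ g) w ≈ (f' ⋆ g') w
  ⋆-cong {f} {f'} {g} {g'} e e' w = ev-cong {f = λ t → f (fst t) * g (snd t)} {g = λ t → f' (fst t) * g' (snd t)} (ΔGon w)
    (λ t → *-cong {f (fst t)} {f' (fst t)} {g (snd t)} {g' (snd t)} (e (fst t)) (e' (snd t)))

  ⋆-assoc : ∀ f g h w → ((f ⋆ g) ⋆ h) w ≈ (f ⋆ (g ⋆ h)) w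
  ⋆-assoc f g h w = begin
    ev (λ uv → ev₂ f g (ΔGon (fst uv)) * h (snd uv)) (ΔGon w)
      ≈⟨ trans (ev-linExt F _ (ΔGon w)) (ev-cong (ΔGon w) (λ uv → trans (ev-map F (λ t → fst t ∷ snd t ∷ snd uv ∷ []) (ΔGon (fst uv)))
           (O-*ʳ (ev-linear (ΔGon (fst uv))) (λ t → f (fst t) * g (snd t)) (h (snd uv))))) ⟨
    ev F (Δ⊗id (ΔGon w))
      ≈⟨ UniversalTriple.ev-coassoc K F w ⟩
    ev F (id⊗Δ (ΔGon w))
      ≈⟨ trans (ev-linExt F _ (ΔGon w)) (ev-cong (ΔGon w) (λ uv → trans (ev-map F (λ t → fst uv ∷ fst t ∷ snd t ∷ []) (ΔGon (snd uv)))
           (trans (ev-cong {f = λ t → (f (fst uv) * g (fst t)) * h (snd t)} {g = λ t → f (fst uv) * (g (fst t) * h (snd t))} (ΔGon (snd uv))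
               (λ t → *-assoc (f (fst uv)) (g (fst t)) (h (snd t))))
             (O-* (ev-linear (ΔGon (snd uv))) (f (fst uv)) (λ t → g (fst t) * h (snd t)))))) ⟩
    ev (λ uv → f (fst uv) * ev₂ g h (ΔGon (snd uv))) (ΔGon w) ∎
    where
    F : Vec Word 3 → Poly
    F t = (f (Vec.head t) * g (Vec.head (Vec.tail t))) * h (Vec.head (Vec.tail (Vec.tail t)))

  ⋆-ε : ∀ {f} → Descends f → ∀ w → (f ⋆ X.ε) w ≈ f w
  ⋆-ε {f} d w = begin
    ev (λ uv → f (fst uv) * X.ε (snd uv)) (ΔGon w)
      ≈⟨ trans (ev-linExt f (λ uv → [ (QX.ε (snd uv) , fst uv) ]) (ΔGon w)) (ev-cong {f = λ uv → ev f [ (QX.ε (snd uv) , fst uv) ]} {g = λ uv → f (fst uv) * X.ε (snd uv)} (ΔGon w)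
           (λ uv → trans (+-identityʳ _) (trans (*-congʳ {f (fst uv)} (κ-ε (snd uv))) (*-comm (X.ε (snd uv)) (f (fst uv)))))) ⟨
    ev f (id⊗ε QX.ε (ΔGon w))
      ≈⟨ trans (∼-descends {f} d (counitʳ w)) (ev-mono f w) ⟩
    f w ∎

  ε-⋆ : ∀ {f} → Descends f → ∀ w → (X.ε ⋆ f) w ≈ f w
  ε-⋆ {f} d w = begin
    ev (λ uv → X.ε (fst uv) * f (snd uv)) (ΔGon w)
      ≈⟨ trans (ev-linExt f (λ uv → [ (QX.ε (fst uv) , snd uv) ]) (ΔGon w)) (ev-cong {f = λ uv → ev f [ (QX.ε (fst uv) , snd uv) ]} {g = λ uv → X.ε (fst uv) * f (snd uv)} (ΔGon w)
           (λ uv → trans (+-identityʳ _) (*-congʳ {f (snd uv)} (κ-ε (fst uv))))) ⟨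
    ev f (ε⊗id QX.ε (ΔGon w))
      ≈⟨ trans (∼-descends {f} d (counitˡ w)) (ev-mono f w) ⟩
    f w ∎

  -- Takeuchi's formula S = Σ_k (-1)^k J^{⋆ k} with J = id - ε
  J : Word → Poly
  J []      = []
  J (a ∷ w) = mono (a ∷ w)

  mono≈J+ε : ∀ w → mono w ≈ J w + X.ε w
  mono≈J+ε []      = refl
  mono≈J+ε (a ∷ w) = sym (+-identityʳ (mono (a ∷ w)))

  J-descends : Descends J
  J-descends {p} s = begin
    ev J p                              ≈⟨ trans (sym (+-identityʳ _)) (+-congˡ {ev J p} (sym (ε-descends s))) ⟩
    ev J p + ev X.ε p                   ≈⟨ O-+ (ev-linear p) J X.ε ⟨
    ev (λ w → J w + X.ε w) p            ≈⟨ ev-cong {f = mono} {g = λ w → J w + X.ε w} p mono≈J+ε ⟨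
    ev mono p                           ≈⟨ mono-descends s ⟩
    0#                                  ∎

  J^ : ℕ → Word → Poly
  J^ zero    = X.ε
  J^ (suc k) = J^ k ⋆ J

  J^-descends : ∀ k → Descends (J^ k)
  J^-descends zero    = ε-descends
  J^-descends (suc k) = ⋆-descends {J^ k} {J} (J^-descends k) J-descends

  J^-sucˡ : ∀ k w → (J ⋆ J^ k) w ≈ J^ (suc k) w
  J^-sucˡ zero    w = trans (⋆-ε {J} J-descends w) (sym (ε-⋆ {J} J-descends w))
  J^-sucˡ (suc k) w = trans (sym (⋆-assoc J (J^ k) J w)) (⋆-cong {g = J} (J^-sucˡ k) (λ _ → refl) w)

  -- Each convolution factor `J` consumes a letter, as it vanishes on the empty word and the
  -- coproduct preserves the total length.
  J^-vanish : ∀ k w → length w ℕ.< k → J^ k w ≈ 0#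
  J^-vanish (suc k) w (s≤s w≤k) = trans (ev-All {P = λ t → size t ≡ length w} {f = λ t → J^ k (fst t) * J (snd t)} {g = λ _ → 0#} (ΔGon-weighted w) step)
    (O-0 (ev-linear (ΔGon w)))
    where
    step : ∀ t → size t ≡ length w → J^ k (fst t) * J (snd t) ≈ 0#
    step (u ∷ [] ∷ [])      e = zeroʳ (J^ k u)
    step (u ∷ (a ∷ v) ∷ []) e = trans (*-congʳ {mono (a ∷ v)} (J^-vanish k u (ℕ.≤-trans (ℕ.m≤m+n (suc (length u)) (length v)) (ℕ.≤-trans (ℕ.≤-reflexive (≡.trans (≡.sym (ℕ.+-suc (length u) (length v))) e)) w≤k))))
      (zeroˡ (mono (a ∷ v)))

  partial : ℕ → Word → Poly
  partial zero    w = J^ 0 w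
  partial (suc n) w = partial n w + sgn (suc n) * J^ (suc n) w

  S : Word → Poly
  S w = partial (length w) w

  partial-stable : ∀ k n w → n ≡ length w → partial (k ℕ.+ n) w ≈ S w
  partial-stable zero    n w ≡.refl = refl
  partial-stable (suc k) n w e = trans (+-cong (partial-stable k n w e) (trans (*-congˡ {sgn (suc (k ℕ.+ n))} (J^-vanish (suc (k ℕ.+ n)) w
      (s≤s (ℕ.≤-trans (ℕ.≤-reflexive (≡.sym e)) (ℕ.m≤n+m n k))))) (zeroʳ (sgn (suc (k ℕ.+ n))))))
    (+-identityʳ (S w))

  partial≈S : ∀ n w → length w ℕ.≤ n → partial n w ≈ S w
  partial≈S n w w≤n with ℕ.m≤n⇒∃[o]m+o≡n w≤n
  ... | k , ≡.refl = trans (reflexive (≡.cong (λ m → partial m w) (ℕ.+-comm (length w) k))) (partial-stable k (length w) w ≡.refl)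

  partial-descends : ∀ n → Descends (partial n)
  partial-descends zero    = ε-descends
  partial-descends (suc n) {p} s = begin
    ev (λ w → partial n w + sgn (suc n) * J^ (suc n) w) p
      ≈⟨ trans (O-+ (ev-linear p) (partial n) (λ w → sgn (suc n) * J^ (suc n) w)) (+-congˡ {ev (partial n) p} (O-* (ev-linear p) (sgn (suc n)) (J^ (suc n)))) ⟩
    ev (partial n) p + sgn (suc n) * ev (J^ (suc n)) p
      ≈⟨ +-cong (partial-descends n s) (trans (*-congˡ {sgn (suc n)} (J^-descends (suc n) s)) (zeroʳ (sgn (suc n)))) ⟩
    0# + 0#
      ≈⟨ +-identityˡ 0# ⟩
    0# ∎

  bound : Poly → ℕ
  bound []            = 0
  bound ((c , w) ∷ p) = length w ℕ.+ bound p

  bounded : ∀ p n → bound p ℕ.≤ n → All (λ t → length (proj₂ t) ℕ.≤ n) p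
  bounded []            n b = []
  bounded ((c , w) ∷ p) n b = ℕ.≤-trans (ℕ.m≤m+n (length w) (bound p)) b ∷ bounded p n (ℕ.≤-trans (ℕ.m≤n+m (bound p) (length w)) b)

  -- `S` truncates the series at the length of the word, but an element of the ideal may mix
  -- lengths; truncating all its words at a common bound gives a map known to descend.
  S-descends : Descends S
  S-descends {p} s = trans (ev-All {P = λ w → length w ℕ.≤ bound p} {f = S} {g = partial (bound p)} (bounded p (bound p) ℕ.≤-refl) (λ w w≤ → sym (partial≈S (bound p) w w≤)))
    (partial-descends (bound p) s)

  private
    size-≤ˡ : ∀ n t → size t ≡ n → length (fst t) ℕ.≤ n
    size-≤ˡ n t e = ℕ.≤-trans (ℕ.m≤m+n _ _) (ℕ.≤-reflexive e)

    size-≤ʳ : ∀ n t → size t ≡ n → length (snd t) ℕ.≤ n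
    size-≤ʳ n t e = ℕ.≤-trans (ℕ.m≤n+m _ (length (fst t))) (ℕ.≤-reflexive e)

    -- `M` is convolution with the identity `J + ε`, which sends each power to the sum of itself and
    -- the next; with alternating signs only the two ends remain.
    telescope : ∀ (M : (Word → Poly) → Poly) → IsLinear M → ∀ w → (∀ k → M (J^ k) ≈ J^ (suc k) w + J^ k w) →
                ∀ n → M (partial n) ≈ J^ 0 w + sgn n * J^ (suc n) w
    telescope M l w e zero    = trans (e 0) (trans (+-comm (J^ 1 w) (J^ 0 w)) (+-congˡ {J^ 0 w} (sym (*-identityˡ (J^ 1 w)))))
    telescope M l w e (suc n) = begin
      M (λ v → partial n v + sgn (suc n) * J^ (suc n) v)
        ≈⟨ trans (O-+ l (partial n) (λ v → sgn (suc n) * J^ (suc n) v)) (+-cong (telescope M l w e n) (trans (O-* l (sgn (suc n)) (J^ (suc n))) (*-congˡ {sgn (suc n)} (e (suc n))))) ⟩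
      (J^ 0 w + sgn n * J^ (suc n) w) + - sgn n * (J^ (suc (suc n)) w + J^ (suc n) w)
        ≈⟨ solve 4 (λ a s x y → (a :+ s :* x) :+ (:- s) :* (y :+ x) := a :+ (:- s) :* y) refl (J^ 0 w) (sgn n) (J^ (suc n) w) (J^ (suc (suc n)) w) ⟩
      J^ 0 w + sgn (suc n) * J^ (suc (suc n)) w ∎

    end : ∀ w → J^ 0 w + sgn (length w) * J^ (suc (length w)) w ≈ X.ε w
    end w = trans (+-congˡ {J^ 0 w} (trans (*-congˡ {sgn (length w)} (J^-vanish (suc (length w)) w ℕ.≤-refl)) (zeroʳ (sgn (length w))))) (+-identityʳ (X.ε w))

  S⋆id : ∀ w → (S ⋆ mono) w ≈ X.ε w
  S⋆id w = begin
    (S ⋆ mono) w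
      ≈⟨ ev-All {P = λ t → size t ≡ length w} {f = λ t → S (fst t) * mono (snd t)} {g = λ t → partial (length w) (fst t) * mono (snd t)} (ΔGon-weighted w)
           (λ t e → *-congʳ {mono (snd t)} (sym (partial≈S (length w) (fst t) (size-≤ˡ (length w) t e)))) ⟩
    (partial (length w) ⋆ mono) w
      ≈⟨ telescope (λ f → (f ⋆ mono) w) lin w step (length w) ⟩
    J^ 0 w + sgn (length w) * J^ (suc (length w)) w
      ≈⟨ end w ⟩
    X.ε w ∎
    where
    lin : IsLinear (λ f → (f ⋆ mono) w)
    lin = record
      { O-cong = λ {f} {g} e → ⋆-cong {f} {g} {mono} e (λ _ → refl) w
      ; O-+ = λ f g → trans (ev-cong {f = λ t → (f (fst t) + g (fst t)) * mono (snd t)} {g = λ t → f (fst t) * mono (snd t) + g (fst t) * mono (snd t)} (ΔGon w)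
          (λ t → distribʳ (mono (snd t)) (f (fst t)) (g (fst t)))) (O-+ (ev-linear (ΔGon w)) (λ t → f (fst t) * mono (snd t)) (λ t → g (fst t) * mono (snd t)))
      ; O-* = λ c f → trans (ev-cong {f = λ t → (c * f (fst t)) * mono (snd t)} {g = λ t → c * (f (fst t) * mono (snd t))} (ΔGon w)
          (λ t → *-assoc c (f (fst t)) (mono (snd t)))) (O-* (ev-linear (ΔGon w)) c (λ t → f (fst t) * mono (snd t))) }
    step : ∀ k → (J^ k ⋆ mono) w ≈ J^ (suc k) w + J^ k w
    step k = begin
      (J^ k ⋆ mono) w
        ≈⟨ ⋆-cong {J^ k} {J^ k} {mono} {λ v → J v + X.ε v} (λ _ → refl) mono≈J+ε w ⟩
      (J^ k ⋆ (λ v → J v + X.ε v)) w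
        ≈⟨ trans (ev-cong {f = λ t → J^ k (fst t) * (J (snd t) + X.ε (snd t))} {g = λ t → J^ k (fst t) * J (snd t) + J^ k (fst t) * X.ε (snd t)} (ΔGon w)
             (λ t → distribˡ (J^ k (fst t)) (J (snd t)) (X.ε (snd t)))) (O-+ (ev-linear (ΔGon w)) (λ t → J^ k (fst t) * J (snd t)) (λ t → J^ k (fst t) * X.ε (snd t))) ⟩
      J^ (suc k) w + (J^ k ⋆ X.ε) w
        ≈⟨ +-congˡ {J^ (suc k) w} (⋆-ε {J^ k} (J^-descends k) w) ⟩
      J^ (suc k) w + J^ k w ∎

  id⋆S : ∀ w → (mono ⋆ S) w ≈ X.ε w
  id⋆S w = begin
    (mono ⋆ S) w
      ≈⟨ ev-All {P = λ t → size t ≡ length w} {f = λ t → mono (fst t) * S (snd t)} {g = λ t → mono (fst t) * partial (length w) (snd t)} (ΔGon-weighted w)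
           (λ t e → *-congˡ {mono (fst t)} (sym (partial≈S (length w) (snd t) (size-≤ʳ (length w) t e)))) ⟩
    (mono ⋆ partial (length w)) w
      ≈⟨ telescope (λ f → (mono ⋆ f) w) lin w step (length w) ⟩
    J^ 0 w + sgn (length w) * J^ (suc (length w)) w
      ≈⟨ end w ⟩
    X.ε w ∎
    where
    lin : IsLinear (λ f → (mono ⋆ f) w)
    lin = record
      { O-cong = λ {f} {g} e → ⋆-cong {mono} {mono} {f} {g} (λ _ → refl) e w
      ; O-+ = λ f g → trans (ev-cong {f = λ t → mono (fst t) * (f (snd t) + g (snd t))} {g = λ t → mono (fst t) * f (snd t) + mono (fst t) * g (snd t)} (ΔGon w)
          (λ t → distribˡ (mono (fst t)) (f (snd t)) (g (snd t)))) (O-+ (ev-linear (ΔGon w)) (λ t → mono (fst t) * f (snd t)) (λ t → mono (fst t) * g (snd t)))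
      ; O-* = λ c f → trans (ev-cong {f = λ t → mono (fst t) * (c * f (snd t))} {g = λ t → c * (mono (fst t) * f (snd t))} (ΔGon w)
          (λ t → trans (sym (*-assoc (mono (fst t)) c (f (snd t)))) (trans (*-congʳ {f (snd t)} (*-comm (mono (fst t)) c)) (*-assoc c (mono (fst t)) (f (snd t))))))
          (O-* (ev-linear (ΔGon w)) c (λ t → mono (fst t) * f (snd t))) }
    step : ∀ k → (mono ⋆ J^ k) w ≈ J^ (suc k) w + J^ k w
    step k = begin
      (mono ⋆ J^ k) w
        ≈⟨ ⋆-cong {mono} {λ v → J v + X.ε v} {J^ k} {J^ k} mono≈J+ε (λ _ → refl) w ⟩
      ((λ v → J v + X.ε v) ⋆ J^ k) w
        ≈⟨ trans (ev-cong {f = λ t → (J (fst t) + X.ε (fst t)) * J^ k (snd t)} {g = λ t → J (fst t) * J^ k (snd t) + X.ε (fst t) * J^ k (snd t)} (ΔGon w)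
             (λ t → distribʳ (J^ k (snd t)) (J (fst t)) (X.ε (fst t)))) (O-+ (ev-linear (ΔGon w)) (λ t → J (fst t) * J^ k (snd t)) (λ t → X.ε (fst t) * J^ k (snd t))) ⟩
      (J ⋆ J^ k) w + (X.ε ⋆ J^ k) w
        ≈⟨ +-cong (J^-sucˡ k w) (ε-⋆ {J^ k} (J^-descends k) w) ⟩
      J^ (suc k) w + J^ k w ∎

  private
    ev₂-weighted : ∀ f g → (∀ w → wHom (length w) (f w)) → (∀ w → wHom (length w) (g w)) → ∀ {n T} → Weighted size n T → wHom n (ev₂ f g T)
    ev₂-weighted f g hf hg []                       = []
    ev₂-weighted f g hf hg {T = (c , t) ∷ T} (e ∷ es) = All.++⁺
      (≡.subst (λ m → wHom m ((κ c) * (f (fst t) * g (snd t)))) e (shP-weighted {0} {p = κ c} (≡.refl ∷ []) (shP-weighted (hf (fst t)) (hg (snd t)))))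
      (ev₂-weighted f g hf hg es)

    ε-weighted : ∀ w → wHom (length w) (X.ε w)
    ε-weighted []      = ≡.refl ∷ []
    ε-weighted (_ ∷ _) = []

    J-weighted : ∀ w → wHom (length w) (J w)
    J-weighted []      = []
    J-weighted (a ∷ w) = ≡.refl ∷ []

    J^-weighted : ∀ k w → wHom (length w) (J^ k w)
    J^-weighted zero    w = ε-weighted w
    J^-weighted (suc k) w = ev₂-weighted (J^ k) J (J^-weighted k) J-weighted (ΔGon-weighted w)

    sgn-weighted : ∀ n → wHom 0 (sgn n)
    sgn-weighted zero    = ≡.refl ∷ []
    sgn-weighted (suc n) = weighted-scale (ℚ.- 1ℚ) (sgn-weighted n)

  partial-weighted : ∀ n w → wHom (length w) (partial n w)
  partial-weighted zero    w = ε-weighted w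
  partial-weighted (suc n) w = All.++⁺ (partial-weighted n w) (shP-weighted (sgn-weighted (suc n)) (J^-weighted (suc n) w))

  ε-mono : ∀ w → X.ε w ≈ [ (QX.ε w , []) ]
  ε-mono w = sym (κ-ε w)

theorem5p37 : WeightGradedHopf
theorem5p37 = record
  { Δ-welldef   = UniversalPair.Δ-welldef
  ; ideal-homog = ideal-homog
  ; sh-graded   = λ u v w ne → weighted-coeff _≟W_ length (sh-weighted u v) w ne
  ; Δ-graded    = λ w u v ne → weighted-coeff _≟V_ size (ΔGon-weighted w) (u ∷ v ∷ []) ne
  ; Δ-unit      = A⊗A.difference (QAlg.refl A⊗A.alg {ΔGon []})
  ; Δ-mult      = UniversalPair.Δ-mult
  ; Δ-coassoc   = UniversalTriple.Δ-coassoc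
  ; ε           = QX.ε
  ; ε-welldef   = λ p s → ≡.trans (linForm≡ev QX.ε p) (Characters.DMR⇒kills ℚAlg (Counit.ε-DMR ℚAlg) s)
  ; ε-graded    = λ { [] ne → ⊥-elim (ne ≡.refl) ; (_ ∷ _) _ → ≡.refl }
  ; ε-unit      = ≡.refl
  ; ε-mult      = λ u v → ≡.trans (linForm≡ev QX.ε (sh u v)) (≡.trans (EvalProducts.ev-sh ℚAlg QX.ε u v) (proj₂ QX.ε-char u v))
  ; counitˡ     = λ w → difference (counitˡ w)
  ; counitʳ     = λ w → difference (counitʳ w)
  ; S           = S
  ; S-welldef   = λ p s → ∼⇒zero (trans (linExt≈ev S p) (S-descends s))
  ; S-graded    = λ w → S w , (λ v ne → weighted-coeff _≟W_ length (partial-weighted (length w) w) v ne) , difference (refl {S w})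
  ; antipodeˡ   = λ w → difference (trans (linExt≈ev (λ uv → shP (S (fst uv)) (word (snd uv))) (ΔGon w)) (trans (S⋆id w) (ε-mono w)))
  ; antipodeʳ   = λ w → difference (trans (linExt≈ev (λ uv → shP (word (fst uv)) (S (snd uv))) (ΔGon w)) (trans (id⋆S w) (ε-mono w)))
  }
  where
  open Antipode
  open A using (difference; ∼⇒zero)
  open Alg A.alg using (trans; refl)
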